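{- Let $m\ge 2$ and $n\ge 1$ be integers and let $\lambda\vdash n$. Then \[ P^{(m)}_{n,\lambda}(t)=\frac{|C(\lambda)|}{n}\,t^{\ell(\lambda)}\sum_{a=0}^{n-1}(-1)^a\,H_{n,a}(t)^{m-1}\,\chi^{[n-a,1^a]}_{\lambda}, \] where $H_{n,a}(t)=\prod_{k=-a}^{n-a-1}(t+k)$.
   Context: Here $\mathbb{S}_n$ is the symmetric group on $n$ letters. For a partition $\lambda\vdash n$, $\ell(\lambda)$ is its number of parts and $C(\lambda)\subset\mathbb{S}_n$ is the conjugacy class of permutations of cycle type $\lambda$. For $\theta,\mu\vdash n$, $\chi^{\theta}_{\mu}$ is the value at the class $C(\mu)$ of the irreducible character of $\mathbb{S}_n$ indexed by $\theta$ (standard convention, $\chi^{[n]}$ being the trivial character), and $[n-a,1^a]$ is the hook partition with first part $n-a$ followed by $a$ parts equal to $1$. For $\sigma\in\mathbb{S}_n$, $\mathrm{cyc}(\sigma)$ is its number of cycles. For $m\ge 2$, $\mathcal{M}_m(n,\lambda)$ is the set of tuples $(\phi,\sigma_0,\ldots,\sigma_{m-1})$ of permutations in $\mathbb{S}_n$ with $\phi\sigma_0\sigma_1\cdots\sigma_{m-1}=\mathrm{id}_n$, $\phi\in C(\lambda)$ and $\sigma_0$ an $n$-cycle. The genus of such a tuple is \[ g(\phi,\sigma_0,\ldots,\sigma_{m-1})=1+\tfrac12\Big((m-1)n-\ell(\lambda)-\sum_{i=0}^{m-1}\mathrm{cyc}(\sigma_i)\Big), \] and $\Gamma^{(m)}_{n,\lambda}(x)=\sum_{M\in\mathcal{M}_m(n,\lambda)}x^{g(M)}$.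 Finally, $P^{(m)}_{n,\lambda}(t)=t^{(m-1)n+1}\,\Gamma^{(m)}_{n,\lambda}(t^{ -2})$. -}

module Defs where

open import Algebra.Definitions.RawMonoid using (sum)
open import Data.Bool.Base using (true; false; if_then_else_)
open import Data.Empty using (⊥)
open import Data.Fin.Base as Fin using (Fin; zero; suc; toℕ)
import Data.Fin.Properties as Fin
open import Data.Fin.Permutation using (Permutation′; _⟨$⟩ʳ_; _⟨$⟩ˡ_; _≈_; id; _∘ₚ_; flip; insert; remove; insert-remove; inverseˡ; inverseʳ)
open import Data.Integer.Base as ℤ using (ℤ; +_; 0ℤ; 1ℤ; -1ℤ)
import Data.Integer.Properties as ℤ
open import Data.List.Base as List using (List; []; _∷_; _++_; map; filter; length; replicate; allFin; upTo; cartesianProduct; cartesianProductWith; concatMap; foldr)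
open import Data.List.Membership.Propositional using (_∈_)
open import Data.List.Membership.Propositional.Properties using (∈-allFin; ∈-map⁺; ∈-concat⁺′)
import Data.List.Properties as List
import Data.List.Relation.Unary.Any as Any
open import Data.List.Relation.Unary.Any using (here; there)
open import Data.List.Relation.Unary.Any.Properties using (lookup-index)
open import Data.List.Relation.Unary.All using (All; []; _∷_)
open import Data.List.Relation.Unary.Linked using (Linked; []; [-]; _∷_)
open import Data.Nat.Base as ℕ using (ℕ; zero; suc; _∸_; _≤_; _≥_)
open import Data.Nat.GeneralisedArithmetic using (fold)
import Data.Nat.ListAction as ℕ
import Data.Nat.Properties as ℕ
open import Data.Product.Base using (∃; _×_; _,_; proj₁; proj₂; map₁; map₂)
open import Data.Rational.Base as ℚ using (ℚ; 0ℚ; 1ℚ; 1/_; ≢-nonZero)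
import Data.Rational.Properties as ℚ
open import Data.Rational.Solver using (module +-*-Solver)
open import Data.Sum.Base using (_⊎_; inj₁; inj₂)
open import Data.Vec.Base as Vec using (Vec; []; _∷_; lookup; tabulate)
import Data.Vec.Properties as Vec
open import Function.Base using (_∘_)
open import Relation.Binary.Construct.Flip.EqAndOrd using () renaming (decTotalOrder to flipOrder)
open import Relation.Binary.Definitions using (DecidableEquality)
open import Relation.Binary.PropositionalEquality
open import Relation.Nullary.Decidable using (Dec; yes; no; does; ¬?; _×-dec_; _→-dec_; dec-true; dec-false)
open import Relation.Nullary.Negation.Core using (contradiction)
open import Relation.Unary using (Decidable)

open import Data.List.Sort.InsertionSort (flipOrder ℕ.≤-decTotalOrder) using (sort)

------------------------------------------------------------------------
-- Finite formal ℚ-linear combinations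

-- The list (q₁ , x₁) ∷ … ∷ (qₖ , xₖ) ∷ [] stands for q₁x₁ + … + qₖxₖ;
-- the same element may occur several times.
Free : Set → Set
Free X = List (ℚ × X)

scale : ∀ {X} → ℚ → Free X → Free X
scale q = map (map₁ (q ℚ.*_))

lin : ∀ {I X} → (I → Free X) → Free I → Free X
lin f []            = []
lin f ((q , i) ∷ c) = scale q (f i) ++ lin f c

comb : ∀ {X k} → (Fin k → Free X) → (Fin k → ℚ) → Free X
comb {k = zero}  f c = []
comb {k = suc k} f c = scale (c zero) (f zero) ++ comb (f ∘ suc) (c ∘ suc)

module FreeModule {X : Set} (_≟_ : DecidableEquality X) where

  coeff : Free X → X → ℚ
  coeff []            y = 0ℚ
  coeff ((q , x) ∷ v) y = (if does (x ≟ y) then q else 0ℚ) ℚ.+ coeff v y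

  infix 4 _≋_
  _≋_ : Free X → Free X → Set
  v ≋ w = ∀ y → coeff v y ≡ coeff w y

  Span : ∀ {I : Set} → (I → Free X) → Free X → Set
  Span {I} f v = ∃ λ (c : Free I) → v ≋ lin f c

  record Basis (S : Free X → Set) : Set where
    field
      dim         : ℕ
      vec         : Fin dim → Free X
      vec∈        : ∀ i → S (vec i)
      coords      : ∀ v → S v → Fin dim → ℚ
      coords-comb : ∀ v (s : S v) → v ≋ comb vec (coords v s)
      independent : ∀ c → comb vec c ≋ [] → ∀ i → c i ≡ 0ℚ

  trace : ∀ {S} → Basis S → (T : Free X → Free X) → (∀ v → S v → S (T v)) → ℚ
  trace B T inv = sum ℚ.+-0-rawMonoid (λ i → coords (T (vec i)) (inv (vec i) (vec∈ i)) i)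
    where open Basis B

  -- Existence of a basis for any span of finitely many vectors, by
  -- Gaussian elimination.

  coeff-++ : ∀ v w y → coeff (v ++ w) y ≡ coeff v y ℚ.+ coeff w y
  coeff-++ []            w y = sym (ℚ.+-identityˡ _)
  coeff-++ ((q , x) ∷ v) w y = trans (cong (h ℚ.+_) (coeff-++ v w y)) (sym (ℚ.+-assoc h (coeff v y) (coeff w y)))
    where h = if does (x ≟ y) then q else 0ℚ

  coeff-scale : ∀ r v y → coeff (scale r v) y ≡ r ℚ.* coeff v y
  coeff-scale r []            y = sym (ℚ.*-zeroʳ r)
  coeff-scale r ((q , x) ∷ v) y with does (x ≟ y)
  ... | true  = trans (cong (r ℚ.* q ℚ.+_) (coeff-scale r v y)) (sym (ℚ.*-distribˡ-+ r q (coeff v y)))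
  ... | false = trans (cong₂ ℚ._+_ (sym (ℚ.*-zeroʳ r)) (coeff-scale r v y)) (sym (ℚ.*-distribˡ-+ r 0ℚ (coeff v y)))

  record IsSubspace (S : Free X → Set) : Set where
    field
      S-[]    : S []
      S-++    : ∀ v w → S v → S w → S (v ++ w)
      S-scale : ∀ q v → S v → S (scale q v)
      S-resp  : ∀ v w → v ≋ w → S v → S w

    S-comb : ∀ {k} (f : Fin k → Free X) (c : Fin k → ℚ) → (∀ i → S (f i)) → S (comb f c)
    S-comb {zero}  f c f∈ = S-[]
    S-comb {suc k} f c f∈ =
      S-++ (scale (c zero) (f zero)) (comb (f ∘ suc) (c ∘ suc)) (S-scale (c zero) (f zero) (f∈ zero)) (S-comb (f ∘ suc) (c ∘ suc) (f∈ ∘ suc))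

    S-lin : ∀ {I} (f : I → Free X) (c : Free I) → (∀ i → S (f i)) → S (lin f c)
    S-lin f []            f∈ = S-[]
    S-lin f ((q , i) ∷ c) f∈ = S-++ (scale q (f i)) (lin f c) (S-scale q (f i) (f∈ i)) (S-lin f c f∈)

  FinSpan : ∀ {k} → (Fin k → Free X) → Free X → Set
  FinSpan {k} f v = ∃ λ (c : Fin k → ℚ) → v ≋ comb f c

  scale-0 : ∀ v y → coeff (scale 0ℚ v) y ≡ 0ℚ
  scale-0 v y = trans (coeff-scale 0ℚ v y) (ℚ.*-zeroˡ (coeff v y))

  comb-0 : ∀ {k} (f : Fin k → Free X) → comb f (λ _ → 0ℚ) ≋ []
  comb-0 {zero}  f y = refl
  comb-0 {suc k} f y = trans (coeff-++ (scale 0ℚ (f zero)) _ y)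
    (cong₂ ℚ._+_ (scale-0 (f zero) y) (comb-0 (f ∘ suc) y))

  comb-+ : ∀ {k} (f : Fin k → Free X) c d y →
           coeff (comb f (λ i → c i ℚ.+ d i)) y ≡ coeff (comb f c) y ℚ.+ coeff (comb f d) y
  comb-+ {zero}  f c d y = sym (ℚ.+-identityˡ 0ℚ)
  comb-+ {suc k} f c d y
    rewrite coeff-++ (scale (c zero ℚ.+ d zero) (f zero)) (comb (f ∘ suc) (λ i → c (suc i) ℚ.+ d (suc i))) y
          | coeff-++ (scale (c zero) (f zero)) (comb (f ∘ suc) (c ∘ suc)) y
          | coeff-++ (scale (d zero) (f zero)) (comb (f ∘ suc) (d ∘ suc)) y
          | coeff-scale (c zero ℚ.+ d zero) (f zero) y
          | coeff-scale (c zero) (f zero) y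
          | coeff-scale (d zero) (f zero) y
          | comb-+ (f ∘ suc) (c ∘ suc) (d ∘ suc) y
    = solve 5 (λ a b v p q → (a :+ b) :* v :+ (p :+ q) := (a :* v :+ p) :+ (b :* v :+ q)) refl
        (c zero) (d zero) (coeff (f zero) y) (coeff (comb (f ∘ suc) (c ∘ suc)) y) (coeff (comb (f ∘ suc) (d ∘ suc)) y)
    where open +-*-Solver

  comb-* : ∀ {k} (f : Fin k → Free X) q c y →
           coeff (comb f (λ i → q ℚ.* c i)) y ≡ q ℚ.* coeff (comb f c) y
  comb-* {zero}  f q c y = sym (ℚ.*-zeroʳ q)
  comb-* {suc k} f q c y
    rewrite coeff-++ (scale (q ℚ.* c zero) (f zero)) (comb (f ∘ suc) (λ i → q ℚ.* c (suc i))) y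
          | coeff-++ (scale (c zero) (f zero)) (comb (f ∘ suc) (c ∘ suc)) y
          | coeff-scale (q ℚ.* c zero) (f zero) y
          | coeff-scale (c zero) (f zero) y
          | comb-* (f ∘ suc) q (c ∘ suc) y
    = solve 4 (λ q a v p → (q :* a) :* v :+ q :* p := q :* (a :* v :+ p)) refl
        q (c zero) (coeff (f zero) y) (coeff (comb (f ∘ suc) (c ∘ suc)) y)
    where open +-*-Solver

  FinSpan-subspace : ∀ {k} (f : Fin k → Free X) → IsSubspace (FinSpan f)
  FinSpan-subspace f = record
    { S-[]    = (λ _ → 0ℚ) , λ y → sym (comb-0 f y)
    ; S-++    = λ { v w (c , p) (d , q) → (λ i → c i ℚ.+ d i) , λ y →
                  trans (coeff-++ v w y) (trans (cong₂ ℚ._+_ (p y) (q y)) (sym (comb-+ f c d y))) }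
    ; S-scale = λ { r v (c , p) → (λ i → r ℚ.* c i) , λ y →
                  trans (coeff-scale r v y) (trans (cong (r ℚ.*_) (p y)) (sym (comb-* f r c y))) }
    ; S-resp  = λ { v w e (c , p) → c , λ y → trans (sym (e y)) (p y) }
    }

  FinSpan-suc : ∀ {k} (f : Fin (suc k) → Free X) v → FinSpan (f ∘ suc) v → FinSpan f v
  FinSpan-suc f v (c , p) = (λ { zero → 0ℚ ; (suc i) → c i }) , λ y → begin
    coeff v y                                                       ≡⟨ p y ⟩
    coeff (comb (f ∘ suc) c) y                                      ≡⟨ ℚ.+-identityˡ (coeff (comb (f ∘ suc) c) y) ⟨
    0ℚ ℚ.+ coeff (comb (f ∘ suc) c) y                               ≡⟨ cong (ℚ._+ coeff (comb (f ∘ suc) c) y) (scale-0 (f zero) y) ⟨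
    coeff (scale 0ℚ (f zero)) y ℚ.+ coeff (comb (f ∘ suc) c) y      ≡⟨ coeff-++ (scale 0ℚ (f zero)) _ y ⟨
    coeff (scale 0ℚ (f zero) ++ comb (f ∘ suc) c) y                 ∎
    where open ≡-Reasoning

  FinSpan-gen : ∀ {k} (f : Fin k → Free X) i → FinSpan f (f i)
  FinSpan-gen f (suc i) = FinSpan-suc f (f (suc i)) (FinSpan-gen (f ∘ suc) i)
  FinSpan-gen f zero    = (λ { zero → 1ℚ ; (suc i) → 0ℚ }) , λ y → sym (begin
    coeff (scale 1ℚ (f zero) ++ comb (f ∘ suc) (λ _ → 0ℚ)) y               ≡⟨ coeff-++ (scale 1ℚ (f zero)) _ y ⟩
    coeff (scale 1ℚ (f zero)) y ℚ.+ coeff (comb (f ∘ suc) (λ _ → 0ℚ)) y    ≡⟨ cong₂ ℚ._+_ (coeff-scale 1ℚ (f zero) y) (comb-0 (f ∘ suc) y) ⟩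
    1ℚ ℚ.* coeff (f zero) y ℚ.+ 0ℚ                                        ≡⟨ trans (ℚ.+-identityʳ (1ℚ ℚ.* coeff (f zero) y)) (ℚ.*-identityˡ (coeff (f zero) y)) ⟩
    coeff (f zero) y                                                      ∎)
    where open ≡-Reasoning

  FinSpan-⊆ : ∀ {k} (f : Fin k → Free X) {S} → IsSubspace S → (∀ i → S (f i)) → ∀ v → FinSpan f v → S v
  FinSpan-⊆ f S-sub f∈ v (c , p) = S-resp (comb f c) v (λ y → sym (p y)) (S-comb f c f∈)
    where open IsSubspace S-sub

  coeff-outside : ∀ v y → (∀ {x} → x ∈ map proj₂ v → x ≢ y) → coeff v y ≡ 0ℚ
  coeff-outside []            y out = refl
  coeff-outside ((q , x) ∷ v) y out with x ≟ y
  ... | yes x≡y = contradiction x≡y (out (here refl))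
  ... | no  _   = trans (ℚ.+-identityˡ (coeff v y)) (coeff-outside v y (out ∘ there))

  zero-or-pivot : ∀ v → (v ≋ []) ⊎ (∃ λ x → coeff v x ≢ 0ℚ)
  zero-or-pivot v with Any.any? (λ x → ¬? (coeff v x ℚ.≟ 0ℚ)) (map proj₂ v)
  ... | yes p = inj₂ (Any.satisfied p)
  ... | no ¬p = inj₁ vanish
    where
    vanish : v ≋ []
    vanish y with coeff v y ℚ.≟ 0ℚ
    ... | yes e = e
    ... | no ne = coeff-outside v y λ { x∈ refl → ¬p (Any.map (λ { refl → ne }) x∈) }

  *-cancel-0 : ∀ a b → b ≢ 0ℚ → a ℚ.* b ≡ 0ℚ → a ≡ 0ℚ
  *-cancel-0 a b b≢0 ab≡0 = begin
    a                       ≡⟨ ℚ.*-identityʳ a ⟨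
    a ℚ.* 1ℚ                ≡⟨ cong (a ℚ.*_) (ℚ.*-inverseʳ b) ⟨
    a ℚ.* (b ℚ.* 1/ b)      ≡⟨ ℚ.*-assoc a b (1/ b) ⟨
    a ℚ.* b ℚ.* 1/ b        ≡⟨ cong (ℚ._* 1/ b) ab≡0 ⟩
    0ℚ ℚ.* 1/ b             ≡⟨ ℚ.*-zeroˡ (1/ b) ⟩
    0ℚ                      ∎
    where
    open ≡-Reasoning
    instance _ = ≢-nonZero b≢0

  Vanish-subspace : ∀ x → IsSubspace (λ v → coeff v x ≡ 0ℚ)
  Vanish-subspace x = record
    { S-[]    = refl
    ; S-++    = λ v w p q → trans (coeff-++ v w x) (cong₂ ℚ._+_ p q)
    ; S-scale = λ q v p → trans (coeff-scale q v x) (trans (cong (q ℚ.*_) p) (ℚ.*-zeroʳ q))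
    ; S-resp  = λ v w e p → trans (sym (e x)) p
    }

  Basis-transport : ∀ {S S′} → (∀ v → S v → S′ v) → (∀ v → S′ v → S v) → Basis S → Basis S′
  Basis-transport to from B = record
    { dim         = dim
    ; vec         = vec
    ; vec∈        = λ i → to (vec i) (vec∈ i)
    ; coords      = λ v s → coords v (from v s)
    ; coords-comb = λ v s → coords-comb v (from v s)
    ; independent = independent
    }
    where open Basis B

  FinSpan-basis : ∀ k (f : Fin k → Free X) → Basis (FinSpan f)
  FinSpan-basis zero f = record
    { dim         = zero
    ; vec         = λ ()
    ; vec∈        = λ ()
    ; coords      = λ _ _ ()
    ; coords-comb = λ v s → proj₂ s
    ; independent = λ _ _ ()
    }
  FinSpan-basis (suc k) f with zero-or-pivot (f zero)
  ... | inj₁ f₀≋0 = Basis-transport (FinSpan-suc f) (FinSpan-⊆ f rest gens) (FinSpan-basis k (f ∘ suc))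
    where
    rest = FinSpan-subspace (f ∘ suc)
    gens : ∀ i → FinSpan (f ∘ suc) (f i)
    gens zero    = IsSubspace.S-resp rest [] (f zero) (λ y → sym (f₀≋0 y)) (IsSubspace.S-[] rest)
    gens (suc i) = FinSpan-gen (f ∘ suc) i
  ... | inj₂ (x , a≢0) = Basis-transport ⊆f f⊆ B⁺
    where
    open ≡-Reasoning
    instance _ = ≢-nonZero a≢0
    v : Free X
    v = f zero
    a⁻¹ : ℚ
    a⁻¹ = 1/ (coeff v x)

    r : Fin k → ℚ
    r i = coeff (f (suc i)) x ℚ.* a⁻¹

    f′ : Fin k → Free X
    f′ i = f (suc i) ++ scale (ℚ.- r i) v

    f′-vanish : ∀ i → coeff (f′ i) x ≡ 0ℚ
    f′-vanish i = begin
      coeff (f′ i) x                                        ≡⟨ coeff-++ (f (suc i)) (scale (ℚ.- r i) v) x ⟩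
      b ℚ.+ coeff (scale (ℚ.- r i) v) x                     ≡⟨ cong (b ℚ.+_) (coeff-scale (ℚ.- r i) v x) ⟩
      b ℚ.+ (ℚ.- (b ℚ.* a⁻¹)) ℚ.* coeff v x                 ≡⟨ solve 3 (λ b i a → b :+ (:- (b :* i)) :* a := b :+ :- (b :* (i :* a))) refl b a⁻¹ (coeff v x) ⟩
      b ℚ.+ ℚ.- (b ℚ.* (a⁻¹ ℚ.* coeff v x))                 ≡⟨ cong (λ z → b ℚ.+ ℚ.- (b ℚ.* z)) (ℚ.*-inverseˡ (coeff v x)) ⟩
      b ℚ.+ ℚ.- (b ℚ.* 1ℚ)                                  ≡⟨ cong (λ z → b ℚ.+ ℚ.- z) (ℚ.*-identityʳ b) ⟩
      b ℚ.+ ℚ.- b                                           ≡⟨ ℚ.+-inverseʳ b ⟩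
      0ℚ                                                    ∎
      where
      open +-*-Solver
      b = coeff (f (suc i)) x

    B : Basis (FinSpan f′)
    B = FinSpan-basis k f′
    open Basis B

    vec⁺ : Fin (suc dim) → Free X
    vec⁺ zero    = v
    vec⁺ (suc i) = vec i

    vec-vanish : ∀ i → coeff (vec i) x ≡ 0ℚ
    vec-vanish i = FinSpan-⊆ f′ (Vanish-subspace x) f′-vanish (vec i) (vec∈ i)

    independent⁺ : ∀ c → comb vec⁺ c ≋ [] → ∀ i → c i ≡ 0ℚ
    independent⁺ c p = λ { zero → c₀≡0 ; (suc i) → independent (c ∘ suc) tail≋0 i }
      where
      split : ∀ y → c zero ℚ.* coeff v y ℚ.+ coeff (comb vec (c ∘ suc)) y ≡ 0ℚ
      split y = trans (cong (ℚ._+ coeff (comb vec (c ∘ suc)) y) (sym (coeff-scale (c zero) v y)))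
                      (trans (sym (coeff-++ (scale (c zero) v) (comb vec (c ∘ suc)) y)) (p y))

      c₀≡0 : c zero ≡ 0ℚ
      c₀≡0 = *-cancel-0 (c zero) (coeff v x) a≢0 (begin
        c zero ℚ.* coeff v x                                         ≡⟨ ℚ.+-identityʳ (c zero ℚ.* coeff v x) ⟨
        c zero ℚ.* coeff v x ℚ.+ 0ℚ                                  ≡⟨ cong (c zero ℚ.* coeff v x ℚ.+_) (IsSubspace.S-comb (Vanish-subspace x) vec (c ∘ suc) vec-vanish) ⟨
        c zero ℚ.* coeff v x ℚ.+ coeff (comb vec (c ∘ suc)) x        ≡⟨ split x ⟩
        0ℚ                                                           ∎)

      tail≋0 : comb vec (c ∘ suc) ≋ []
      tail≋0 y = begin
        coeff (comb vec (c ∘ suc)) y                                 ≡⟨ ℚ.+-identityˡ (coeff (comb vec (c ∘ suc)) y) ⟨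
        0ℚ ℚ.+ coeff (comb vec (c ∘ suc)) y                          ≡⟨ cong (ℚ._+ coeff (comb vec (c ∘ suc)) y) (trans (cong (ℚ._* coeff v y) c₀≡0) (ℚ.*-zeroˡ (coeff v y))) ⟨
        c zero ℚ.* coeff v y ℚ.+ coeff (comb vec (c ∘ suc)) y        ≡⟨ split y ⟩
        0ℚ                                                           ∎

    B⁺ : Basis (FinSpan vec⁺)
    B⁺ = record
      { dim         = suc dim
      ; vec         = vec⁺
      ; vec∈        = FinSpan-gen vec⁺
      ; coords      = λ _ → proj₁
      ; coords-comb = λ _ → proj₂
      ; independent = independent⁺
      }

    module F = IsSubspace (FinSpan-subspace f)
    module V = IsSubspace (FinSpan-subspace vec⁺)

    f′∈f : ∀ i → FinSpan f (f′ i)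
    f′∈f i = F.S-++ (f (suc i)) (scale (ℚ.- r i) v) (FinSpan-gen f (suc i)) (F.S-scale (ℚ.- r i) v (FinSpan-gen f zero))

    ⊆f : ∀ w → FinSpan vec⁺ w → FinSpan f w
    ⊆f = FinSpan-⊆ vec⁺ (FinSpan-subspace f)
      λ { zero → FinSpan-gen f zero ; (suc i) → FinSpan-⊆ f′ (FinSpan-subspace f) f′∈f (vec i) (vec∈ i) }

    f′∈vec⁺ : ∀ i → FinSpan vec⁺ (f′ i)
    f′∈vec⁺ i = FinSpan-suc vec⁺ (f′ i) (coords (f′ i) s , coords-comb (f′ i) s)
      where s = FinSpan-gen f′ i

    f⊆ : ∀ w → FinSpan f w → FinSpan vec⁺ w
    f⊆ = FinSpan-⊆ f (FinSpan-subspace vec⁺) λ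
      { zero    → FinSpan-gen vec⁺ zero
      ; (suc i) → V.S-resp (f′ i ++ scale (r i) v) (f (suc i)) (undo i)
                    (V.S-++ (f′ i) (scale (r i) v) (f′∈vec⁺ i) (V.S-scale (r i) v (FinSpan-gen vec⁺ zero))) }
      where
      undo : ∀ i → f′ i ++ scale (r i) v ≋ f (suc i)
      undo i y = begin
        coeff (f′ i ++ scale (r i) v) y                                   ≡⟨ coeff-++ (f′ i) (scale (r i) v) y ⟩
        coeff (f′ i) y ℚ.+ coeff (scale (r i) v) y                        ≡⟨ cong₂ ℚ._+_ (trans (coeff-++ (f (suc i)) (scale (ℚ.- r i) v) y) (cong (b ℚ.+_) (coeff-scale (ℚ.- r i) v y))) (coeff-scale (r i) v y) ⟩
        (b ℚ.+ (ℚ.- r i) ℚ.* coeff v y) ℚ.+ r i ℚ.* coeff v y             ≡⟨ solve 3 (λ b r z → (b :+ (:- r) :* z) :+ r :* z := b) refl b (r i) (coeff v y) ⟩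
        b                                                                 ∎
        where
        open +-*-Solver
        b = coeff (f (suc i)) y

  Span-subspace : ∀ {I : Set} (f : I → Free X) → IsSubspace (Span f)
  Span-subspace f = record
    { S-[]    = [] , λ y → refl
    ; S-++    = λ { v w (c , p) (d , q) → c ++ d , λ y → begin
        coeff (v ++ w) y                             ≡⟨ coeff-++ v w y ⟩
        coeff v y ℚ.+ coeff w y                      ≡⟨ cong₂ ℚ._+_ (p y) (q y) ⟩
        coeff (lin f c) y ℚ.+ coeff (lin f d) y      ≡⟨ coeff-++ (lin f c) (lin f d) y ⟨
        coeff (lin f c ++ lin f d) y                 ≡⟨ cong (λ u → coeff u y) (lin-++ c d) ⟨
        coeff (lin f (c ++ d)) y                     ∎ }
    ; S-scale = λ { q v (c , p) → scale q c , λ y → begin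
        coeff (scale q v) y                          ≡⟨ coeff-scale q v y ⟩
        q ℚ.* coeff v y                              ≡⟨ cong (q ℚ.*_) (p y) ⟩
        q ℚ.* coeff (lin f c) y                      ≡⟨ lin-scale q c y ⟨
        coeff (lin f (scale q c)) y                  ∎ }
    ; S-resp  = λ { v w e (c , p) → c , λ y → trans (sym (e y)) (p y) }
    }
    where
    open ≡-Reasoning
    lin-++ : ∀ c d → lin f (c ++ d) ≡ lin f c ++ lin f d
    lin-++ []            d = refl
    lin-++ ((q , i) ∷ c) d =
      trans (cong (scale q (f i) ++_) (lin-++ c d)) (sym (List.++-assoc (scale q (f i)) _ _))

    lin-scale : ∀ q c y → coeff (lin f (scale q c)) y ≡ q ℚ.* coeff (lin f c) y
    lin-scale q []            y = sym (ℚ.*-zeroʳ q)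
    lin-scale q ((r , i) ∷ c) y
      rewrite coeff-++ (scale (q ℚ.* r) (f i)) (lin f (scale q c)) y
            | coeff-++ (scale r (f i)) (lin f c) y
            | coeff-scale (q ℚ.* r) (f i) y
            | coeff-scale r (f i) y
            | lin-scale q c y
      = solve 4 (λ q r a b → (q :* r) :* a :+ q :* b := q :* (r :* a :+ b)) refl q r (coeff (f i) y) (coeff (lin f c) y)
      where open +-*-Solver

  Span-gen : ∀ {I : Set} (f : I → Free X) i → Span f (f i)
  Span-gen f i = (1ℚ , i) ∷ [] , λ y → sym (begin
    coeff (scale 1ℚ (f i) ++ []) y   ≡⟨ cong (λ u → coeff u y) (List.++-identityʳ (scale 1ℚ (f i))) ⟩
    coeff (scale 1ℚ (f i)) y         ≡⟨ coeff-scale 1ℚ (f i) y ⟩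
    1ℚ ℚ.* coeff (f i) y             ≡⟨ ℚ.*-identityˡ (coeff (f i) y) ⟩
    coeff (f i) y                    ∎)
    where open ≡-Reasoning

  Span-basis : ∀ {I : Set} (f : I → Free X) (is : List I) →
               (∀ i → ∃ λ j → j ∈ is × f i ≡ f j) → Basis (Span f)
  Span-basis f is covers = Basis-transport
    (FinSpan-⊆ g (Span-subspace f) (λ k → Span-gen f (List.lookup is k)))
    (λ { v (c , p) → G.S-resp (lin f c) v (λ y → sym (p y)) (G.S-lin f c f∈) })
    (FinSpan-basis (length is) g)
    where
    g : Fin (length is) → Free X
    g k = f (List.lookup is k)
    module G = IsSubspace (FinSpan-subspace g)
    f∈ : ∀ i → FinSpan g (f i)
    f∈ i with covers i
    ... | j , j∈ , fi≡fj = subst (FinSpan g)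
      (trans (cong f (sym (lookup-index j∈))) (sym fi≡fj)) (FinSpan-gen g (Any.index j∈))

------------------------------------------------------------------------
-- Laurent polynomials over ℚ, as combinations of exponents in ℤ;
-- _≈ᴸ_ compares all coefficients.

Laurent : Set
Laurent = Free ℤ

open FreeModule ℤ._≟_ public using () renaming (_≋_ to _≈ᴸ_)

monomial : ℚ → ℤ → Laurent
monomial q k = (q , k) ∷ []

const : ℚ → Laurent
const q = monomial q 0ℤ

infix  9 t^_
infix  8 _[t^_]
infixl 6 _+ᴸ_
infixl 7 _*ᴸ_
infixr 8 _^ᴸ_

_+ᴸ_ : Laurent → Laurent → Laurent
_+ᴸ_ = _++_

_*ᴸ_ : Laurent → Laurent → Laurent
_*ᴸ_ = cartesianProductWith λ { (p , i) (q , j) → p ℚ.* q , i ℤ.+ j }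

_^ᴸ_ : Laurent → ℕ → Laurent
p ^ᴸ zero  = const 1ℚ
p ^ᴸ suc k = p *ᴸ p ^ᴸ k

t^_ : ℤ → Laurent
t^ k = monomial 1ℚ k

-- p [t^ k ] is p(tᵏ).
_[t^_] : Laurent → ℤ → Laurent
p [t^ k ] = map (map₂ (k ℤ.*_)) p

∑ᴸ ∏ᴸ : ∀ {A : Set} → List A → (A → Laurent) → Laurent
∑ᴸ xs f = foldr _+ᴸ_ [] (map f xs)
∏ᴸ xs f = foldr _*ᴸ_ (const 1ℚ) (map f xs)

[-1]^_ : ℕ → ℚ
[-1]^ zero  = 1ℚ
[-1]^ suc k = ℚ.- ([-1]^ k)

------------------------------------------------------------------------
-- Permutations

-- Composition of functions, right factor first.
infixr 9 _·_
_·_ : ∀ {n} → Permutation′ n → Permutation′ n → Permutation′ n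
π · ρ = ρ ∘ₚ π

-- insert zero j π sends 0 to j and is order-isomorphic to π elsewhere,
-- so every permutation is listed exactly once up to _≈_.
perms : ∀ n → List (Permutation′ n)
perms zero    = id ∷ []
perms (suc n) = concatMap (λ j → map (insert zero j) (perms n)) (allFin (suc n))

-- Exponents k < n suffice, as a cycle has at most n elements.
SameCycle : ∀ {n} → Permutation′ n → Fin n → Fin n → Set
SameCycle {n} σ i j = ∃ λ (k : Fin n) → fold i (σ ⟨$⟩ʳ_) (toℕ k) ≡ j

sameCycle? : ∀ {n} (σ : Permutation′ n) i j → Dec (SameCycle σ i j)
sameCycle? σ i j = Fin.any? λ k → fold i (σ ⟨$⟩ʳ_) (toℕ k) Fin.≟ j

-- Each cycle is represented by its least element.
CycleMin : ∀ {n} → Permutation′ n → Fin n → Set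
CycleMin σ i = ∀ j → SameCycle σ i j → i Fin.≤ j

cycleMin? : ∀ {n} (σ : Permutation′ n) → Decidable (CycleMin σ)
cycleMin? σ i = Fin.all? λ j → sameCycle? σ i j →-dec (i Fin.≤? j)

cycleLengths : ∀ {n} → Permutation′ n → List ℕ
cycleLengths {n} σ =
  map (λ i → length (filter (sameCycle? σ i) (allFin n))) (filter (cycleMin? σ) (allFin n))

cyc : ∀ {n} → Permutation′ n → ℕ
cyc = length ∘ cycleLengths

-- The sorting order is _≥_, so cycle lengths are listed in weakly
-- decreasing order.
cycleType : ∀ {n} → Permutation′ n → List ℕ
cycleType = sort ∘ cycleLengths

sgn : ∀ {n} → Permutation′ n → ℚ
sgn {n} σ = [-1]^ (n ∸ cyc σ)

------------------------------------------------------------------------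
-- Partitions and conjugacy classes

record Partition (n : ℕ) : Set where
  field
    parts      : List ℕ
    decreasing : Linked _≥_ parts
    positive   : All (1 ≤_) parts
    total      : ℕ.sum parts ≡ n

open Partition public

ℓ : ∀ {n} → Partition n → ℕ
ℓ lam = length (parts lam)

hook : ∀ n → Fin n → Partition n
hook n a = record
  { parts      = n ∸ toℕ a ∷ replicate (toℕ a) 1
  ; decreasing = dec (toℕ a) (ℕ.m<n⇒0<n∸m (Fin.toℕ<n a))
  ; positive   = ℕ.m<n⇒0<n∸m (Fin.toℕ<n a) ∷ ones (toℕ a)
  ; total      = trans (cong (n ∸ toℕ a ℕ.+_) (sum-ones (toℕ a))) (ℕ.m∸n+n≡m (Fin.toℕ≤n a))
  }
  where
  dec : ∀ k {p} → 1 ≤ p → Linked _≥_ (p ∷ replicate k 1)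
  dec zero    p≥1 = [-]
  dec (suc k) p≥1 = p≥1 ∷ dec k ℕ.≤-refl

  ones : ∀ k → All (1 ≤_) (replicate k 1)
  ones zero    = []
  ones (suc k) = ℕ.≤-refl ∷ ones k

  sum-ones : ∀ k → ℕ.sum (replicate k 1) ≡ k
  sum-ones zero    = refl
  sum-ones (suc k) = cong suc (sum-ones k)

InClass : ∀ {n} → Partition n → Permutation′ n → Set
InClass lam σ = cycleType σ ≡ parts lam

inClass? : ∀ {n} (lam : Partition n) → Decidable (InClass lam)
inClass? lam σ = List.≡-dec ℕ._≟_ (cycleType σ) (parts lam)

∣C_∣ : ∀ {n} → Partition n → ℕ
∣C_∣ {n} lam = length (filter (inClass? lam) (perms n))

------------------------------------------------------------------------
-- Irreducible characters, as characters of Specht modules over ℚ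

-- (row , column) of the i-th cell of a Young diagram read row by row;
-- the fixed tableau T₀ has the letter i in this cell. The value for i
-- beyond the size of the diagram is irrelevant.
cell : List ℕ → ℕ → ℕ × ℕ
cell []       i = 0 , 0
cell (p ∷ ps) i = if i ℕ.<ᵇ p then (0 , i) else map₁ suc (cell ps (i ∸ p))

-- A tabloid, as the function sending each letter to its row.
Tabloid : ℕ → Set
Tabloid n = Vec ℕ n

open module TabloidModule {n : ℕ} = FreeModule (Vec.≡-dec {n = n} ℕ._≟_)

infixr 8 _•_ _•ᴹ_

_•_ : ∀ {n} → Permutation′ n → Tabloid n → Tabloid n
g • r = tabulate λ x → lookup r (g ⟨$⟩ˡ x)

_•ᴹ_ : ∀ {n} → Permutation′ n → Free (Tabloid n) → Free (Tabloid n)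
g •ᴹ v = map (map₂ (g •_)) v

tabloid₀ : ∀ {n} → Partition n → Tabloid n
tabloid₀ θ = tabulate λ x → proj₁ (cell (parts θ) (toℕ x))

ColumnStable : ∀ {n} → Partition n → Permutation′ n → Set
ColumnStable θ π = ∀ x → proj₂ (cell (parts θ) (toℕ (π ⟨$⟩ʳ x))) ≡ proj₂ (cell (parts θ) (toℕ x))

columnStable? : ∀ {n} (θ : Partition n) → Decidable (ColumnStable θ)
columnStable? θ π = Fin.all? λ x → _ ℕ.≟ _

polytabloid₀ : ∀ {n} → Partition n → Free (Tabloid n)
polytabloid₀ {n} θ = map (λ π → sgn π , π • tabloid₀ θ) (filter (columnStable? θ) (perms n))

-- Every tableau of shape θ is τ T₀ for a unique permutation τ, and its
-- polytabloid is τ applied to that of T₀.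
polytabloid : ∀ {n} → Partition n → Permutation′ n → Free (Tabloid n)
polytabloid θ τ = τ •ᴹ polytabloid₀ θ

Specht : ∀ {n} → Partition n → Free (Tabloid n) → Set
Specht θ = Span (polytabloid θ)

perms-complete : ∀ {n} (π : Permutation′ n) → ∃ λ ρ → ρ ∈ perms n × π ≈ ρ
perms-complete {zero}  π = id , here refl , λ ()
perms-complete {suc n} π with perms-complete (remove zero π)
... | ρ , ρ∈ , e = insert zero j ρ
    , ∈-concat⁺′ (∈-map⁺ (insert zero j) ρ∈) (∈-map⁺ (λ j → map (insert zero j) (perms n)) (∈-allFin j))
    , λ i → trans (sym (insert-remove zero π i)) (insert-cong i)
  where
  j = π ⟨$⟩ʳ zero
  insert-cong : insert zero j (remove zero π) ≈ insert zero j ρ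
  insert-cong zero    = refl
  insert-cong (suc i) = cong (Fin.punchIn j) (e i)

inverse-cong : ∀ {n} (π ρ : Permutation′ n) → π ≈ ρ → ∀ x → π ⟨$⟩ˡ x ≡ ρ ⟨$⟩ˡ x
inverse-cong π ρ e x = begin
  π ⟨$⟩ˡ x                       ≡⟨ inverseˡ ρ ⟨
  ρ ⟨$⟩ˡ (ρ ⟨$⟩ʳ (π ⟨$⟩ˡ x))     ≡⟨ cong (ρ ⟨$⟩ˡ_) (e _) ⟨
  ρ ⟨$⟩ˡ (π ⟨$⟩ʳ (π ⟨$⟩ˡ x))     ≡⟨ cong (ρ ⟨$⟩ˡ_) (inverseʳ π) ⟩
  ρ ⟨$⟩ˡ x                       ∎
  where open ≡-Reasoning

•-cong : ∀ {n} (π ρ : Permutation′ n) → π ≈ ρ → ∀ r → π • r ≡ ρ • r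
•-cong π ρ e r = Vec.tabulate-cong λ x → cong (lookup r) (inverse-cong π ρ e x)

•-· : ∀ {n} (g h : Permutation′ n) r → g • h • r ≡ (g · h) • r
•-· g h r = Vec.tabulate-cong λ x → Vec.lookup∘tabulate _ (g ⟨$⟩ˡ x)

•-inverse : ∀ {n} (g : Permutation′ n) r → flip g • g • r ≡ r
•-inverse g r = trans
  (Vec.tabulate-cong λ x → trans (Vec.lookup∘tabulate _ (g ⟨$⟩ʳ x)) (cong (lookup r) (inverseˡ g)))
  (Vec.tabulate∘lookup r)

•ᴹ-· : ∀ {n} (g h : Permutation′ n) v → g •ᴹ h •ᴹ v ≡ (g · h) •ᴹ v
•ᴹ-· g h v = trans (sym (List.map-∘ v)) (List.map-cong (λ { (q , r) → cong (q ,_) (•-· g h r) }) v)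

•ᴹ-coeff : ∀ {n} (g : Permutation′ n) v r → coeff (g •ᴹ v) (g • r) ≡ coeff v r
•ᴹ-coeff g []            r = refl
•ᴹ-coeff g ((q , s) ∷ v) r = cong₂ (λ b → (if b then q else 0ℚ) ℚ.+_) same (•ᴹ-coeff g v r)
  where
  injective : g • s ≡ g • r → s ≡ r
  injective e = trans (sym (•-inverse g s)) (trans (cong (flip g •_) e) (•-inverse g r))
  same : does (Vec.≡-dec ℕ._≟_ (g • s) (g • r)) ≡ does (Vec.≡-dec ℕ._≟_ s r)
  same with Vec.≡-dec ℕ._≟_ s r
  ... | yes e = dec-true (Vec.≡-dec ℕ._≟_ (g • s) (g • r)) (cong (g •_) e)
  ... | no ne = dec-false (Vec.≡-dec ℕ._≟_ (g • s) (g • r)) (ne ∘ injective)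

•ᴹ-resp : ∀ {n} (g : Permutation′ n) v w → v ≋ w → g •ᴹ v ≋ g •ᴹ w
•ᴹ-resp g v w e r =
  subst (λ r → coeff (g •ᴹ v) r ≡ coeff (g •ᴹ w) r) (•-inverse (flip g) r)
    (trans (•ᴹ-coeff g v r′) (trans (e r′) (sym (•ᴹ-coeff g w r′))))
  where r′ = flip g • r

•ᴹ-scale : ∀ {n} (g : Permutation′ n) q v → g •ᴹ scale q v ≡ scale q (g •ᴹ v)
•ᴹ-scale g q v = trans (sym (List.map-∘ v)) (List.map-∘ v)

•ᴹ-lin : ∀ {n} {I : Set} (g : Permutation′ n) (f : I → Free (Tabloid n)) c →
         g •ᴹ lin f c ≡ lin (λ i → g •ᴹ f i) c
•ᴹ-lin g f []            = refl
•ᴹ-lin g f ((q , i) ∷ c) = trans (List.map-++ _ (scale q (f i)) _)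
  (cong₂ _++_ (•ᴹ-scale g q (f i)) (•ᴹ-lin g f c))

Specht-invariant : ∀ {n} (θ : Partition n) (g : Permutation′ n) v → Specht θ v → Specht θ (g •ᴹ v)
Specht-invariant θ g v (c , p) =
  S-resp (lin (λ τ → g •ᴹ polytabloid θ τ) c) (g •ᴹ v)
    (λ r → sym (trans (•ᴹ-resp g v (lin (polytabloid θ) c) p r) (cong (λ u → coeff u r) (•ᴹ-lin g (polytabloid θ) c))))
    (S-lin (λ τ → g •ᴹ polytabloid θ τ) c λ τ → subst (Specht θ) (sym (•ᴹ-· g τ (polytabloid₀ θ))) (Span-gen (polytabloid θ) (g · τ)))
  where open IsSubspace (Span-subspace (polytabloid θ))

Specht-basis : ∀ {n} (θ : Partition n) → Basis (Specht θ)
Specht-basis {n} θ = Span-basis (polytabloid θ) (perms n) λ τ →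
  let ρ , ρ∈ , e = perms-complete τ in
  ρ , ρ∈ , List.map-cong (λ { (q , r) → cong (q ,_) (•-cong τ ρ e r) }) (polytabloid₀ θ)

χ : ∀ {n} → Partition n → Permutation′ n → ℚ
χ θ g = trace (Specht-basis θ) (g •ᴹ_) (Specht-invariant θ g)

------------------------------------------------------------------------
-- The tuples (φ , σ₀ , … , σₘ₋₁) and their generating function

product : ∀ {m n} → Vec (Permutation′ n) m → Permutation′ n
product = Vec.foldr′ _·_ id

HeadIsLongCycle : ∀ {m n} → Vec (Permutation′ n) m → Set
HeadIsLongCycle         []      = ⊥
HeadIsLongCycle {n = n} (σ ∷ _) = cycleType σ ≡ n ∷ []

headIsLongCycle? : ∀ {m n} → Decidable (HeadIsLongCycle {m} {n})
headIsLongCycle? []      = no λ ()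
headIsLongCycle? (σ ∷ _) = List.≡-dec ℕ._≟_ (cycleType σ) _

Tuple : ℕ → ℕ → Set
Tuple m n = Permutation′ n × Vec (Permutation′ n) m

In𝓜 : ∀ {m n} → Partition n → Tuple m n → Set
In𝓜 lam (φ , σs) = φ · product σs ≈ id × InClass lam φ × HeadIsLongCycle σs

in𝓜? : ∀ {m n} (lam : Partition n) → Decidable (In𝓜 {m} lam)
in𝓜? lam (φ , σs) =
  Fin.all? (λ i → (φ · product σs ⟨$⟩ʳ i) Fin.≟ i) ×-dec inClass? lam φ ×-dec headIsLongCycle? σs

vectors : ∀ {A : Set} m → List A → List (Vec A m)
vectors zero    xs = [] ∷ []
vectors (suc m) xs = cartesianProductWith _∷_ xs (vectors m xs)

𝓜 : ∀ m {n} → Partition n → List (Tuple m n)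
𝓜 m {n} lam = filter (in𝓜? lam) (cartesianProduct (perms n) (vectors m (perms n)))

-- For tuples in 𝓜 the numerator is even, since the signs of the
-- permutations multiply to 1; so the division is exact.
genus : ∀ {m n} → Partition n → Tuple m n → ℤ
genus {m} {n} lam (φ , σs) =
  1ℤ ℤ.+ ((+ m ℤ.- 1ℤ) ℤ.* + n ℤ.- + ℓ lam ℤ.- + Vec.sum (Vec.map cyc σs)) ℤ./ (+ 2)

Γ : ∀ m {n} → Partition n → Laurent
Γ m lam = ∑ᴸ (𝓜 m lam) λ M → monomial 1ℚ (genus lam M)

P : ∀ m {n} → Partition n → Laurent
P m {n} lam = t^ ((+ m ℤ.- 1ℤ) ℤ.* + n ℤ.+ 1ℤ) *ᴸ Γ m lam [t^ ℤ.- + 2 ]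

H : ℕ → ℕ → Laurent
H n a = ∏ᴸ (upTo n) λ j → t^ 1ℤ +ᴸ const ((+ j ℤ.- + a) ℚ./ 1)

{-# OPTIONS --safe #-}
-- For the hook [n − a, 1ᵃ] let F(σ) be the coefficient of a polytabloid e at σ • y. By the Garnir
-- relations, a polytabloid whose column consists of the last letters is an eigenvector of every
-- Jucys–Murphy element Σ_{j > i} (i j), the eigenvalues being the contents of the hook. As
-- Σ_σ t^cyc(σ) σ = ∏ᵢ (t + Σ_{j > i} (i j)) is central, it acts on the Specht module as H_{n,a}(t).
-- The Garnir relations also give the reproducing formula
-- a! (n − a − 1)! n v(y) = Σ_g v(g y₀) (g e)(y) for v in the Specht module, so that its character
-- χ_a satisfies a! (n − a − 1)! n χ_a(φ) = Σ_g F(g⁻¹ φ⁻¹ g) with y = y₀. Rewriting the sum over g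
-- as one over sets of letters with a marked element j, one finds that n Σ_a (−1)^a χ_a(φ) is the
-- sum over j of det(1 − φ) with the row of j replaced by ones, hence n² if φ is an n-cycle and 0
-- otherwise. So (1/n) Σ_a (−1)^a χ_a is the indicator of the n-cycles, which accounts for σ₀, and
-- summing over σ₁, …, σₘ₋₁ in turn multiplies χ_a by H_{n,a}(t) each time.

module Submission where

open import Defs
open import Algebra.Bundles using (CommutativeRing; CommutativeSemiring)
import Algebra.Properties.CommutativeMonoid.Sum as MonoidSum
import Algebra.Properties.Semiring.Mult as Mult
import Algebra.Properties.Semiring.Sum as SemiringSum
open import Data.Bool.Base using (Bool; true; false; if_then_else_; not)
import Data.Bool.Properties as Bool
open import Data.Empty using (⊥)
open import Data.Fin.Base as Fin using (Fin; zero; suc; toℕ)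
open import Data.Fin.Permutation as Perm using (Permutation′; _⟨$⟩ʳ_; _⟨$⟩ˡ_; flip; insert; remove; transpose; lift₀; inverseˡ; inverseʳ) renaming (_≈_ to _≈ₚ_; id to idₚ)
import Data.Fin.Properties as Fin
open import Data.Integer.Base as ℤ using (ℤ; 0ℤ; 1ℤ)
open import Data.Integer.DivMod using (a≡a%n+[a/n]*n; n%d<d)
import Data.Integer.Properties as ℤ
open import Data.Integer.Solver using () renaming (module +-*-Solver to ℤ-Solver)
open import Data.List.Base as List using (List; []; _∷_; _++_; map; filter; foldr; length; concatMap; allFin; tabulate; applyUpTo; cartesianProductWith)
open import Data.List.Membership.Propositional using (_∈_)
open import Data.List.Membership.Propositional.Properties using (∈-filter⁺; ∈-filter⁻; ∈-allFin)
import Data.List.Properties as List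
open import Data.List.Relation.Binary.Permutation.Propositional using (_↭_; ↭-sym; ↭-trans; ↭-reflexive; ↭⇒↭ₛ)
open import Data.List.Relation.Binary.Permutation.Propositional.Properties using (↭-length; ↭-singleton-inv)
import Data.List.Relation.Unary.All as All
open import Data.List.Relation.Unary.AllPairs using ([]; _∷_)
open import Data.List.Relation.Unary.Any using (here; there)
open import Data.List.Relation.Unary.Unique.Propositional using (Unique)
import Data.List.Relation.Unary.Unique.Propositional.Properties as Unique
open import Data.Nat.Base as ℕ using (ℕ; zero; suc; _∸_; _!; NonZero)
open import Data.Nat.Divisibility using (_∣_; divides; m%n≡0⇒n∣m)
open import Data.Nat.DivMod using (_%_; m≡m%n+[m/n]*n; m%n<n)
open import Data.Nat.GeneralisedArithmetic using (fold)
import Data.Nat.Properties as ℕ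
open import Data.Product.Base using (_×_; _,_; proj₁; proj₂; ∃; map₁; map₂)
open import Data.Rational.Base as ℚ using (ℚ; 0ℚ; 1ℚ)
import Data.Rational.Properties as ℚ
open import Data.Rational.Solver using () renaming (module +-*-Solver to ℚ-Solver)
open import Data.Rational.Unnormalised.Base as ℚᵘ using (mkℚᵘ; *≡*)
import Data.Rational.Unnormalised.Properties as ℚᵘ
open import Data.Sum.Base using (inj₁; inj₂)
open import Data.Vec.Base as Vec using (Vec; []; _∷_; lookup)
import Data.Vec.Properties as Vec
open import Function.Base using (_∘_)
open import Function.Bundles using (Inverse)
open import Level using (0ℓ)
open import Relation.Binary.Construct.Flip.EqAndOrd using () renaming (decTotalOrder to flipOrder)
open import Relation.Binary.Definitions using (Tri; tri<; tri≈; tri>)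
import Relation.Binary.PropositionalEquality as ≡
open import Relation.Nullary using (¬_)
open import Relation.Nullary.Decidable using (Dec; yes; no; does; ¬?; _×-dec_; _→-dec_; decidable-stable; dec-true; dec-false)
open import Relation.Nullary.Negation using (contradiction)
open import Relation.Unary using (Decidable)

open import Algebra.Properties.Ring ℚ.+-*-ring using () renaming (-‿involutive to neg-involutive)
open import Data.List.Relation.Binary.Permutation.Setoid (≡.setoid ℕ) using (onIndices)
open import Data.List.Relation.Binary.Permutation.Setoid.Properties (≡.setoid ℕ) using (onIndices-lookup)
open import Data.List.Sort.InsertionSort.Properties (flipOrder ℕ.≤-decTotalOrder) using (sort-↭)

open ≡ using (_≡_; _≢_; cong; cong₂; subst)

-- Finite sums and sums over permutations

-- The basis of a Specht module comes from Gaussian elimination and is not explicit, so `χ` must be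
-- reached through a formula valid in every basis. The reproducing formula serves here: for y = y₀
-- it says that the Young symmetrizer is idempotent up to a factor, the product a! (n - a - 1)! n of
-- the hook lengths. It writes a multiple of any v as a combination of polytabloids with
-- coefficients linear in v, and from this the trace is read off. The determinant arises because the
-- condition on a column permutation π in F(g⁻¹ φ⁻¹ g), after conjugation by g, splits letter by
-- letter: apart from the corner, a letter is fixed by φ π if it is in the column and by π if not.
-- Summed over all columns with signs, this multiplies out to one factor [π u = u] - [φ π u = u] per
-- letter; the corner is unconstrained and gives the row of ones. Permutations are records of
-- functions and are compared pointwise by `_≈ₚ_`, so a summand must be shown to respect this
-- relation (`Resp`) before a sum is reindexed.

module Sums (R : CommutativeSemiring 0ℓ 0ℓ) where
  open CommutativeSemiring R hiding (zero)
  private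
    module S = SemiringSum semiring
    module M = MonoidSum *-commutativeMonoid
  open import Relation.Binary.Reasoning.Setoid setoid

  private variable
    X Y : Set
    A B : Set

  -- Opaque, so that an equation between sums determines the summands.
  opaque
    ∑ : List X → (X → Carrier) → Carrier
    ∑ xs f = foldr _+_ 0# (map f xs)

  opaque
    sum : ∀ {n} → (Fin n → Carrier) → Carrier
    sum = S.sum

  opaque
    𝟙 : Dec A → Carrier
    𝟙 d = if does d then 1# else 0#

  opaque
    unfolding 𝟙

    𝟙-yes : (d : Dec A) → A → 𝟙 d ≈ 1#
    𝟙-yes d a rewrite dec-true d a = refl

    𝟙-no : (d : Dec A) → ¬ A → 𝟙 d ≈ 0#
    𝟙-no d ¬a rewrite dec-false d ¬a = refl

  opaque
    unfolding sum

    sum-[] : (f : Fin 0 → Carrier) → sum f ≈ 0#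
    sum-[] f = refl

    sum-suc : ∀ {n} (f : Fin (suc n) → Carrier) → sum f ≈ f zero + sum (λ i → f (suc i))
    sum-suc f = refl

    sum-cong : ∀ {n} {f g : Fin n → Carrier} → (∀ i → f i ≈ g i) → sum f ≈ sum g
    sum-cong = S.sum-cong-≋

    sum-0 : ∀ n → sum {n} (λ _ → 0#) ≈ 0#
    sum-0 = S.sum-replicate-zero

    sum-+ : ∀ {n} (f g : Fin n → Carrier) → sum (λ i → f i + g i) ≈ sum f + sum g
    sum-+ = S.∑-distrib-+

    sum-swap : ∀ {m n} (f : Fin m → Fin n → Carrier) → sum (λ i → sum (f i)) ≈ sum (λ j → sum (λ i → f i j))
    sum-swap = S.∑-comm

    sum-*ˡ : ∀ {n} a (f : Fin n → Carrier) → a * sum f ≈ sum (λ i → a * f i)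
    sum-*ˡ = S.*-distribˡ-sum

    sum-*ʳ : ∀ {n} a (f : Fin n → Carrier) → sum f * a ≈ sum (λ i → f i * a)
    sum-*ʳ = S.*-distribʳ-sum

    sum-permute : ∀ {n} (f : Fin n → Carrier) (π : Permutation′ n) → sum (λ i → f (π ⟨$⟩ʳ i)) ≈ sum f
    sum-permute f π = sym (S.sum-permute f π)

    sum-punchIn : ∀ {n} (i : Fin (suc n)) (f : Fin (suc n) → Carrier) → sum f ≈ f i + sum (λ j → f (Fin.punchIn i j))
    sum-punchIn i f = S.sum-remove f

  opaque
    prod : ∀ {n} → (Fin n → Carrier) → Carrier
    prod = M.sum

  opaque
    unfolding prod

    prod-[] : (f : Fin 0 → Carrier) → prod f ≈ 1#
    prod-[] f = refl

    prod-suc : ∀ {n} (f : Fin (suc n) → Carrier) → prod f ≈ f zero * prod (λ i → f (suc i))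
    prod-suc f = refl

    prod-cong : ∀ {n} {f g : Fin n → Carrier} → (∀ i → f i ≈ g i) → prod f ≈ prod g
    prod-cong = M.sum-cong-≋

    prod-* : ∀ {n} (f g : Fin n → Carrier) → prod (λ i → f i * g i) ≈ prod f * prod g
    prod-* = M.∑-distrib-+

    prod-permute : ∀ {n} (f : Fin n → Carrier) (π : Permutation′ n) → prod (λ i → f (π ⟨$⟩ʳ i)) ≈ prod f
    prod-permute f π = sym (M.sum-permute f π)

    prod-punchIn : ∀ {n} (i : Fin (suc n)) (f : Fin (suc n) → Carrier) → prod f ≈ f i * prod (λ j → f (Fin.punchIn i j))
    prod-punchIn i f = M.sum-remove f

    prod-init-last : ∀ {n} (f : Fin (suc n) → Carrier) → prod f ≈ prod (λ i → f (Fin.inject₁ i)) * f (Fin.fromℕ n)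
    prod-init-last = M.sum-init-last

    ∏-applyUpTo : (h : ℕ → X) (n : ℕ) (f : X → Carrier) → foldr _*_ 1# (map f (applyUpTo h n)) ≡ prod {n} (λ i → f (h (toℕ i)))
    ∏-applyUpTo h zero    f = ≡.refl
    ∏-applyUpTo h (suc n) f = cong (f (h 0) *_) (∏-applyUpTo (h ∘ suc) n f)

  sum-zero : ∀ {n} {f : Fin n → Carrier} → (∀ i → f i ≈ 0#) → sum f ≈ 0#
  sum-zero {n} e = trans (sum-cong e) (sum-0 n)

  𝟙-cong : (d : Dec A) (e : Dec B) → (A → B) → (B → A) → 𝟙 d ≈ 𝟙 e
  𝟙-cong d e@(yes b) f g = trans (𝟙-yes d (g b)) (sym (𝟙-yes e b))
  𝟙-cong d e@(no ¬b) f g = trans (𝟙-no d (¬b ∘ f)) (sym (𝟙-no e ¬b))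

  𝟙-yes* : (d : Dec A) {x : Carrier} → A → 𝟙 d * x ≈ x
  𝟙-yes* d a = trans (*-congʳ (𝟙-yes d a)) (*-identityˡ _)

  𝟙-no* : (d : Dec A) {x : Carrier} → ¬ A → 𝟙 d * x ≈ 0#
  𝟙-no* d ¬a = trans (*-congʳ (𝟙-no d ¬a)) (zeroˡ _)

  𝟙-× : (d : Dec A) (e : Dec B) → 𝟙 (d ×-dec e) ≈ 𝟙 d * 𝟙 e
  𝟙-× d@(yes a) e = trans (𝟙-cong (d ×-dec e) e proj₂ (a ,_)) (sym (𝟙-yes* d a))
  𝟙-× d@(no ¬a) e = trans (𝟙-no (d ×-dec e) (¬a ∘ proj₁)) (sym (𝟙-no* d ¬a))

  -- An equation that holds only under a condition may be used inside a sum weighted by the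
  -- indicator of that condition. Membership in a class, in a support or in 𝓜 is exploited in this
  -- way.
  𝟙-guard : (d : Dec A) {x y : Carrier} → (A → x ≈ y) → 𝟙 d * x ≈ 𝟙 d * y
  𝟙-guard d@(yes a) f = *-congˡ (f a)
  𝟙-guard d@(no ¬a) f = trans (𝟙-no* d ¬a) (sym (𝟙-no* d ¬a))

  x*yz≈y*xz : ∀ x y z → x * (y * z) ≈ y * (x * z)
  x*yz≈y*xz x y z = trans (sym (*-assoc x y z)) (trans (*-congʳ (*-comm x y)) (*-assoc y x z))

  opaque
    unfolding ∑

    ∑-[] : (f : X → Carrier) → ∑ [] f ≈ 0#
    ∑-[] f = refl

    ∑-∷ : ∀ x (xs : List X) (f : X → Carrier) → ∑ (x ∷ xs) f ≈ f x + ∑ xs f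
    ∑-∷ x xs f = refl

    ∑≡foldr : (xs : List X) (f : X → Carrier) → ∑ xs f ≡ foldr _+_ 0# (map f xs)
    ∑≡foldr xs f = ≡.refl

    ∑-cong : (xs : List X) {f g : X → Carrier} → (∀ x → f x ≈ g x) → ∑ xs f ≈ ∑ xs g
    ∑-cong []       e = refl
    ∑-cong (x ∷ xs) e = +-cong (e x) (∑-cong xs e)

    ∑-0 : (xs : List X) → ∑ xs (λ _ → 0#) ≈ 0#
    ∑-0 []       = refl
    ∑-0 (x ∷ xs) = trans (+-identityˡ _) (∑-0 xs)

    ∑-zero : (xs : List X) {f : X → Carrier} → (∀ x → f x ≈ 0#) → ∑ xs f ≈ 0#
    ∑-zero xs e = trans (∑-cong xs e) (∑-0 xs)

    ∑-++ : (xs ys : List X) (f : X → Carrier) → ∑ (xs ++ ys) f ≈ ∑ xs f + ∑ ys f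
    ∑-++ []       ys f = sym (+-identityˡ _)
    ∑-++ (x ∷ xs) ys f = trans (+-congˡ (∑-++ xs ys f)) (sym (+-assoc _ _ _))

    ∑-map : (h : X → Y) (xs : List X) (f : Y → Carrier) → ∑ (map h xs) f ≈ ∑ xs (f ∘ h)
    ∑-map h []       f = refl
    ∑-map h (x ∷ xs) f = +-congˡ (∑-map h xs f)

    ∑-concatMap : (h : X → List Y) (xs : List X) (f : Y → Carrier) →
                  ∑ (concatMap h xs) f ≈ ∑ xs (λ x → ∑ (h x) f)
    ∑-concatMap h []       f = refl
    ∑-concatMap h (x ∷ xs) f = trans (∑-++ (h x) (concatMap h xs) f) (+-congˡ (∑-concatMap h xs f))

    ∑-cartesianProductWith : ∀ {Z : Set} (h : X → Y → Z) (xs : List X) (ys : List Y) (f : Z → Carrier) →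
                             ∑ (cartesianProductWith h xs ys) f ≈ ∑ xs (λ x → ∑ ys (λ y → f (h x y)))
    ∑-cartesianProductWith h []       ys f = refl
    ∑-cartesianProductWith h (x ∷ xs) ys f =
      trans (∑-++ (map (h x) ys) _ f) (+-cong (∑-map (h x) ys f) (∑-cartesianProductWith h xs ys f))

    ∑-filter : {P : X → Set} (P? : Decidable P) (xs : List X) (f : X → Carrier) →
               ∑ (filter P? xs) f ≈ ∑ xs (λ x → 𝟙 (P? x) * f x)
    ∑-filter P? []       f = refl
    ∑-filter P? (x ∷ xs) f with P? x
    ... | d@(yes p) = +-cong (sym (𝟙-yes* d p)) (∑-filter P? xs f)
    ... | d@(no ¬p) = trans (∑-filter P? xs f) (sym (trans (+-congʳ (𝟙-no* d ¬p)) (+-identityˡ _)))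

    ∑-tabulate : ∀ {n} (h : Fin n → X) (f : X → Carrier) → ∑ (tabulate h) f ≈ sum (λ i → f (h i))
    ∑-tabulate {n = zero}  h f = sym (sum-[] _)
    ∑-tabulate {n = suc n} h f = trans (+-congˡ (∑-tabulate (h ∘ suc) f)) (sym (sum-suc _))

    ∑-+ : (xs : List X) (f g : X → Carrier) → ∑ xs (λ x → f x + g x) ≈ ∑ xs f + ∑ xs g
    ∑-+ []       f g = sym (+-identityˡ _)
    ∑-+ (x ∷ xs) f g = begin
      (f x + g x) + ∑ xs (λ x → f x + g x) ≈⟨ +-congˡ (∑-+ xs f g) ⟩
      (f x + g x) + (∑ xs f + ∑ xs g) ≈⟨ +-assoc _ _ _ ⟩
      f x + (g x + (∑ xs f + ∑ xs g)) ≈⟨ +-congˡ (trans (sym (+-assoc _ _ _)) (trans (+-congʳ (+-comm _ _)) (+-assoc _ _ _))) ⟩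
      f x + (∑ xs f + (g x + ∑ xs g)) ≈⟨ +-assoc _ _ _ ⟨
      (f x + ∑ xs f) + (g x + ∑ xs g) ∎

    ∑-*ˡ : ∀ a (xs : List X) (f : X → Carrier) → a * ∑ xs f ≈ ∑ xs (λ x → a * f x)
    ∑-*ˡ a []       f = zeroʳ a
    ∑-*ˡ a (x ∷ xs) f = trans (distribˡ a _ _) (+-congˡ (∑-*ˡ a xs f))

    ∑-*ʳ : ∀ a (xs : List X) (f : X → Carrier) → ∑ xs f * a ≈ ∑ xs (λ x → f x * a)
    ∑-*ʳ a xs f = trans (*-comm _ a) (trans (∑-*ˡ a xs f) (∑-cong xs λ x → *-comm a (f x)))

    ∑-swap : (xs : List X) (ys : List Y) (f : X → Y → Carrier) →
             ∑ xs (λ x → ∑ ys (f x)) ≈ ∑ ys (λ y → ∑ xs (λ x → f x y))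
    ∑-swap []       ys f = sym (∑-0 ys)
    ∑-swap (x ∷ xs) ys f = trans (+-congˡ (∑-swap xs ys f)) (sym (∑-+ ys (f x) _))

    ∑-sum : ∀ {n} (xs : List X) (f : X → Fin n → Carrier) →
            ∑ xs (λ x → sum (f x)) ≈ sum (λ i → ∑ xs (λ x → f x i))
    ∑-sum {n = n} [] f = sym (sum-0 n)
    ∑-sum (x ∷ xs) f = trans (+-congˡ (∑-sum xs f)) (sym (sum-+ (f x) _))

  sum-single : ∀ {n} (i : Fin n) (f : Fin n → Carrier) → sum (λ j → 𝟙 (i Fin.≟ j) * f j) ≈ f i
  sum-single {suc n} i f = begin
    sum (λ j → 𝟙 (i Fin.≟ j) * f j) ≈⟨ sum-punchIn i _ ⟩
    𝟙 (i Fin.≟ i) * f i + sum (λ j → 𝟙 (i Fin.≟ Fin.punchIn i j) * f (Fin.punchIn i j)) ≈⟨ +-cong (𝟙-yes* (i Fin.≟ i) ≡.refl) (sum-zero λ j → 𝟙-no* (i Fin.≟ Fin.punchIn i j) (Fin.punchInᵢ≢i i j ∘ ≡.sym)) ⟩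
    f i + 0# ≈⟨ +-identityʳ _ ⟩
    f i ∎

  sum-single-1 : ∀ {n} (i : Fin n) → sum (λ j → 𝟙 (i Fin.≟ j)) ≈ 1#
  sum-single-1 i = trans (sum-cong λ j → sym (*-identityʳ _)) (sum-single i (λ _ → 1#))

-- Transpositions and enumerations of the symmetric group

infix 4 _≈ₚ?_
_≈ₚ?_ : ∀ {n} (σ τ : Permutation′ n) → Dec (σ ≈ₚ τ)
σ ≈ₚ? τ = Fin.all? λ i → (σ ⟨$⟩ʳ i) Fin.≟ (τ ⟨$⟩ʳ i)

to-injective : ∀ {n} (σ : Permutation′ n) {i j} → σ ⟨$⟩ʳ i ≡ σ ⟨$⟩ʳ j → i ≡ j
to-injective σ {i} {j} e = ≡.trans (≡.sym (inverseˡ σ)) (≡.trans (cong (σ ⟨$⟩ˡ_) e) (inverseˡ σ))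

to⇒from : ∀ {n} (σ : Permutation′ n) {i j} → σ ⟨$⟩ʳ i ≡ j → i ≡ σ ⟨$⟩ˡ j
to⇒from σ e = ≡.trans (≡.sym (inverseˡ σ)) (cong (σ ⟨$⟩ˡ_) e)

from⇒to : ∀ {n} (σ : Permutation′ n) {i j} → σ ⟨$⟩ˡ i ≡ j → i ≡ σ ⟨$⟩ʳ j
from⇒to σ e = ≡.trans (≡.sym (inverseʳ σ)) (cong (σ ⟨$⟩ʳ_) e)

transpose-matchˡ : ∀ {n} (i j : Fin n) → transpose i j ⟨$⟩ʳ i ≡ j
transpose-matchˡ i j rewrite dec-true (i Fin.≟ i) ≡.refl = ≡.refl

transpose-matchʳ : ∀ {n} (i j : Fin n) → transpose i j ⟨$⟩ʳ j ≡ i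
transpose-matchʳ i j with j Fin.≟ i
... | yes e = e
... | no _ rewrite dec-true (j Fin.≟ j) ≡.refl = ≡.refl

transpose-other : ∀ {n} {i j k : Fin n} → k ≢ i → k ≢ j → transpose i j ⟨$⟩ʳ k ≡ k
transpose-other {i = i} {j} {k} k≢i k≢j rewrite dec-false (k Fin.≟ i) k≢i | dec-false (k Fin.≟ j) k≢j = ≡.refl

-- Indexed by the value of the transposition at k, so that matching on the view replaces that value.
-- `atʳ` records `k ≢ i` because i may equal j and `k ≡ i` is tested before `k ≡ j`.
data TransposeView {n} (i j k : Fin n) : Fin n → Set where
  atˡ   : k ≡ i → TransposeView i j k j
  atʳ   : k ≢ i → k ≡ j → TransposeView i j k i
  other : k ≢ i → k ≢ j → TransposeView i j k k

transposeView : ∀ {n} (i j k : Fin n) → TransposeView i j k (transpose i j ⟨$⟩ʳ k)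
transposeView i j k with k Fin.≟ i
... | yes e = atˡ e
... | no ne with k Fin.≟ j
...   | yes e = atʳ ne e
...   | no ne′ = other ne ne′

transpose-involutive : ∀ {n} (i j k : Fin n) → transpose i j ⟨$⟩ʳ (transpose i j ⟨$⟩ʳ k) ≡ k
transpose-involutive i j k with transpose i j ⟨$⟩ʳ k | transposeView i j k
... | _ | atˡ e     = ≡.trans (transpose-matchʳ i j) (≡.sym e)
... | _ | atʳ _ e   = ≡.trans (transpose-matchˡ i j) (≡.sym e)
... | _ | other a b = transpose-other a b

transpose-conj : ∀ {n} (g : Permutation′ n) (i j k : Fin n) →
                 g ⟨$⟩ʳ (transpose i j ⟨$⟩ʳ k) ≡ transpose (g ⟨$⟩ʳ i) (g ⟨$⟩ʳ j) ⟨$⟩ʳ (g ⟨$⟩ʳ k)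
transpose-conj g i j k with transpose i j ⟨$⟩ʳ k | transposeView i j k
... | _ | atˡ ≡.refl   = ≡.sym (transpose-matchˡ (g ⟨$⟩ʳ i) (g ⟨$⟩ʳ j))
... | _ | atʳ _ ≡.refl = ≡.sym (transpose-matchʳ (g ⟨$⟩ʳ i) (g ⟨$⟩ʳ j))
... | _ | other a b    = ≡.sym (transpose-other (a ∘ to-injective g) (b ∘ to-injective g))

insert-cong : ∀ {n} (j : Fin (suc n)) {π ρ : Permutation′ n} → π ≈ₚ ρ → insert zero j π ≈ₚ insert zero j ρ
insert-cong j e zero    = ≡.refl
insert-cong j e (suc i) = cong (Fin.punchIn j) (e i)

remove-cong : ∀ {n} {π ρ : Permutation′ (suc n)} → π ≈ₚ ρ → remove zero π ≈ₚ remove zero ρ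
remove-cong {π = π} {ρ} e i =
  Fin.punchIn-injective (π ⟨$⟩ʳ zero) _ _ (≡.trans (≡.sym (Perm.punchIn-permute π zero i))
    (≡.trans (e (suc i)) (≡.trans (Perm.punchIn-permute ρ zero i) (cong (λ z → Fin.punchIn z (remove zero ρ ⟨$⟩ʳ i)) (≡.sym (e zero))))))

opaque
  𝔖 : ∀ n → List (Permutation′ n)
  𝔖 = perms

  𝔖≡perms : ∀ n → 𝔖 n ≡ perms n
  𝔖≡perms n = ≡.refl

-- A second enumeration, by the cosets of the stabilizer of `zero`. The factorization (0 j) · lift₀
-- π shows how the number of cycles changes with n and splits off one Jucys-Murphy factor, neither
-- of which is visible in `insert zero j π`.
perms′ : ∀ n → List (Permutation′ (suc n))
perms′ n = concatMap (λ j → map (λ π → transpose zero j · lift₀ π) (𝔖 n)) (allFin (suc n))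

module PermSums (R : CommutativeSemiring 0ℓ 0ℓ) where
  open CommutativeSemiring R hiding (zero)
  open Sums R public
  open import Relation.Binary.Reasoning.Setoid setoid

  Resp : ∀ {n} → (Permutation′ n → Carrier) → Set
  Resp F = ∀ {σ τ} → σ ≈ₚ τ → F σ ≈ F τ

  -- Multiplicity one up to `_≈ₚ_`, counted in `R`: in this form it is a factor 1# that can be
  -- inserted into a sum.
  Enumerates : ∀ {n} → List (Permutation′ n) → Set
  Enumerates xs = ∀ τ → ∑ xs (λ σ → 𝟙 (σ ≈ₚ? τ)) ≈ 1#

  -- The double sum of [τ ≈ f σ] F(f σ) is evaluated in both orders. Summing over τ first leaves F(f
  -- σ); summing over σ first finds the one σ ≈ g τ and leaves F τ.
  ∑-bijection : ∀ {n} {xs ys : List (Permutation′ n)} → Enumerates xs → Enumerates ys →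
                (f g : Permutation′ n → Permutation′ n) →
                (∀ {σ τ} → f σ ≈ₚ τ → σ ≈ₚ g τ) → (∀ {σ τ} → σ ≈ₚ g τ → f σ ≈ₚ τ) →
                {F : Permutation′ n → Carrier} → Resp F → ∑ xs (λ σ → F (f σ)) ≈ ∑ ys F
  ∑-bijection {xs = xs} {ys} xs! ys! f g to from {F} F-resp = begin
    ∑ xs (λ σ → F (f σ)) ≈⟨ ∑-cong xs (λ σ → trans (sym (*-identityˡ _)) (*-congʳ (sym (ys! (f σ))))) ⟩
    ∑ xs (λ σ → ∑ ys (λ τ → 𝟙 (τ ≈ₚ? f σ)) * F (f σ)) ≈⟨ ∑-cong xs (λ σ → ∑-*ʳ (F (f σ)) ys _) ⟩
    ∑ xs (λ σ → ∑ ys (λ τ → 𝟙 (τ ≈ₚ? f σ) * F (f σ))) ≈⟨ ∑-swap xs ys _ ⟩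
    ∑ ys (λ τ → ∑ xs (λ σ → 𝟙 (τ ≈ₚ? f σ) * F (f σ))) ≈⟨ ∑-cong ys (λ τ → ∑-cong xs λ σ → trans (𝟙-guard (τ ≈ₚ? f σ) (λ e → F-resp (λ i → ≡.sym (e i)))) (*-congʳ (𝟙-cong (τ ≈ₚ? f σ) (σ ≈ₚ? g τ) (λ e → to (λ i → ≡.sym (e i))) (λ e i → ≡.sym (from e i))))) ⟩
    ∑ ys (λ τ → ∑ xs (λ σ → 𝟙 (σ ≈ₚ? g τ) * F τ)) ≈⟨ ∑-cong ys (λ τ → trans (sym (∑-*ʳ (F τ) xs _)) (trans (*-congʳ (xs! (g τ))) (*-identityˡ _))) ⟩
    ∑ ys F ∎

  ∑-enumerations : ∀ {n} {xs ys : List (Permutation′ n)} → Enumerates xs → Enumerates ys →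
                   {F : Permutation′ n → Carrier} → Resp F → ∑ xs F ≈ ∑ ys F
  ∑-enumerations xs! ys! = ∑-bijection xs! ys! (λ σ → σ) (λ σ → σ) (λ e → e) (λ e → e)

  ∑-concatMap-allFin : ∀ {m n} {X : Set} (h : Fin n → Permutation′ m → X) (F : X → Carrier) →
    ∑ (concatMap (λ j → map (h j) (𝔖 m)) (allFin n)) F ≈ sum (λ j → ∑ (𝔖 m) (λ π → F (h j π)))
  ∑-concatMap-allFin {m} {n} h F = begin
    ∑ (concatMap (λ j → map (h j) (𝔖 m)) (allFin n)) F ≈⟨ ∑-concatMap _ (allFin n) F ⟩
    ∑ (allFin n) (λ j → ∑ (map (h j) (𝔖 m)) F) ≈⟨ ∑-tabulate (λ j → j) (λ j → ∑ (map (h j) (𝔖 m)) F) ⟩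
    sum (λ j → ∑ (map (h j) (𝔖 m)) F) ≈⟨ sum-cong (λ j → ∑-map (h j) (𝔖 m) F) ⟩
    sum (λ j → ∑ (𝔖 m) (λ π → F (h j π))) ∎

  opaque
    unfolding 𝔖

    ∑-perms-suc : ∀ {n} (F : Permutation′ (suc n) → Carrier) →
                  ∑ (𝔖 (suc n)) F ≈ sum (λ j → ∑ (𝔖 n) (λ π → F (insert zero j π)))
    ∑-perms-suc = ∑-concatMap-allFin (insert zero)

    ∑-perms-0 : (F : Permutation′ 0 → Carrier) → ∑ (𝔖 0) F ≈ F idₚ
    ∑-perms-0 F = trans (∑-∷ _ _ _) (trans (+-congˡ (∑-[] _)) (+-identityʳ _))

  perms! : ∀ {n} → Enumerates (𝔖 n)
  perms! {zero}  τ = trans (∑-perms-0 _) (𝟙-yes (idₚ ≈ₚ? τ) (λ ()))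
  perms! {suc n} τ = begin
    ∑ (𝔖 (suc n)) (λ σ → 𝟙 (σ ≈ₚ? τ)) ≈⟨ ∑-perms-suc _ ⟩
    sum (λ j → ∑ (𝔖 n) (λ π → 𝟙 (insert zero j π ≈ₚ? τ))) ≈⟨ sum-cong (λ j → ∑-cong (𝔖 n) λ π → trans (𝟙-cong (insert zero j π ≈ₚ? τ) ((τ ⟨$⟩ʳ zero) Fin.≟ j ×-dec π ≈ₚ? remove zero τ) split join) (𝟙-× ((τ ⟨$⟩ʳ zero) Fin.≟ j) (π ≈ₚ? remove zero τ))) ⟩
    sum (λ j → ∑ (𝔖 n) (λ π → 𝟙 ((τ ⟨$⟩ʳ zero) Fin.≟ j) * 𝟙 (π ≈ₚ? remove zero τ))) ≈⟨ sum-cong (λ j → trans (sym (∑-*ˡ _ (𝔖 n) _)) (trans (*-congˡ (perms! {n} (remove zero τ))) (*-identityʳ _))) ⟩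
    sum (λ j → 𝟙 ((τ ⟨$⟩ʳ zero) Fin.≟ j)) ≈⟨ sum-single-1 (τ ⟨$⟩ʳ zero) ⟩
    1# ∎
    where
    split : ∀ {j π} → insert zero j π ≈ₚ τ → τ ⟨$⟩ʳ zero ≡ j × π ≈ₚ remove zero τ
    split {j} {π} e = ≡.sym (e zero) , λ i → ≡.trans (≡.sym (Perm.remove-insert zero j π i)) (remove-cong {π = insert zero j π} {τ} e i)
    join : ∀ {j π} → τ ⟨$⟩ʳ zero ≡ j × π ≈ₚ remove zero τ → insert zero j π ≈ₚ τ
    join {j} {π} (≡.refl , e) i = ≡.trans (insert-cong j {π} {remove zero τ} e i) (Perm.insert-remove zero τ i)

  perms′! : ∀ {n} → Enumerates (perms′ n)
  perms′! {n} τ = begin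
    ∑ (perms′ n) (λ σ → 𝟙 (σ ≈ₚ? τ)) ≈⟨ ∑-concatMap-allFin (λ j π → transpose zero j · lift₀ π) _ ⟩
    sum (λ j → ∑ (𝔖 n) (λ π → 𝟙 (transpose zero j · lift₀ π ≈ₚ? τ))) ≈⟨ sum-cong (λ j → ∑-cong (𝔖 n) λ π → trans (𝟙-cong (transpose zero j · lift₀ π ≈ₚ? τ) ((τ ⟨$⟩ʳ zero) Fin.≟ j ×-dec π ≈ₚ? rest j) split join) (𝟙-× ((τ ⟨$⟩ʳ zero) Fin.≟ j) (π ≈ₚ? rest j))) ⟩
    sum (λ j → ∑ (𝔖 n) (λ π → 𝟙 ((τ ⟨$⟩ʳ zero) Fin.≟ j) * 𝟙 (π ≈ₚ? rest j))) ≈⟨ sum-cong (λ j → trans (sym (∑-*ˡ _ (𝔖 n) _)) (trans (*-congˡ (perms! {n} (rest j))) (*-identityʳ _))) ⟩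
    sum (λ j → 𝟙 ((τ ⟨$⟩ʳ zero) Fin.≟ j)) ≈⟨ sum-single-1 (τ ⟨$⟩ʳ zero) ⟩
    1# ∎
    where
    -- If τ sends `zero` to j, then (0 j) τ fixes `zero` and is therefore a lift.
    τ⁰ : Fin (suc n) → Permutation′ (suc n)
    τ⁰ j = transpose zero j · τ
    rest : Fin (suc n) → Permutation′ n
    rest j = remove zero (τ⁰ j)
    split : ∀ {j π} → transpose zero j · lift₀ π ≈ₚ τ → τ ⟨$⟩ʳ zero ≡ j × π ≈ₚ rest j
    split {j} {π} e = ≡.trans (≡.sym (e zero)) (transpose-matchˡ zero j) , λ i →
      Fin.suc-injective (≡.trans (≡.trans (≡.sym (transpose-involutive zero j (suc (π ⟨$⟩ʳ i)))) (cong (transpose zero j ⟨$⟩ʳ_) (e (suc i))))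
        (≡.sym (Perm.lift₀-remove (τ⁰ j) (≡.trans (cong (transpose zero j ⟨$⟩ʳ_) (≡.sym (e zero))) (transpose-involutive zero j zero)) (suc i))))
    join : ∀ {j π} → τ ⟨$⟩ʳ zero ≡ j × π ≈ₚ rest j → transpose zero j · lift₀ π ≈ₚ τ
    join {j} {π} (≡.refl , e) i = ≡.trans (cong (transpose zero j ⟨$⟩ʳ_) (≡.trans (Perm.lift₀-cong π (rest j) e i) (Perm.lift₀-remove (τ⁰ j) (transpose-matchʳ zero j) i))) (transpose-involutive zero j (τ ⟨$⟩ʳ i))

  ∑-perms-suc′ : ∀ {n} {F : Permutation′ (suc n) → Carrier} → Resp F →
                 ∑ (𝔖 (suc n)) F ≈ sum (λ j → ∑ (𝔖 n) (λ π → F (transpose zero j · lift₀ π)))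
  ∑-perms-suc′ {n} {F} F-resp = trans (∑-enumerations {xs = 𝔖 (suc n)} {perms′ n} perms! perms′! F-resp) (∑-concatMap-allFin (λ j π → transpose zero j · lift₀ π) F)

  module _ {n} {F : Permutation′ n → Carrier} (F-resp : Resp F) where

    ∑-left : ∀ g → ∑ (𝔖 n) (λ σ → F (g · σ)) ≈ ∑ (𝔖 n) F
    ∑-left g = ∑-bijection {xs = 𝔖 n} {𝔖 n} perms! perms! (g ·_) (flip g ·_)
      (λ e i → to⇒from g (e i)) (λ e i → ≡.trans (cong (g ⟨$⟩ʳ_) (e i)) (inverseʳ g)) F-resp

    ∑-right : ∀ g → ∑ (𝔖 n) (λ σ → F (σ · g)) ≈ ∑ (𝔖 n) F
    ∑-right g = ∑-bijection {xs = 𝔖 n} {𝔖 n} perms! perms! (_· g) (_· flip g)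
      (λ {σ} {τ} e i → ≡.trans (cong (σ ⟨$⟩ʳ_) (≡.sym (inverseʳ g))) (e (g ⟨$⟩ˡ i)))
      (λ {σ} {τ} e i → ≡.trans (e (g ⟨$⟩ʳ i)) (cong (τ ⟨$⟩ʳ_) (inverseˡ g))) F-resp

    ∑-conj : ∀ g → ∑ (𝔖 n) (λ σ → F (g · σ · flip g)) ≈ ∑ (𝔖 n) F
    ∑-conj g = ∑-bijection {xs = 𝔖 n} {𝔖 n} perms! perms! (λ σ → g · σ · flip g) (λ σ → flip g · σ · g)
      (λ {σ} {τ} e i → to⇒from g (≡.trans (cong (λ z → g ⟨$⟩ʳ (σ ⟨$⟩ʳ z)) (≡.sym (inverseˡ g))) (e (g ⟨$⟩ʳ i))))
      (λ {σ} {τ} e i → ≡.trans (cong (g ⟨$⟩ʳ_) (e (g ⟨$⟩ˡ i))) (≡.trans (inverseʳ g) (cong (τ ⟨$⟩ʳ_) (inverseʳ g)))) F-resp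

    ∑-flip : ∑ (𝔖 n) (λ σ → F (flip σ)) ≈ ∑ (𝔖 n) F
    ∑-flip = ∑-bijection {xs = 𝔖 n} {𝔖 n} perms! perms! flip flip
      (λ {σ} {τ} e i → to⇒from τ (≡.trans (≡.sym (e (σ ⟨$⟩ʳ i))) (inverseˡ σ)))
      (λ {σ} {τ} e i → ≡.sym (to⇒from σ (≡.trans (e (τ ⟨$⟩ʳ i)) (inverseˡ τ)))) F-resp

open ≡ hiding (setoid; [_]; isEquivalence; decSetoid; preorder; isPreorder; poset)

-- Cycles and signs

module _ {n} (σ : Permutation′ n) where

  pow : ℕ → Fin n → Fin n
  pow k i = fold i (σ ⟨$⟩ʳ_) k

  pow-+ : ∀ k l i → pow (k ℕ.+ l) i ≡ pow k (pow l i)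
  pow-+ zero    l i = refl
  pow-+ (suc k) l i = cong (σ ⟨$⟩ʳ_) (pow-+ k l i)

  pow-injective : ∀ k {i j} → pow k i ≡ pow k j → i ≡ j
  pow-injective zero    e = e
  pow-injective (suc k) e = pow-injective k (to-injective σ e)

  infix 4 _∼_
  -- Unbounded exponents make transitivity immediate, while the bounded ones of `SameCycle` make it
  -- decidable. The two agree because an exponent may be reduced modulo a period, and the pigeonhole
  -- principle gives a period of at most n.
  _∼_ : Fin n → Fin n → Set
  i ∼ j = ∃ λ k → pow k i ≡ j

  pow-cancel : ∀ {k l i} → k ℕ.≤ l → pow k i ≡ pow l i → pow (l ∸ k) i ≡ i
  pow-cancel {k} {l} {i} k≤l e = sym (pow-injective k (trans e (trans (cong (λ z → pow z i) (sym (ℕ.m+[n∸m]≡n k≤l))) (pow-+ k (l ∸ k) i))))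

  period : ∀ i → ∃ λ p → NonZero p × p ℕ.≤ n × pow p i ≡ i
  period i with Fin.pigeonhole (ℕ.n<1+n n) (λ (k : Fin (suc n)) → pow (toℕ k) i)
  ... | k , l , k<l , e = toℕ l ∸ toℕ k , ℕ.>-nonZero (ℕ.m<n⇒0<n∸m k<l) , ℕ.≤-trans (ℕ.m∸n≤m (toℕ l) (toℕ k)) (ℕ.≤-pred (Fin.toℕ<n l)) , pow-cancel (ℕ.<⇒≤ k<l) e

  pow-* : ∀ {p i} k → pow p i ≡ i → pow (k ℕ.* p) i ≡ i
  pow-* {p} {i} zero    e = refl
  pow-* {p} {i} (suc k) e = trans (pow-+ p (k ℕ.* p) i) (trans (cong (pow p) (pow-* k e)) e)

  pow-% : ∀ {p i} k .{{_ : NonZero p}} → pow p i ≡ i → pow (k % p) i ≡ pow k i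
  pow-% {p} {i} k e = sym (trans (cong (λ z → pow z i) (m≡m%n+[m/n]*n k p)) (trans (pow-+ (k % p) _ i) (cong (pow (k % p)) (pow-* (k ℕ./ p) e))))

  ∼⇒SameCycle : ∀ {i j} → i ∼ j → SameCycle σ i j
  ∼⇒SameCycle {i} {j} (k , e) with period i
  ... | p , p≢0 , p≤n , pᵢ = Fin.fromℕ< k%p<n , trans (cong (λ z → pow z i) (Fin.toℕ-fromℕ< k%p<n)) (trans (pow-% k pᵢ) e)
    where
    instance _ = p≢0
    k%p<n : k % p ℕ.< n
    k%p<n = ℕ.<-≤-trans (m%n<n k p) p≤n

  SameCycle⇒∼ : ∀ {i j} → SameCycle σ i j → i ∼ j
  SameCycle⇒∼ (k , e) = toℕ k , e

  ∼-refl : ∀ {i} → i ∼ i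
  ∼-refl = 0 , refl

  ∼-trans : ∀ {i j k} → i ∼ j → j ∼ k → i ∼ k
  ∼-trans (a , refl) (b , refl) = b ℕ.+ a , pow-+ b a _

  ∼-sym : ∀ {i j} → i ∼ j → j ∼ i
  ∼-sym {i} (k , refl) with period i
  -- The exponent k p is a multiple of the period and at least k, so k p - k further steps lead back
  -- to i.
  ... | p , p≢0 , _ , pᵢ = k ℕ.* p ∸ k , trans (sym (pow-+ (k ℕ.* p ∸ k) k i)) (trans (cong (λ z → pow z i) (ℕ.m∸n+n≡m (ℕ.m≤m*n k p {{p≢0}}))) (pow-* k pᵢ))

  ∼-step : ∀ {i} → i ∼ σ ⟨$⟩ʳ i
  ∼-step = 1 , refl

  SameCycle-refl : ∀ {i} → SameCycle σ i i
  SameCycle-refl = ∼⇒SameCycle ∼-refl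

  SameCycle-trans : ∀ {i j k} → SameCycle σ i j → SameCycle σ j k → SameCycle σ i k
  SameCycle-trans p q = ∼⇒SameCycle (∼-trans (SameCycle⇒∼ p) (SameCycle⇒∼ q))

  SameCycle-sym : ∀ {i j} → SameCycle σ i j → SameCycle σ j i
  SameCycle-sym p = ∼⇒SameCycle (∼-sym (SameCycle⇒∼ p))

  leader : ∀ i → ∃ λ j → CycleMin σ j × SameCycle σ j i
  leader i with Fin.¬∀⟶∃¬-smallest n (λ j → ¬ SameCycle σ i j) (λ j → ¬? (sameCycle? σ i j)) (λ none → none i SameCycle-refl)
  ... | m , ¬¬s , below = m , least , SameCycle-sym m~
    where
    m~ : SameCycle σ i m
    m~ = decidable-stable (sameCycle? σ i m) ¬¬s
    least : CycleMin σ m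
    least j s with m Fin.≤? j
    ... | yes m≤j = m≤j
    ... | no m≰j = contradiction (SameCycle-trans m~ s)
      (subst (λ z → ¬ SameCycle σ i z) (Fin.toℕ-injective (trans (Fin.toℕ-inject _) (Fin.toℕ-fromℕ< (ℕ.≰⇒> m≰j)))) (below (Fin.fromℕ< (ℕ.≰⇒> m≰j))))

  CycleMin-unique : ∀ {i j} → CycleMin σ i → CycleMin σ j → SameCycle σ i j → i ≡ j
  CycleMin-unique {i} {j} mi mj s = Fin.≤-antisym (mi j s) (mj i (SameCycle-sym s))

-- One step of σ may become any number of steps of τ, in either direction, since only connectedness
-- is asked for. This covers maps that are not equivariant, such as contracting a letter of a cycle.
∼-map : ∀ {m n} {σ : Permutation′ m} {τ : Permutation′ n} (f : Fin m → Fin n) →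
        (∀ x → _∼_ τ (f x) (f (σ ⟨$⟩ʳ x))) → ∀ {i j} → _∼_ σ i j → _∼_ τ (f i) (f j)
∼-map {σ = σ} {τ} f step (zero , refl)  = ∼-refl τ
∼-map {σ = σ} {τ} f step {i} (suc k , refl) = ∼-trans τ (∼-map {σ = σ} {τ} f step {i} (k , refl)) (step _)

SameCycle-map : ∀ {m n} {σ : Permutation′ m} {τ : Permutation′ n} (f : Fin m → Fin n) →
        (∀ x → _∼_ τ (f x) (f (σ ⟨$⟩ʳ x))) → ∀ {i j} → SameCycle σ i j → SameCycle τ (f i) (f j)
SameCycle-map {σ = σ} {τ} f step s = ∼⇒SameCycle τ (∼-map {σ = σ} {τ} f step (SameCycle⇒∼ σ s))

SameCycle-cong : ∀ {n} {σ τ : Permutation′ n} → σ ≈ₚ τ → ∀ {i j} → SameCycle σ i j → SameCycle τ i j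
SameCycle-cong {σ = σ} {τ} e = SameCycle-map {σ = σ} {τ} (λ i → i) (λ x → 1 , sym (e x))

SameCycle-flip : ∀ {n} (σ : Permutation′ n) {i j} → SameCycle σ i j → SameCycle (flip σ) i j
SameCycle-flip σ = SameCycle-map {σ = σ} {flip σ} (λ i → i) (λ x → ∼-sym (flip σ) (1 , inverseˡ σ))

SameCycle-conj : ∀ {n} (g σ : Permutation′ n) {i j} → SameCycle σ i j → SameCycle (g · σ · flip g) (g ⟨$⟩ʳ i) (g ⟨$⟩ʳ j)
SameCycle-conj g σ = SameCycle-map {σ = σ} {g · σ · flip g} (g ⟨$⟩ʳ_) (λ x → 1 , cong (λ z → g ⟨$⟩ʳ (σ ⟨$⟩ʳ z)) (inverseˡ g))

SameCycle-unconj : ∀ {n} (g σ : Permutation′ n) {i j} → SameCycle (g · σ · flip g) (g ⟨$⟩ʳ i) (g ⟨$⟩ʳ j) → SameCycle σ i j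
SameCycle-unconj g σ s = subst₂ (SameCycle σ) (inverseˡ g) (inverseˡ g)
  (SameCycle-map {σ = g · σ · flip g} {σ} (g ⟨$⟩ˡ_) (λ x → 1 , sym (inverseˡ g)) s)

module ℕ∑ = PermSums ℕ.+-*-commutativeSemiring

-- A weighted system of representatives with total weight 1 on each cycle. `cyc` counts least
-- elements, which conjugation does not preserve; as all transversals have the same total weight,
-- cycles may be counted with any convenient one.
Transversal : ∀ {n} → Permutation′ n → (Fin n → ℕ) → Set
Transversal σ w = ∀ i → ℕ∑.sum (λ j → w j ℕ.* ℕ∑.𝟙 (sameCycle? σ j i)) ≡ 1

-- Double counting of the pairs (i , j) in a common cycle, with weight w i · w′ j.
transversals-sum : ∀ {n} (σ : Permutation′ n) {w w′ : Fin n → ℕ} → Transversal σ w → Transversal σ w′ → ℕ∑.sum w ≡ ℕ∑.sum w′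
transversals-sum σ {w} {w′} t t′ = begin
  ℕ∑.sum w ≡⟨ ℕ∑.sum-cong (λ i → sym (trans (cong (w i ℕ.*_) (t′ i)) (ℕ.*-identityʳ (w i)))) ⟩
  ℕ∑.sum (λ i → w i ℕ.* ℕ∑.sum (λ j → w′ j ℕ.* ℕ∑.𝟙 (sameCycle? σ j i))) ≡⟨ ℕ∑.sum-cong (λ i → ℕ∑.sum-*ˡ (w i) _) ⟩
  ℕ∑.sum (λ i → ℕ∑.sum (λ j → w i ℕ.* (w′ j ℕ.* ℕ∑.𝟙 (sameCycle? σ j i)))) ≡⟨ ℕ∑.sum-swap _ ⟩
  ℕ∑.sum (λ j → ℕ∑.sum (λ i → w i ℕ.* (w′ j ℕ.* ℕ∑.𝟙 (sameCycle? σ j i)))) ≡⟨ ℕ∑.sum-cong (λ j → ℕ∑.sum-cong λ i → trans (ℕ∑.x*yz≈y*xz (w i) (w′ j) _) (cong (λ z → w′ j ℕ.* (w i ℕ.* z)) (ℕ∑.𝟙-cong (sameCycle? σ j i) (sameCycle? σ i j) (SameCycle-sym σ) (SameCycle-sym σ)))) ⟩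
  ℕ∑.sum (λ j → ℕ∑.sum (λ i → w′ j ℕ.* (w i ℕ.* ℕ∑.𝟙 (sameCycle? σ i j)))) ≡⟨ ℕ∑.sum-cong (λ j → sym (ℕ∑.sum-*ˡ (w′ j) _)) ⟩
  ℕ∑.sum (λ j → w′ j ℕ.* ℕ∑.sum (λ i → w i ℕ.* ℕ∑.𝟙 (sameCycle? σ i j))) ≡⟨ ℕ∑.sum-cong (λ j → trans (cong (w′ j ℕ.*_) (t j)) (ℕ.*-identityʳ (w′ j))) ⟩
  ℕ∑.sum w′ ∎
  where open ≡-Reasoning

minima-transversal : ∀ {n} (σ : Permutation′ n) → Transversal σ (λ j → ℕ∑.𝟙 (cycleMin? σ j))
minima-transversal σ i = trans (ℕ∑.sum-cong step) (ℕ∑.sum-single-1 m)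
  where
  m = proj₁ (leader σ i)
  min = proj₁ (proj₂ (leader σ i))
  s = proj₂ (proj₂ (leader σ i))
  step : ∀ j → ℕ∑.𝟙 (cycleMin? σ j) ℕ.* ℕ∑.𝟙 (sameCycle? σ j i) ≡ ℕ∑.𝟙 (m Fin.≟ j)
  step j = trans (sym (ℕ∑.𝟙-× (cycleMin? σ j) (sameCycle? σ j i)))
    (ℕ∑.𝟙-cong (cycleMin? σ j ×-dec sameCycle? σ j i) (m Fin.≟ j)
      (λ (min′ , s′) → CycleMin-unique σ min min′ (SameCycle-trans σ s (SameCycle-sym σ s′)))
      (λ e → subst (λ k → CycleMin σ k × SameCycle σ k i) e (min , s)))

length≡∑ : ∀ {X : Set} (xs : List X) → length xs ≡ ℕ∑.∑ xs (λ _ → 1)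
length≡∑ []       = sym (ℕ∑.∑-[] {X = _} (λ _ → 1))
length≡∑ (x ∷ xs) = trans (cong suc (length≡∑ xs)) (sym (ℕ∑.∑-∷ x xs _))

length-filter-allFin : ∀ {n} {P : Fin n → Set} (P? : Decidable P) → length (filter P? (allFin n)) ≡ ℕ∑.sum (λ i → ℕ∑.𝟙 (P? i))
length-filter-allFin {n} P? = begin
  length (filter P? (allFin n)) ≡⟨ length≡∑ (filter P? (allFin n)) ⟩
  ℕ∑.∑ (filter P? (allFin n)) (λ _ → 1) ≡⟨ ℕ∑.∑-filter P? (allFin n) (λ _ → 1) ⟩
  ℕ∑.∑ (allFin n) (λ i → ℕ∑.𝟙 (P? i) ℕ.* 1) ≡⟨ ℕ∑.∑-tabulate (λ i → i) _ ⟩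
  ℕ∑.sum (λ i → ℕ∑.𝟙 (P? i) ℕ.* 1) ≡⟨ ℕ∑.sum-cong (λ i → ℕ.*-identityʳ _) ⟩
  ℕ∑.sum (λ i → ℕ∑.𝟙 (P? i)) ∎
  where open ≡-Reasoning

cyc≡minima : ∀ {n} (σ : Permutation′ n) → cyc σ ≡ ℕ∑.sum (λ i → ℕ∑.𝟙 (cycleMin? σ i))
cyc≡minima {n} σ = trans (List.length-map _ (filter (cycleMin? σ) (allFin n))) (length-filter-allFin (cycleMin? σ))

cyc-transversal : ∀ {n} (σ : Permutation′ n) {w} → Transversal σ w → cyc σ ≡ ℕ∑.sum w
cyc-transversal σ t = trans (cyc≡minima σ) (transversals-sum σ (minima-transversal σ) t)

cyc-SameCycle : ∀ {n} (σ τ : Permutation′ n) → (∀ {i j} → SameCycle σ i j → SameCycle τ i j) →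
                (∀ {i j} → SameCycle τ i j → SameCycle σ i j) → cyc σ ≡ cyc τ
cyc-SameCycle σ τ to from = trans (cyc-transversal σ λ i →
    trans (ℕ∑.sum-cong λ j → cong (ℕ∑.𝟙 (cycleMin? τ j) ℕ.*_) (ℕ∑.𝟙-cong (sameCycle? σ j i) (sameCycle? τ j i) to from)) (minima-transversal τ i))
  (sym (cyc≡minima τ))

cyc-cong : ∀ {n} {σ τ : Permutation′ n} → σ ≈ₚ τ → cyc σ ≡ cyc τ
cyc-cong {σ = σ} {τ} e = cyc-SameCycle σ τ (SameCycle-cong {σ = σ} {τ} e) (SameCycle-cong {σ = τ} {σ} (λ i → sym (e i)))

cyc-flip : ∀ {n} (σ : Permutation′ n) → cyc (flip σ) ≡ cyc σ
cyc-flip σ = cyc-SameCycle (flip σ) σ (SameCycle-flip (flip σ)) (SameCycle-flip σ)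

cyc-conj : ∀ {n} (g σ : Permutation′ n) → cyc (g · σ · flip g) ≡ cyc σ
cyc-conj g σ = sym (trans (cyc-transversal σ λ i → begin
    ℕ∑.sum (λ j → ℕ∑.𝟙 (cycleMin? σ′ (g ⟨$⟩ʳ j)) ℕ.* ℕ∑.𝟙 (sameCycle? σ j i)) ≡⟨ ℕ∑.sum-cong (λ j → cong (ℕ∑.𝟙 (cycleMin? σ′ (g ⟨$⟩ʳ j)) ℕ.*_) (ℕ∑.𝟙-cong (sameCycle? σ j i) (sameCycle? σ′ (g ⟨$⟩ʳ j) (g ⟨$⟩ʳ i)) (SameCycle-conj g σ) (SameCycle-unconj g σ))) ⟩
    ℕ∑.sum (λ j → ℕ∑.𝟙 (cycleMin? σ′ (g ⟨$⟩ʳ j)) ℕ.* ℕ∑.𝟙 (sameCycle? σ′ (g ⟨$⟩ʳ j) (g ⟨$⟩ʳ i))) ≡⟨ ℕ∑.sum-permute (λ j → ℕ∑.𝟙 (cycleMin? σ′ j) ℕ.* ℕ∑.𝟙 (sameCycle? σ′ j (g ⟨$⟩ʳ i))) g ⟩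
    ℕ∑.sum (λ j → ℕ∑.𝟙 (cycleMin? σ′ j) ℕ.* ℕ∑.𝟙 (sameCycle? σ′ j (g ⟨$⟩ʳ i))) ≡⟨ minima-transversal σ′ (g ⟨$⟩ʳ i) ⟩
    1 ∎)
  (trans (ℕ∑.sum-permute (λ j → ℕ∑.𝟙 (cycleMin? σ′ j)) g) (sym (cyc≡minima σ′))))
  where
  open ≡-Reasoning
  σ′ = g · σ · flip g

cyc≤n : ∀ {n} (σ : Permutation′ n) → cyc σ ℕ.≤ n
cyc≤n {n} σ = ℕ.≤-trans (ℕ.≤-reflexive (List.length-map _ (filter (cycleMin? σ) (allFin n))))
  (ℕ.≤-trans (List.length-filter (cycleMin? σ) (allFin n)) (ℕ.≤-reflexive (List.length-tabulate (λ i → i))))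

lift₀-~ : ∀ {n} (π : Permutation′ n) {i j} → SameCycle π i j → SameCycle (lift₀ π) (suc i) (suc j)
lift₀-~ π = SameCycle-map {σ = π} {lift₀ π} suc (λ x → 1 , refl)

cyc-lift₀ : ∀ {n} (π : Permutation′ n) → cyc (lift₀ π) ≡ suc (cyc π)
cyc-lift₀ {n} π = trans (cyc-transversal (lift₀ π) {w} t) (trans (ℕ∑.sum-suc w) (cong suc (sym (cyc≡minima π))))
  where
  w : Fin (suc n) → ℕ
  w zero    = 1
  w (suc i) = ℕ∑.𝟙 (cycleMin? π i)
  fixed : ∀ {i} → ¬ _∼_ (lift₀ π) zero (suc i)
  fixed (k , e) = contradiction (trans (sym (stays k)) e) λ ()
    where
    stays : ∀ k → pow (lift₀ π) k zero ≡ zero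
    stays zero    = refl
    stays (suc k) = cong (lift₀ π ⟨$⟩ʳ_) (stays k)
  back : ∀ {i j} → SameCycle (lift₀ π) (suc i) (suc j) → SameCycle π i j
  back s with SameCycle⇒∼ (lift₀ π) s
  ... | k , e = ∼⇒SameCycle π (k , Fin.suc-injective (trans (sym (powsuc k)) e))
    where
    powsuc : ∀ k {i} → pow (lift₀ π) k (suc i) ≡ suc (pow π k i)
    powsuc zero    = refl
    powsuc (suc k) = cong (lift₀ π ⟨$⟩ʳ_) (powsuc k)
  t : Transversal (lift₀ π) w
  t zero    = trans (ℕ∑.sum-suc _) (cong₂ ℕ._+_ (trans (ℕ.*-identityˡ _) (ℕ∑.𝟙-yes (sameCycle? (lift₀ π) zero zero) (SameCycle-refl (lift₀ π))))
    (ℕ∑.sum-zero λ j → trans (cong (w (suc j) ℕ.*_) (ℕ∑.𝟙-no (sameCycle? (lift₀ π) (suc j) zero) (fixed ∘ SameCycle⇒∼ (lift₀ π) ∘ SameCycle-sym (lift₀ π)))) (ℕ.*-zeroʳ (w (suc j)))))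
  t (suc i) = trans (ℕ∑.sum-suc _) (cong₂ ℕ._+_ (trans (ℕ.*-identityˡ _) (ℕ∑.𝟙-no (sameCycle? (lift₀ π) zero (suc i)) (fixed ∘ SameCycle⇒∼ (lift₀ π))))
    (trans (ℕ∑.sum-cong λ j → cong (w (suc j) ℕ.*_) (ℕ∑.𝟙-cong (sameCycle? (lift₀ π) (suc j) (suc i)) (sameCycle? π j i) back (lift₀-~ π))) (minima-transversal π i)))

-- The letter `zero` is spliced into a cycle of π directly before `suc j`, so the cycles stay in
-- bijection; `f` contracts `zero` onto j again, and `zero` gets weight 0.
cyc-transpose-lift₀ : ∀ {n} (j : Fin n) (π : Permutation′ n) → cyc (transpose zero (suc j) · lift₀ π) ≡ cyc π
cyc-transpose-lift₀ {n} j π = trans (cyc-transversal σ {w} t) (trans (ℕ∑.sum-suc w) (sym (cyc≡minima π)))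
  where
  σ = transpose zero (suc j) · lift₀ π
  w : Fin (suc n) → ℕ
  w zero    = 0
  w (suc i) = ℕ∑.𝟙 (cycleMin? π i)
  f : Fin (suc n) → Fin n
  f zero    = j
  f (suc i) = i
  f-step : ∀ x → _∼_ π (f x) (f (σ ⟨$⟩ʳ x))
  f-step zero = 0 , refl
  f-step (suc i) with transpose zero (suc j) ⟨$⟩ʳ suc (π ⟨$⟩ʳ i) | transposeView zero (suc j) (suc (π ⟨$⟩ʳ i))
  ... | _ | atʳ _ e   = 1 , Fin.suc-injective e
  ... | _ | other _ _ = 1 , refl
  unfold : ∀ x → _∼_ σ (suc x) (suc (π ⟨$⟩ʳ x))
  unfold x with suc (π ⟨$⟩ʳ x) Fin.≟ suc j
  -- Where π x is j, the walk makes a detour through `zero`.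
  ... | yes e = 2 , trans (cong (σ ⟨$⟩ʳ_) (trans (cong (transpose zero (suc j) ⟨$⟩ʳ_) e) (transpose-matchʳ zero (suc j)))) (sym e)
  ... | no ne = 1 , transpose-other {i = zero} {suc j} {suc (π ⟨$⟩ʳ x)} (λ ()) ne
  to : ∀ {i x} → SameCycle σ (suc i) x → SameCycle π i (f x)
  to = SameCycle-map {σ = σ} {π} f f-step
  retract : ∀ x → SameCycle σ (suc (f x)) x
  retract zero    = SameCycle-sym σ (∼⇒SameCycle σ (1 , refl))
  retract (suc x) = SameCycle-refl σ
  from : ∀ {i x} → SameCycle π i (f x) → SameCycle σ (suc i) x
  from {i} {x} s = SameCycle-trans σ (SameCycle-map {σ = π} {σ} suc unfold s) (retract x)
  t : Transversal σ w
  t x = trans (ℕ∑.sum-suc _) (trans (ℕ∑.sum-cong λ i → cong (w (suc i) ℕ.*_) (ℕ∑.𝟙-cong (sameCycle? σ (suc i) x) (sameCycle? π i (f x)) to from)) (minima-transversal π (f x)))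

opaque
  cycles : ∀ {n} → Permutation′ n → ℕ
  cycles = cyc

  sign : ∀ {n} → Permutation′ n → ℚ
  sign = sgn

opaque
  unfolding cycles

  cycles≡cyc : ∀ {n} (σ : Permutation′ n) → cycles σ ≡ cyc σ
  cycles≡cyc σ = refl

  sign≡sgn : ∀ {n} (σ : Permutation′ n) → sign σ ≡ sgn σ
  sign≡sgn σ = refl

  sign≡ : ∀ {n} (σ : Permutation′ n) → sign σ ≡ [-1]^ (n ∸ cycles σ)
  sign≡ σ = refl

  cycles-cong : ∀ {n} {σ τ : Permutation′ n} → σ ≈ₚ τ → cycles σ ≡ cycles τ
  cycles-cong {σ = σ} {τ} = cyc-cong {σ = σ} {τ}

  cycles-flip : ∀ {n} (σ : Permutation′ n) → cycles (flip σ) ≡ cycles σ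
  cycles-flip = cyc-flip

  cycles-conj : ∀ {n} (g σ : Permutation′ n) → cycles (g · σ · flip g) ≡ cycles σ
  cycles-conj = cyc-conj

  cycles≤n : ∀ {n} (σ : Permutation′ n) → cycles σ ℕ.≤ n
  cycles≤n = cyc≤n

  cycles-lift₀ : ∀ {n} (π : Permutation′ n) → cycles (lift₀ π) ≡ suc (cycles π)
  cycles-lift₀ = cyc-lift₀

  cycles-transpose-lift₀ : ∀ {n} (j : Fin n) (π : Permutation′ n) → cycles (transpose zero (suc j) · lift₀ π) ≡ cycles π
  cycles-transpose-lift₀ = cyc-transpose-lift₀

sign-cycles : ∀ {m n} (σ : Permutation′ m) (τ : Permutation′ n) → m ∸ cycles σ ≡ n ∸ cycles τ → sign σ ≡ sign τ
sign-cycles σ τ e = trans (sign≡ σ) (trans (cong [-1]^_ e) (sym (sign≡ τ)))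

sign-cong : ∀ {n} {σ τ : Permutation′ n} → σ ≈ₚ τ → sign σ ≡ sign τ
sign-cong {n} {σ} {τ} e = sign-cycles σ τ (cong (n ∸_) (cycles-cong {σ = σ} {τ} e))

sign-flip : ∀ {n} (σ : Permutation′ n) → sign (flip σ) ≡ sign σ
sign-flip {n} σ = sign-cycles (flip σ) σ (cong (n ∸_) (cycles-flip σ))

sign-conj : ∀ {n} (g σ : Permutation′ n) → sign (g · σ · flip g) ≡ sign σ
sign-conj {n} g σ = sign-cycles (g · σ · flip g) σ (cong (n ∸_) (cycles-conj g σ))

sign-lift₀ : ∀ {n} (π : Permutation′ n) → sign (lift₀ π) ≡ sign π
sign-lift₀ {n} π = sign-cycles (lift₀ π) π (cong (suc n ∸_) (cycles-lift₀ π))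

sign-transpose-lift₀ : ∀ {n} (j : Fin n) (π : Permutation′ n) → sign (transpose zero (suc j) · lift₀ π) ≡ ℚ.- sign π
sign-transpose-lift₀ {n} j π = trans (sign≡ _) (trans (cong (λ c → [-1]^ (suc n ∸ c)) (cycles-transpose-lift₀ j π))
  (trans (cong [-1]^_ (ℕ.+-∸-assoc 1 (cycles≤n π))) (cong ℚ.-_ (sym (sign≡ π)))))

transpose-id : ∀ {n} (i x : Fin n) → transpose i i ⟨$⟩ʳ x ≡ x
transpose-id i x with transpose i i ⟨$⟩ʳ x | transposeView i i x
... | _ | atˡ e     = sym e
... | _ | atʳ _ e   = sym e
... | _ | other _ _ = refl

split₀ : ∀ {n} (σ : Permutation′ (suc n)) → ∃ λ ρ → σ ≈ₚ transpose zero (σ ⟨$⟩ʳ zero) · lift₀ ρ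
split₀ σ = remove zero τ , λ i → sym (trans (cong (transpose zero j ⟨$⟩ʳ_) (Perm.lift₀-remove τ (transpose-matchʳ zero j) i)) (transpose-involutive zero j (σ ⟨$⟩ʳ i)))
  where
  j = σ ⟨$⟩ʳ zero
  τ = transpose zero j · σ

transpose-comm : ∀ {n} (i j : Fin n) → transpose i j ≈ₚ transpose j i
transpose-comm i j k with transpose i j ⟨$⟩ʳ k | transposeView i j k
... | _ | atˡ refl = sym (transpose-matchʳ j i)
... | _ | atʳ _ refl = sym (transpose-matchˡ j i)
... | _ | other a b = sym (transpose-other b a)

-- As `sgn` is defined by counting cycles, multiplicativity has to be extracted from the recursion σ
-- = (0 j) · lift₀ ρ. A transposition that fixes 0 is (0 i)(0 j)(0 i), which reduces it to those
-- moving 0; a product of two of the latter produces a transposition of the remaining n letters, so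
-- the three statements are proved by a joint induction on n.
sign-transpose-· : ∀ {n} {i j : Fin n} → i ≢ j → (σ : Permutation′ n) → sign (transpose i j · σ) ≡ ℚ.- sign σ
sign-transpose₀-· : ∀ {n} (j : Fin n) (σ : Permutation′ (suc n)) → sign (transpose zero (suc j) · σ) ≡ ℚ.- sign σ

sign-transpose₀-·-lift₀ : ∀ {n} (j : Fin n) (k : Fin (suc n)) (ρ : Permutation′ n) →
  sign (transpose zero (suc j) · transpose zero k · lift₀ ρ) ≡ ℚ.- sign (transpose zero k · lift₀ ρ)

sign-transpose-· {suc n} {zero}  {zero}  i≢j σ = contradiction refl i≢j
sign-transpose-· {suc n} {zero}  {suc j} i≢j σ = sign-transpose₀-· j σ
sign-transpose-· {suc n} {suc i} {zero}  i≢j σ = trans (sign-cong {σ = transpose (suc i) zero · σ} {transpose zero (suc i) · σ} (λ x → transpose-comm (suc i) zero (σ ⟨$⟩ʳ x))) (sign-transpose₀-· i σ)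
sign-transpose-· {suc n} {suc i} {suc j} i≢j σ = begin
  sign (transpose (suc i) (suc j) · σ) ≡⟨ sign-cong {σ = transpose (suc i) (suc j) · σ} {t i · t j · t i · σ} (λ x → sym (conj (σ ⟨$⟩ʳ x))) ⟩
  sign (t i · t j · t i · σ) ≡⟨ sign-transpose₀-· i (t j · t i · σ) ⟩
  ℚ.- sign (t j · t i · σ) ≡⟨ cong ℚ.-_ (trans (sign-transpose₀-· j (t i · σ)) (cong ℚ.-_ (sign-transpose₀-· i σ))) ⟩
  ℚ.- (ℚ.- (ℚ.- sign σ)) ≡⟨ neg-involutive _ ⟩
  ℚ.- sign σ ∎
  where
  open ≡-Reasoning
  t : Fin n → Permutation′ (suc n)
  t k = transpose zero (suc k)
  conj : ∀ x → (t i · t j · t i) ⟨$⟩ʳ x ≡ transpose (suc i) (suc j) ⟨$⟩ʳ x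
  conj x = trans (transpose-conj (t i) zero (suc j) (t i ⟨$⟩ʳ x))
    (trans (cong (λ z → transpose z (t i ⟨$⟩ʳ suc j) ⟨$⟩ʳ (t i ⟨$⟩ʳ (t i ⟨$⟩ʳ x))) (transpose-matchˡ zero (suc i)))
      (cong₂ (λ y z → transpose (suc i) y ⟨$⟩ʳ z) (transpose-other {i = zero} {suc i} {suc j} (λ ()) (i≢j ∘ sym)) (transpose-involutive zero (suc i) x)))

sign-transpose₀-·-lift₀ {n} j zero ρ = begin
  sign (t j · transpose zero zero · lift₀ ρ) ≡⟨ sign-cong {σ = t j · transpose zero zero · lift₀ ρ} {t j · lift₀ ρ} (λ x → cong (t j ⟨$⟩ʳ_) (transpose-id zero (lift₀ ρ ⟨$⟩ʳ x))) ⟩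
  sign (t j · lift₀ ρ) ≡⟨ sign-transpose-lift₀ j ρ ⟩
  ℚ.- sign ρ ≡⟨ cong ℚ.-_ (sign-lift₀ ρ) ⟨
  ℚ.- sign (lift₀ ρ) ≡⟨ cong ℚ.-_ (sign-cong {σ = transpose zero zero · lift₀ ρ} {lift₀ ρ} (λ x → transpose-id zero (lift₀ ρ ⟨$⟩ʳ x))) ⟨
  ℚ.- sign (transpose zero zero · lift₀ ρ) ∎
  where
  open ≡-Reasoning
  t : Fin n → Permutation′ (suc n)
  t k = transpose zero (suc k)
sign-transpose₀-·-lift₀ {n} j (suc k) ρ with j Fin.≟ k
... | yes refl = begin
  sign (t · t · lift₀ ρ) ≡⟨ sign-cong {σ = t · t · lift₀ ρ} {lift₀ ρ} (λ x → transpose-involutive zero (suc j) (lift₀ ρ ⟨$⟩ʳ x)) ⟩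
  sign (lift₀ ρ) ≡⟨ sign-lift₀ ρ ⟩
  sign ρ ≡⟨ neg-involutive _ ⟨
  ℚ.- (ℚ.- sign ρ) ≡⟨ cong ℚ.-_ (sign-transpose-lift₀ j ρ) ⟨
  ℚ.- sign (t · lift₀ ρ) ∎
  where
  open ≡-Reasoning
  t : Permutation′ (suc n)
  t = transpose zero (suc j)
... | no j≢k = begin
  -- (0 j)(0 k) = (0 k)(k j), and (k j) fixes 0, so it is absorbed into the lifted factor.
  sign (t j · t k · lift₀ ρ) ≡⟨ sign-cong {σ = t j · t k · lift₀ ρ} {t k · lift₀ (transpose k j · ρ)} (λ x → trans (slide (lift₀ ρ ⟨$⟩ʳ x)) (cong (t k ⟨$⟩ʳ_) (trans (Perm.lift₀-transpose k j (lift₀ ρ ⟨$⟩ʳ x)) (Perm.lift₀-comp ρ (transpose k j) x)))) ⟩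
  sign (t k · lift₀ (transpose k j · ρ)) ≡⟨ sign-transpose-lift₀ k (transpose k j · ρ) ⟩
  ℚ.- sign (transpose k j · ρ) ≡⟨ cong ℚ.-_ (sign-transpose-· (j≢k ∘ sym) ρ) ⟩
  ℚ.- (ℚ.- sign ρ) ≡⟨ cong ℚ.-_ (sign-transpose-lift₀ k ρ) ⟨
  ℚ.- sign (t k · lift₀ ρ) ∎
  where
  open ≡-Reasoning
  t : Fin n → Permutation′ (suc n)
  t k = transpose zero (suc k)
  slide : ∀ x → t j ⟨$⟩ʳ (t k ⟨$⟩ʳ x) ≡ t k ⟨$⟩ʳ (transpose (suc k) (suc j) ⟨$⟩ʳ x)
  slide x = sym (trans (transpose-conj (t k) (suc k) (suc j) x)
    (cong₂ (λ y z → transpose y z ⟨$⟩ʳ (t k ⟨$⟩ʳ x)) (transpose-matchʳ zero (suc k)) (transpose-other {i = zero} {suc k} {suc j} (λ ()) (j≢k ∘ Fin.suc-injective))))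

sign-transpose₀-· {n} j σ = begin
  sign (t · σ) ≡⟨ sign-cong {σ = t · σ} {t · transpose zero k · lift₀ ρ} (λ x → cong (t ⟨$⟩ʳ_) (e x)) ⟩
  sign (t · transpose zero k · lift₀ ρ) ≡⟨ sign-transpose₀-·-lift₀ j k ρ ⟩
  ℚ.- sign (transpose zero k · lift₀ ρ) ≡⟨ cong ℚ.-_ (sign-cong {σ = σ} {transpose zero k · lift₀ ρ} e) ⟨
  ℚ.- sign σ ∎
  where
  open ≡-Reasoning
  t : Permutation′ (suc n)
  t = transpose zero (suc j)
  k : Fin (suc n)
  k = σ ⟨$⟩ʳ zero
  ρ : Permutation′ n
  ρ = proj₁ (split₀ σ)
  e : σ ≈ₚ transpose zero k · lift₀ ρ
  e = proj₂ (split₀ σ)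

ε₀ : ∀ {n} → Fin n → ℚ
ε₀ zero    = 1ℚ
ε₀ (suc _) = ℚ.- 1ℚ

sign-ε₀ : ∀ {n} j (σ : Permutation′ (suc n)) → sign (transpose zero j · σ) ≡ ε₀ j ℚ.* sign σ
sign-ε₀ zero σ = trans (sign-cong {σ = transpose zero zero · σ} {σ} (λ x → transpose-id zero (σ ⟨$⟩ʳ x))) (sym (ℚ.*-identityˡ (sign σ)))
sign-ε₀ (suc j) σ = trans (sign-transpose₀-· j σ) (trans (cong ℚ.-_ (sym (ℚ.*-identityˡ (sign σ)))) (ℚ.neg-distribˡ-* 1ℚ (sign σ)))

-- With σ = (0 j) · lift₀ ρ and τ = (0 k) · lift₀ υ, the transposition (0 k) is moved to the left
-- past lift₀ ρ, where it becomes (0 k′) with k′ the image of k. It is trivial exactly when (0 k)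
-- is, so the signs agree and the induction applies to ρ · υ.
sign-· : ∀ {n} (σ τ : Permutation′ n) → sign (σ · τ) ≡ sign σ ℚ.* sign τ
sign-· {zero}  σ τ = trans (sign-0 (σ · τ)) (sym (cong₂ ℚ._*_ (sign-0 σ) (sign-0 τ)))
  where
  sign-0 : (π : Permutation′ 0) → sign π ≡ 1ℚ
  sign-0 π = trans (sign≡ π) (cong [-1]^_ (ℕ.0∸n≡0 (cycles π)))
sign-· {suc n} σ τ = begin
  sign (σ · τ) ≡⟨ sign-cong {σ = σ · τ} {t j · t k′ · lift₀ (ρ · υ)} (λ x → trans (e (τ ⟨$⟩ʳ x)) (cong (t j ⟨$⟩ʳ_) (trans (cong (lift₀ ρ ⟨$⟩ʳ_) (e′ x)) (trans (transpose-conj (lift₀ ρ) zero k (lift₀ υ ⟨$⟩ʳ x)) (cong (t k′ ⟨$⟩ʳ_) (Perm.lift₀-comp υ ρ x)))))) ⟩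
  sign (t j · t k′ · lift₀ (ρ · υ)) ≡⟨ trans (sign-ε₀ j (t k′ · lift₀ (ρ · υ))) (cong (ε₀ j ℚ.*_) (sign-ε₀ k′ (lift₀ (ρ · υ)))) ⟩
  ε₀ j ℚ.* (ε₀ k′ ℚ.* sign (lift₀ (ρ · υ))) ≡⟨ cong₂ (λ y z → ε₀ j ℚ.* (y ℚ.* z)) ε-k′ (trans (sign-lift₀ (ρ · υ)) (trans (sign-· ρ υ) (sym (cong₂ ℚ._*_ (sign-lift₀ ρ) (sign-lift₀ υ))))) ⟩
  ε₀ j ℚ.* (ε₀ k ℚ.* (sign (lift₀ ρ) ℚ.* sign (lift₀ υ))) ≡⟨ cong (ε₀ j ℚ.*_) (left-comm (ε₀ k) (sign (lift₀ ρ)) (sign (lift₀ υ))) ⟩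
  ε₀ j ℚ.* (sign (lift₀ ρ) ℚ.* (ε₀ k ℚ.* sign (lift₀ υ))) ≡⟨ ℚ.*-assoc (ε₀ j) (sign (lift₀ ρ)) _ ⟨
  (ε₀ j ℚ.* sign (lift₀ ρ)) ℚ.* (ε₀ k ℚ.* sign (lift₀ υ)) ≡⟨ cong₂ ℚ._*_ (sign-ε₀ j (lift₀ ρ)) (sign-ε₀ k (lift₀ υ)) ⟨
  sign (t j · lift₀ ρ) ℚ.* sign (t k · lift₀ υ) ≡⟨ cong₂ ℚ._*_ (sign-cong {σ = σ} {t j · lift₀ ρ} e) (sign-cong {σ = τ} {t k · lift₀ υ} e′) ⟨
  sign σ ℚ.* sign τ ∎
  where
  open ≡-Reasoning
  t : Fin (suc n) → Permutation′ (suc n)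
  t = transpose zero
  j k k′ : Fin (suc n)
  ρ υ : Permutation′ n
  j = σ ⟨$⟩ʳ zero
  k = τ ⟨$⟩ʳ zero
  ρ = proj₁ (split₀ σ)
  υ = proj₁ (split₀ τ)
  e : σ ≈ₚ t j · lift₀ ρ
  e = proj₂ (split₀ σ)
  e′ : τ ≈ₚ t k · lift₀ υ
  e′ = proj₂ (split₀ τ)
  k′ = lift₀ ρ ⟨$⟩ʳ k
  ε-lift : ∀ k → ε₀ (lift₀ ρ ⟨$⟩ʳ k) ≡ ε₀ k
  ε-lift zero    = refl
  ε-lift (suc k) = refl
  ε-k′ : ε₀ k′ ≡ ε₀ k
  ε-k′ = ε-lift k
  left-comm : ∀ x y z → x ℚ.* (y ℚ.* z) ≡ y ℚ.* (x ℚ.* z)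
  left-comm x y z = trans (sym (ℚ.*-assoc x y z)) (trans (cong (ℚ._* z) (ℚ.*-comm x y)) (ℚ.*-assoc y x z))

-- Conjugacy

Long : ∀ {n} → Permutation′ n → Set
Long φ = ∀ i j → SameCycle φ i j

long? : ∀ {n} (φ : Permutation′ n) → Dec (Long φ)
long? φ = Fin.all? λ i → Fin.all? λ j → sameCycle? φ i j

count-interval : ∀ n lo hi → hi ℕ.≤ n → ℕ∑.sum {n} (λ x → ℕ∑.𝟙 (lo ℕ.≤? toℕ x ×-dec toℕ x ℕ.<? hi)) ≡ hi ∸ lo
count-interval zero lo zero p = trans (ℕ∑.sum-[] _) (sym (ℕ.0∸n≡0 lo))
count-interval (suc n) lo zero p = trans (ℕ∑.sum-zero λ x → ℕ∑.𝟙-no (lo ℕ.≤? toℕ x ×-dec toℕ x ℕ.<? zero) (λ ())) (sym (ℕ.0∸n≡0 lo))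
count-interval (suc n) zero (suc hi) (ℕ.s≤s p) = trans (ℕ∑.sum-suc _) (cong₂ ℕ._+_
  (ℕ∑.𝟙-yes (0 ℕ.≤? 0 ×-dec 0 ℕ.<? suc hi) (ℕ.z≤n , ℕ.z<s))
  (trans (ℕ∑.sum-cong λ x → ℕ∑.𝟙-cong (0 ℕ.≤? suc (toℕ x) ×-dec suc (toℕ x) ℕ.<? suc hi) (0 ℕ.≤? toℕ x ×-dec toℕ x ℕ.<? hi) (λ (_ , q) → ℕ.z≤n , ℕ.s<s⁻¹ q) (λ (_ , q) → ℕ.z≤n , ℕ.s<s q)) (count-interval n 0 hi p)))
count-interval (suc n) (suc lo) (suc hi) (ℕ.s≤s p) = trans (ℕ∑.sum-suc _) (cong₂ ℕ._+_
  (ℕ∑.𝟙-no (suc lo ℕ.≤? 0 ×-dec 0 ℕ.<? suc hi) (λ ()))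
  (trans (ℕ∑.sum-cong λ x → ℕ∑.𝟙-cong (suc lo ℕ.≤? suc (toℕ x) ×-dec suc (toℕ x) ℕ.<? suc hi) (lo ℕ.≤? toℕ x ×-dec toℕ x ℕ.<? hi) (λ (r , q) → ℕ.s≤s⁻¹ r , ℕ.s<s⁻¹ q) (λ (r , q) → ℕ.s≤s r , ℕ.s<s q)) (count-interval n lo hi p)))

cycleSize : ∀ {n} → Permutation′ n → Fin n → ℕ
cycleSize {n} σ i = length (filter (sameCycle? σ i) (allFin n))

record MinimalPeriod {n} (σ : Permutation′ n) (i : Fin n) : Set where
  field
    p        : ℕ
    p≢0      : NonZero p
    returns  : pow σ p i ≡ i
    minimal  : ∀ {k} → k ≢ 0 → k ℕ.< p → pow σ k i ≢ i

minimalPeriod : ∀ {n} (σ : Permutation′ n) i → MinimalPeriod σ i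
minimalPeriod {n} σ i = record
  { p       = suc (toℕ k)
  ; p≢0     = _
  ; returns = decidable-stable (pow σ (suc (toℕ k)) i Fin.≟ i) (proj₁ (proj₂ smallest))
  ; minimal = least
  }
  where
  smallest : ∃ λ (k : Fin n) → ¬ ¬ (pow σ (suc (toℕ k)) i ≡ i) × ((j : Fin.Fin′ k) → ¬ (pow σ (suc (toℕ (Fin.inject j))) i ≡ i))
  smallest = Fin.¬∀⟶∃¬-smallest n (λ k → ¬ (pow σ (suc (toℕ k)) i ≡ i)) (λ k → ¬? (pow σ (suc (toℕ k)) i Fin.≟ i)) none
    where
    none : ¬ (∀ (k : Fin n) → ¬ (pow σ (suc (toℕ k)) i ≡ i))
    none all with period σ i
    ... | suc p , _ , p<n , e = all (Fin.fromℕ< p<n) (trans (cong (λ z → pow σ (suc z) i) (Fin.toℕ-fromℕ< p<n)) e)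
  k : Fin n
  k = proj₁ smallest
  least : ∀ {l} → l ≢ 0 → l ℕ.< suc (toℕ k) → pow σ l i ≢ i
  least {zero}  l≢0 _ = contradiction refl l≢0
  least {suc l} _ (ℕ.s≤s l<k) e = proj₂ (proj₂ smallest) (Fin.fromℕ< l<k)
    (trans (cong (λ z → pow σ (suc z) i) (trans (Fin.toℕ-inject (Fin.fromℕ< l<k)) (Fin.toℕ-fromℕ< l<k))) e)

module _ {n} (σ : Permutation′ n) (i : Fin n) where
  open MinimalPeriod (minimalPeriod σ i)
  private instance _ = p≢0

  periodic⇒∣ : ∀ q → pow σ q i ≡ i → p ∣ q
  periodic⇒∣ q e = m%n≡0⇒n∣m q p (decidable-stable (q % p ℕ.≟ 0) λ r≢0 → minimal r≢0 (m%n<n q p) (trans (pow-% σ q returns) e))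

  -- The iterates with exponents below the minimal period run through the cycle and are distinct,
  -- since a coincidence would give a shorter period.
  cycleSize≡period : cycleSize σ i ≡ p
  cycleSize≡period = begin
    cycleSize σ i ≡⟨ length-filter-allFin (sameCycle? σ i) ⟩
    ℕ∑.sum (λ j → ℕ∑.𝟙 (sameCycle? σ i j)) ≡⟨ ℕ∑.sum-cong (λ j → spread j (sameCycle? σ i j)) ⟩
    ℕ∑.sum (λ j → ℕ∑.sum {p} (λ k → ℕ∑.𝟙 (pow σ (toℕ k) i Fin.≟ j))) ≡⟨ ℕ∑.sum-swap (λ j (k : Fin p) → ℕ∑.𝟙 (pow σ (toℕ k) i Fin.≟ j)) ⟩
    ℕ∑.sum {p} (λ k → ℕ∑.sum (λ j → ℕ∑.𝟙 (pow σ (toℕ k) i Fin.≟ j))) ≡⟨ ℕ∑.sum-cong (λ k → ℕ∑.sum-single-1 (pow σ (toℕ k) i)) ⟩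
    ℕ∑.sum {p} (λ _ → 1) ≡⟨ ones p ⟩
    p ∎
    where
    open ≡-Reasoning
    ones : ∀ k → ℕ∑.sum {k} (λ _ → 1) ≡ k
    ones zero    = ℕ∑.sum-[] _
    ones (suc k) = trans (ℕ∑.sum-suc (λ (_ : Fin (suc k)) → 1)) (cong suc (ones k))
    distinct : ∀ {k l} → k ℕ.< l → l ℕ.< p → pow σ k i ≢ pow σ l i
    distinct {k} {l} k<l l<p e = minimal (λ z → ℕ.<⇒≢ (ℕ.m<n⇒0<n∸m k<l) (sym z)) (ℕ.≤-<-trans (ℕ.m∸n≤m l k) l<p) (pow-cancel σ (ℕ.<⇒≤ k<l) e)
    injective : ∀ {k l : Fin p} → pow σ (toℕ k) i ≡ pow σ (toℕ l) i → k ≡ l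
    injective {k} {l} e = decidable-stable (k Fin.≟ l) λ k≢l → apart (ℕ.<-cmp (toℕ k) (toℕ l)) k≢l
      where
      apart : Tri (toℕ k ℕ.< toℕ l) (toℕ k ≡ toℕ l) (toℕ l ℕ.< toℕ k) → k ≢ l → ⊥
      apart (tri< k<l _ _) _   = distinct k<l (Fin.toℕ<n l) e
      apart (tri≈ _ k≡l _) k≢l = k≢l (Fin.toℕ-injective k≡l)
      apart (tri> _ _ l<k) _   = distinct l<k (Fin.toℕ<n k) (sym e)
    spread : ∀ j → (d : Dec (SameCycle σ i j)) → ℕ∑.𝟙 d ≡ ℕ∑.sum {p} (λ k → ℕ∑.𝟙 (pow σ (toℕ k) i Fin.≟ j))
    spread j d@(no ¬s) = trans (ℕ∑.𝟙-no d ¬s) (sym (ℕ∑.sum-zero λ k → ℕ∑.𝟙-no (pow σ (toℕ k) i Fin.≟ j) (λ e → ¬s (∼⇒SameCycle σ (toℕ k , e)))))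
    spread j d@(yes (l , e)) = trans (ℕ∑.𝟙-yes d (l , e)) (sym (trans
      (ℕ∑.sum-cong λ k → ℕ∑.𝟙-cong (pow σ (toℕ k) i Fin.≟ j) (k₀ Fin.≟ k) (λ e′ → injective (trans reach (sym e′))) (λ { refl → reach }))
      (ℕ∑.sum-single-1 k₀)))
      where
      k₀ : Fin p
      k₀ = Fin.fromℕ< (m%n<n (toℕ l) p)
      reach : pow σ (toℕ k₀) i ≡ j
      reach = trans (cong (λ z → pow σ z i) (Fin.toℕ-fromℕ< (m%n<n (toℕ l) p))) (trans (pow-% σ (toℕ l) returns) e)

  periodic⇒size∣ : ∀ q → pow σ q i ≡ i → cycleSize σ i ∣ q
  periodic⇒size∣ q e = subst (_∣ q) (sym cycleSize≡period) (periodic⇒∣ q e)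

  size∣⇒periodic : ∀ q → cycleSize σ i ∣ q → pow σ q i ≡ i
  size∣⇒periodic q (divides k refl) = pow-* σ k (subst (λ z → pow σ z i ≡ i) (sym cycleSize≡period) returns)

-- Iterates of i agree exactly when their exponents are congruent modulo the size of the cycle, so
-- cycles of equal size have the same coincidences. This makes `transport` well defined.
pow-transfer : ∀ {n} (σ τ : Permutation′ n) {i j} → cycleSize σ i ≡ cycleSize τ j → ∀ k l → pow σ k i ≡ pow σ l i → pow τ k j ≡ pow τ l j
pow-transfer σ τ {i} {j} e k l q = go (ℕ.≤-total k l)
  where
  ordered : ∀ {k l} → k ℕ.≤ l → pow σ k i ≡ pow σ l i → pow τ k j ≡ pow τ l j
  ordered {k} {l} k≤l q = sym (trans (cong (λ z → pow τ z j) (sym (ℕ.m+[n∸m]≡n k≤l))) (trans (pow-+ τ k (l ∸ k) j)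
    (cong (pow τ k) (size∣⇒periodic τ j (l ∸ k) (subst (_∣ l ∸ k) e (periodic⇒size∣ σ i (l ∸ k) (pow-cancel σ k≤l q)))))))
  go : _ → pow τ k j ≡ pow τ l j
  go (inj₁ k≤l) = ordered k≤l q
  go (inj₂ l≤k) = sym (ordered l≤k (sym q))

module _ {A B : Set} (f : A → B) where

  -- The bijection between the cycles of two permutations comes from a rearrangement of their lists
  -- of lengths; `source` leads from a position in such a list back to the least letter of the
  -- cycle.
  source : ∀ xs → Fin (length (map f xs)) → A
  source (x ∷ xs) zero    = x
  source (x ∷ xs) (suc i) = source xs i

  lookup-source : ∀ xs i → f (source xs i) ≡ List.lookup (map f xs) i
  lookup-source (x ∷ xs) zero    = refl
  lookup-source (x ∷ xs) (suc i) = lookup-source xs i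

  source-∈ : ∀ xs i → source xs i ∈ xs
  source-∈ (x ∷ xs) zero    = here refl
  source-∈ (x ∷ xs) (suc i) = there (source-∈ xs i)

  source-surjective : ∀ {xs x} → x ∈ xs → ∃ λ i → source xs i ≡ x
  source-surjective (here refl) = zero , refl
  source-surjective (there p) with source-surjective p
  ... | i , e = suc i , e

  source-injective : ∀ {xs} → Unique xs → ∀ {i j} → source xs i ≡ source xs j → i ≡ j
  source-injective {x ∷ xs} (_ ∷ _)  {zero}  {zero}  e = refl
  source-injective {x ∷ xs} (x∉ ∷ _) {zero}  {suc j} e = contradiction e (All.lookup x∉ (source-∈ xs j))
  source-injective {x ∷ xs} (x∉ ∷ _) {suc i} {zero}  e = contradiction (sym e) (All.lookup x∉ (source-∈ xs i))
  source-injective {x ∷ xs} (_ ∷ u)  {suc i} {suc j} e = cong suc (source-injective u e)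

minima : ∀ {n} → Permutation′ n → List (Fin n)
minima {n} σ = filter (cycleMin? σ) (allFin n)

minima! : ∀ {n} (σ : Permutation′ n) → Unique (minima σ)
minima! {n} σ = Unique.filter⁺ (cycleMin? σ) (Unique.allFin⁺ n)

module CycleIndex {n} (σ : Permutation′ n) where

  Index : Set
  Index = Fin (length (cycleLengths σ))

  start : Index → Fin n
  start = source (cycleSize σ) (minima σ)

  start-min : ∀ i → CycleMin σ (start i)
  start-min i = proj₂ (∈-filter⁻ (cycleMin? σ) {xs = allFin n} (source-∈ (cycleSize σ) (minima σ) i))

  start-size : ∀ i → cycleSize σ (start i) ≡ List.lookup (cycleLengths σ) i
  start-size = lookup-source (cycleSize σ) (minima σ)

  position : ∀ x → ∃ λ i → ∃ λ k → pow σ k (start i) ≡ x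
  position x = i , proj₁ reach , trans (cong (pow σ (proj₁ reach)) e) (proj₂ reach)
    where
    m = proj₁ (leader σ x)
    reach : ∃ λ k → pow σ k m ≡ x
    reach = SameCycle⇒∼ σ (proj₂ (proj₂ (leader σ x)))
    found = source-surjective (cycleSize σ) (∈-filter⁺ (cycleMin? σ) (∈-allFin m) (proj₁ (proj₂ (leader σ x))))
    i = proj₁ found
    e : start i ≡ m
    e = proj₂ found

  index-unique : ∀ i j {k l} → pow σ k (start i) ≡ pow σ l (start j) → i ≡ j
  index-unique i j {k} {l} e = source-injective (cycleSize σ) (minima! σ)
    (CycleMin-unique σ (start-min i) (start-min j) (∼⇒SameCycle σ (∼-trans σ (k , e) (∼-sym σ (l , refl)))))

module Transport {n} (σ τ : Permutation′ n) (f : CycleIndex.Index σ → CycleIndex.Index τ)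
                 (sizes : ∀ i → cycleSize σ (CycleIndex.start σ i) ≡ cycleSize τ (CycleIndex.start τ (f i))) where

  open CycleIndex

  transport : Fin n → Fin n
  transport x = pow τ (proj₁ (proj₂ (position σ x))) (start τ (f (proj₁ (position σ x))))

  -- `position` picks some representation of a letter as an iterate of a starting point. The index
  -- of the cycle is unique, and for the exponent the choice does not matter by `pow-transfer`.
  transport-pow : ∀ i k → transport (pow σ k (start σ i)) ≡ pow τ k (start τ (f i))
  transport-pow i k = trans (cong (λ z → pow τ l (start τ (f z))) j≡i) (pow-transfer σ τ (sizes i) l k (trans (cong (λ z → pow σ l (start σ z)) (sym j≡i)) e))
    where
    x = pow σ k (start σ i)
    j = proj₁ (position σ x)
    l = proj₁ (proj₂ (position σ x))
    e : pow σ l (start σ j) ≡ x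
    e = proj₂ (proj₂ (position σ x))
    j≡i : j ≡ i
    j≡i = index-unique σ j i {l} {k} e

  transport-step : ∀ x → transport (σ ⟨$⟩ʳ x) ≡ τ ⟨$⟩ʳ transport x
  transport-step x = trans (cong (λ z → transport (σ ⟨$⟩ʳ z)) (sym e)) (trans (transport-pow i (suc k)) (cong (τ ⟨$⟩ʳ_) (trans (sym (transport-pow i k)) (cong transport e))))
    where
    i = proj₁ (position σ x)
    k = proj₁ (proj₂ (position σ x))
    e = proj₂ (proj₂ (position σ x))

-- Equal sorted lists give a bijection of cycles that preserves lengths. The transports along it and
-- along its inverse undo each other, and a transport carries σ to τ by `transport-step`.
conjugate : ∀ {n} (σ τ : Permutation′ n) → cycleType σ ≡ cycleType τ → ∃ λ g → τ ≈ₚ g · σ · flip g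
conjugate {n} σ τ types = g , λ x → trans (cong (τ ⟨$⟩ʳ_) (sym (inverseʳ g))) (sym (transport-step (g ⟨$⟩ˡ x)))
  where
  open CycleIndex
  lengths : cycleLengths σ ↭ cycleLengths τ
  lengths = ↭-trans (↭-sym (sort-↭ (cycleLengths σ))) (↭-trans (↭-reflexive types) (sort-↭ (cycleLengths τ)))
  π = onIndices (↭⇒↭ₛ lengths)
  sizes : ∀ i → cycleSize σ (start σ i) ≡ cycleSize τ (start τ (Inverse.to π i))
  sizes i = trans (start-size σ i) (trans (onIndices-lookup (↭⇒↭ₛ lengths) i) (sym (start-size τ (Inverse.to π i))))
  sizes⁻ : ∀ i → cycleSize τ (start τ i) ≡ cycleSize σ (start σ (Inverse.from π i))
  sizes⁻ i = sym (trans (sizes (Inverse.from π i)) (cong (λ z → cycleSize τ (start τ z)) (Inverse.inverseˡ π refl)))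
  module T = Transport σ τ (Inverse.to π) sizes
  module T⁻ = Transport τ σ (Inverse.from π) sizes⁻
  open T using (transport-step)
  there-back : ∀ x → T⁻.transport (T.transport x) ≡ x
  there-back x = trans (cong (λ z → T⁻.transport (T.transport z)) (sym e)) (trans (cong T⁻.transport (T.transport-pow i k))
    (trans (T⁻.transport-pow (Inverse.to π i) k) (trans (cong (λ z → pow σ k (start σ z)) (Inverse.inverseʳ π refl)) e)))
    where
    i = proj₁ (position σ x)
    k = proj₁ (proj₂ (position σ x))
    e = proj₂ (proj₂ (position σ x))
  back-there : ∀ x → T.transport (T⁻.transport x) ≡ x
  back-there x = trans (cong (λ z → T.transport (T⁻.transport z)) (sym e)) (trans (cong T.transport (T⁻.transport-pow i k))
    (trans (T.transport-pow (Inverse.from π i) k) (trans (cong (λ z → pow τ k (start τ z)) (Inverse.inverseˡ π refl)) e)))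
    where
    i = proj₁ (position τ x)
    k = proj₁ (proj₂ (position τ x))
    e = proj₂ (proj₂ (position τ x))
  g : Permutation′ n
  g = Perm.permutation T.transport T⁻.transport back-there there-back

module _ {n} (σ : Permutation′ (suc n)) where
  private N = suc n

  cycleType⇒long : cycleType σ ≡ N ∷ [] → Long σ
  cycleType⇒long e i j = SameCycle-trans σ (SameCycle-sym σ (from i)) (from j)
    where
    lengths : cycleLengths σ ≡ N ∷ []
    lengths = ↭-singleton-inv (↭-trans (↭-sym (sort-↭ (cycleLengths σ))) (↭-reflexive e))
    open CycleIndex σ
    only : ∀ {m} → m ≡ 1 → (i j : Fin m) → i ≡ j
    only refl zero zero = refl
    i₀ : Index
    i₀ = proj₁ (position zero)
    from : ∀ x → SameCycle σ (start i₀) x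
    from x = ∼⇒SameCycle σ (proj₁ (proj₂ (position x)) , trans (cong (λ z → pow σ (proj₁ (proj₂ (position x))) (start z)) (only (cong length lengths) i₀ (proj₁ (position x)))) (proj₂ (proj₂ (position x))))

  long⇒cyc : Long σ → cyc σ ≡ 1
  long⇒cyc long = trans (cyc≡minima σ) (trans (ℕ∑.sum-cong λ i → ℕ∑.𝟙-cong (cycleMin? σ i) (m Fin.≟ i) (λ min → CycleMin-unique σ m-min min (long m i)) (λ { refl → m-min })) (ℕ∑.sum-single-1 m))
    where
    m = proj₁ (leader σ zero)
    m-min : CycleMin σ m
    m-min = proj₁ (proj₂ (leader σ zero))

  long⇒cycleType : Long σ → cycleType σ ≡ N ∷ []
  long⇒cycleType long = ↭-singleton-inv (↭-trans (sort-↭ (cycleLengths σ)) (↭-reflexive (singleton (minima σ) (trans (sym (List.length-map (cycleSize σ) (minima σ))) (long⇒cyc long)))))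
    where
    size : ∀ i → cycleSize σ i ≡ N
    size i = trans (length-filter-allFin (sameCycle? σ i)) (trans (ℕ∑.sum-cong λ j → trans (ℕ∑.𝟙-yes (sameCycle? σ i j) (long i j)) (sym (ℕ∑.𝟙-yes (0 ℕ.≤? toℕ j ×-dec toℕ j ℕ.<? N) (ℕ.z≤n , Fin.toℕ<n j)))) (count-interval N 0 N ℕ.≤-refl))
    singleton : ∀ xs → length xs ≡ 1 → map (cycleSize σ) xs ≡ N ∷ []
    singleton (x ∷ []) _ = cong (_∷ []) (size x)

long-flip : ∀ {n} {σ : Permutation′ n} → Long σ → Long (flip σ)
long-flip {σ = σ} long i j = SameCycle-flip σ (long i j)

long-cong : ∀ {n} {σ τ : Permutation′ n} → σ ≈ₚ τ → Long σ → Long τ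
long-cong {σ = σ} {τ} e long i j = SameCycle-cong {σ = σ} {τ} e (long i j)

-- Jucys–Murphy elements

module Jucys (R : CommutativeSemiring 0ℓ 0ℓ) where
  open CommutativeSemiring R hiding (zero; isEquivalence) renaming (refl to ≈-refl; sym to ≈-sym; trans to ≈-trans)
  open PermSums R
  open import Relation.Binary.Reasoning.Setoid setoid

  module _ (t : Carrier) (w : ℕ → Carrier) (w-zero : w 0 ≈ 1#) (w-suc : ∀ k → w (suc k) ≈ t * w k) where

    -- Induction on n along σ = (0 j) · lift₀ π. The term j = 0 has one cycle more than π and
    -- contributes t; the terms j > 0 have as many as π and form the Jucys-Murphy element of the
    -- letter 0, which contributes κ 0. What remains is a sum over π for which the eigenvalue
    -- equations of the later letters are still available.
    ∑-cycles : ∀ {n} (κ : Fin n → Carrier) (F : Permutation′ n → Carrier) → Resp F →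
               (∀ i σ → sum (λ j → 𝟙 (i Fin.<? j) * F (transpose i j · σ)) ≈ κ i * F σ) →
               ∀ ρ → ∑ (𝔖 n) (λ σ → w (cycles σ) * F (σ · ρ)) ≈ prod (λ i → t + κ i) * F ρ
    ∑-cycles {zero} κ F F-resp eigen ρ = begin
      ∑ (𝔖 0) (λ σ → w (cycles σ) * F (σ · ρ)) ≈⟨ ∑-perms-0 _ ⟩
      w (cycles {0} idₚ) * F (idₚ · ρ) ≈⟨ *-cong (≈-trans (reflexive (cong w (ℕ.n≤0⇒n≡0 (cycles≤n {0} idₚ)))) w-zero) (F-resp (λ ())) ⟩
      1# * F ρ ≈⟨ *-congʳ (≈-sym (prod-[] _)) ⟩
      prod (λ i → t + κ i) * F ρ ∎
    ∑-cycles {suc n} κ F F-resp eigen ρ = begin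
      ∑ (𝔖 (suc n)) (λ σ → w (cycles σ) * F (σ · ρ))
        ≈⟨ ∑-perms-suc′ (λ {σ} {τ} e → *-cong (reflexive (cong w (cycles-cong {σ = σ} {τ} e))) (F-resp (λ i → e (ρ ⟨$⟩ʳ i)))) ⟩
      sum (λ j → ∑ (𝔖 n) (λ π → w (cycles (t₀ j · lift₀ π)) * F ((t₀ j · lift₀ π) · ρ)))
        ≈⟨ ∑-sum (𝔖 n) _ ⟨
      ∑ (𝔖 n) (λ π → sum (λ j → w (cycles (t₀ j · lift₀ π)) * F ((t₀ j · lift₀ π) · ρ)))
        ≈⟨ ∑-cong (𝔖 n) per-π ⟩
      ∑ (𝔖 n) (λ π → (t + κ zero) * (w (cycles π) * F′ (π · idₚ)))
        ≈⟨ ∑-*ˡ _ (𝔖 n) _ ⟨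
      (t + κ zero) * ∑ (𝔖 n) (λ π → w (cycles π) * F′ (π · idₚ))
        ≈⟨ *-congˡ (∑-cycles (κ ∘ suc) F′ F′-resp eigen′ idₚ) ⟩
      (t + κ zero) * (prod (λ i → t + κ (suc i)) * F′ idₚ)
        ≈⟨ *-assoc _ _ _ ⟨
      ((t + κ zero) * prod (λ i → t + κ (suc i))) * F′ idₚ
        ≈⟨ *-cong (≈-sym (prod-suc _)) (F-resp (λ i → Perm.lift₀-id (ρ ⟨$⟩ʳ i))) ⟩
      prod (λ i → t + κ i) * F ρ ∎
      where
      t₀ : Fin (suc n) → Permutation′ (suc n)
      t₀ = transpose zero
      -- With ρ absorbed into the function, the induction hypothesis is applied at the identity.
      F′ : Permutation′ n → Carrier
      F′ π = F (lift₀ π · ρ)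
      F′-resp : Resp F′
      F′-resp {σ} {τ} e = F-resp (λ i → Perm.lift₀-cong σ τ e (ρ ⟨$⟩ʳ i))
      eigen′ : ∀ i σ → sum (λ j → 𝟙 (i Fin.<? j) * F′ (transpose i j · σ)) ≈ κ (suc i) * F′ σ
      eigen′ i σ = begin
        sum (λ j → 𝟙 (i Fin.<? j) * F′ (transpose i j · σ))
          ≈⟨ sum-cong (λ j → *-cong (𝟙-cong (i Fin.<? j) (suc i Fin.<? suc j) ℕ.s≤s ℕ.s≤s⁻¹) (F-resp (λ x → trans (sym (Perm.lift₀-comp σ (transpose i j) (ρ ⟨$⟩ʳ x))) (sym (Perm.lift₀-transpose i j _))))) ⟩
        sum (λ j → 𝟙 (suc i Fin.<? suc j) * F (transpose (suc i) (suc j) · lift₀ σ · ρ))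
          ≈⟨ +-identityˡ _ ⟨
        0# + sum (λ j → 𝟙 (suc i Fin.<? suc j) * F (transpose (suc i) (suc j) · lift₀ σ · ρ))
          ≈⟨ +-congʳ (𝟙-no* (suc i Fin.<? zero {n}) (λ ())) ⟨
        𝟙 (suc i Fin.<? zero {n}) * F (transpose (suc i) zero · lift₀ σ · ρ) + sum (λ j → 𝟙 (suc i Fin.<? suc j) * F (transpose (suc i) (suc j) · lift₀ σ · ρ))
          ≈⟨ sum-suc (λ j → 𝟙 (suc i Fin.<? j) * F (transpose (suc i) j · lift₀ σ · ρ)) ⟨
        sum (λ j → 𝟙 (suc i Fin.<? j) * F (transpose (suc i) j · lift₀ σ · ρ))
          ≈⟨ eigen (suc i) (lift₀ σ · ρ) ⟩
        κ (suc i) * F′ σ ∎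
      eigen₀ : ∀ σ → sum (λ j → F (t₀ (suc j) · σ)) ≈ κ zero * F σ
      eigen₀ σ = begin
        sum (λ j → F (t₀ (suc j) · σ)) ≈⟨ sum-cong (λ j → 𝟙-yes* (zero {n} Fin.<? suc j) ℕ.z<s) ⟨
        sum (λ j → 𝟙 (zero {n} Fin.<? suc j) * F (t₀ (suc j) · σ)) ≈⟨ +-identityˡ _ ⟨
        0# + sum (λ j → 𝟙 (zero {n} Fin.<? suc j) * F (t₀ (suc j) · σ)) ≈⟨ +-congʳ (𝟙-no* (zero {n} Fin.<? zero {n}) (λ ())) ⟨
        𝟙 (zero {n} Fin.<? zero {n}) * F (t₀ zero · σ) + sum (λ j → 𝟙 (zero {n} Fin.<? suc j) * F (t₀ (suc j) · σ)) ≈⟨ sum-suc (λ j → 𝟙 (zero {n} Fin.<? j) * F (t₀ j · σ)) ⟨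
        sum (λ j → 𝟙 (zero {n} Fin.<? j) * F (t₀ j · σ)) ≈⟨ eigen zero σ ⟩
        κ zero * F σ ∎
      per-π : ∀ π → sum (λ j → w (cycles (t₀ j · lift₀ π)) * F ((t₀ j · lift₀ π) · ρ)) ≈ (t + κ zero) * (w (cycles π) * F′ (π · idₚ))
      per-π π = begin
        sum (λ j → w (cycles (t₀ j · lift₀ π)) * F ((t₀ j · lift₀ π) · ρ))
          ≈⟨ sum-suc _ ⟩
        w (cycles (t₀ zero · lift₀ π)) * F ((t₀ zero · lift₀ π) · ρ) + sum (λ j → w (cycles (t₀ (suc j) · lift₀ π)) * F ((t₀ (suc j) · lift₀ π) · ρ))
          ≈⟨ +-cong (*-cong (reflexive (cong w (trans (cycles-cong {σ = t₀ zero · lift₀ π} {lift₀ π} (λ x → transpose-id zero (lift₀ π ⟨$⟩ʳ x))) (cycles-lift₀ π)))) (F-resp (λ x → transpose-id zero _)))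
                    (sum-cong λ j → *-cong (reflexive (cong w (cycles-transpose-lift₀ j π))) (F-resp (λ x → refl))) ⟩
        w (suc (cycles π)) * F′ π + sum (λ j → w (cycles π) * F (t₀ (suc j) · lift₀ π · ρ))
          ≈⟨ +-cong (≈-trans (*-congʳ (w-suc _)) (*-assoc _ _ _)) (≈-trans (≈-sym (sum-*ˡ _ _)) (≈-trans (*-congˡ (eigen₀ (lift₀ π · ρ))) (x*yz≈y*xz _ _ _))) ⟩
        t * (w (cycles π) * F′ π) + κ zero * (w (cycles π) * F′ π)
          ≈⟨ distribʳ _ _ _ ⟨
        (t + κ zero) * (w (cycles π) * F′ π)
          ≈⟨ *-congˡ (*-congˡ (F′-resp (λ _ → refl))) ⟩
        (t + κ zero) * (w (cycles π) * F′ (π · idₚ)) ∎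

-- Tuples of permutations

-- The relation φ σ₀ σ₁ ⋯ = id determines σ₀ as the inverse of σ₁ ⋯ φ, so all that is left of the
-- choice of σ₀ is the condition of being one cycle.
InM⇔ : ∀ {n k} (lam : Partition (suc n)) (φ σ : Permutation′ (suc n)) (σs : Vec (Permutation′ (suc n)) k) →
       (In𝓜 lam (φ , σ ∷ σs) → InClass lam φ × σ ≈ₚ flip (product σs · φ) × Long σ) ×
       (InClass lam φ × σ ≈ₚ flip (product σs · φ) × Long σ → In𝓜 lam (φ , σ ∷ σs))
InM⇔ lam φ σ σs =
  (λ (e , c , l) → c , (λ x → trans (to⇒from φ (trans (cong (λ z → φ ⟨$⟩ʳ (σ ⟨$⟩ʳ z)) (sym (inverseʳ (product σs)))) (e (product σs ⟨$⟩ˡ x)))) refl) , cycleType⇒long σ l) ,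
  (λ (c , e , l) → (λ x → trans (cong (φ ⟨$⟩ʳ_) (trans (e (product σs ⟨$⟩ʳ x)) (cong (φ ⟨$⟩ˡ_) (inverseˡ (product σs))))) (inverseʳ φ)) , c , long⇒cycleType σ l)

module Assembly (R : CommutativeSemiring 0ℓ 0ℓ) where
  open CommutativeSemiring R hiding (zero; isEquivalence) renaming (refl to ≈-refl; sym to ≈-sym; trans to ≈-trans; _+_ to _⊕_; _*_ to _⊛_)
  open PermSums R
  open import Relation.Binary.Reasoning.Setoid setoid

  power : Carrier → ℕ → Carrier
  power h zero    = 1#
  power h (suc k) = h ⊛ power h k

  ∑-pick : ∀ {n} (τ : Permutation′ n) {F : Permutation′ n → Carrier} → Resp F → ∑ (𝔖 n) (λ σ → 𝟙 (σ ≈ₚ? τ) ⊛ F σ) ≈ F τ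
  ∑-pick {n} τ {F} F-resp = begin
    ∑ (𝔖 n) (λ σ → 𝟙 (σ ≈ₚ? τ) ⊛ F σ) ≈⟨ ∑-cong (𝔖 n) (λ σ → 𝟙-guard (σ ≈ₚ? τ) F-resp) ⟩
    ∑ (𝔖 n) (λ σ → 𝟙 (σ ≈ₚ? τ) ⊛ F τ) ≈⟨ ∑-*ʳ (F τ) (𝔖 n) _ ⟨
    ∑ (𝔖 n) (λ σ → 𝟙 (σ ≈ₚ? τ)) ⊛ F τ ≈⟨ *-congʳ (perms! τ) ⟩
    1# ⊛ F τ ≈⟨ *-identityˡ _ ⟩
    F τ ∎

  module _ {n : ℕ} (wt : Permutation′ (suc n) → Carrier) where
    private N = suc n

    weights : ∀ {k} → Vec (Permutation′ N) k → Carrier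
    weights []       = 1#
    weights (σ ∷ σs) = wt σ ⊛ weights σs

    -- The sum over the first factor is taken innermost, with the other factors held fixed; there
    -- `eigen` applies at `product σs · φ` and releases one h.
    ∑-product : (f : Permutation′ N → Carrier) → Resp f → (h : Carrier) → (∀ φ → ∑ (𝔖 N) (λ σ → wt σ ⊛ f (σ · φ)) ≈ h ⊛ f φ) →
                ∀ k φ → ∑ (vectors k (𝔖 N)) (λ σs → weights σs ⊛ f (product σs · φ)) ≈ power h k ⊛ f φ
    ∑-product f f-resp h eigen zero φ = ≈-trans (∑-∷ [] [] _) (≈-trans (+-cong (*-congˡ (f-resp (λ _ → refl))) (∑-[] _)) (+-identityʳ _))
    ∑-product f f-resp h eigen (suc k) φ = begin
      ∑ (vectors (suc k) (𝔖 N)) (λ σs → weights σs ⊛ f (product σs · φ))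
        ≈⟨ ∑-cartesianProductWith _∷_ (𝔖 N) (vectors k (𝔖 N)) _ ⟩
      ∑ (𝔖 N) (λ σ → ∑ (vectors k (𝔖 N)) (λ σs → (wt σ ⊛ weights σs) ⊛ f ((σ · product σs) · φ)))
        ≈⟨ ∑-swap (𝔖 N) (vectors k (𝔖 N)) _ ⟩
      ∑ (vectors k (𝔖 N)) (λ σs → ∑ (𝔖 N) (λ σ → (wt σ ⊛ weights σs) ⊛ f ((σ · product σs) · φ)))
        ≈⟨ ∑-cong (vectors k (𝔖 N)) (λ σs → ≈-trans (∑-cong (𝔖 N) λ σ → ≈-trans (*-cong (*-comm (wt σ) (weights σs)) (f-resp (λ _ → refl))) (*-assoc _ _ _)) (≈-trans (≈-sym (∑-*ˡ (weights σs) (𝔖 N) _)) (*-congˡ (eigen (product σs · φ))))) ⟩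
      ∑ (vectors k (𝔖 N)) (λ σs → weights σs ⊛ (h ⊛ f (product σs · φ)))
        ≈⟨ ≈-trans (∑-cong (vectors k (𝔖 N)) λ σs → x*yz≈y*xz _ _ _) (≈-sym (∑-*ˡ h (vectors k (𝔖 N)) _)) ⟩
      h ⊛ ∑ (vectors k (𝔖 N)) (λ σs → weights σs ⊛ f (product σs · φ))
        ≈⟨ *-congˡ (∑-product f f-resp h eigen k φ) ⟩
      h ⊛ (power h k ⊛ f φ)
        ≈⟨ *-assoc _ _ _ ⟨
      power h (suc k) ⊛ f φ ∎

    module _ (s h : Fin N → Carrier) (f : Fin N → Permutation′ N → Carrier) (f-resp : ∀ a → Resp (f a))
             (eigen : ∀ a φ → ∑ (𝔖 N) (λ σ → wt σ ⊛ f a (σ · φ)) ≈ h a ⊛ f a φ)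
             (ν κ : Carrier) (κν : κ ⊛ ν ≈ 1#) (alternating : ∀ ψ → sum (λ a → s a ⊛ f a ψ) ≈ ν ⊛ 𝟙 (long? ψ)) where

      -- After insertion of κ ν = 1 the indicator of the n-cycles becomes a combination of the
      -- eigenfunctions f a, on each of which the k summations act by the factor h a.
      ∑-long : ∀ k φ → ∑ (vectors k (𝔖 N)) (λ σs → weights σs ⊛ 𝟙 (long? (product σs · φ))) ≈ κ ⊛ sum (λ a → (s a ⊛ power (h a) k) ⊛ f a φ)
      ∑-long k φ = begin
        ∑ V (λ σs → weights σs ⊛ 𝟙 (long? (product σs · φ)))
          ≈⟨ ∑-cong V (λ σs → ≈-trans (*-congˡ (≈-trans (≈-sym (*-identityˡ _)) (≈-trans (*-congʳ (≈-sym κν)) (≈-trans (*-assoc _ _ _) (*-congˡ (≈-sym (alternating (product σs · φ)))))))) (x*yz≈y*xz _ _ _)) ⟩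
        ∑ V (λ σs → κ ⊛ (weights σs ⊛ sum (λ a → s a ⊛ f a (product σs · φ))))
          ≈⟨ ≈-sym (∑-*ˡ κ V _) ⟩
        κ ⊛ ∑ V (λ σs → weights σs ⊛ sum (λ a → s a ⊛ f a (product σs · φ)))
          ≈⟨ *-congˡ (≈-trans (∑-cong V λ σs → ≈-trans (sum-*ˡ _ _) (sum-cong λ a → x*yz≈y*xz _ _ _)) (∑-sum V _)) ⟩
        κ ⊛ sum (λ a → ∑ V (λ σs → s a ⊛ (weights σs ⊛ f a (product σs · φ))))
          ≈⟨ *-congˡ (sum-cong λ a → ≈-trans (≈-sym (∑-*ˡ (s a) V _)) (≈-trans (*-congˡ (∑-product (f a) (f-resp a) (h a) (eigen a) k φ)) (≈-sym (*-assoc _ _ _)))) ⟩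
        κ ⊛ sum (λ a → (s a ⊛ power (h a) k) ⊛ f a φ) ∎
        where V = vectors k (𝔖 N)

      -- The sum over σ₀ has a single nonzero candidate and leaves the indicator treated by
      -- `∑-long`. On the class of φ the functions f a are constant, so the sum over φ′ merely
      -- counts the class.
      ∑-tuples : ∀ k (lam : Partition N) φ → (∀ a φ′ → InClass lam φ′ → f a φ′ ≈ f a φ) → ∀ tℓ →
        ∑ (𝔖 N) (λ φ′ → ∑ (𝔖 N) (λ σ → ∑ (vectors k (𝔖 N)) (λ σs → 𝟙 (in𝓜? lam (φ′ , σ ∷ σs)) ⊛ (tℓ ⊛ weights σs)))) ≈
        ((∑ (𝔖 N) (λ φ′ → 𝟙 (inClass? lam φ′)) ⊛ κ) ⊛ tℓ) ⊛ sum (λ a → (s a ⊛ power (h a) k) ⊛ f a φ)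
      ∑-tuples k lam φ class tℓ = begin
        ∑ (𝔖 N) (λ φ′ → ∑ (𝔖 N) (λ σ → ∑ V (λ σs → 𝟙 (in𝓜? lam (φ′ , σ ∷ σs)) ⊛ (tℓ ⊛ weights σs))))
          ≈⟨ ∑-cong (𝔖 N) (λ φ′ → ≈-trans (∑-swap (𝔖 N) V _) (∑-cong V (by-σs φ′))) ⟩
        ∑ (𝔖 N) (λ φ′ → ∑ V (λ σs → (𝟙 (inClass? lam φ′) ⊛ tℓ) ⊛ (weights σs ⊛ 𝟙 (long? (product σs · φ′)))))
          ≈⟨ ∑-cong (𝔖 N) (λ φ′ → ≈-trans (≈-sym (∑-*ˡ _ V _)) (≈-trans (*-congˡ (∑-long k φ′)) (*-assoc _ _ _))) ⟩
        ∑ (𝔖 N) (λ φ′ → 𝟙 (inClass? lam φ′) ⊛ (tℓ ⊛ (κ ⊛ S φ′)))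
          ≈⟨ ∑-cong (𝔖 N) (λ φ′ → 𝟙-guard (inClass? lam φ′) λ c → *-congˡ (*-congˡ (sum-cong λ a → *-congˡ (class a φ′ c)))) ⟩
        ∑ (𝔖 N) (λ φ′ → 𝟙 (inClass? lam φ′) ⊛ (tℓ ⊛ (κ ⊛ S φ)))
          ≈⟨ ∑-*ʳ (tℓ ⊛ (κ ⊛ S φ)) (𝔖 N) _ ⟨
        ∑ (𝔖 N) (λ φ′ → 𝟙 (inClass? lam φ′)) ⊛ (tℓ ⊛ (κ ⊛ S φ))
          ≈⟨ ≈-trans (*-congˡ (x*yz≈y*xz _ _ _)) (≈-trans (≈-sym (*-assoc _ _ _)) (≈-sym (*-assoc _ _ _))) ⟩
        ((∑ (𝔖 N) (λ φ′ → 𝟙 (inClass? lam φ′)) ⊛ κ) ⊛ tℓ) ⊛ S φ ∎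
        where
        V = vectors k (𝔖 N)
        S : Permutation′ N → Carrier
        S φ′ = sum (λ a → (s a ⊛ power (h a) k) ⊛ f a φ′)
        by-σs : ∀ φ′ σs → ∑ (𝔖 N) (λ σ → 𝟙 (in𝓜? lam (φ′ , σ ∷ σs)) ⊛ (tℓ ⊛ weights σs)) ≈ (𝟙 (inClass? lam φ′) ⊛ tℓ) ⊛ (weights σs ⊛ 𝟙 (long? (product σs · φ′)))
        by-σs φ′ σs = begin
          ∑ (𝔖 N) (λ σ → 𝟙 (in𝓜? lam (φ′ , σ ∷ σs)) ⊛ (tℓ ⊛ weights σs))
            ≈⟨ ∑-*ʳ (tℓ ⊛ weights σs) (𝔖 N) _ ⟨
          ∑ (𝔖 N) (λ σ → 𝟙 (in𝓜? lam (φ′ , σ ∷ σs))) ⊛ (tℓ ⊛ weights σs)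
            ≈⟨ *-congʳ (≈-trans (∑-cong (𝔖 N) separate) (≈-trans (≈-sym (∑-*ˡ c (𝔖 N) _)) (*-congˡ (∑-pick τ (λ {σ} {ρ} → long-resp {σ} {ρ}))))) ⟩
          (c ⊛ 𝟙 (long? τ)) ⊛ (tℓ ⊛ weights σs)
            ≈⟨ *-congʳ (*-congˡ (𝟙-cong (long? τ) (long? (product σs · φ′)) (λ l → long-cong {σ = flip τ} {product σs · φ′} (λ _ → refl) (long-flip {σ = τ} l)) (λ l → long-flip {σ = product σs · φ′} l))) ⟩
          (c ⊛ d) ⊛ (tℓ ⊛ weights σs)
            ≈⟨ *-assoc _ _ _ ⟩
          c ⊛ (d ⊛ (tℓ ⊛ weights σs))
            ≈⟨ *-congˡ (≈-trans (x*yz≈y*xz _ _ _) (*-congˡ (*-comm _ _))) ⟩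
          c ⊛ (tℓ ⊛ (weights σs ⊛ d))
            ≈⟨ *-assoc _ _ _ ⟨
          (c ⊛ tℓ) ⊛ (weights σs ⊛ d) ∎
          where
          τ : Permutation′ N
          τ = flip (product σs · φ′)
          c d : Carrier
          c = 𝟙 (inClass? lam φ′)
          d = 𝟙 (long? (product σs · φ′))
          long-resp : Resp (λ σ → 𝟙 (long? σ))
          long-resp {σ} {ρ} e = 𝟙-cong (long? σ) (long? ρ) (long-cong {σ = σ} {ρ} e) (long-cong {σ = ρ} {σ} (λ i → sym (e i)))
          separate : ∀ σ → 𝟙 (in𝓜? lam (φ′ , σ ∷ σs)) ≈ c ⊛ (𝟙 (σ ≈ₚ? τ) ⊛ 𝟙 (long? σ))
          separate σ = ≈-trans (𝟙-cong (in𝓜? lam (φ′ , σ ∷ σs)) (inClass? lam φ′ ×-dec (σ ≈ₚ? τ ×-dec long? σ)) (proj₁ (InM⇔ lam φ′ σ σs)) (proj₂ (InM⇔ lam φ′ σ σs)))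
            (≈-trans (𝟙-× (inClass? lam φ′) (σ ≈ₚ? τ ×-dec long? σ)) (*-congˡ (𝟙-× (σ ≈ₚ? τ) (long? σ))))

-- Laurent polynomials

module Lᴸ = FreeModule ℤ._≟_
open Lᴸ using () renaming (coeff to coeffᴸ; coeff-++ to coeffᴸ-++)

≟-shift : ∀ i j k → does (i ℤ.+ j ℤ.≟ k) ≡ does (j ℤ.≟ k ℤ.- i)
≟-shift i j k with j ℤ.≟ k ℤ.- i
... | yes e = dec-true (i ℤ.+ j ℤ.≟ k) (trans (cong (λ z → i ℤ.+ z) e) (ℤ-Solver.solve 2 (λ i k → i :+ (k :- i) := k) refl i k))
  where open ℤ-Solver
... | no ne = dec-false (i ℤ.+ j ℤ.≟ k) (λ { refl → ne (ℤ-Solver.solve 2 (λ i j → j := i :+ j :- i) refl i j) })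
  where open ℤ-Solver

if-* : ∀ b a x → (if b then a ℚ.* x else 0ℚ) ≡ a ℚ.* (if b then x else 0ℚ)
if-* true  a x = refl
if-* false a x = sym (ℚ.*-zeroʳ a)

coeffᴸ-map : ∀ {a i} (g : ℚ × ℤ → ℚ × ℤ) → (∀ b j → g (b , j) ≡ (a ℚ.* b , i ℤ.+ j)) →
             ∀ q k → coeffᴸ (map g q) k ≡ a ℚ.* coeffᴸ q (k ℤ.- i)
coeffᴸ-map {a} {i} g e []            k = sym (ℚ.*-zeroʳ a)
coeffᴸ-map {a} {i} g e ((b , j) ∷ q) k rewrite e b j = begin
  (if does (i ℤ.+ j ℤ.≟ k) then a ℚ.* b else 0ℚ) ℚ.+ coeffᴸ (map g q) k ≡⟨ cong₂ ℚ._+_ (trans (if-* _ a b) (cong (λ d → a ℚ.* (if d then b else 0ℚ)) (≟-shift i j k))) (coeffᴸ-map {a} {i} g e q k) ⟩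
  a ℚ.* (if does (j ℤ.≟ k ℤ.- i) then b else 0ℚ) ℚ.+ a ℚ.* coeffᴸ q (k ℤ.- i) ≡⟨ ℚ.*-distribˡ-+ a _ _ ⟨
  a ℚ.* ((if does (j ℤ.≟ k ℤ.- i) then b else 0ℚ) ℚ.+ coeffᴸ q (k ℤ.- i)) ∎
  where open ≡-Reasoning

coeffᴸ-∷-* : ∀ a i p q k → coeffᴸ (((a , i) ∷ p) *ᴸ q) k ≡ a ℚ.* coeffᴸ q (k ℤ.- i) ℚ.+ coeffᴸ (p *ᴸ q) k
coeffᴸ-∷-* a i p q k = trans (coeffᴸ-++ (map (λ z → a ℚ.* proj₁ z , i ℤ.+ proj₂ z) q) (p *ᴸ q) k) (cong (ℚ._+ coeffᴸ (p *ᴸ q) k) (coeffᴸ-map {a} {i} _ (λ _ _ → refl) q k))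

*ᴸ-congˡ : ∀ p {q r} → q ≈ᴸ r → p *ᴸ q ≈ᴸ p *ᴸ r
*ᴸ-congˡ []            e k = refl
*ᴸ-congˡ ((a , i) ∷ p) {q} {r} e k = trans (coeffᴸ-∷-* a i p q k)
  (trans (cong₂ ℚ._+_ (cong (a ℚ.*_) (e (k ℤ.- i))) (*ᴸ-congˡ p e k)) (sym (coeffᴸ-∷-* a i p r k)))

*ᴸ-zeroʳ : ∀ p → p *ᴸ [] ≡ []
*ᴸ-zeroʳ []      = refl
*ᴸ-zeroʳ (_ ∷ p) = *ᴸ-zeroʳ p

-- Expansion along the right factor, whereas `_*ᴸ_` recurses on the left one; comparing the two
-- expansions gives commutativity, and with it the laws on the other side.
coeffᴸ-*-∷ : ∀ a i p q k → coeffᴸ (q *ᴸ ((a , i) ∷ p)) k ≡ a ℚ.* coeffᴸ q (k ℤ.- i) ℚ.+ coeffᴸ (q *ᴸ p) k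
coeffᴸ-*-∷ a i p []            k = sym (trans (ℚ.+-identityʳ _) (ℚ.*-zeroʳ a))
coeffᴸ-*-∷ a i p ((b , j) ∷ q) k = begin
  coeffᴸ (((b , j) ∷ q) *ᴸ ((a , i) ∷ p)) k
    ≡⟨ coeffᴸ-∷-* b j q ((a , i) ∷ p) k ⟩
  b ℚ.* ((if does (i ℤ.≟ k ℤ.- j) then a else 0ℚ) ℚ.+ coeffᴸ p (k ℤ.- j)) ℚ.+ coeffᴸ (q *ᴸ ((a , i) ∷ p)) k
    ≡⟨ cong₂ (λ y z → b ℚ.* (y ℚ.+ coeffᴸ p (k ℤ.- j)) ℚ.+ z) swap (coeffᴸ-*-∷ a i p q k) ⟩
  b ℚ.* (a ℚ.* d ℚ.+ coeffᴸ p (k ℤ.- j)) ℚ.+ (a ℚ.* coeffᴸ q (k ℤ.- i) ℚ.+ coeffᴸ (q *ᴸ p) k)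
    ≡⟨ solve 6 (λ a b d x y z → b :* (a :* d :+ x) :+ (a :* y :+ z) := a :* (b :* d :+ y) :+ (b :* x :+ z)) refl a b d (coeffᴸ p (k ℤ.- j)) (coeffᴸ q (k ℤ.- i)) (coeffᴸ (q *ᴸ p) k) ⟩
  a ℚ.* (b ℚ.* d ℚ.+ coeffᴸ q (k ℤ.- i)) ℚ.+ (b ℚ.* coeffᴸ p (k ℤ.- j) ℚ.+ coeffᴸ (q *ᴸ p) k)
    ≡⟨ cong₂ (λ y z → a ℚ.* (y ℚ.+ coeffᴸ q (k ℤ.- i)) ℚ.+ z) bd (coeffᴸ-∷-* b j q p k) ⟨
  a ℚ.* coeffᴸ ((b , j) ∷ q) (k ℤ.- i) ℚ.+ coeffᴸ (((b , j) ∷ q) *ᴸ p) k ∎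
  where
  open ≡-Reasoning
  open ℚ-Solver
  d : ℚ
  d = if does (j ℤ.≟ k ℤ.- i) then 1ℚ else 0ℚ
  if-1 : ∀ b a → (if b then a else 0ℚ) ≡ a ℚ.* (if b then 1ℚ else 0ℚ)
  if-1 true  a = sym (ℚ.*-identityʳ a)
  if-1 false a = sym (ℚ.*-zeroʳ a)
  bd : (if does (j ℤ.≟ k ℤ.- i) then b else 0ℚ) ≡ b ℚ.* d
  bd = if-1 (does (j ℤ.≟ k ℤ.- i)) b
  swap : (if does (i ℤ.≟ k ℤ.- j) then a else 0ℚ) ≡ a ℚ.* d
  swap = trans (cong (if_then a else 0ℚ) (trans (sym (≟-shift j i k)) (trans (cong (λ z → does (z ℤ.≟ k)) (ℤ.+-comm j i)) (≟-shift i j k)))) (if-1 (does (j ℤ.≟ k ℤ.- i)) a)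

*ᴸ-comm : ∀ p q → p *ᴸ q ≈ᴸ q *ᴸ p
*ᴸ-comm []            q k = cong (λ z → coeffᴸ z k) (sym (*ᴸ-zeroʳ q))
*ᴸ-comm ((a , i) ∷ p) q k = trans (coeffᴸ-∷-* a i p q k) (trans (cong (a ℚ.* coeffᴸ q (k ℤ.- i) ℚ.+_) (*ᴸ-comm p q k)) (sym (coeffᴸ-*-∷ a i p q k)))

*ᴸ-cong : ∀ {p p′ q q′} → p ≈ᴸ p′ → q ≈ᴸ q′ → p *ᴸ q ≈ᴸ p′ *ᴸ q′
*ᴸ-cong {p} {p′} {q} {q′} e f k = trans (*ᴸ-congˡ p f k) (trans (*ᴸ-comm p q′ k) (trans (*ᴸ-congˡ q′ e k) (*ᴸ-comm q′ p′ k)))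

*ᴸ-distribʳ : ∀ r p q → (p +ᴸ q) *ᴸ r ≈ᴸ p *ᴸ r +ᴸ q *ᴸ r
*ᴸ-distribʳ r []            q k = refl
*ᴸ-distribʳ r ((a , i) ∷ p) q k = begin
  coeffᴸ (((a , i) ∷ (p +ᴸ q)) *ᴸ r) k ≡⟨ coeffᴸ-∷-* a i (p +ᴸ q) r k ⟩
  a ℚ.* coeffᴸ r (k ℤ.- i) ℚ.+ coeffᴸ ((p +ᴸ q) *ᴸ r) k ≡⟨ cong (a ℚ.* coeffᴸ r (k ℤ.- i) ℚ.+_) (trans (*ᴸ-distribʳ r p q k) (coeffᴸ-++ (p *ᴸ r) (q *ᴸ r) k)) ⟩
  a ℚ.* coeffᴸ r (k ℤ.- i) ℚ.+ (coeffᴸ (p *ᴸ r) k ℚ.+ coeffᴸ (q *ᴸ r) k) ≡⟨ ℚ.+-assoc (a ℚ.* coeffᴸ r (k ℤ.- i)) _ _ ⟨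
  (a ℚ.* coeffᴸ r (k ℤ.- i) ℚ.+ coeffᴸ (p *ᴸ r) k) ℚ.+ coeffᴸ (q *ᴸ r) k ≡⟨ cong (ℚ._+ coeffᴸ (q *ᴸ r) k) (coeffᴸ-∷-* a i p r k) ⟨
  coeffᴸ (((a , i) ∷ p) *ᴸ r) k ℚ.+ coeffᴸ (q *ᴸ r) k ≡⟨ coeffᴸ-++ (((a , i) ∷ p) *ᴸ r) (q *ᴸ r) k ⟨
  coeffᴸ (((a , i) ∷ p) *ᴸ r +ᴸ q *ᴸ r) k ∎
  where open ≡-Reasoning

+ᴸ-cong : ∀ {p p′ q q′} → p ≈ᴸ p′ → q ≈ᴸ q′ → p +ᴸ q ≈ᴸ p′ +ᴸ q′
+ᴸ-cong {p} {p′} {q} {q′} e f k = trans (coeffᴸ-++ p q k) (trans (cong₂ ℚ._+_ (e k) (f k)) (sym (coeffᴸ-++ p′ q′ k)))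

+ᴸ-comm : ∀ p q → p +ᴸ q ≈ᴸ q +ᴸ p
+ᴸ-comm p q k = trans (coeffᴸ-++ p q k) (trans (ℚ.+-comm (coeffᴸ p k) (coeffᴸ q k)) (sym (coeffᴸ-++ q p k)))

coeffᴸ-map-* : ∀ {a i} (g : ℚ × ℤ → ℚ × ℤ) → (∀ b j → g (b , j) ≡ (a ℚ.* b , i ℤ.+ j)) →
               ∀ q r k → coeffᴸ (map g q *ᴸ r) k ≡ a ℚ.* coeffᴸ (q *ᴸ r) (k ℤ.- i)
coeffᴸ-map-* {a} {i} g e []            r k = sym (ℚ.*-zeroʳ a)
coeffᴸ-map-* {a} {i} g e ((b , j) ∷ q) r k rewrite e b j = begin
  coeffᴸ (((a ℚ.* b , i ℤ.+ j) ∷ map g q) *ᴸ r) k ≡⟨ coeffᴸ-∷-* (a ℚ.* b) (i ℤ.+ j) (map g q) r k ⟩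
  (a ℚ.* b) ℚ.* coeffᴸ r (k ℤ.- (i ℤ.+ j)) ℚ.+ coeffᴸ (map g q *ᴸ r) k ≡⟨ cong₂ ℚ._+_ (trans (ℚ.*-assoc a b _) (cong (λ z → a ℚ.* (b ℚ.* coeffᴸ r z)) (ℤ-Solver.solve 3 (λ i j k → k :- (i :+ j) := k :- i :- j) refl i j k))) (coeffᴸ-map-* {a} {i} g e q r k) ⟩
  a ℚ.* (b ℚ.* coeffᴸ r (k ℤ.- i ℤ.- j)) ℚ.+ a ℚ.* coeffᴸ (q *ᴸ r) (k ℤ.- i) ≡⟨ ℚ.*-distribˡ-+ a _ _ ⟨
  a ℚ.* (b ℚ.* coeffᴸ r (k ℤ.- i ℤ.- j) ℚ.+ coeffᴸ (q *ᴸ r) (k ℤ.- i)) ≡⟨ cong (a ℚ.*_) (coeffᴸ-∷-* b j q r (k ℤ.- i)) ⟨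
  a ℚ.* coeffᴸ (((b , j) ∷ q) *ᴸ r) (k ℤ.- i) ∎
  where
  open ≡-Reasoning
  open ℤ-Solver

*ᴸ-assoc : ∀ p q r → (p *ᴸ q) *ᴸ r ≈ᴸ p *ᴸ (q *ᴸ r)
*ᴸ-assoc []            q r k = refl
*ᴸ-assoc ((a , i) ∷ p) q r k = begin
  coeffᴸ ((((a , i) ∷ p) *ᴸ q) *ᴸ r) k ≡⟨ trans (*ᴸ-distribʳ r (map _ q) (p *ᴸ q) k) (coeffᴸ-++ (map _ q *ᴸ r) ((p *ᴸ q) *ᴸ r) k) ⟩
  coeffᴸ (map _ q *ᴸ r) k ℚ.+ coeffᴸ ((p *ᴸ q) *ᴸ r) k ≡⟨ cong₂ ℚ._+_ (coeffᴸ-map-* {a} {i} _ (λ _ _ → refl) q r k) (*ᴸ-assoc p q r k) ⟩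
  a ℚ.* coeffᴸ (q *ᴸ r) (k ℤ.- i) ℚ.+ coeffᴸ (p *ᴸ (q *ᴸ r)) k ≡⟨ coeffᴸ-∷-* a i p (q *ᴸ r) k ⟨
  coeffᴸ (((a , i) ∷ p) *ᴸ (q *ᴸ r)) k ∎
  where open ≡-Reasoning

*ᴸ-identityˡ : ∀ p → const 1ℚ *ᴸ p ≈ᴸ p
*ᴸ-identityˡ p k = trans (coeffᴸ-∷-* 1ℚ 0ℤ [] p k) (trans (ℚ.+-identityʳ _) (trans (ℚ.*-identityˡ _) (cong (coeffᴸ p) (ℤ.+-identityʳ k))))

laurentSemiring : CommutativeSemiring 0ℓ 0ℓ
laurentSemiring = record
  { Carrier = Laurent ; _≈_ = _≈ᴸ_ ; _+_ = _+ᴸ_ ; _*_ = _*ᴸ_ ; 0# = [] ; 1# = const 1ℚ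
  ; isCommutativeSemiring = record
    { isSemiring = record
      { isSemiringWithoutAnnihilatingZero = record
        { +-isCommutativeMonoid = record
          { isMonoid = record
            { isSemigroup = record
              { isMagma = record
                { isEquivalence = record { refl = λ _ → refl ; sym = λ e k → sym (e k) ; trans = λ e f k → trans (e k) (f k) }
                ; ∙-cong = λ {p} {p′} {q} {q′} → +ᴸ-cong {p} {p′} {q} {q′}
                }
              ; assoc = λ p q r k → cong (λ z → coeffᴸ z k) (List.++-assoc p q r)
              }
            ; identity = (λ p k → refl) , (λ p k → cong (λ z → coeffᴸ z k) (List.++-identityʳ p))
            }
          ; comm = +ᴸ-comm
          }
        ; *-cong = λ {p} {p′} {q} {q′} → *ᴸ-cong {p} {p′} {q} {q′}
        ; *-assoc = *ᴸ-assoc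
        ; *-identity = *ᴸ-identityˡ , (λ p k → trans (*ᴸ-comm p (const 1ℚ) k) (*ᴸ-identityˡ p k))
        ; distrib = (λ p q r k → trans (*ᴸ-comm p (q +ᴸ r) k) (trans (*ᴸ-distribʳ p q r k) (+ᴸ-cong {q *ᴸ p} {p *ᴸ q} {r *ᴸ p} {p *ᴸ r} (*ᴸ-comm q p) (*ᴸ-comm r p) k)))
                  , *ᴸ-distribʳ
        }
      ; zero = (λ p k → refl) , (λ p k → cong (λ z → coeffᴸ z k) (*ᴸ-zeroʳ p))
      }
    ; *-comm = *ᴸ-comm
    }
  }

const-+ : ∀ a b → const (a ℚ.+ b) ≈ᴸ const a +ᴸ const b
const-+ a b k with does (0ℤ ℤ.≟ k)
... | true  = trans (ℚ.+-identityʳ _) (cong (a ℚ.+_) (sym (ℚ.+-identityʳ b)))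
... | false = refl

const-0 : const 0ℚ ≈ᴸ []
const-0 k with does (0ℤ ℤ.≟ k)
... | true  = refl
... | false = refl

open import Data.Rational.Base using (½; _+_; _*_; -_)
open TabloidModule using (coeff; coeff-++; coeff-scale; Basis; IsSubspace; Span-gen; Span-subspace; _≋_; comb-+; comb-*)

-- Hook polytabloids

module ℚ∑ = PermSums (CommutativeRing.commutativeSemiring ℚ.+-*-commutativeRing)
open ℚ∑

[-1]^-square : ∀ k → [-1]^ k * [-1]^ k ≡ 1ℚ
[-1]^-square zero    = refl
[-1]^-square (suc k) = trans (ℚ-Solver.solve 1 (λ x → (:- x) :* (:- x) := x :* x) refl ([-1]^ k)) ([-1]^-square k)
  where open ℚ-Solver

sign-square : ∀ {n} (σ : Permutation′ n) → sign σ * sign σ ≡ 1ℚ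
sign-square {n} σ = trans (cong₂ _*_ (sign≡ σ) (sign≡ σ)) ([-1]^-square (n ∸ cycles σ))

sign-id : ∀ {n} → sign (idₚ {n}) ≡ 1ℚ
sign-id {n} = trans (sign-cong {σ = idₚ} {idₚ · idₚ} (λ _ → refl)) (trans (sign-· (idₚ {n}) idₚ) (sign-square (idₚ {n})))

sign-transpose : ∀ {n} {i j : Fin n} → i ≢ j → sign (transpose i j) ≡ - 1ℚ
sign-transpose {i = i} {j} i≢j = trans (sign-cong {σ = transpose i j} {transpose i j · idₚ} (λ _ → refl)) (trans (sign-transpose-· i≢j idₚ) (cong -_ sign-id))

x≡-x⇒x≡0 : ∀ x → x ≡ - x → x ≡ 0ℚ
x≡-x⇒x≡0 x e = begin
  x ≡⟨ ℚ.*-identityˡ x ⟨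
  (½ + ½) * x ≡⟨ solve 2 (λ h x → (h :+ h) :* x := h :* (x :+ x)) refl ½ x ⟩
  ½ * (x + x) ≡⟨ cong (λ y → ½ * (x + y)) e ⟩
  ½ * (x + - x) ≡⟨ cong (½ *_) (ℚ.+-inverseʳ x) ⟩
  0ℚ ∎
  where
  open ≡-Reasoning
  open ℚ-Solver

open Mult (CommutativeRing.semiring ℚ.+-*-commutativeRing) using (×-homo-+; ×1-homo-*) renaming (_×_ to _×ℚ_)

ι : ℕ → ℚ
ι k = k ×ℚ 1ℚ

ι-+ : ∀ k l → ι (k ℕ.+ l) ≡ ι k + ι l
ι-+ = ×-homo-+ 1ℚ

ι-* : ∀ k l → ι (k ℕ.* l) ≡ ι k * ι l
ι-* = ×1-homo-*

0≤ι : ∀ k → 0ℚ ℚ.≤ ι k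
0≤ι zero    = ℚ.≤-refl
0≤ι (suc k) = ℚ.≤-trans (ℚ.≤-reflexive (sym (ℚ.+-identityˡ 0ℚ))) (ℚ.+-mono-≤ {0ℚ} {1ℚ} (ℚ.<⇒≤ (ℚ.positive⁻¹ 1ℚ)) (0≤ι k))

ι-suc≢0 : ∀ k → ι (suc k) ≢ 0ℚ
ι-suc≢0 k e = ℚ.<⇒≢ (ℚ.<-≤-trans (ℚ.positive⁻¹ 1ℚ) (ℚ.≤-trans (ℚ.≤-reflexive (sym (ℚ.+-identityʳ 1ℚ))) (ℚ.+-monoʳ-≤ 1ℚ (0≤ι k)))) (sym e)

ι≢0 : ∀ k .{{_ : NonZero k}} → ι k ≢ 0ℚ
ι≢0 (suc k) = ι-suc≢0 k

*-cancelˡ : ∀ {a x y} → a ≢ 0ℚ → a * x ≡ a * y → x ≡ y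
*-cancelˡ {a} {x} {y} a≢0 e = begin
  x ≡⟨ unit x ⟨
  ℚ.1/ a * (a * x) ≡⟨ cong (ℚ.1/ a *_) e ⟩
  ℚ.1/ a * (a * y) ≡⟨ unit y ⟩
  y ∎
  where
  open ≡-Reasoning
  instance _ = ℚ.≢-nonZero a≢0
  unit : ∀ z → ℚ.1/ a * (a * z) ≡ z
  unit z = trans (sym (ℚ.*-assoc (ℚ.1/ a) a z)) (trans (cong (_* z) (ℚ.*-inverseˡ a)) (ℚ.*-identityˡ z))

ι-𝟙 : ∀ {A : Set} (d : Dec A) → ι (ℕ∑.𝟙 d) ≡ 𝟙 d
ι-𝟙 d@(yes a) = trans (cong ι (ℕ∑.𝟙-yes d a)) (sym (𝟙-yes d a))
ι-𝟙 d@(no ¬a) = trans (cong ι (ℕ∑.𝟙-no d ¬a)) (sym (𝟙-no d ¬a))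

ι-sum : ∀ {n} (f : Fin n → ℕ) → ι (ℕ∑.sum f) ≡ sum (λ i → ι (f i))
ι-sum {zero}  f = trans (cong ι (ℕ∑.sum-[] f)) (sym (sum-[] _))
ι-sum {suc n} f = trans (cong ι (ℕ∑.sum-suc f)) (trans (ι-+ (f zero) _) (trans (cong (ι (f zero) +_) (ι-sum (f ∘ suc))) (sym (sum-suc _))))

∑-neg : ∀ {X : Set} (xs : List X) (f : X → ℚ) → ∑ xs (λ x → - f x) ≡ - ∑ xs f
∑-neg xs f = trans (∑-cong xs (λ x → neg-1 (f x))) (trans (sym (∑-*ˡ (- 1ℚ) xs f)) (sym (neg-1 _)))
  where
  neg-1 : ∀ x → - x ≡ - 1ℚ * x
  neg-1 x = trans (cong -_ (sym (ℚ.*-identityˡ x))) (ℚ.neg-distribˡ-* 1ℚ x)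

-- Sets of letters and permutations supported on them

infix 4 _∈ᵇ?_
_∈ᵇ?_ : ∀ {n} (x : Fin n) (U : Fin n → Bool) → Dec (U x ≡ true)
x ∈ᵇ? U = U x Bool.≟ true

card : ∀ {n} → (Fin n → Bool) → ℕ
card U = ℕ∑.sum (λ x → ℕ∑.𝟙 (x ∈ᵇ? U))

ι-card : ∀ {n} (U : Fin n → Bool) → ι (card U) ≡ sum (λ x → 𝟙 (x ∈ᵇ? U))
ι-card U = trans (ι-sum _) (sum-cong λ x → ι-𝟙 (x ∈ᵇ? U))

Supp : ∀ {n} → (Fin n → Bool) → Permutation′ n → Set
Supp U π = ∀ x → U x ≡ false → π ⟨$⟩ʳ x ≡ x

supp? : ∀ {n} (U : Fin n → Bool) (π : Permutation′ n) → Dec (Supp U π)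
supp? U π = Fin.all? λ x → (U x Bool.≟ false) →-dec ((π ⟨$⟩ʳ x) Fin.≟ x)

true≢false : ∀ {b} → b ≡ true → b ≢ false
true≢false refl ()

Supp-cong : ∀ {n} {U : Fin n → Bool} {π ρ} → π ≈ₚ ρ → Supp U π → Supp U ρ
Supp-cong e s x u = trans (sym (e x)) (s x u)

Supp-· : ∀ {n} {U : Fin n → Bool} {π ρ} → Supp U π → Supp U ρ → Supp U (π · ρ)
Supp-· {π = π} s s′ x u = trans (cong (π ⟨$⟩ʳ_) (s′ x u)) (s x u)

Supp-flip : ∀ {n} {U : Fin n → Bool} {π} → Supp U π → Supp U (flip π)
Supp-flip {π = π} s x u = sym (to⇒from π (s x u))

Supp-transpose : ∀ {n} {U : Fin n → Bool} {i j} → U i ≡ true → U j ≡ true → Supp U (transpose i j)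
Supp-transpose p q x u = transpose-other (λ { refl → true≢false p u }) (λ { refl → true≢false q u })

Supp-cancelˡ : ∀ {n} {U : Fin n → Bool} {π ρ} → Supp U π → Supp U (π · ρ) → Supp U ρ
Supp-cancelˡ {π = π} s s′ x u = to-injective π (trans (s′ x u) (sym (s x u)))

Supp-cancelʳ : ∀ {n} {U : Fin n → Bool} {π ρ} → Supp U ρ → Supp U (π · ρ) → Supp U π
Supp-cancelʳ {π = π} s s′ x u = trans (cong (π ⟨$⟩ʳ_) (sym (s x u))) (s′ x u)

Supp-image : ∀ {n} {U : Fin n → Bool} {π} → Supp U π → ∀ {x} → U x ≡ true → U (π ⟨$⟩ʳ x) ≡ true
Supp-image {U = U} {π} s {x} u with U (π ⟨$⟩ʳ x) in e
... | true  = refl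
... | false = contradiction (trans (cong U (to-injective π (sym (s (π ⟨$⟩ʳ x) e)))) e) (true≢false u)

-- Left cosets of the permutations of U = V \ {r} in those of V, represented by the transpositions (c r).
∑-cosets : ∀ {n} {U V : Fin n → Bool} {r} → V r ≡ true → U r ≡ false → (∀ x → x ≢ r → U x ≡ V x) →
           {K : Permutation′ n → ℚ} → Resp K →
           ∑ (𝔖 n) (λ π → 𝟙 (supp? V π) * K π) ≡
           sum (λ c → 𝟙 (c ∈ᵇ? V) * ∑ (𝔖 n) (λ π → 𝟙 (supp? U π) * K (transpose c r · π)))
∑-cosets {n} {U} {V} {r} Vr Ur U≡V {K} K-resp = begin
  ∑ (𝔖 n) (λ π → 𝟙 (supp? V π) * K π)
    ≡⟨ ∑-cong (𝔖 n) (λ π → sym (trans (sym (sum-*ʳ _ (λ c → 𝟙 ((π ⟨$⟩ʳ r) Fin.≟ c)))) (trans (cong (_* _) (sum-single-1 (π ⟨$⟩ʳ r))) (ℚ.*-identityˡ _)))) ⟩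
  ∑ (𝔖 n) (λ π → sum (λ c → G c π))
    ≡⟨ ∑-sum (𝔖 n) _ ⟩
  sum (λ c → ∑ (𝔖 n) (G c))
    ≡⟨ sum-cong (λ c → ∑-left {F = G c} (G-resp c) (transpose c r)) ⟨
  -- Translation by (c r) turns the condition π r = c into π r = r, and a permutation of V that
  -- fixes r is one of U.
  sum (λ c → ∑ (𝔖 n) (λ π → G c (transpose c r · π)))
    ≡⟨ sum-cong (λ c → trans (∑-cong (𝔖 n) (step c)) (sym (∑-*ˡ (𝟙 (c ∈ᵇ? V)) (𝔖 n) (λ π → 𝟙 (supp? U π) * K (transpose c r · π))))) ⟩
  sum (λ c → 𝟙 (c ∈ᵇ? V) * ∑ (𝔖 n) (λ π → 𝟙 (supp? U π) * K (transpose c r · π))) ∎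
  where
  open ≡-Reasoning
  G : Fin n → Permutation′ n → ℚ
  G c π = 𝟙 ((π ⟨$⟩ʳ r) Fin.≟ c) * (𝟙 (supp? V π) * K π)
  G-resp : ∀ c → Resp (G c)
  G-resp c {σ} {τ} e = cong₂ _*_ (𝟙-cong ((σ ⟨$⟩ʳ r) Fin.≟ c) ((τ ⟨$⟩ʳ r) Fin.≟ c) (trans (sym (e r))) (trans (e r)))
    (cong₂ _*_ (𝟙-cong (supp? V σ) (supp? V τ) (Supp-cong {π = σ} {τ} e) (Supp-cong {π = τ} {σ} (λ i → sym (e i)))) (K-resp e))
  step : ∀ c π → G c (transpose c r · π) ≡ 𝟙 (c ∈ᵇ? V) * (𝟙 (supp? U π) * K (transpose c r · π))
  step c π = begin
    𝟙 d * (𝟙 (supp? V (t · π)) * k) ≡⟨ ℚ.*-assoc (𝟙 d) _ k ⟨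
    𝟙 d * 𝟙 (supp? V (t · π)) * k ≡⟨ cong (_* k) (trans (sym (𝟙-× d (supp? V (t · π)))) (trans (𝟙-cong (d ×-dec supp? V (t · π)) (c ∈ᵇ? V ×-dec supp? U π) to from) (𝟙-× (c ∈ᵇ? V) (supp? U π)))) ⟩
    𝟙 (c ∈ᵇ? V) * 𝟙 (supp? U π) * k ≡⟨ ℚ.*-assoc (𝟙 (c ∈ᵇ? V)) _ k ⟩
    𝟙 (c ∈ᵇ? V) * (𝟙 (supp? U π) * k) ∎
    where
    t = transpose c r
    d = ((t · π) ⟨$⟩ʳ r) Fin.≟ c
    k = K (t · π)
    to : (t · π) ⟨$⟩ʳ r ≡ c × Supp V (t · π) → V c ≡ true × Supp U π
    to (e , s) = c∈V , fixes
      where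
      πr≡r : π ⟨$⟩ʳ r ≡ r
      πr≡r = to-injective t (trans e (sym (transpose-matchʳ c r)))
      c∈V : V c ≡ true
      c∈V with V c in q
      ... | true  = refl
      ... | false = contradiction (trans (cong V (to-injective π (trans πr≡r (sym (to-injective t (trans (s c q) (sym (transpose-matchʳ c r)))))))) q) (true≢false Vr)
      fixes : Supp U π
      fixes x u with x Fin.≟ r
      ... | yes refl = πr≡r
      ... | no x≢r = to-injective t (trans (s x x∉V) (sym (transpose-other (λ { refl → true≢false c∈V x∉V }) x≢r)))
        where
        x∉V : V x ≡ false
        x∉V = trans (sym (U≡V x x≢r)) u
    from : V c ≡ true × Supp U π → (t · π) ⟨$⟩ʳ r ≡ c × Supp V (t · π)
    from (c∈V , s) = trans (cong (t ⟨$⟩ʳ_) (s r Ur)) (transpose-matchʳ c r) ,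
      Supp-· {π = t} {π} (Supp-transpose c∈V Vr) (λ x v → s x (trans (U≡V x (λ { refl → true≢false Vr v })) v))

remove-letter : ∀ {n} → (Fin n → Bool) → Fin n → Fin n → Bool
remove-letter U r x = if does (x Fin.≟ r) then false else U x

remove-self : ∀ {n} (U : Fin n → Bool) r → remove-letter U r r ≡ false
remove-self U r rewrite dec-true (r Fin.≟ r) refl = refl

remove-other : ∀ {n} (U : Fin n → Bool) r x → x ≢ r → remove-letter U r x ≡ U x
remove-other U r x x≢r rewrite dec-false (x Fin.≟ r) x≢r = refl

card-remove : ∀ {n} (U V : Fin n → Bool) r → V r ≡ true → U r ≡ false → (∀ x → x ≢ r → U x ≡ V x) → card V ≡ suc (card U)
card-remove {suc n} U V r Vr Ur U≡V = begin
  card V ≡⟨ ℕ∑.sum-punchIn r _ ⟩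
  ℕ∑.𝟙 (r ∈ᵇ? V) ℕ.+ ℕ∑.sum (λ x → ℕ∑.𝟙 (Fin.punchIn r x ∈ᵇ? V)) ≡⟨ cong₂ ℕ._+_ (ℕ∑.𝟙-yes (r ∈ᵇ? V) Vr) (ℕ∑.sum-cong λ x → ℕ∑.𝟙-cong (Fin.punchIn r x ∈ᵇ? V) (Fin.punchIn r x ∈ᵇ? U) (trans (U≡V _ (Fin.punchInᵢ≢i r x))) (trans (sym (U≡V _ (Fin.punchInᵢ≢i r x))))) ⟩
  suc (ℕ∑.sum (λ x → ℕ∑.𝟙 (Fin.punchIn r x ∈ᵇ? U))) ≡⟨ cong (λ z → suc (z ℕ.+ ℕ∑.sum (λ x → ℕ∑.𝟙 (Fin.punchIn r x ∈ᵇ? U)))) (sym (ℕ∑.𝟙-no (r ∈ᵇ? U) (λ e → true≢false e Ur))) ⟩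
  suc (ℕ∑.𝟙 (r ∈ᵇ? U) ℕ.+ ℕ∑.sum (λ x → ℕ∑.𝟙 (Fin.punchIn r x ∈ᵇ? U))) ≡⟨ cong suc (ℕ∑.sum-punchIn r _) ⟨
  suc (card U) ∎
  where open ≡-Reasoning

card≡0 : ∀ {n} (U : Fin n → Bool) → card U ≡ 0 → ∀ x → U x ≡ false
card≡0 {suc n} U e x with U x in u
... | false = refl
... | true  = contradiction (trans (sym (ℕ∑.𝟙-yes (x ∈ᵇ? U) u)) (ℕ.m+n≡0⇒m≡0 (ℕ∑.𝟙 (x ∈ᵇ? U)) (trans (sym (ℕ∑.sum-punchIn x _)) e))) λ ()

∃-member : ∀ {n} (U : Fin n → Bool) {k} → card U ≡ suc k → ∃ λ r → U r ≡ true
∃-member {n} U {k} e with Fin.any? (_∈ᵇ? U)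
... | yes p = p
... | no ¬p = contradiction (trans (sym e) (ℕ∑.sum-zero (λ x → ℕ∑.𝟙-no (x ∈ᵇ? U) (λ u → ¬p (x , u))))) λ ()

-- By `∑-cosets`, removing one letter leaves as many cosets of the smaller group as U has letters.
∑-supp : ∀ {n} k (U : Fin n → Bool) → card U ≡ k → ∑ (𝔖 n) (λ π → 𝟙 (supp? U π)) ≡ ι (k !)
∑-supp {n} zero    U e = trans (∑-cong (𝔖 n) λ π → 𝟙-cong (supp? U π) (π ≈ₚ? idₚ) (λ s x → s x (card≡0 U e x)) (λ s x _ → s x)) (trans (perms! {n} idₚ) (sym (ℚ.+-identityʳ 1ℚ)))
∑-supp {n} (suc k) U e = begin
  ∑ (𝔖 n) (λ π → 𝟙 (supp? U π)) ≡⟨ ∑-cong (𝔖 n) (λ π → sym (ℚ.*-identityʳ _)) ⟩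
  ∑ (𝔖 n) (λ π → 𝟙 (supp? U π) * 1ℚ) ≡⟨ ∑-cosets {U = W} {U} {r} Ur (remove-self U r) (remove-other U r) {λ _ → 1ℚ} (λ _ → refl) ⟩
  sum (λ c → 𝟙 (c ∈ᵇ? U) * ∑ (𝔖 n) (λ π → 𝟙 (supp? W π) * 1ℚ)) ≡⟨ sum-cong (λ c → cong (𝟙 (c ∈ᵇ? U) *_) (trans (∑-cong (𝔖 n) (λ π → ℚ.*-identityʳ _)) (∑-supp k W (ℕ.suc-injective (trans (sym (card-remove W U r Ur (remove-self U r) (remove-other U r))) e))))) ⟩
  sum (λ c → 𝟙 (c ∈ᵇ? U) * ι (k !)) ≡⟨ trans (sym (sum-*ʳ _ _)) (cong (_* ι (k !)) (trans (sym (ι-card U)) (cong ι e))) ⟩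
  ι (suc k) * ι (k !) ≡⟨ ι-* (suc k) (k !) ⟨
  ι (suc k !) ∎
  where
  open ≡-Reasoning
  r = proj₁ (∃-member U e)
  Ur = proj₂ (∃-member U e)
  W = remove-letter U r

infix 4 _≟ᵗ_
_≟ᵗ_ : ∀ {n} (r s : Tabloid n) → Dec (r ≡ s)
_≟ᵗ_ = Vec.≡-dec ℕ._≟_

•-cancel : ∀ {n} (g : Permutation′ n) {r s : Tabloid n} → g • r ≡ g • s → r ≡ s
•-cancel g {r} {s} e = trans (sym (•-inverse g r)) (trans (cong (flip g •_) e) (•-inverse g s))

•-id : ∀ {n} (r : Tabloid n) → idₚ • r ≡ r
•-id r = Vec.tabulate∘lookup r

-- In a hook with corner 0, the letter 0 lies in both the first row and the first column, and any
-- other letter in exactly one of them.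
firstRow : ∀ {n} → (Fin (suc n) → Bool) → Fin (suc n) → Bool
firstRow C zero    = true
firstRow C (suc i) = not (C (suc i))

module ℚ-identities where
  open ℚ-Solver

  pull-sign : ∀ a r p e → a * ((r * p) * e) ≡ r * (a * (p * e))
  pull-sign = solve 4 (λ a r p e → a :* ((r :* p) :* e) := r :* (a :* (p :* e))) refl

  negate-middle : ∀ a p e → a * ((p * - 1ℚ) * e) ≡ - (a * (p * e))
  negate-middle = solve 3 (λ a p e → a :* ((p :* (:- con 1ℚ)) :* e) := :- (a :* (p :* e))) refl

  negate-first : ∀ a p e → a * ((- 1ℚ * p) * e) ≡ - (a * (p * e))
  negate-first = solve 3 (λ a p e → a :* (((:- con 1ℚ) :* p) :* e) := :- (a :* (p :* e))) refl

  cancels : ∀ a b → a * - b + a * b ≡ 0ℚ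
  cancels = solve 2 (λ a b → a :* (:- b) :+ a :* b := con 0ℚ) refl

  regroup : ∀ a p e f → a * (p * e) * f ≡ (a * p) * (e * f)
  regroup = solve 4 (λ a p e f → a :* (p :* e) :* f := (a :* p) :* (e :* f)) refl

  collect : ∀ x s y b f → x * (s * y * f + b * (y * f)) ≡ y * x * (s + b) * f
  collect = solve 5 (λ x s y b f → x :* (s :* y :* f :+ b :* (y :* f)) := (y :* x :* (s :+ b)) :* f) refl

open ℚ-identities

-- C is the set of letters in the first column of a hook tableau whose corner contains 0;
-- y₀ is its tabloid.
module Hook {n : ℕ} (C : Fin (suc n) → Bool) (C₀ : C zero ≡ true) (y₀ : Tabloid (suc n))
            (stabilizer⇒ : ∀ ρ → ρ • y₀ ≡ y₀ → Supp (firstRow C) ρ)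
            (⇒stabilizer : ∀ ρ → Supp (firstRow C) ρ → ρ • y₀ ≡ y₀) where

  private
    N = suc n
    R : Fin N → Bool
    R = firstRow C

  outside : Fin N → Bool
  outside x = not (C x)

  not-true : ∀ {b} → b ≡ false → not b ≡ true
  not-true refl = refl

  not-false : ∀ {b} → b ≡ true → not b ≡ false
  not-false refl = refl

  R-outside : ∀ x → x ≢ zero → outside x ≡ R x
  R-outside zero    x≢0 = contradiction refl x≢0
  R-outside (suc x) _   = refl

  outside₀ : outside zero ≡ false
  outside₀ = not-false C₀

  Supp-outside⇒R : ∀ {ρ} → Supp outside ρ → Supp R ρ
  Supp-outside⇒R s (suc x) u = s (suc x) u

  term : Tabloid N → Permutation′ N → Permutation′ N → ℚ
  term y σ π = 𝟙 (supp? C π) * (sign π * 𝟙 (π • y₀ ≟ᵗ σ • y))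

  -- The coefficient of σ • y in the polytabloid.
  F : Tabloid N → Permutation′ N → ℚ
  F y σ = ∑ (𝔖 N) (term y σ)

  𝟙-supp-cong : ∀ (U : Fin N → Bool) {π ρ : Permutation′ N} → π ≈ₚ ρ → 𝟙 (supp? U π) ≡ 𝟙 (supp? U ρ)
  𝟙-supp-cong U {π} {ρ} e = 𝟙-cong (supp? U π) (supp? U ρ) (Supp-cong {π = π} {ρ} e) (Supp-cong {π = ρ} {π} (λ i → sym (e i)))

  term-resp : ∀ y σ → Resp (term y σ)
  term-resp y σ {π} {ρ} e = cong₂ _*_ (𝟙-supp-cong C {π} {ρ} e)
    (cong₂ _*_ (sign-cong {σ = π} {ρ} e) (cong (λ z → 𝟙 (z ≟ᵗ σ • y)) (•-cong π ρ e y₀)))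

  F-resp : ∀ y → Resp (F y)
  F-resp y {σ} {τ} e = ∑-cong (𝔖 N) λ π → cong (λ z → 𝟙 (supp? C π) * (sign π * 𝟙 (π • y₀ ≟ᵗ z))) (•-cong σ τ e y)

  F-• : ∀ y σ ρ → F (ρ • y) σ ≡ F y (σ · ρ)
  F-• y σ ρ = ∑-cong (𝔖 N) λ π → cong (λ z → 𝟙 (supp? C π) * (sign π * 𝟙 (π • y₀ ≟ᵗ z))) (•-· σ ρ y)

  F-antisymmetric : ∀ y {ρ} → Supp C ρ → ∀ σ → F y (ρ · σ) ≡ sign ρ * F y σ
  F-antisymmetric y {ρ} s σ = begin
    F y (ρ · σ) ≡⟨ ∑-left {F = term y (ρ · σ)} (term-resp y (ρ · σ)) ρ ⟨
    ∑ (𝔖 N) (λ π → term y (ρ · σ) (ρ · π)) ≡⟨ ∑-cong (𝔖 N) step ⟩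
    ∑ (𝔖 N) (λ π → sign ρ * term y σ π) ≡⟨ ∑-*ˡ (sign ρ) (𝔖 N) (term y σ) ⟨
    sign ρ * F y σ ∎
    where
    open ≡-Reasoning
    step : ∀ π → term y (ρ · σ) (ρ · π) ≡ sign ρ * term y σ π
    step π = trans (cong₂ _*_ (𝟙-cong (supp? C (ρ · π)) (supp? C π) (Supp-cancelˡ {π = ρ} {π} s) (Supp-· {π = ρ} {π} s))
        (cong₂ _*_ (sign-· ρ π) (𝟙-cong ((ρ · π) • y₀ ≟ᵗ (ρ · σ) • y) (π • y₀ ≟ᵗ σ • y)
          (λ e → •-cancel ρ (trans (•-· ρ π y₀) (trans e (sym (•-· ρ σ y)))))
          (λ e → trans (sym (•-· ρ π y₀)) (trans (cong (ρ •_) e) (•-· ρ σ y))))))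
      (pull-sign (𝟙 (supp? C π)) (sign ρ) (sign π) (𝟙 (π • y₀ ≟ᵗ σ • y)))

  -- Conjugation by ρ: its support is disjoint from C, so the column group is preserved, and it is
  -- contained in the first row, so y₀ is fixed.
  F-outside : ∀ y {ρ} → Supp outside ρ → ∀ σ → F y (ρ · σ) ≡ F y σ
  F-outside y {ρ} s σ = begin
    F y (ρ · σ) ≡⟨ ∑-conj {F = term y (ρ · σ)} (term-resp y (ρ · σ)) ρ ⟨
    ∑ (𝔖 N) (λ π → term y (ρ · σ) (ρ · π · flip ρ)) ≡⟨ ∑-cong (𝔖 N) step ⟩
    F y σ ∎
    where
    open ≡-Reasoning
    fixed : flip ρ • y₀ ≡ y₀
    fixed = ⇒stabilizer (flip ρ) (Supp-outside⇒R {flip ρ} (Supp-flip {π = ρ} s))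
    stays : ∀ {x} → C x ≡ true → ρ ⟨$⟩ʳ x ≡ x
    stays c = s _ (not-false c)
    image : ∀ {x} → C x ≡ false → C (ρ ⟨$⟩ʳ x) ≡ false
    image {x} c with C (ρ ⟨$⟩ʳ x) in e
    ... | false = refl
    ... | true  = contradiction (trans (cong C (to-injective ρ (sym (stays e)))) e) (λ q → true≢false q c)
    image⁻ : ∀ {x} → C x ≡ false → C (ρ ⟨$⟩ˡ x) ≡ false
    image⁻ {x} c with C (ρ ⟨$⟩ˡ x) in e
    ... | false = refl
    ... | true  = contradiction (trans (cong C (sym (trans (sym (stays e)) (inverseʳ ρ)))) e) (λ q → true≢false q c)
    to : ∀ {π} → Supp C (ρ · π · flip ρ) → Supp C π
    to {π} t x c = to-injective ρ (trans (cong (λ z → ρ ⟨$⟩ʳ (π ⟨$⟩ʳ z)) (sym (inverseˡ ρ))) (t (ρ ⟨$⟩ʳ x) (image c)))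
    from : ∀ {π} → Supp C π → Supp C (ρ · π · flip ρ)
    from {π} t x c = trans (cong (ρ ⟨$⟩ʳ_) (t (ρ ⟨$⟩ˡ x) (image⁻ c))) (inverseʳ ρ)
    step : ∀ π → term y (ρ · σ) (ρ · π · flip ρ) ≡ term y σ π
    step π = cong₂ _*_ (𝟙-cong (supp? C (ρ · π · flip ρ)) (supp? C π) (to {π}) (from {π}))
      (cong₂ _*_ (sign-conj ρ π) (𝟙-cong ((ρ · π · flip ρ) • y₀ ≟ᵗ (ρ · σ) • y) (π • y₀ ≟ᵗ σ • y)
        (λ e → •-cancel ρ (trans (sym (move π)) (trans e (sym (•-· ρ σ y)))))
        (λ e → trans (move π) (trans (cong (ρ •_) e) (•-· ρ σ y)))))
      where
      move : ∀ π → (ρ · π · flip ρ) • y₀ ≡ ρ • π • y₀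
      move π = trans (sym (•-· ρ (π · flip ρ) y₀)) (cong (ρ •_) (trans (sym (•-· π (flip ρ) y₀)) (cong (π •_) fixed)))

  -- Antisymmetrizing over C ∪ {r} kills y₀, which is fixed by the transposition (0 r); now split into cosets.
  garnir : ∀ y {r} → C r ≡ false → ∀ σ → sum (λ c → 𝟙 (c ∈ᵇ? C) * F y (transpose c r · σ)) ≡ F y σ
  garnir y {r} Cr σ = begin
    sum f ≡⟨ ℚ.+-identityˡ (sum f) ⟨
    0ℚ + sum f ≡⟨ cong (_+ sum f) vanishes ⟨
    sum (λ c → 𝟙 (c ∈ᵇ? V) * X c) + sum f ≡⟨ sum-+ (λ c → 𝟙 (c ∈ᵇ? V) * X c) f ⟨
    sum (λ c → 𝟙 (c ∈ᵇ? V) * X c + f c) ≡⟨ sum-cong split ⟩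
    sum (λ c → 𝟙 (r Fin.≟ c) * F y σ) ≡⟨ sum-single r (λ _ → F y σ) ⟩
    F y σ ∎
    where
    open ≡-Reasoning
    f : Fin N → ℚ
    f c = 𝟙 (c ∈ᵇ? C) * F y (transpose c r · σ)
    V : Fin N → Bool
    V x = if does (x Fin.≟ r) then true else C x
    Vr : V r ≡ true
    Vr rewrite dec-true (r Fin.≟ r) refl = refl
    V-other : ∀ x → x ≢ r → C x ≡ V x
    V-other x x≢r rewrite dec-false (x Fin.≟ r) x≢r = refl
    0≢r : zero ≢ r
    0≢r refl = true≢false C₀ Cr
    V₀ : V zero ≡ true
    V₀ = trans (sym (V-other zero 0≢r)) C₀
    event : Permutation′ N → ℚ
    event π = 𝟙 (π • y₀ ≟ᵗ σ • y)
    K : Permutation′ N → ℚ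
    K π = sign π * event π
    K-resp : Resp K
    K-resp {π} {ρ} e = cong₂ _*_ (sign-cong {σ = π} {ρ} e) (cong (λ z → 𝟙 (z ≟ᵗ σ • y)) (•-cong π ρ e y₀))
    X : Fin N → ℚ
    X c = ∑ (𝔖 N) (λ π → 𝟙 (supp? C π) * K (transpose c r · π))
    t : Permutation′ N
    t = transpose zero r
    Rr : R r ≡ true
    Rr = trans (sym (R-outside r (0≢r ∘ sym))) (not-true Cr)
    ty₀ : t • y₀ ≡ y₀
    ty₀ = ⇒stabilizer t (Supp-transpose {U = R} refl Rr)
    G : Permutation′ N → ℚ
    G π = 𝟙 (supp? V π) * K π
    G-resp : Resp G
    G-resp {π} {ρ} e = cong₂ _*_ (𝟙-supp-cong V {π} {ρ} e) (K-resp {π} {ρ} e)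
    flips : ∀ π → G (π · t) ≡ - G π
    flips π = trans (cong₂ _*_ (𝟙-cong (supp? V (π · t)) (supp? V π) (Supp-cancelʳ {π = π} {t} tV) (λ s → Supp-· {π = π} {t} s tV))
        (cong₂ _*_ (trans (sign-· π t) (cong (sign π *_) (sign-transpose 0≢r))) (cong (λ z → 𝟙 (z ≟ᵗ σ • y)) (trans (sym (•-· π t y₀)) (cong (π •_) ty₀)))))
      (negate-middle (𝟙 (supp? V π)) (sign π) (event π))
      where
      tV = Supp-transpose {U = V} V₀ Vr
    vanishes : sum (λ c → 𝟙 (c ∈ᵇ? V) * X c) ≡ 0ℚ
    vanishes = trans (sym (∑-cosets {U = C} {V} {r} Vr Cr V-other {K} (λ {π} {ρ} → K-resp {π} {ρ})))
      (x≡-x⇒x≡0 _ (trans (sym (∑-right {F = G} G-resp t)) (trans (∑-cong (𝔖 N) flips) (∑-neg (𝔖 N) G))))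
    split-r : 𝟙 (r ∈ᵇ? V) * X r + f r ≡ F y σ
    split-r = begin
      𝟙 (r ∈ᵇ? V) * X r + f r ≡⟨ cong₂ _+_ (𝟙-yes* (r ∈ᵇ? V) {X r} Vr) (𝟙-no* (r ∈ᵇ? C) {F y (transpose r r · σ)} (λ q → true≢false q Cr)) ⟩
      X r + 0ℚ ≡⟨ ℚ.+-identityʳ (X r) ⟩
      X r ≡⟨ ∑-cong (𝔖 N) (λ π → cong (𝟙 (supp? C π) *_) (K-resp {transpose r r · π} {π} (λ x → transpose-id r (π ⟨$⟩ʳ x)))) ⟩
      F y σ ∎
    split-other : ∀ c → r ≢ c → 𝟙 (c ∈ᵇ? V) * X c + f c ≡ 0ℚ
    split-other c r≢c = begin
      𝟙 (c ∈ᵇ? V) * X c + f c ≡⟨ cong₂ (λ u v → u * v + f c) (𝟙-cong (c ∈ᵇ? V) (c ∈ᵇ? C) (trans (V-other c (r≢c ∘ sym))) (trans (sym (V-other c (r≢c ∘ sym))))) X≡ ⟩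
      𝟙 (c ∈ᵇ? C) * - F y (transpose c r · σ) + f c ≡⟨ cancels (𝟙 (c ∈ᵇ? C)) (F y (transpose c r · σ)) ⟩
      0ℚ ∎
      where
      u : Permutation′ N
      u = transpose c r
      -- (c r) is an involution of sign -1; moving it from π over to σ turns the coset sum into the
      -- negative of the Garnir term for c, so only the trivial coset c = r survives.
      X≡ : X c ≡ - F y (u · σ)
      X≡ = trans (∑-cong (𝔖 N) step) (∑-neg (𝔖 N) (term y (u · σ)))
        where
        step : ∀ π → 𝟙 (supp? C π) * K (u · π) ≡ - term y (u · σ) π
        step π = trans (cong (𝟙 (supp? C π) *_) (cong₂ _*_ (trans (sign-· u π) (cong (_* sign π) (sign-transpose (r≢c ∘ sym))))
            (𝟙-cong ((u · π) • y₀ ≟ᵗ σ • y) (π • y₀ ≟ᵗ (u · σ) • y)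
              (λ e → trans (sym (back π y₀)) (trans (cong (u •_) e) (•-· u σ y)))
              (λ e → trans (sym (•-· u π y₀)) (trans (cong (u •_) (trans e (sym (•-· u σ y)))) (twice (σ • y)))))))
          (negate-first (𝟙 (supp? C π)) (sign π) (𝟙 (π • y₀ ≟ᵗ (u · σ) • y)))
          where
          twice : ∀ z → u • u • z ≡ z
          twice z = trans (•-· u u z) (trans (•-cong (u · u) idₚ (transpose-involutive c r) z) (•-id z))
          back : ∀ π z → u • (u · π) • z ≡ π • z
          back π z = trans (cong (u •_) (sym (•-· u π z))) (twice (π • z))
    split : ∀ c → 𝟙 (c ∈ᵇ? V) * X c + f c ≡ 𝟙 (r Fin.≟ c) * F y σ
    split c = cases (r Fin.≟ c)
      where
      cases : (d : Dec (r ≡ c)) → 𝟙 (c ∈ᵇ? V) * X c + f c ≡ 𝟙 d * F y σ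
      cases d@(yes refl) = trans split-r (sym (𝟙-yes* d {F y σ} refl))
      cases d@(no r≢c) = trans (split-other c r≢c) (sym (𝟙-no* d {F y σ} r≢c))

  -- X_r below is ι (a !) F for every r outside C: conjugating (0 r) by (0 c) makes it
  -- the c-th term of the Garnir relation, for each c in C.
  reproducing : ∀ {a b} → card C ≡ suc a → card outside ≡ b → suc a ℕ.+ b ≡ N → ∀ y σ →
    ∑ (𝔖 N) (λ g → F y₀ g * F y (flip g · σ)) ≡ ι (a ! ℕ.* b ! ℕ.* N) * F y σ
  reproducing {a} {b} |C| |B| a+b y σ = begin
    ∑ (𝔖 N) (λ g → F y₀ g * F y (flip g · σ))
      ≡⟨ ∑-cong (𝔖 N) (λ g → ∑-*ʳ (F y (flip g · σ)) (𝔖 N) (term y₀ g)) ⟩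
    ∑ (𝔖 N) (λ g → ∑ (𝔖 N) (λ π → term y₀ g π * F y (flip g · σ)))
      ≡⟨ ∑-swap (𝔖 N) (𝔖 N) _ ⟩
    ∑ (𝔖 N) (λ π → ∑ (𝔖 N) (λ g → term y₀ g π * F y (flip g · σ)))
      ≡⟨ ∑-cong (𝔖 N) (λ π → sym (∑-left (λ {g} {h} → inner-resp π {g} {h}) π)) ⟩
    -- With π g in place of g, the condition π y₀ = π g y₀ says that g stabilizes y₀, that is,
    -- permutes the first row.
    ∑ (𝔖 N) (λ π → ∑ (𝔖 N) (λ g → term y₀ (π · g) π * F y (flip (π · g) · σ)))
      ≡⟨ ∑-cong (𝔖 N) (λ π → trans (∑-cong (𝔖 N) (factor π)) (sym (∑-*ˡ (u π) (𝔖 N) _))) ⟩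
    ∑ (𝔖 N) (λ π → u π * ∑ (𝔖 N) (λ g → 𝟙 (supp? R g) * F y (flip g · flip π · σ)))
      ≡⟨ ∑-cong (𝔖 N) (λ π → cong (u π *_) (row-sum (flip π · σ))) ⟩
    ∑ (𝔖 N) (λ π → u π * (ι (b !) * sum (λ r → 𝟙 (r ∈ᵇ? R) * F y (transpose r zero · flip π · σ))))
      ≡⟨ ∑-cong (𝔖 N) (λ π → trans (x*yz≈y*xz (u π) (ι (b !)) _) (cong (ι (b !) *_) (trans (sum-*ˡ (u π) _) (sum-cong λ r → x*yz≈y*xz (u π) (𝟙 (r ∈ᵇ? R)) _)))) ⟩
    ∑ (𝔖 N) (λ π → ι (b !) * sum (λ r → 𝟙 (r ∈ᵇ? R) * (u π * F y (transpose r zero · flip π · σ))))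
      ≡⟨ trans (sym (∑-*ˡ (ι (b !)) (𝔖 N) _)) (cong (ι (b !) *_) (trans (∑-sum (𝔖 N) _) (sum-cong λ r → sym (∑-*ˡ (𝟙 (r ∈ᵇ? R)) (𝔖 N) _)))) ⟩
    ι (b !) * sum (λ r → 𝟙 (r ∈ᵇ? R) * X r)
      ≡⟨ cong (ι (b !) *_) (trans (sum-cong by-letter) (trans (sum-+ _ _) (cong₂ _+_ (sum-single zero (λ _ → ι (suc a !) * F y σ)) (trans (sym (sum-*ʳ (ι (a !) * F y σ) (λ r → 𝟙 (r ∈ᵇ? outside)))) (cong (_* (ι (a !) * F y σ)) (trans (sym (ι-card outside)) (cong ι |B|))))))) ⟩
    -- The corner contributes (a + 1)! and each of the b other letters of the first row contributes
    -- a!, so that the bracket is a! (a + 1 + b) F.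
    ι (b !) * (ι (suc a !) * F y σ + ι b * (ι (a !) * F y σ))
      ≡⟨ cong (λ z → ι (b !) * (z * F y σ + ι b * (ι (a !) * F y σ))) (ι-* (suc a) (a !)) ⟩
    ι (b !) * (ι (suc a) * ι (a !) * F y σ + ι b * (ι (a !) * F y σ))
      ≡⟨ collect (ι (b !)) (ι (suc a)) (ι (a !)) (ι b) (F y σ) ⟩
    ι (a !) * ι (b !) * (ι (suc a) + ι b) * F y σ
      ≡⟨ cong (_* F y σ) (trans (cong₂ _*_ (sym (ι-* (a !) (b !))) (trans (sym (ι-+ (suc a) b)) (cong ι a+b))) (sym (ι-* (a ! ℕ.* b !) N))) ⟩
    ι (a ! ℕ.* b ! ℕ.* N) * F y σ ∎
    where
    open ≡-Reasoning
    u : Permutation′ N → ℚ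
    u π = 𝟙 (supp? C π) * sign π
    inner-resp : ∀ π → Resp (λ g → term y₀ g π * F y (flip g · σ))
    inner-resp π {g} {h} e = cong₂ _*_ (cong (λ z → 𝟙 (supp? C π) * (sign π * 𝟙 (π • y₀ ≟ᵗ z))) (•-cong g h e y₀))
      (F-resp y {flip g · σ} {flip h · σ} (λ i → inverse-cong g h e (σ ⟨$⟩ʳ i)))
    factor : ∀ π g → term y₀ (π · g) π * F y (flip (π · g) · σ) ≡ u π * (𝟙 (supp? R g) * F y (flip g · flip π · σ))
    factor π g = trans (cong (λ z → 𝟙 (supp? C π) * (sign π * z) * F y (flip (π · g) · σ))
        (𝟙-cong (π • y₀ ≟ᵗ (π · g) • y₀) (supp? R g)
          (λ e → stabilizer⇒ g (sym (•-cancel π (trans e (sym (•-· π g y₀))))))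
          (λ s → trans (cong (π •_) (sym (⇒stabilizer g s))) (•-· π g y₀))))
      (regroup (𝟙 (supp? C π)) (sign π) (𝟙 (supp? R g)) (F y (flip (π · g) · σ)))
    row-sum : ∀ τ → ∑ (𝔖 N) (λ g → 𝟙 (supp? R g) * F y (flip g · τ)) ≡ ι (b !) * sum (λ r → 𝟙 (r ∈ᵇ? R) * F y (transpose r zero · τ))
    row-sum τ = begin
      ∑ (𝔖 N) (λ g → 𝟙 (supp? R g) * F y (flip g · τ))
        ≡⟨ ∑-cosets {U = outside} {R} {zero} refl outside₀ R-outside {λ g → F y (flip g · τ)} (λ {g} {h} e → F-resp y {flip g · τ} {flip h · τ} (λ i → inverse-cong g h e (τ ⟨$⟩ʳ i))) ⟩
      sum (λ r → 𝟙 (r ∈ᵇ? R) * ∑ (𝔖 N) (λ g → 𝟙 (supp? outside g) * F y (flip (transpose r zero · g) · τ)))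
        ≡⟨ sum-cong (λ r → cong (𝟙 (r ∈ᵇ? R) *_) (trans (∑-cong (𝔖 N) (absorb r)) (trans (sym (∑-*ʳ (F y (transpose r zero · τ)) (𝔖 N) _)) (cong (_* F y (transpose r zero · τ)) (∑-supp b outside |B|))))) ⟩
      sum (λ r → 𝟙 (r ∈ᵇ? R) * (ι (b !) * F y (transpose r zero · τ)))
        ≡⟨ trans (sum-cong λ r → x*yz≈y*xz (𝟙 (r ∈ᵇ? R)) (ι (b !)) _) (sym (sum-*ˡ (ι (b !)) _)) ⟩
      ι (b !) * sum (λ r → 𝟙 (r ∈ᵇ? R) * F y (transpose r zero · τ)) ∎
      where
      absorb : ∀ r g → 𝟙 (supp? outside g) * F y (flip (transpose r zero · g) · τ) ≡ 𝟙 (supp? outside g) * F y (transpose r zero · τ)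
      absorb r g = 𝟙-guard (supp? outside g) λ s → trans (F-outside y {flip g} (Supp-flip {π = g} s) (flip (transpose r zero) · τ))
        (F-resp y {flip (transpose r zero) · τ} {transpose r zero · τ} (λ i → transpose-comm zero r (τ ⟨$⟩ʳ i)))
    X : Fin N → ℚ
    X r = ∑ (𝔖 N) (λ π → u π * F y (transpose r zero · flip π · σ))
    column-sum : ∑ (𝔖 N) (λ π → u π * F y (flip π · σ)) ≡ ι (suc a !) * F y σ
    column-sum = trans (∑-cong (𝔖 N) step) (trans (sym (∑-*ʳ (F y σ) (𝔖 N) (λ π → 𝟙 (supp? C π)))) (cong (_* F y σ) (∑-supp (suc a) C |C|)))
      where
      step : ∀ π → u π * F y (flip π · σ) ≡ 𝟙 (supp? C π) * F y σ
      step π = trans (ℚ.*-assoc (𝟙 (supp? C π)) (sign π) _) (𝟙-guard (supp? C π) λ s →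
        trans (cong (sign π *_) (trans (F-antisymmetric y {flip π} (Supp-flip {π = π} s) σ) (cong (_* F y σ) (sign-flip π))))
          (trans (sym (ℚ.*-assoc (sign π) (sign π) (F y σ))) (trans (cong (_* F y σ) (sign-square π)) (ℚ.*-identityˡ (F y σ)))))
    X₀ : X zero ≡ ι (suc a !) * F y σ
    X₀ = trans (∑-cong (𝔖 N) λ π → cong (u π *_) (F-resp y {transpose zero zero · flip π · σ} {flip π · σ} (λ i → transpose-id zero _))) column-sum
    X-conj : ∀ {r c} → C r ≡ false → C c ≡ true → X r ≡ ∑ (𝔖 N) (λ π → u π * F y (transpose c r · flip π · σ))
    X-conj {r} {c} Cr Cc = begin
      X r ≡⟨ ∑-right {F = λ π → u π * F y (transpose r zero · flip π · σ)} X-resp t ⟨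
      ∑ (𝔖 N) (λ π → u (π · t) * F y (transpose r zero · flip (π · t) · σ)) ≡⟨ ∑-cong (𝔖 N) step ⟩
      ∑ (𝔖 N) (λ π → u π * F y (transpose c r · flip π · σ)) ∎
      where
      t : Permutation′ N
      t = transpose c zero
      t-supp : Supp C t
      t-supp = Supp-transpose {U = C} Cc C₀
      X-resp : Resp (λ π → u π * F y (transpose r zero · flip π · σ))
      X-resp {π} {ρ} e = cong₂ _*_ (cong₂ _*_ (𝟙-supp-cong C {π} {ρ} e) (sign-cong {σ = π} {ρ} e))
        (F-resp y {transpose r zero · flip π · σ} {transpose r zero · flip ρ · σ} (λ i → cong (transpose r zero ⟨$⟩ʳ_) (inverse-cong π ρ e (σ ⟨$⟩ʳ i))))
      r≢c : r ≢ c
      r≢c refl = true≢false Cc Cr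
      r≢0 : r ≢ zero
      r≢0 refl = true≢false C₀ Cr
      step : ∀ π → u (π · t) * F y (transpose r zero · flip (π · t) · σ) ≡ u π * F y (transpose c r · flip π · σ)
      -- The sign of t split off from `u (π · t)` is traded by antisymmetry for a factor t in front
      -- of the argument, where t (r 0) t = (c r).
      step π = trans (cong₂ (λ v w → v * w * F y (transpose r zero · flip (π · t) · σ))
          (𝟙-cong (supp? C (π · t)) (supp? C π) (Supp-cancelʳ {π = π} {t} t-supp) (λ s → Supp-· {π = π} {t} s t-supp)) (sign-· π t))
        (trans (regroup (𝟙 (supp? C π)) (sign π) (sign t) (F y (transpose r zero · flip (π · t) · σ)))
          (cong (u π *_) (trans (sym (F-antisymmetric y {t} t-supp (transpose r zero · flip (π · t) · σ)))
            (F-resp y {t · transpose r zero · flip (π · t) · σ} {transpose c r · flip π · σ} (λ i → conj (π ⟨$⟩ˡ (σ ⟨$⟩ʳ i)))))))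
        where
        conj : ∀ x → t ⟨$⟩ʳ (transpose r zero ⟨$⟩ʳ (flip t ⟨$⟩ʳ x)) ≡ transpose c r ⟨$⟩ʳ x
        conj x = trans (transpose-conj t r zero (flip t ⟨$⟩ʳ x))
          (trans (cong₂ (λ v w → transpose v w ⟨$⟩ʳ (t ⟨$⟩ʳ (flip t ⟨$⟩ʳ x))) (transpose-other r≢c r≢0) (transpose-matchʳ c zero))
            (trans (cong (transpose r c ⟨$⟩ʳ_) (inverseʳ t {x})) (transpose-comm r c x)))
    Xᵣ : ∀ r → C r ≡ false → X r ≡ ι (a !) * F y σ
    Xᵣ r Cr = *-cancelˡ (ι-suc≢0 a) (begin
      ι (suc a) * X r ≡⟨ cong (λ z → ι z * X r) |C| ⟨
      ι (card C) * X r ≡⟨ trans (cong (_* X r) (ι-card C)) (sum-*ʳ (X r) (λ c → 𝟙 (c ∈ᵇ? C))) ⟩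
      sum (λ c → 𝟙 (c ∈ᵇ? C) * X r) ≡⟨ sum-cong (λ c → trans (𝟙-guard (c ∈ᵇ? C) (X-conj Cr)) (∑-*ˡ (𝟙 (c ∈ᵇ? C)) (𝔖 N) _)) ⟩
      sum (λ c → ∑ (𝔖 N) (λ π → 𝟙 (c ∈ᵇ? C) * (u π * F y (transpose c r · flip π · σ)))) ≡⟨ trans (sym (∑-sum (𝔖 N) _)) (∑-cong (𝔖 N) λ π → trans (sum-cong λ c → x*yz≈y*xz (𝟙 (c ∈ᵇ? C)) (u π) (F y (transpose c r · flip π · σ))) (sym (sum-*ˡ (u π) _))) ⟩
      ∑ (𝔖 N) (λ π → u π * sum (λ c → 𝟙 (c ∈ᵇ? C) * F y (transpose c r · flip π · σ))) ≡⟨ ∑-cong (𝔖 N) (λ π → cong (u π *_) (garnir y Cr (flip π · σ))) ⟩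
      ∑ (𝔖 N) (λ π → u π * F y (flip π · σ)) ≡⟨ column-sum ⟩
      ι (suc a !) * F y σ ≡⟨ trans (cong (_* F y σ) (ι-* (suc a) (a !))) (ℚ.*-assoc (ι (suc a)) (ι (a !)) (F y σ)) ⟩
      ι (suc a) * (ι (a !) * F y σ) ∎)
    by-letter : ∀ r → 𝟙 (r ∈ᵇ? R) * X r ≡ 𝟙 (zero Fin.≟ r) * (ι (suc a !) * F y σ) + 𝟙 (r ∈ᵇ? outside) * (ι (a !) * F y σ)
    by-letter zero = trans (trans (𝟙-yes* (zero ∈ᵇ? R) {X zero} refl) X₀) (sym (trans (cong₂ _+_ (𝟙-yes* (zero {n} Fin.≟ zero) {ι (suc a !) * F y σ} refl) (𝟙-no* (zero ∈ᵇ? outside) {ι (a !) * F y σ} (λ q → true≢false q outside₀))) (ℚ.+-identityʳ (ι (suc a !) * F y σ))))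
    by-letter (suc r) = trans (𝟙-guard (suc r ∈ᵇ? R) {X (suc r)} {ι (a !) * F y σ} (λ q → Xᵣ (suc r) (C-false q)))
      (sym (trans (cong (_+ 𝟙 (suc r ∈ᵇ? outside) * (ι (a !) * F y σ)) (𝟙-no* (zero Fin.≟ suc r) {ι (suc a !) * F y σ} (λ ()))) (ℚ.+-identityˡ (𝟙 (suc r ∈ᵇ? outside) * (ι (a !) * F y σ)))))
      where
      C-false : not (C (suc r)) ≡ true → C (suc r) ≡ false
      C-false q with C (suc r)
      C-false () | true
      C-false q  | false = refl

card-complement : ∀ {n} (U : Fin n → Bool) → card U ℕ.+ card (not ∘ U) ≡ n
card-complement {n} U = begin
  card U ℕ.+ card (not ∘ U) ≡⟨ ℕ∑.sum-+ _ _ ⟨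
  ℕ∑.sum (λ x → ℕ∑.𝟙 (x ∈ᵇ? U) ℕ.+ ℕ∑.𝟙 (x ∈ᵇ? (not ∘ U))) ≡⟨ ℕ∑.sum-cong (λ x → one (U x)) ⟩
  ℕ∑.sum {n} (λ _ → 1) ≡⟨ ℕ∑.sum-cong (λ x → ℕ∑.𝟙-yes (0 ℕ.≤? toℕ x ×-dec toℕ x ℕ.<? n) (ℕ.z≤n , Fin.toℕ<n x)) ⟨
  ℕ∑.sum {n} (λ x → ℕ∑.𝟙 (0 ℕ.≤? toℕ x ×-dec toℕ x ℕ.<? n)) ≡⟨ count-interval n 0 n ℕ.≤-refl ⟩
  n ∎
  where
  open ≡-Reasoning
  one : ∀ b → ℕ∑.𝟙 (b Bool.≟ true) ℕ.+ ℕ∑.𝟙 (not b Bool.≟ true) ≡ 1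
  one true  = cong₂ ℕ._+_ (ℕ∑.𝟙-yes (true Bool.≟ true) refl) (ℕ∑.𝟙-no (false Bool.≟ true) λ ())
  one false = cong₂ ℕ._+_ (ℕ∑.𝟙-no (false Bool.≟ true) λ ()) (ℕ∑.𝟙-yes (true Bool.≟ true) refl)

opaque
  unfolding 𝟙 ∑

  coeff-map : ∀ {X : Set} {n} (xs : List X) (q : X → ℚ) (h : X → Tabloid n) z →
              coeff (map (λ x → q x , h x) xs) z ≡ ∑ xs (λ x → q x * 𝟙 (h x ≟ᵗ z))
  coeff-map []       q h z = refl
  coeff-map (x ∷ xs) q h z = cong₂ _+_ (weigh (does (h x ≟ᵗ z))) (coeff-map xs q h z)
    where
    weigh : ∀ b → (if b then q x else 0ℚ) ≡ q x * (if b then 1ℚ else 0ℚ)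
    weigh true  = sym (ℚ.*-identityʳ (q x))
    weigh false = sym (ℚ.*-zeroʳ (q x))

does⇒ : ∀ {A : Set} (d : Dec A) → does d ≡ true → A
does⇒ (yes a) _ = a

-- The cells of a hook

module _ {n : ℕ} (a : Fin (suc n)) where
  private
    N = suc n
    θ = hook N a
    rest = N ∸ toℕ a

  row col : Fin N → ℕ
  row x = proj₁ (cell (parts θ) (toℕ x))
  col x = proj₂ (cell (parts θ) (toℕ x))

  cell-ones : ∀ k i → i ℕ.< k → cell (List.replicate k 1) i ≡ (i , 0)
  cell-ones (suc k) zero    _         = refl
  cell-ones (suc k) (suc i) (ℕ.s≤s p) = cong (map₁ suc) (cell-ones k i p)

  -- The corner counts as part of the arm, with both coordinates 0.
  data Cell (x : Fin N) : Set where
    arm : toℕ x ℕ.< rest → row x ≡ 0 → col x ≡ toℕ x → Cell x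
    leg : rest ℕ.≤ toℕ x → row x ≡ suc (toℕ x ∸ rest) → col x ≡ 0 → Cell x

  cellOf : ∀ x → Cell x
  cellOf x with toℕ x ℕ.<? rest
  ... | yes p = arm p (cong proj₁ c) (cong proj₂ c)
    where
    c : cell (parts θ) (toℕ x) ≡ (0 , toℕ x)
    c rewrite dec-true (toℕ x ℕ.<? rest) p = refl
  ... | no ¬p = leg (ℕ.≮⇒≥ ¬p) (cong proj₁ c) (cong proj₂ c)
    where
    below : toℕ x ∸ rest ℕ.< toℕ a
    below = ℕ.+-cancelˡ-< rest _ _ (subst₂ ℕ._<_ (sym (ℕ.m+[n∸m]≡n (ℕ.≮⇒≥ ¬p))) (sym (ℕ.m∸n+n≡m (Fin.toℕ≤n a))) (Fin.toℕ<n x))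
    c : cell (parts θ) (toℕ x) ≡ (suc (toℕ x ∸ rest) , 0)
    c rewrite dec-false (toℕ x ℕ.<? rest) ¬p = cong (map₁ suc) (cell-ones (toℕ a) (toℕ x ∸ rest) below)

  column : Fin N → Bool
  column x = does (col x ℕ.≟ 0)

  0<rest : 0 ℕ.< rest
  0<rest = ℕ.m<n⇒0<n∸m (Fin.toℕ<n a)

  column⇒ : ∀ {x} → column x ≡ true → col x ≡ 0
  column⇒ {x} = does⇒ (col x ℕ.≟ 0)

  ⇒column : ∀ {x} → col x ≡ 0 → column x ≡ true
  ⇒column {x} = dec-true (col x ℕ.≟ 0)

  ¬column⇒ : ∀ {x} → column x ≡ false → col x ≢ 0
  ¬column⇒ e p = true≢false (⇒column p) e

  column-zero : column zero ≡ true
  column-zero with cellOf zero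
  ... | arm _ _ c = ⇒column {zero} c
  ... | leg _ _ c = ⇒column {zero} c

  column-leg : ∀ {x} → rest ℕ.≤ toℕ x → column x ≡ true
  column-leg {x} p with cellOf x
  ... | arm q _ _ = contradiction p (ℕ.<⇒≱ q)
  ... | leg _ _ c = ⇒column c

  column-arm : ∀ {x} → toℕ x ℕ.< rest → toℕ x ≢ 0 → column x ≡ false
  column-arm {x} p x≢0 with cellOf x
  ... | arm _ _ c = dec-false (col x ℕ.≟ 0) (λ e → x≢0 (trans (sym c) e))
  ... | leg q _ _ = contradiction q (ℕ.<⇒≱ p)

  -- Every column except the first consists of one cell, so the letter in it cannot move.
  stable⇒supp : ∀ {π} → ColumnStable θ π → Supp column π
  stable⇒supp {π} s x u with cellOf x | cellOf (π ⟨$⟩ʳ x)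
  ... | leg _ _ c | _         = contradiction c (¬column⇒ u)
  ... | arm _ _ c | arm _ _ d = Fin.toℕ-injective (trans (sym d) (trans (s x) c))
  ... | arm _ _ c | leg _ _ d = contradiction (trans (sym (s x)) d) (¬column⇒ u)

  supp⇒stable : ∀ {π} → Supp column π → ColumnStable θ π
  supp⇒stable {π} s x = cases (x ∈ᵇ? column)
    where
    cases : Dec (column x ≡ true) → col (π ⟨$⟩ʳ x) ≡ col x
    cases (yes u) = trans (column⇒ (Supp-image {π = π} s u)) (sym (column⇒ u))
    cases (no ¬u) = cong col (s x (Bool.¬-not ¬u))

  lookup₀ : ∀ x → lookup (tabloid₀ θ) x ≡ row x
  lookup₀ = Vec.lookup∘tabulate row

  lookup-• : ∀ ρ x → lookup (ρ • tabloid₀ θ) x ≡ row (ρ ⟨$⟩ˡ x)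
  lookup-• ρ x = trans (Vec.lookup∘tabulate (λ z → lookup (tabloid₀ θ) (ρ ⟨$⟩ˡ z)) x) (lookup₀ (ρ ⟨$⟩ˡ x))

  -- Every row except the first consists of one cell, so a letter of the leg is determined by its
  -- row.
  stabilizer⇒ : ∀ ρ → ρ • tabloid₀ θ ≡ tabloid₀ θ → Supp (firstRow column) ρ
  stabilizer⇒ ρ e zero ()
  stabilizer⇒ ρ e (suc i) u with cellOf (suc i) | cellOf (ρ ⟨$⟩ˡ suc i)
  ... | arm _ _ c | _ = contradiction (trans (sym c) (column⇒ (not-false⁻ u))) λ ()
    where
    not-false⁻ : ∀ {b} → not b ≡ false → b ≡ true
    not-false⁻ {true} _ = refl
  ... | leg q r _ | arm _ r′ _ = contradiction (trans (sym r′) (trans (rows ρ e (suc i)) r)) λ ()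
    where
    rows : ∀ ρ → ρ • tabloid₀ θ ≡ tabloid₀ θ → ∀ x → row (ρ ⟨$⟩ˡ x) ≡ row x
    rows ρ e x = trans (sym (lookup-• ρ x)) (trans (cong (λ y → lookup y x) e) (lookup₀ x))
  ... | leg q r _ | leg q′ r′ _ = sym (from⇒to ρ (Fin.toℕ-injective (ℕ.∸-cancelʳ-≡ q′ q (ℕ.suc-injective (trans (sym r′) (trans (rows ρ e (suc i)) r))))))
    where
    rows : ∀ ρ → ρ • tabloid₀ θ ≡ tabloid₀ θ → ∀ x → row (ρ ⟨$⟩ˡ x) ≡ row x
    rows ρ e x = trans (sym (lookup-• ρ x)) (trans (cong (λ y → lookup y x) e) (lookup₀ x))

  firstRow⇒ : ∀ x → firstRow column x ≡ true → row x ≡ 0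
  firstRow⇒ zero _ with cellOf zero
  ... | arm _ r _ = r
  ... | leg q _ _ = contradiction 0<rest (ℕ.≤⇒≯ q)
  firstRow⇒ (suc i) u with cellOf (suc i)
  ... | arm _ r _ = r
  ... | leg _ _ c = contradiction (trans (sym (cong not (⇒column c))) u) λ ()

  ⇒stabilizer : ∀ ρ → Supp (firstRow column) ρ → ρ • tabloid₀ θ ≡ tabloid₀ θ
  ⇒stabilizer ρ s = Vec.tabulate-cong λ x → trans (lookup₀ (ρ ⟨$⟩ˡ x)) (rows x (x ∈ᵇ? firstRow column))
    where
    rows : ∀ x → Dec (firstRow column x ≡ true) → row (ρ ⟨$⟩ˡ x) ≡ row x
    rows x (yes u) = trans (firstRow⇒ (ρ ⟨$⟩ˡ x) (Supp-image {π = flip ρ} (Supp-flip {π = ρ} s) u)) (sym (firstRow⇒ x u))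
    rows x (no ¬u) = cong row (sym (to⇒from ρ (s x (Bool.¬-not ¬u))))

  open Hook column column-zero (tabloid₀ θ) stabilizer⇒ ⇒stabilizer public

  a≤n : toℕ a ℕ.≤ n
  a≤n = ℕ.≤-pred (Fin.toℕ<n a)

  rest≡ : rest ≡ suc (n ∸ toℕ a)
  rest≡ = ℕ.+-∸-assoc 1 a≤n

  card-outside : card outside ≡ n ∸ toℕ a
  card-outside = begin
    card outside ≡⟨ ℕ∑.sum-cong (λ x → ℕ∑.𝟙-cong (x ∈ᵇ? outside) (1 ℕ.≤? toℕ x ×-dec toℕ x ℕ.<? rest) (to x (cellOf x)) (from x)) ⟩
    ℕ∑.sum {N} (λ x → ℕ∑.𝟙 (1 ℕ.≤? toℕ x ×-dec toℕ x ℕ.<? rest)) ≡⟨ count-interval N 1 rest (ℕ.m∸n≤m N (toℕ a)) ⟩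
    rest ∸ 1 ≡⟨ cong (_∸ 1) rest≡ ⟩
    n ∸ toℕ a ∎
    where
    open ≡-Reasoning
    to : ∀ x → Cell x → outside x ≡ true → 1 ℕ.≤ toℕ x × toℕ x ℕ.< rest
    to x (arm p _ c) u = ℕ.n≢0⇒n>0 (λ e → contradiction (trans (sym u) (cong not (⇒column {x} (trans c e)))) λ ()) , p
    to x (leg _ _ c) u = contradiction (trans (sym u) (cong not (⇒column {x} c))) λ ()
    from : ∀ x → 1 ℕ.≤ toℕ x × toℕ x ℕ.< rest → outside x ≡ true
    from x (p , q) = cong not (column-arm q (λ e → ℕ.<⇒≢ p (sym e)))

  card-column : card column ≡ suc (toℕ a)
  card-column = ℕ.+-cancelʳ-≡ (n ∸ toℕ a) _ _ (trans (cong (card column ℕ.+_) (sym card-outside)) (trans (card-complement column) (sym (cong suc (ℕ.m+[n∸m]≡n a≤n)))))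

  -- The product of the hook lengths: a! along the leg, (n - a)! along the arm and N = n + 1 at the
  -- corner.
  order : ℕ
  order = toℕ a ! ℕ.* (n ∸ toℕ a) ! ℕ.* N

  reproducing′ : ∀ y σ → ∑ (𝔖 N) (λ g → F (tabloid₀ θ) g * F y (flip g · σ)) ≡ ι order * F y σ
  reproducing′ = reproducing card-column card-outside (cong suc (ℕ.m+[n∸m]≡n a≤n))

  coeff-polytabloid₀ : ∀ y σ → coeff (polytabloid₀ θ) (σ • y) ≡ F y σ
  coeff-polytabloid₀ y σ = begin
    coeff (polytabloid₀ θ) (σ • y)
      ≡⟨ coeff-map (filter (columnStable? θ) (perms N)) sgn (_• tabloid₀ θ) (σ • y) ⟩
    ∑ (filter (columnStable? θ) (perms N)) (λ π → sgn π * 𝟙 (π • tabloid₀ θ ≟ᵗ σ • y))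
      ≡⟨ ∑-filter (columnStable? θ) (perms N) _ ⟩
    ∑ (perms N) (λ π → 𝟙 (columnStable? θ π) * (sgn π * 𝟙 (π • tabloid₀ θ ≟ᵗ σ • y)))
      ≡⟨ ∑-cong (perms N) (λ π → cong₂ (λ u v → u * (v * 𝟙 (π • tabloid₀ θ ≟ᵗ σ • y))) (𝟙-cong (columnStable? θ π) (supp? column π) (stable⇒supp {π}) (supp⇒stable {π})) (sym (sign≡sgn π))) ⟩
    ∑ (perms N) (term y σ)
      ≡⟨ cong (λ xs → ∑ xs (term y σ)) (𝔖≡perms N) ⟨
    F y σ ∎
    where open ≡-Reasoning

-- Characters of hooks

coeff-•ᴹ : ∀ {n} (g : Permutation′ n) v y → coeff (g •ᴹ v) y ≡ coeff v (flip g • y)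
coeff-•ᴹ g v y = trans (cong (coeff (g •ᴹ v)) (sym (•-inverse (flip g) y))) (•ᴹ-coeff g v (flip g • y))

coeff-comb : ∀ {n k} (f : Fin k → Free (Tabloid n)) c y → coeff (comb f c) y ≡ sum (λ i → c i * coeff (f i) y)
coeff-comb {k = zero}  f c y = sym (sum-[] _)
coeff-comb {k = suc k} f c y = trans (coeff-++ (scale (c zero) (f zero)) _ y)
  (trans (cong₂ _+_ (coeff-scale (c zero) (f zero) y) (coeff-comb (f ∘ suc) (c ∘ suc) y)) (sym (sum-suc _)))

coords-unique : ∀ {n} {S : Free (Tabloid n) → Set} (B : Basis S) c d → comb (Basis.vec B) c ≋ comb (Basis.vec B) d → ∀ i → c i ≡ d i
coords-unique B c d e i = begin
  c i ≡⟨ ℚ.+-identityʳ (c i) ⟨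
  c i + 0ℚ ≡⟨ cong (c i +_) (difference₁ (d i)) ⟨
  c i + (- 1ℚ * d i + d i) ≡⟨ ℚ.+-assoc (c i) _ (d i) ⟨
  c i + - 1ℚ * d i + d i ≡⟨ cong (_+ d i) (independent (λ i → c i + - 1ℚ * d i) vanishes i) ⟩
  0ℚ + d i ≡⟨ ℚ.+-identityˡ (d i) ⟩
  d i ∎
  where
  open ≡-Reasoning
  open Basis B
  difference₁ : ∀ x → - 1ℚ * x + x ≡ 0ℚ
  difference₁ = solve 1 (λ x → (:- con 1ℚ) :* x :+ x := con 0ℚ) refl
    where open ℚ-Solver
  difference₂ : ∀ x → x + - 1ℚ * x ≡ 0ℚ
  difference₂ x = trans (ℚ.+-comm x (- 1ℚ * x)) (difference₁ x)
  vanishes : comb vec (λ i → c i + - 1ℚ * d i) ≋ []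
  vanishes y = trans (comb-+ vec c (λ i → - 1ℚ * d i) y)
    (trans (cong₂ _+_ (e y) (comb-* vec (- 1ℚ) d y)) (difference₂ (coeff (comb vec d) y)))

opaque
  unfolding sum

  χ-sum : ∀ {n} (θ : Partition n) φ → let open Basis (Specht-basis θ) in
          χ θ φ ≡ sum (λ i → coords (φ •ᴹ vec i) (Specht-invariant θ φ (vec i) (vec∈ i)) i)
  χ-sum θ φ = refl

module Trace {n : ℕ} (a : Fin (suc n)) where
  private
    N = suc n
    y₀ = tabloid₀ (hook (suc n) a)
    Φ = F a

  coeff-polytabloid : ∀ τ y → coeff (polytabloid (hook (suc n) a) τ) y ≡ Φ y (flip τ)
  coeff-polytabloid τ y = trans (coeff-•ᴹ τ (polytabloid₀ (hook (suc n) a)) y) (coeff-polytabloid₀ a y (flip τ))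

  -- The condition is linear in v, so it passes from the polytabloids to their span; for these it is
  -- a translate of `reproducing′`.
  Reproduced : Free (Tabloid N) → Set
  Reproduced v = ∀ y → ∑ (𝔖 N) (λ g → coeff v (g • y₀) * Φ y (flip g)) ≡ ι (order a) * coeff v y

  Reproduced-subspace : IsSubspace Reproduced
  Reproduced-subspace = record
    { S-[]    = λ y → trans (∑-zero (𝔖 N) λ g → ℚ.*-zeroˡ (Φ y (flip g))) (sym (ℚ.*-zeroʳ (ι (order a))))
    ; S-++    = λ v w p q y → trans (∑-cong (𝔖 N) λ g → trans (cong (_* Φ y (flip g)) (coeff-++ v w (g • y₀))) (ℚ.*-distribʳ-+ (Φ y (flip g)) (coeff v (g • y₀)) (coeff w (g • y₀))))
        (trans (∑-+ (𝔖 N) _ _) (trans (cong₂ _+_ (p y) (q y)) (trans (sym (ℚ.*-distribˡ-+ (ι (order a)) (coeff v y) (coeff w y))) (cong (ι (order a) *_) (sym (coeff-++ v w y))))))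
    ; S-scale = λ r v p y → trans (∑-cong (𝔖 N) λ g → trans (cong (_* Φ y (flip g)) (coeff-scale r v (g • y₀))) (ℚ.*-assoc r (coeff v (g • y₀)) (Φ y (flip g))))
        (trans (sym (∑-*ˡ r (𝔖 N) (λ g → coeff v (g • y₀) * Φ y (flip g)))) (trans (cong (r *_) (p y)) (trans (x*yz≈y*xz r (ι (order a)) (coeff v y)) (cong (ι (order a) *_) (sym (coeff-scale r v y))))))
    ; S-resp  = λ v w e p y → trans (∑-cong (𝔖 N) λ g → cong (_* Φ y (flip g)) (sym (e (g • y₀)))) (trans (p y) (cong (ι (order a) *_) (e y)))
    }

  reproduced-polytabloid : ∀ τ → Reproduced (polytabloid (hook (suc n) a) τ)
  reproduced-polytabloid τ y = begin
    ∑ (𝔖 N) (λ g → coeff (polytabloid (hook (suc n) a) τ) (g • y₀) * Φ y (flip g)) ≡⟨ ∑-cong (𝔖 N) (λ g → cong (_* Φ y (flip g)) (trans (coeff-polytabloid τ (g • y₀)) (F-• a y₀ (flip τ) g))) ⟩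
    ∑ (𝔖 N) G ≡⟨ ∑-left {F = G} (λ {σ} {ρ} → G-resp {σ} {ρ}) τ ⟨
    ∑ (𝔖 N) (λ g → G (τ · g)) ≡⟨ ∑-cong (𝔖 N) (λ g → cong (_* Φ y (flip (τ · g))) (F-resp a y₀ {flip τ · τ · g} {g} (λ z → inverseˡ τ {g ⟨$⟩ʳ z}))) ⟩
    ∑ (𝔖 N) (λ g → Φ y₀ g * Φ y (flip g · flip τ)) ≡⟨ reproducing′ a y (flip τ) ⟩
    ι (order a) * Φ y (flip τ) ≡⟨ cong (ι (order a) *_) (coeff-polytabloid τ y) ⟨
    ι (order a) * coeff (polytabloid (hook (suc n) a) τ) y ∎
    where
    open ≡-Reasoning
    G : Permutation′ N → ℚ
    G g = Φ y₀ (flip τ · g) * Φ y (flip g)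
    G-resp : Resp G
    G-resp {σ} {ρ} e = cong₂ _*_ (F-resp a y₀ {flip τ · σ} {flip τ · ρ} (λ i → cong (τ ⟨$⟩ˡ_) (e i))) (F-resp a y {flip σ} {flip ρ} (inverse-cong σ ρ e))

  reproduced : ∀ v → Specht (hook (suc n) a) v → Reproduced v
  reproduced v (c , p) = S-resp (lin (polytabloid (hook (suc n) a)) c) v (λ y → sym (p y)) (S-lin (polytabloid (hook (suc n) a)) c reproduced-polytabloid)
    where open IsSubspace Reproduced-subspace

  open Basis (Specht-basis (hook (suc n) a))

  private
    κ : Permutation′ N → Fin dim → ℚ
    κ g = coords (polytabloid (hook (suc n) a) g) (Span-gen (polytabloid (hook (suc n) a)) g)

    κ-coeff : ∀ g y → sum (λ i → κ g i * coeff (vec i) y) ≡ coeff (polytabloid (hook (suc n) a) g) y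
    κ-coeff g y = trans (sym (coeff-comb vec (κ g) y)) (sym (coords-comb (polytabloid (hook (suc n) a) g) (Span-gen (polytabloid (hook (suc n) a)) g) y))

  -- `Φ y (flip g)` is the coefficient at y of the polytabloid of g, so `reproduced` exhibits a
  -- multiple of v as a combination of polytabloids. Expanding these in the basis by κ and using the
  -- uniqueness of coordinates gives formulas for `coords` that are linear in v.
  coords-reproduced : ∀ v s i → ι (order a) * coords v s i ≡ ∑ (𝔖 N) (λ g → coeff v (g • y₀) * κ g i)
  coords-reproduced v s = coords-unique (Specht-basis (hook (suc n) a)) (λ i → ι (order a) * coords v s i) c λ y → sym (begin
    coeff (comb vec c) y ≡⟨ coeff-comb vec c y ⟩
    sum (λ i → ∑ (𝔖 N) (λ g → coeff v (g • y₀) * κ g i) * coeff (vec i) y) ≡⟨ sum-cong (λ i → ∑-*ʳ (coeff (vec i) y) (𝔖 N) (λ g → coeff v (g • y₀) * κ g i)) ⟩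
    sum (λ i → ∑ (𝔖 N) (λ g → coeff v (g • y₀) * κ g i * coeff (vec i) y)) ≡⟨ ∑-sum (𝔖 N) (λ g i → coeff v (g • y₀) * κ g i * coeff (vec i) y) ⟨
    ∑ (𝔖 N) (λ g → sum (λ i → coeff v (g • y₀) * κ g i * coeff (vec i) y)) ≡⟨ ∑-cong (𝔖 N) (λ g → trans (sum-cong λ i → ℚ.*-assoc (coeff v (g • y₀)) (κ g i) (coeff (vec i) y)) (sym (sum-*ˡ (coeff v (g • y₀)) (λ i → κ g i * coeff (vec i) y)))) ⟩
    ∑ (𝔖 N) (λ g → coeff v (g • y₀) * sum (λ i → κ g i * coeff (vec i) y)) ≡⟨ ∑-cong (𝔖 N) (λ g → cong (coeff v (g • y₀) *_) (trans (κ-coeff g y) (coeff-polytabloid g y))) ⟩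
    ∑ (𝔖 N) (λ g → coeff v (g • y₀) * Φ y (flip g)) ≡⟨ reproduced v s y ⟩
    ι (order a) * coeff v y ≡⟨ cong (ι (order a) *_) (coords-comb v s y) ⟩
    ι (order a) * coeff (comb vec (coords v s)) y ≡⟨ comb-* vec (ι (order a)) (coords v s) y ⟨
    coeff (comb vec (λ i → ι (order a) * coords v s i)) y ∎)
    where
    open ≡-Reasoning
    c : Fin dim → ℚ
    c i = ∑ (𝔖 N) (λ g → coeff v (g • y₀) * κ g i)

  opaque
    hookχ : Permutation′ N → ℚ
    hookχ = χ (hook (suc n) a)

    hookχ≡χ : ∀ φ → hookχ φ ≡ χ (hook (suc n) a) φ
    hookχ≡χ φ = refl

  classSum : Permutation′ N → ℚ
  classSum φ = ∑ (𝔖 N) (λ g → Φ y₀ (flip g · flip φ · g))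

  -- For fixed g the diagonal entries sum up to Σ_i κ g i times the coefficient of `vec i` at φ⁻¹ g
  -- y₀. By `κ-coeff` this recombines to a coefficient of the polytabloid of g, and the basis has
  -- disappeared.
  trace-formula : ∀ φ → ι (order a) * hookχ φ ≡ classSum φ
  trace-formula φ = begin
    ι (order a) * hookχ φ ≡⟨ cong (ι (order a) *_) (trans (hookχ≡χ φ) (χ-sum (hook (suc n) a) φ)) ⟩
    ι (order a) * sum (λ i → coords (φ •ᴹ vec i) (∈V i) i) ≡⟨ sum-*ˡ (ι (order a)) (λ i → coords (φ •ᴹ vec i) (∈V i) i) ⟩
    sum (λ i → ι (order a) * coords (φ •ᴹ vec i) (∈V i) i) ≡⟨ sum-cong (λ i → coords-reproduced (φ •ᴹ vec i) (∈V i) i) ⟩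
    sum (λ i → ∑ (𝔖 N) (λ g → coeff (φ •ᴹ vec i) (g • y₀) * κ g i)) ≡⟨ ∑-sum (𝔖 N) (λ g i → coeff (φ •ᴹ vec i) (g • y₀) * κ g i) ⟨
    ∑ (𝔖 N) (λ g → sum (λ i → coeff (φ •ᴹ vec i) (g • y₀) * κ g i)) ≡⟨ ∑-cong (𝔖 N) (λ g → trans (sum-cong λ i → trans (ℚ.*-comm (coeff (φ •ᴹ vec i) (g • y₀)) (κ g i)) (cong (κ g i *_) (coeff-•ᴹ φ (vec i) (g • y₀)))) (κ-coeff g (flip φ • g • y₀))) ⟩
    ∑ (𝔖 N) (λ g → coeff (polytabloid (hook (suc n) a) g) (flip φ • g • y₀)) ≡⟨ ∑-cong (𝔖 N) (λ g → trans (coeff-polytabloid g (flip φ • g • y₀)) (trans (cong (λ z → Φ z (flip g)) (•-· (flip φ) g y₀)) (F-• a y₀ (flip g) (flip φ · g)))) ⟩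
    classSum φ ∎
    where
    open ≡-Reasoning
    ∈V : ∀ i → Specht (hook (suc n) a) (φ •ᴹ vec i)
    ∈V i = Specht-invariant (hook (suc n) a) φ (vec i) (vec∈ i)

-- For b = n - a, the contents of the hook filled backwards: n in the corner, n - 1, ..., b down the
-- leg, and b - 1, ..., 0 along the arm. This is the filling suited to sums of (i j) over j > i, in
-- which larger letters come earlier.
κℕ : (b n i : ℕ) → ℚ
κℕ b n i = if does (b ℕ.≤? i) then - ι (n ∸ i) else ι (b ∸ i)

module Contents {n : ℕ} (a : Fin (suc n)) where
  private
    N = suc n
    b = n ∸ toℕ a
    Φ = F a

  b<N : b ℕ.< N
  b<N = ℕ.s≤s (ℕ.m∸n≤m n (toℕ a))

  corner : Fin N
  corner = Fin.fromℕ< b<N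

  -- Moves the corner past the rest of the first row, so that the letters b , … , n form the column.
  h : Permutation′ N
  h = transpose zero corner

  h-column⇒ : ∀ i → column a (h ⟨$⟩ʳ i) ≡ true → b ℕ.≤ toℕ i
  h-column⇒ i e with h ⟨$⟩ʳ i | transposeView zero corner i
  -- `h` sends 0 to b, the last letter of the first row, which lies in the column only if it is the
  -- corner itself.
  ... | _ | atˡ refl = ℕ.≤-reflexive (b≡0 (b ℕ.≟ 0))
    where
    b≡0 : Dec (b ≡ 0) → b ≡ 0
    b≡0 (yes p) = p
    b≡0 (no ¬p) = contradiction (column-arm a {corner} (subst₂ ℕ._<_ (sym (Fin.toℕ-fromℕ< b<N)) (sym (rest≡ a)) ℕ.≤-refl) (λ q → ¬p (trans (sym (Fin.toℕ-fromℕ< b<N)) q))) (true≢false e)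
  ... | _ | atʳ _ refl = ℕ.≤-reflexive (sym (Fin.toℕ-fromℕ< b<N))
  ... | _ | other i≢0 _ = ℕ.≮⇒≥ λ i<b → true≢false e (column-arm a {i} (subst (toℕ i ℕ.<_) (sym (rest≡ a)) (ℕ.m<n⇒m<1+n i<b)) (λ q → i≢0 (Fin.toℕ-injective q)))

  ⇒h-column : ∀ i → b ℕ.≤ toℕ i → column a (h ⟨$⟩ʳ i) ≡ true
  ⇒h-column i p with h ⟨$⟩ʳ i | transposeView zero corner i
  ... | _ | atˡ refl = subst (λ z → column a z ≡ true) (Fin.toℕ-injective (trans (sym (ℕ.n≤0⇒n≡0 p)) (sym (Fin.toℕ-fromℕ< b<N)))) (column-zero a)
  ... | _ | atʳ _ _ = column-zero a
  ... | _ | other _ i≢c = column-leg a (subst (ℕ._≤ toℕ i) (sym (rest≡ a)) (ℕ.≤∧≢⇒< p (λ q → i≢c (Fin.toℕ-injective (trans (sym q) (sym (Fin.toℕ-fromℕ< b<N)))))))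

  count-above : ∀ (i : Fin N) hi → hi ℕ.≤ N → sum {N} (λ j → 𝟙 (suc (toℕ i) ℕ.≤? toℕ j ×-dec toℕ j ℕ.<? hi)) ≡ ι (hi ∸ suc (toℕ i))
  count-above i hi p = trans (sum-cong λ j → sym (ι-𝟙 (suc (toℕ i) ℕ.≤? toℕ j ×-dec toℕ j ℕ.<? hi))) (trans (sym (ι-sum _)) (cong ι (count-interval N (suc (toℕ i)) hi p)))

  conjugated : ∀ y i j σ → Φ y (h · transpose i j · σ) ≡ Φ y (transpose (h ⟨$⟩ʳ i) (h ⟨$⟩ʳ j) · h · σ)
  conjugated y i j σ = F-resp a y {h · transpose i j · σ} {transpose (h ⟨$⟩ʳ i) (h ⟨$⟩ʳ j) · h · σ} (λ x → transpose-conj h i j (σ ⟨$⟩ʳ x))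

  -- After conjugation by h, each of the n - i transpositions exchanges two letters of the column
  -- and therefore acts by -1.
  eigen-leg : ∀ y i → b ℕ.≤ toℕ i → ∀ σ → sum (λ j → 𝟙 (i Fin.<? j) * Φ y (h · transpose i j · σ)) ≡ - ι (n ∸ toℕ i) * Φ y (h · σ)
  eigen-leg y i b≤i σ = begin
    sum (λ j → 𝟙 (i Fin.<? j) * Φ y (h · transpose i j · σ)) ≡⟨ sum-cong (λ j → 𝟙-guard (i Fin.<? j) (swapped j)) ⟩
    sum (λ j → 𝟙 (i Fin.<? j) * (- 1ℚ * Φ y (h · σ))) ≡⟨ sum-*ʳ (- 1ℚ * Φ y (h · σ)) (λ j → 𝟙 (i Fin.<? j)) ⟨
    sum (λ j → 𝟙 (i Fin.<? j)) * (- 1ℚ * Φ y (h · σ)) ≡⟨ cong (_* (- 1ℚ * Φ y (h · σ))) (trans (sum-cong λ j → 𝟙-cong (i Fin.<? j) (suc (toℕ i) ℕ.≤? toℕ j ×-dec toℕ j ℕ.<? N) (λ p → p , Fin.toℕ<n j) proj₁) (count-above i N ℕ.≤-refl)) ⟩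
    ι (n ∸ toℕ i) * (- 1ℚ * Φ y (h · σ)) ≡⟨ move-sign (ι (n ∸ toℕ i)) (Φ y (h · σ)) ⟩
    - ι (n ∸ toℕ i) * Φ y (h · σ) ∎
    where
    open ≡-Reasoning
    move-sign : ∀ x z → x * (- 1ℚ * z) ≡ - x * z
    move-sign = solve 2 (λ x z → x :* ((:- con 1ℚ) :* z) := (:- x) :* z) refl
      where open ℚ-Solver
    swapped : ∀ j → i Fin.< j → Φ y (h · transpose i j · σ) ≡ - 1ℚ * Φ y (h · σ)
    swapped j i<j = trans (conjugated y i j σ) (trans
      (F-antisymmetric a y {transpose (h ⟨$⟩ʳ i) (h ⟨$⟩ʳ j)} (Supp-transpose {U = column a} (⇒h-column i b≤i) (⇒h-column j (ℕ.≤-trans b≤i (ℕ.<⇒≤ i<j)))) (h · σ))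
      (cong (_* Φ y (h · σ)) (sign-transpose (λ e → ℕ.<⇒≢ i<j (cong toℕ (to-injective h e))))))

  -- The letters j ≥ b are those of the column, and their transpositions with i form a Garnir sum,
  -- which contributes 1. The letters between i and b lie outside the column together with i, so
  -- their b - i - 1 transpositions act trivially.
  eigen-arm : ∀ y i → toℕ i ℕ.< b → ∀ σ → sum (λ j → 𝟙 (i Fin.<? j) * Φ y (h · transpose i j · σ)) ≡ ι (b ∸ toℕ i) * Φ y (h · σ)
  eigen-arm y i i<b σ = begin
    sum (λ j → 𝟙 (i Fin.<? j) * Φ y (h · transpose i j · σ)) ≡⟨ sum-cong split ⟩
    sum (λ j → T (h ⟨$⟩ʳ j) + 𝟙 (between j) * Φ y (h · σ)) ≡⟨ sum-+ (λ j → T (h ⟨$⟩ʳ j)) (λ j → 𝟙 (between j) * Φ y (h · σ)) ⟩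
    sum (λ j → T (h ⟨$⟩ʳ j)) + sum (λ j → 𝟙 (between j) * Φ y (h · σ)) ≡⟨ cong₂ _+_ (trans (sum-permute T h) (garnir a y {h ⟨$⟩ʳ i} i∉ (h · σ))) (trans (sym (sum-*ʳ (Φ y (h · σ)) (λ j → 𝟙 (between j)))) (cong (_* Φ y (h · σ)) (count-above i b (ℕ.<⇒≤ b<N)))) ⟩
    Φ y (h · σ) + ι (b ∸ suc (toℕ i)) * Φ y (h · σ) ≡⟨ add-one (ι (b ∸ suc (toℕ i))) (Φ y (h · σ)) ⟩
    ι (suc (b ∸ suc (toℕ i))) * Φ y (h · σ) ≡⟨ cong (λ k → ι k * Φ y (h · σ)) (sym (ℕ.+-∸-assoc 1 i<b)) ⟩
    ι (b ∸ toℕ i) * Φ y (h · σ) ∎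
    where
    open ≡-Reasoning
    add-one : ∀ x z → z + x * z ≡ (1ℚ + x) * z
    add-one = solve 2 (λ x z → z :+ x :* z := (con 1ℚ :+ x) :* z) refl
      where open ℚ-Solver
    i∉ : column a (h ⟨$⟩ʳ i) ≡ false
    i∉ = Bool.¬-not (λ e → ℕ.<⇒≱ i<b (h-column⇒ i e))
    between : ∀ j → Dec (suc (toℕ i) ℕ.≤ toℕ j × toℕ j ℕ.< b)
    between j = suc (toℕ i) ℕ.≤? toℕ j ×-dec toℕ j ℕ.<? b
    T : Fin N → ℚ
    T c = 𝟙 (c ∈ᵇ? column a) * Φ y (transpose c (h ⟨$⟩ʳ i) · h · σ)
    reversed : ∀ j → Φ y (h · transpose i j · σ) ≡ Φ y (transpose (h ⟨$⟩ʳ j) (h ⟨$⟩ʳ i) · h · σ)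
    reversed j = trans (conjugated y i j σ) (F-resp a y {transpose (h ⟨$⟩ʳ i) (h ⟨$⟩ʳ j) · h · σ} {transpose (h ⟨$⟩ʳ j) (h ⟨$⟩ʳ i) · h · σ} (λ x → transpose-comm (h ⟨$⟩ʳ i) (h ⟨$⟩ʳ j) ((h · σ) ⟨$⟩ʳ x)))
    split : ∀ j → 𝟙 (i Fin.<? j) * Φ y (h · transpose i j · σ) ≡ T (h ⟨$⟩ʳ j) + 𝟙 (between j) * Φ y (h · σ)
    split j = cases (b ℕ.≤? toℕ j)
      where
      cases : Dec (b ℕ.≤ toℕ j) → 𝟙 (i Fin.<? j) * Φ y (h · transpose i j · σ) ≡ T (h ⟨$⟩ʳ j) + 𝟙 (between j) * Φ y (h · σ)
      cases (yes b≤j) = begin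
        𝟙 (i Fin.<? j) * Φ y (h · transpose i j · σ) ≡⟨ 𝟙-yes* (i Fin.<? j) {Φ y (h · transpose i j · σ)} (ℕ.<-≤-trans i<b b≤j) ⟩
        Φ y (h · transpose i j · σ) ≡⟨ reversed j ⟩
        Φ y (transpose (h ⟨$⟩ʳ j) (h ⟨$⟩ʳ i) · h · σ) ≡⟨ 𝟙-yes* ((h ⟨$⟩ʳ j) ∈ᵇ? column a) {Φ y (transpose (h ⟨$⟩ʳ j) (h ⟨$⟩ʳ i) · h · σ)} (⇒h-column j b≤j) ⟨
        T (h ⟨$⟩ʳ j) ≡⟨ ℚ.+-identityʳ (T (h ⟨$⟩ʳ j)) ⟨
        T (h ⟨$⟩ʳ j) + 0ℚ ≡⟨ cong (T (h ⟨$⟩ʳ j) +_) (𝟙-no* (between j) {Φ y (h · σ)} (λ (_ , q) → ℕ.<⇒≱ q b≤j)) ⟨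
        T (h ⟨$⟩ʳ j) + 𝟙 (between j) * Φ y (h · σ) ∎
      cases (no b≰j) = begin
        𝟙 (i Fin.<? j) * Φ y (h · transpose i j · σ) ≡⟨ cong (_* Φ y (h · transpose i j · σ)) (𝟙-cong (i Fin.<? j) (between j) (λ p → p , ℕ.≰⇒> b≰j) proj₁) ⟩
        𝟙 (between j) * Φ y (h · transpose i j · σ) ≡⟨ cong (𝟙 (between j) *_) (trans (reversed j) (F-outside a y {transpose (h ⟨$⟩ʳ j) (h ⟨$⟩ʳ i)} (Supp-transpose {U = outside a} (cong not j∉) (cong not i∉)) (h · σ))) ⟩
        𝟙 (between j) * Φ y (h · σ) ≡⟨ ℚ.+-identityˡ (𝟙 (between j) * Φ y (h · σ)) ⟨
        0ℚ + 𝟙 (between j) * Φ y (h · σ) ≡⟨ cong (_+ 𝟙 (between j) * Φ y (h · σ)) (𝟙-no* ((h ⟨$⟩ʳ j) ∈ᵇ? column a) {Φ y (transpose (h ⟨$⟩ʳ j) (h ⟨$⟩ʳ i) · h · σ)} (λ e → true≢false e j∉)) ⟨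
        T (h ⟨$⟩ʳ j) + 𝟙 (between j) * Φ y (h · σ) ∎
        where
        j∉ : column a (h ⟨$⟩ʳ j) ≡ false
        j∉ = Bool.¬-not (λ e → b≰j (h-column⇒ j e))

  eigen : ∀ y i σ → sum (λ j → 𝟙 (i Fin.<? j) * Φ y (h · transpose i j · σ)) ≡ κℕ b n (toℕ i) * Φ y (h · σ)
  eigen y i σ = cases (b ℕ.≤? toℕ i)
    where
    cases : Dec (b ℕ.≤ toℕ i) → sum (λ j → 𝟙 (i Fin.<? j) * Φ y (h · transpose i j · σ)) ≡ κℕ b n (toℕ i) * Φ y (h · σ)
    cases (yes p) = trans (eigen-leg y i p σ) (cong (λ d → (if d then - ι (n ∸ toℕ i) else ι (b ∸ toℕ i)) * Φ y (h · σ)) (sym (dec-true (b ℕ.≤? toℕ i) p)))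
    cases (no ¬p) = trans (eigen-arm y i (ℕ.≰⇒> ¬p) σ) (cong (λ d → (if d then - ι (n ∸ toℕ i) else ι (b ∸ toℕ i)) * Φ y (h · σ)) (sym (dec-false (b ℕ.≤? toℕ i) ¬p)))

-- Subsets and images of a set of letters

vec-ext : ∀ {A : Set} {n} {xs ys : Vec A n} → (∀ i → lookup xs i ≡ lookup ys i) → xs ≡ ys
vec-ext {xs = xs} {ys} e = trans (sym (Vec.tabulate∘lookup xs)) (trans (Vec.tabulate-cong e) (Vec.tabulate∘lookup ys))

subsets : ∀ n → List (Vec Bool n)
subsets zero    = [] ∷ []
subsets (suc n) = map (true ∷_) (subsets n) ++ map (false ∷_) (subsets n)

∑-subsets : ∀ {n} (F : Vec Bool (suc n) → ℚ) →
            ∑ (subsets (suc n)) F ≡ ∑ (subsets n) (λ U → F (true ∷ U)) + ∑ (subsets n) (λ U → F (false ∷ U))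
∑-subsets {n} F = trans (∑-++ (map (true ∷_) (subsets n)) (map (false ∷_) (subsets n)) F)
  (cong₂ _+_ (∑-map (true ∷_) (subsets n) F) (∑-map (false ∷_) (subsets n) F))

∑-subsets-insertAt : ∀ {n} (j : Fin (suc n)) (F : Vec Bool (suc n) → ℚ) →
  ∑ (subsets (suc n)) F ≡ ∑ (subsets n) (λ U → F (Vec.insertAt U j true)) + ∑ (subsets n) (λ U → F (Vec.insertAt U j false))
∑-subsets-insertAt zero F = ∑-subsets F
∑-subsets-insertAt {suc n} (suc j) F = begin
  ∑ (subsets (suc (suc n))) F
    ≡⟨ ∑-subsets F ⟩
  ∑ (subsets (suc n)) (λ U → F (true ∷ U)) + ∑ (subsets (suc n)) (λ U → F (false ∷ U))
    ≡⟨ cong₂ _+_ (∑-subsets-insertAt j (λ U → F (true ∷ U))) (∑-subsets-insertAt j (λ U → F (false ∷ U))) ⟩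
  (s true true + s true false) + (s false true + s false false)
    ≡⟨ middle (s true true) (s true false) (s false true) (s false false) ⟩
  (s true true + s false true) + (s true false + s false false)
    ≡⟨ cong₂ _+_ (∑-subsets (λ U → F (Vec.insertAt U (suc j) true))) (∑-subsets (λ U → F (Vec.insertAt U (suc j) false))) ⟨
  ∑ (subsets (suc n)) (λ U → F (Vec.insertAt U (suc j) true)) + ∑ (subsets (suc n)) (λ U → F (Vec.insertAt U (suc j) false)) ∎
  where
  open ≡-Reasoning
  s : Bool → Bool → ℚ
  s b c = ∑ (subsets n) (λ U → F (b ∷ Vec.insertAt U j c))
  middle : ∀ x y z w → (x + y) + (z + w) ≡ (x + z) + (y + w)
  middle = solve 4 (λ x y z w → (x :+ y) :+ (z :+ w) := (x :+ z) :+ (y :+ w)) refl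
    where open ℚ-Solver

-- The distributive law: a subset records which of the two summands is taken from each factor.
∑-subsets-prod : ∀ {n} (h : Fin n → Bool → ℚ) → ∑ (subsets n) (λ U → prod (λ u → h u (lookup U u))) ≡ prod (λ u → h u true + h u false)
∑-subsets-prod {zero}  h = trans (∑-∷ [] [] (λ U → prod (λ u → h u (lookup U u)))) (trans (cong₂ _+_ (prod-[] _) (∑-[] _)) (trans (ℚ.+-identityʳ 1ℚ) (sym (prod-[] _))))
∑-subsets-prod {suc n} h = begin
  ∑ (subsets (suc n)) (λ U → prod (λ u → h u (lookup U u)))
    ≡⟨ ∑-subsets (λ U → prod (λ u → h u (lookup U u))) ⟩
  ∑ (subsets n) (λ U → prod (λ u → h u (lookup (true ∷ U) u))) + ∑ (subsets n) (λ U → prod (λ u → h u (lookup (false ∷ U) u)))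
    ≡⟨ cong₂ _+_ (branch true) (branch false) ⟩
  h zero true * rest + h zero false * rest
    ≡⟨ ℚ.*-distribʳ-+ rest (h zero true) (h zero false) ⟨
  (h zero true + h zero false) * rest
    ≡⟨ prod-suc (λ u → h u true + h u false) ⟨
  prod (λ u → h u true + h u false) ∎
  where
  open ≡-Reasoning
  rest = prod (λ u → h (suc u) true + h (suc u) false)
  branch : ∀ b → ∑ (subsets n) (λ U → prod (λ u → h u (lookup (b ∷ U) u))) ≡ h zero b * rest
  branch b = trans (∑-cong (subsets n) (λ U → prod-suc (λ u → h u (lookup (b ∷ U) u))))
    (trans (sym (∑-*ˡ (h zero b) (subsets n) (λ U → prod (λ u → h (suc u) (lookup U u))))) (cong (h zero b *_) (∑-subsets-prod (h ∘ suc))))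

image : ∀ {n} → Permutation′ n → (Fin n → Bool) → Vec Bool n
image g U = Vec.tabulate λ x → U (g ⟨$⟩ˡ x)

lookup-insertAt : ∀ {A : Set} {n} (xs : Vec A n) (j : Fin (suc n)) v {ys : Vec A (suc n)} →
                  lookup ys j ≡ v → (∀ y → lookup ys (Fin.punchIn j y) ≡ lookup xs y) → ys ≡ Vec.insertAt xs j v
lookup-insertAt xs j v {ys} at away = vec-ext λ i → cases i (j Fin.≟ i)
  where
  cases : ∀ i → Dec (j ≡ i) → lookup ys i ≡ lookup (Vec.insertAt xs j v) i
  cases i (yes refl) = trans at (sym (Vec.insertAt-lookup xs j v))
  cases i (no j≢i) = subst (λ z → lookup ys z ≡ lookup (Vec.insertAt xs j v) z) (Fin.punchIn-punchOut j≢i)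
    (trans (away (Fin.punchOut j≢i)) (sym (Vec.insertAt-punchIn xs j v (Fin.punchOut j≢i))))

image-insert : ∀ {n} (j : Fin (suc n)) (π : Permutation′ n) U → image (insert zero j π) U ≡ Vec.insertAt (image π (U ∘ suc)) j (U zero)
image-insert j π U = lookup-insertAt (image π (U ∘ suc)) j (U zero)
  (trans (Vec.lookup∘tabulate (λ x → U (ρ ⟨$⟩ˡ x)) j) (cong U (inverseˡ ρ {zero})))
  (λ y → trans (Vec.lookup∘tabulate (λ x → U (ρ ⟨$⟩ˡ x)) (Fin.punchIn j y))
    (trans (cong U (sym (to⇒from ρ {suc (π ⟨$⟩ˡ y)} (trans (Perm.insert-punchIn zero j π (π ⟨$⟩ˡ y)) (cong (Fin.punchIn j) (inverseʳ π))))))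
      (sym (Vec.lookup∘tabulate (λ x → U (suc (π ⟨$⟩ˡ x))) y))))
  where ρ = insert zero j π

size : ∀ {n} → Vec Bool n → ℕ
size U = card (lookup U)

bit : Bool → ℕ
bit b = ℕ∑.𝟙 (b Bool.≟ true)

bit-true : bit true ≡ 1
bit-true = ℕ∑.𝟙-yes (true Bool.≟ true) refl

bit-false : bit false ≡ 0
bit-false = ℕ∑.𝟙-no (false Bool.≟ true) λ ()

card-suc : ∀ {n} (U : Fin (suc n) → Bool) → card U ≡ bit (U zero) ℕ.+ card (U ∘ suc)
card-suc U = ℕ∑.sum-suc _

size-insertAt : ∀ {n} (U : Vec Bool n) j b → size (Vec.insertAt U j b) ≡ bit b ℕ.+ size U
size-insertAt U j b = trans (ℕ∑.sum-punchIn j _) (cong₂ ℕ._+_ (cong bit (Vec.insertAt-lookup U j b)) (ℕ∑.sum-cong λ y → cong bit (Vec.insertAt-punchIn U j b y)))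

size≤n : ∀ {n} (U : Fin n → Bool) → card U ℕ.≤ n
size≤n U = ℕ.≤-trans (ℕ.m≤m+n (card U) (card (not ∘ U))) (ℕ.≤-reflexive (card-complement U))

count-value : ∀ {n} (U : Vec Bool n) b → sum (λ j → 𝟙 (lookup U j Bool.≟ b)) ≡ ι (if b then size U else n ∸ size U)
count-value {n} U true  = sym (ι-card (lookup U))
count-value {n} U false = trans (sum-cong λ j → 𝟙-cong (lookup U j Bool.≟ false) (not (lookup U j) Bool.≟ true) (cong not) (λ e → trans (sym (Bool.not-involutive _)) (cong not e)))
  (trans (sym (ι-card (not ∘ lookup U))) (cong ι (sym (trans (cong (_∸ size U) (sym (card-complement (lookup U)))) (ℕ.m+n∸m≡n (size U) _)))))

-- Induction along g = insert zero j π, which fixes the membership of j in the image. A given U of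
-- the right size has c positions j with the value `U₀ zero`, namely k of them if 0 belongs to U₀
-- and n + 1 - k otherwise; this is the factor by which k′! (n - k′)! grows to k! (n + 1 - k)!.
∑-image : ∀ {n} (U₀ : Fin n → Bool) (G : Vec Bool n → ℚ) →
          ∑ (𝔖 n) (λ g → G (image g U₀)) ≡ ι (card U₀ ! ℕ.* (n ∸ card U₀) !) * ∑ (subsets n) (λ U → 𝟙 (size U ℕ.≟ card U₀) * G U)
∑-image {zero} U₀ G = begin
  ∑ (𝔖 0) (λ g → G (image g U₀)) ≡⟨ ∑-perms-0 (λ g → G (image g U₀)) ⟩
  G [] ≡⟨ trans (cong₂ (λ v w → v * (w * G [])) (cong (λ k → ι (k ! ℕ.* (0 ∸ k) !)) card₀) (𝟙-yes (size [] ℕ.≟ card U₀) (trans (ℕ∑.sum-[] _) (sym card₀)))) (trans (ℚ.*-identityˡ (1ℚ * G [])) (ℚ.*-identityˡ (G []))) ⟨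
  ι (card U₀ ! ℕ.* (0 ∸ card U₀) !) * (𝟙 (size [] ℕ.≟ card U₀) * G []) ≡⟨ cong (ι (card U₀ ! ℕ.* (0 ∸ card U₀) !) *_) (trans (∑-∷ [] [] (λ U → 𝟙 (size U ℕ.≟ card U₀) * G U)) (trans (cong (λ z → 𝟙 (size [] ℕ.≟ card U₀) * G [] + z) (∑-[] (λ U → 𝟙 (size U ℕ.≟ card U₀) * G U))) (ℚ.+-identityʳ (𝟙 (size [] ℕ.≟ card U₀) * G [])))) ⟨
  ι (card U₀ ! ℕ.* (0 ∸ card U₀) !) * ∑ (subsets 0) (λ U → 𝟙 (size U ℕ.≟ card U₀) * G U) ∎
  where
  open ≡-Reasoning
  card₀ : card U₀ ≡ 0
  card₀ = ℕ∑.sum-[] _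
∑-image {suc n} U₀ G = begin
  ∑ (𝔖 (suc n)) (λ g → G (image g U₀))
    ≡⟨ ∑-perms-suc (λ g → G (image g U₀)) ⟩
  sum (λ j → ∑ (𝔖 n) (λ π → G (image (insert zero j π) U₀)))
    ≡⟨ sum-cong (λ j → trans (∑-cong (𝔖 n) λ π → cong G (image-insert j π U₀)) (∑-image (U₀ ∘ suc) (λ V → G (Vec.insertAt V j b₀)))) ⟩
  sum (λ j → ι w′ * ∑ (subsets n) (λ V → 𝟙 (size V ℕ.≟ k′) * G (Vec.insertAt V j b₀)))
    ≡⟨ sum-*ˡ (ι w′) (λ j → ∑ (subsets n) (λ V → 𝟙 (size V ℕ.≟ k′) * G (Vec.insertAt V j b₀))) ⟨
  ι w′ * sum (λ j → ∑ (subsets n) (λ V → 𝟙 (size V ℕ.≟ k′) * G (Vec.insertAt V j b₀)))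
    ≡⟨ cong (ι w′ *_) (trans (sum-cong λ j → sym (restrict j)) (sym (∑-sum (subsets (suc n)) X))) ⟩
  ι w′ * ∑ (subsets (suc n)) (λ U → sum (X U))
    ≡⟨ cong (ι w′ *_) (∑-cong (subsets (suc n)) collect-U) ⟩
  ι w′ * ∑ (subsets (suc n)) (λ U → ι c * (𝟙 (size U ℕ.≟ k) * G U))
    ≡⟨ cong (ι w′ *_) (∑-*ˡ (ι c) (subsets (suc n)) (λ U → 𝟙 (size U ℕ.≟ k) * G U)) ⟨
  ι w′ * (ι c * ∑ (subsets (suc n)) (λ U → 𝟙 (size U ℕ.≟ k) * G U))
    ≡⟨ ℚ.*-assoc (ι w′) (ι c) _ ⟨
  ι w′ * ι c * ∑ (subsets (suc n)) (λ U → 𝟙 (size U ℕ.≟ k) * G U)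
    ≡⟨ cong (_* ∑ (subsets (suc n)) (λ U → 𝟙 (size U ℕ.≟ k) * G U)) (trans (sym (ι-* w′ c)) (cong ι (weights b₀ k k′ (card-suc U₀) (size≤n (U₀ ∘ suc))))) ⟩
  ι (k ! ℕ.* (suc n ∸ k) !) * ∑ (subsets (suc n)) (λ U → 𝟙 (size U ℕ.≟ k) * G U) ∎
  where
  open ≡-Reasoning
  b₀ : Bool
  b₀ = U₀ zero
  k k′ w′ c : ℕ
  k = card U₀
  k′ = card (U₀ ∘ suc)
  w′ = k′ ! ℕ.* (n ∸ k′) !
  c = if b₀ then k else suc n ∸ k
  X : Vec Bool (suc n) → Fin (suc n) → ℚ
  X U j = 𝟙 (lookup U j Bool.≟ b₀) * (𝟙 (size U ℕ.≟ k) * G U)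
  collect-U : ∀ U → sum (X U) ≡ ι c * (𝟙 (size U ℕ.≟ k) * G U)
  collect-U U = begin
    sum (X U) ≡⟨ sum-*ʳ (𝟙 (size U ℕ.≟ k) * G U) (λ j → 𝟙 (lookup U j Bool.≟ b₀)) ⟨
    sum (λ j → 𝟙 (lookup U j Bool.≟ b₀)) * (𝟙 (size U ℕ.≟ k) * G U) ≡⟨ cong (_* (𝟙 (size U ℕ.≟ k) * G U)) (count-value U b₀) ⟩
    ι c′ * (𝟙 (size U ℕ.≟ k) * G U) ≡⟨ x*yz≈y*xz (ι c′) (𝟙 (size U ℕ.≟ k)) (G U) ⟩
    𝟙 (size U ℕ.≟ k) * (ι c′ * G U) ≡⟨ 𝟙-guard (size U ℕ.≟ k) (λ e → cong (λ s → ι (if b₀ then s else suc n ∸ s) * G U) e) ⟩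
    𝟙 (size U ℕ.≟ k) * (ι c * G U) ≡⟨ x*yz≈y*xz (𝟙 (size U ℕ.≟ k)) (ι c) (G U) ⟩
    ι c * (𝟙 (size U ℕ.≟ k) * G U) ∎
    where
    c′ : ℕ
    c′ = if b₀ then size U else suc n ∸ size U
  weights : ∀ b k k′ → k ≡ bit b ℕ.+ k′ → k′ ℕ.≤ n → k′ ! ℕ.* (n ∸ k′) ! ℕ.* (if b then k else suc n ∸ k) ≡ k ! ℕ.* (suc n ∸ k) !
  weights true k k′ e k′≤n rewrite trans e (cong (ℕ._+ k′) bit-true) =
    trans (ℕ.*-comm (k′ ! ℕ.* (n ∸ k′) !) (suc k′)) (sym (ℕ.*-assoc (suc k′) (k′ !) ((n ∸ k′) !)))
  weights false k k′ e k′≤n rewrite trans e (cong (ℕ._+ k′) bit-false) | ℕ.+-∸-assoc 1 k′≤n =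
    trans (ℕ.*-assoc (k′ !) ((n ∸ k′) !) (suc (n ∸ k′))) (cong (k′ ! ℕ.*_) (ℕ.*-comm ((n ∸ k′) !) (suc (n ∸ k′))))
  restrict : ∀ j → ∑ (subsets (suc n)) (λ U → X U j) ≡ ∑ (subsets n) (λ V → 𝟙 (size V ℕ.≟ k′) * G (Vec.insertAt V j b₀))
  restrict j = trans (∑-subsets-insertAt j (λ U → X U j)) (pick b₀ refl)
    where
    agree : ∀ V → X (Vec.insertAt V j b₀) j ≡ 𝟙 (size V ℕ.≟ k′) * G (Vec.insertAt V j b₀)
    agree V = trans (𝟙-yes* (lookup (Vec.insertAt V j b₀) j Bool.≟ b₀) {𝟙 (size (Vec.insertAt V j b₀) ℕ.≟ k) * G (Vec.insertAt V j b₀)} (Vec.insertAt-lookup V j b₀))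
      (cong (_* G (Vec.insertAt V j b₀)) (𝟙-cong (size (Vec.insertAt V j b₀) ℕ.≟ k) (size V ℕ.≟ k′)
        (λ e → ℕ.+-cancelˡ-≡ (bit b₀) _ _ (trans (sym (size-insertAt V j b₀)) (trans e (card-suc U₀))))
        (λ e → trans (size-insertAt V j b₀) (trans (cong (bit b₀ ℕ.+_) e) (sym (card-suc U₀))))))
    differ : ∀ b → b ≢ b₀ → ∀ V → X (Vec.insertAt V j b) j ≡ 0ℚ
    differ b b≢b₀ V = 𝟙-no* (lookup (Vec.insertAt V j b) j Bool.≟ b₀) (λ e → b≢b₀ (trans (sym (Vec.insertAt-lookup V j b)) e))
    pick : ∀ b → b ≡ b₀ → ∑ (subsets n) (λ V → X (Vec.insertAt V j true) j) + ∑ (subsets n) (λ V → X (Vec.insertAt V j false) j) ≡ ∑ (subsets n) (λ V → 𝟙 (size V ℕ.≟ k′) * G (Vec.insertAt V j b₀))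
    pick true  e = trans (cong₂ _+_ (trans (cong (λ b → ∑ (subsets n) (λ V → X (Vec.insertAt V j b) j)) e) (∑-cong (subsets n) agree)) (∑-zero (subsets n) (differ false (λ q → contradiction (trans q (sym e)) λ ())))) (ℚ.+-identityʳ (∑ (subsets n) (λ V → 𝟙 (size V ℕ.≟ k′) * G (Vec.insertAt V j b₀))))
    pick false e = trans (cong₂ _+_ (∑-zero (subsets n) (differ true (λ q → contradiction (trans q (sym e)) λ ()))) (trans (cong (λ b → ∑ (subsets n) (λ V → X (Vec.insertAt V j b) j)) e) (∑-cong (subsets n) agree))) (ℚ.+-identityˡ (∑ (subsets n) (λ V → 𝟙 (size V ℕ.≟ k′) * G (Vec.insertAt V j b₀))))

-- Determinants

det : ∀ {n} → (Fin n → Fin n → ℚ) → ℚ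
det {n} M = ∑ (𝔖 n) (λ π → sign π * prod (λ u → M u (π ⟨$⟩ʳ u)))

det-term-resp : ∀ {n} (M : Fin n → Fin n → ℚ) → Resp (λ π → sign π * prod (λ u → M u (π ⟨$⟩ʳ u)))
det-term-resp M {σ} {τ} e = cong₂ _*_ (sign-cong {σ = σ} {τ} e) (prod-cong λ u → cong (M u) (e u))

det-cong : ∀ {n} {M M′ : Fin n → Fin n → ℚ} → (∀ u w → M u w ≡ M′ u w) → det M ≡ det M′
det-cong {n} e = ∑-cong (𝔖 n) λ π → cong (sign π *_) (prod-cong λ u → e u (π ⟨$⟩ʳ u))

det-transpose : ∀ {n} (M : Fin n → Fin n → ℚ) → det (λ u w → M w u) ≡ det M
det-transpose {n} M = begin
  ∑ (𝔖 n) T ≡⟨ ∑-flip {F = T} (λ {σ} {τ} → det-term-resp (λ u w → M w u) {σ} {τ}) ⟨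
  ∑ (𝔖 n) (λ π → T (flip π)) ≡⟨ ∑-cong (𝔖 n) (λ π → cong₂ _*_ (sign-flip π) (trans (sym (prod-permute (λ u → M (π ⟨$⟩ˡ u) u) π)) (prod-cong λ u → cong (λ z → M z (π ⟨$⟩ʳ u)) (inverseˡ π)))) ⟩
  det M ∎
  where
  open ≡-Reasoning
  T : Permutation′ n → ℚ
  T π = sign π * prod (λ u → M (π ⟨$⟩ʳ u) u)

det-equal-rows : ∀ {n} (M : Fin n → Fin n → ℚ) {z u} → z ≢ u → (∀ w → M z w ≡ M u w) → det M ≡ 0ℚ
det-equal-rows {n} M {z} {u} z≢u e = x≡-x⇒x≡0 (det M) (begin
  det M ≡⟨ ∑-right {F = T} (λ {σ} {τ} → det-term-resp M {σ} {τ}) t ⟨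
  ∑ (𝔖 n) (λ π → T (π · t)) ≡⟨ ∑-cong (𝔖 n) flips ⟩
  ∑ (𝔖 n) (λ π → - T π) ≡⟨ ∑-neg (𝔖 n) T ⟩
  - det M ∎)
  where
  open ≡-Reasoning
  t : Permutation′ n
  t = transpose z u
  T : Permutation′ n → ℚ
  T π = sign π * prod (λ v → M v (π ⟨$⟩ʳ v))
  rows : ∀ v w → M (t ⟨$⟩ʳ v) w ≡ M v w
  rows v w with t ⟨$⟩ʳ v | transposeView z u v
  ... | _ | atˡ refl   = sym (e w)
  ... | _ | atʳ _ refl = e w
  ... | _ | other _ _  = refl
  flips : ∀ π → T (π · t) ≡ - T π
  flips π = trans (cong₂ _*_ (trans (sign-· π t) (cong (sign π *_) (sign-transpose z≢u)))
      (trans (sym (prod-permute (λ v → M v (π ⟨$⟩ʳ (t ⟨$⟩ʳ v))) t)) (prod-cong λ v → trans (rows v _) (cong (λ x → M v (π ⟨$⟩ʳ x)) (transpose-involutive z u v)))))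
    (negate (sign π) (prod (λ v → M v (π ⟨$⟩ʳ v))))
    where
    negate : ∀ s p → s * - 1ℚ * p ≡ - (s * p)
    negate = solve 2 (λ s p → s :* (:- con 1ℚ) :* p := :- (s :* p)) refl
      where open ℚ-Solver

setRow : ∀ {n} → (Fin n → Fin n → ℚ) → Fin n → (Fin n → ℚ) → Fin n → Fin n → ℚ
setRow M z r u w = if does (u Fin.≟ z) then r w else M u w

setRow-at : ∀ {n} (M : Fin n → Fin n → ℚ) z r w → setRow M z r z w ≡ r w
setRow-at M z r w = cong (if_then r w else M z w) (dec-true (z Fin.≟ z) refl)

setRow-away : ∀ {n} (M : Fin n → Fin n → ℚ) z r {u} → u ≢ z → ∀ w → setRow M z r u w ≡ M u w
setRow-away M z r {u} u≢z w = cong (if_then r w else M u w) (dec-false (u Fin.≟ z) u≢z)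

setRow-self : ∀ {n} (M : Fin n → Fin n → ℚ) z u w → setRow M z (M z) u w ≡ M u w
setRow-self M z u w = cases (u Fin.≟ z)
  where
  cases : Dec (u ≡ z) → setRow M z (M z) u w ≡ M u w
  cases (yes refl) = setRow-at M u (M u) w
  cases (no u≢z)   = setRow-away M z (M z) u≢z w

-- Splitting off the factor of row z leaves a cofactor in which r does not occur, which exhibits
-- linearity in that row.
det-setRow : ∀ {n} (M : Fin (suc n) → Fin (suc n) → ℚ) z r →
  det (setRow M z r) ≡ ∑ (𝔖 (suc n)) (λ π → r (π ⟨$⟩ʳ z) * (sign π * prod (λ p → M (Fin.punchIn z p) (π ⟨$⟩ʳ Fin.punchIn z p))))
det-setRow {n} M z r = ∑-cong (𝔖 (suc n)) λ π → trans
  (cong (sign π *_) (trans (prod-punchIn z (λ u → setRow M z r u (π ⟨$⟩ʳ u)))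
    (cong₂ _*_ (setRow-at M z r (π ⟨$⟩ʳ z)) (prod-cong λ p → setRow-away M z r (Fin.punchInᵢ≢i z p) (π ⟨$⟩ʳ Fin.punchIn z p)))))
  (x*yz≈y*xz (sign π) (r (π ⟨$⟩ʳ z)) (prod (λ p → M (Fin.punchIn z p) (π ⟨$⟩ʳ Fin.punchIn z p))))

det-row-linear : ∀ {m n} (M : Fin (suc n) → Fin (suc n) → ℚ) z (c : Fin m → ℚ) (r : Fin m → Fin (suc n) → ℚ) →
  det (setRow M z (λ w → sum (λ i → c i * r i w))) ≡ sum (λ i → c i * det (setRow M z (r i)))
det-row-linear {m} {n} M z c r = begin
  det (setRow M z (λ w → sum (λ i → c i * r i w))) ≡⟨ det-setRow M z (λ w → sum (λ i → c i * r i w)) ⟩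
  ∑ (𝔖 (suc n)) (λ π → sum (λ i → c i * r i (π ⟨$⟩ʳ z)) * k π) ≡⟨ ∑-cong (𝔖 (suc n)) (λ π → trans (sum-*ʳ (k π) (λ i → c i * r i (π ⟨$⟩ʳ z))) (sum-cong λ i → ℚ.*-assoc (c i) (r i (π ⟨$⟩ʳ z)) (k π))) ⟩
  ∑ (𝔖 (suc n)) (λ π → sum (λ i → c i * (r i (π ⟨$⟩ʳ z) * k π))) ≡⟨ ∑-sum (𝔖 (suc n)) (λ π i → c i * (r i (π ⟨$⟩ʳ z) * k π)) ⟩
  sum (λ i → ∑ (𝔖 (suc n)) (λ π → c i * (r i (π ⟨$⟩ʳ z) * k π))) ≡⟨ sum-cong (λ i → trans (sym (∑-*ˡ (c i) (𝔖 (suc n)) (λ π → r i (π ⟨$⟩ʳ z) * k π))) (cong (c i *_) (sym (det-setRow M z (r i))))) ⟩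
  sum (λ i → c i * det (setRow M z (r i))) ∎
  where
  open ≡-Reasoning
  k : Permutation′ (suc n) → ℚ
  k π = sign π * prod (λ p → M (Fin.punchIn z p) (π ⟨$⟩ʳ Fin.punchIn z p))

-- Adding multiples of the other rows to row z changes nothing, because each of them contributes a
-- matrix with two equal rows; with the coefficients c the row becomes 0.
det-dependent-rows : ∀ {n} (M : Fin (suc n) → Fin (suc n) → ℚ) z (c : Fin (suc n) → ℚ) → c z ≡ 1ℚ →
                     (∀ w → sum (λ u → c u * M u w) ≡ 0ℚ) → det M ≡ 0ℚ
det-dependent-rows {n} M z c cz dep = begin
  det M ≡⟨ ℚ.*-identityˡ (det M) ⟨
  1ℚ * det M ≡⟨ cong₂ _*_ (sym cz) (sym (det-cong (setRow-self M z))) ⟩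
  c z * det (setRow M z (M z)) ≡⟨ sum-single z (λ u → c u * det (setRow M z (M u))) ⟨
  sum (λ u → 𝟙 (z Fin.≟ u) * (c u * det (setRow M z (M u)))) ≡⟨ sum-cong (λ u → only u (z Fin.≟ u)) ⟩
  sum (λ u → c u * det (setRow M z (M u))) ≡⟨ det-row-linear M z c M ⟨
  det (setRow M z (λ w → sum (λ u → c u * M u w))) ≡⟨ det-setRow M z (λ w → sum (λ u → c u * M u w)) ⟩
  ∑ (𝔖 (suc n)) (λ π → sum (λ u → c u * M u (π ⟨$⟩ʳ z)) * k π) ≡⟨ ∑-zero (𝔖 (suc n)) (λ π → trans (cong (_* k π) (dep (π ⟨$⟩ʳ z))) (ℚ.*-zeroˡ (k π))) ⟩
  0ℚ ∎
  where
  open ≡-Reasoning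
  k : Permutation′ (suc n) → ℚ
  k π = sign π * prod (λ p → M (Fin.punchIn z p) (π ⟨$⟩ʳ Fin.punchIn z p))
  only : ∀ u (d : Dec (z ≡ u)) → 𝟙 d * (c u * det (setRow M z (M u))) ≡ c u * det (setRow M z (M u))
  only u d@(yes e) = 𝟙-yes* d {c u * det (setRow M z (M u))} e
  only u d@(no z≢u) = trans (𝟙-no* d {c u * det (setRow M z (M u))} z≢u) (sym (trans (cong (c u *_) (det-equal-rows (setRow M z (M u)) {z} {u} z≢u
    (λ w → trans (setRow-at M z (M u) w) (sym (setRow-away M z (M u) (z≢u ∘ sym) w))))) (ℚ.*-zeroʳ (c u))))

prod-𝟙 : ∀ {n} {P : Fin n → Set} (d : ∀ u → Dec (P u)) → prod (λ u → 𝟙 (d u)) ≡ 𝟙 (Fin.all? d)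
prod-𝟙 {zero}  d = trans (prod-[] _) (sym (𝟙-yes (Fin.all? d) λ ()))
prod-𝟙 {suc n} d = trans (prod-suc _) (trans (cong (𝟙 (d zero) *_) (prod-𝟙 (d ∘ suc)))
  (trans (sym (𝟙-× (d zero) (Fin.all? (d ∘ suc)))) (𝟙-cong (d zero ×-dec Fin.all? (d ∘ suc)) (Fin.all? d) (λ { (p , q) zero → p ; (p , q) (suc i) → q i }) (λ p → p zero , λ i → p (suc i)))))

[-1]^-+ : ∀ k l → [-1]^ (k ℕ.+ l) ≡ [-1]^ k * [-1]^ l
[-1]^-+ zero    l = sym (ℚ.*-identityˡ ([-1]^ l))
[-1]^-+ (suc k) l = trans (cong -_ ([-1]^-+ k l)) (ℚ.neg-distribˡ-* ([-1]^ k) ([-1]^ l))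

[-1]^-size : ∀ {n} (U : Vec Bool n) → [-1]^ size U ≡ prod (λ u → if lookup U u then - 1ℚ else 1ℚ)
[-1]^-size []      = trans (cong [-1]^_ (ℕ∑.sum-[] _)) (sym (prod-[] _))
[-1]^-size (b ∷ U) = trans (cong [-1]^_ (card-suc (lookup (b ∷ U)))) (trans ([-1]^-+ (bit b) (size U))
  (trans (cong₂ _*_ (one b) ([-1]^-size U)) (sym (prod-suc (λ u → if lookup (b ∷ U) u then - 1ℚ else 1ℚ)))))
  where
  one : ∀ b → [-1]^ bit b ≡ (if b then - 1ℚ else 1ℚ)
  one true  = cong [-1]^_ bit-true
  one false = cong [-1]^_ bit-false

-- The alternating sum of hook characters as a sum of determinants

module _ {n : ℕ} (φ : Permutation′ (suc n)) where
  private N = suc n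

  -- Here w stands for π u, and the Boolean tells whether u is in the column. A column permutation π
  -- fixes the letters outside the column, and the equality of tabloids makes φ π fix the letters
  -- outside the first row. The corner lies in both, which is why `Compatible` exempts j.
  Event : Bool → Fin N → Fin N → Set
  Event true  u w = φ ⟨$⟩ʳ w ≡ u
  Event false u w = w ≡ u

  event? : ∀ b u w → Dec (Event b u w)
  event? true  u w = (φ ⟨$⟩ʳ w) Fin.≟ u
  event? false u w = w Fin.≟ u

  Compatible : Fin N → Bool → Fin N → Fin N → Set
  Compatible j b u w = u ≢ j → Event b u w

  compatible? : ∀ j b u w → Dec (Compatible j b u w)
  compatible? j b u w = ¬? (u Fin.≟ j) →-dec event? b u w

  weight : Fin N → Vec Bool N → ℚ
  weight j U = ∑ (𝔖 N) (λ π → sign π * prod (λ u → 𝟙 (compatible? j (lookup U u) u (π ⟨$⟩ʳ u))))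

  cycleMatrix : Fin N → Fin N → Fin N → ℚ
  cycleMatrix j = setRow (λ u w → 𝟙 (w Fin.≟ u) + - 𝟙 ((φ ⟨$⟩ʳ w) Fin.≟ u)) j (λ _ → 1ℚ)

  -- Off the row of j each letter is fixed by π (if outside V) or by φ · π (if in V); summing over V
  -- with signs adds the two alternatives within each row.
  weight-det : ∀ j → ∑ (subsets n) (λ V → [-1]^ size V * weight j (Vec.insertAt V j true)) ≡ det (cycleMatrix j)
  weight-det j = begin
    ∑ S (λ V → [-1]^ size V * weight j (Vec.insertAt V j true))
      ≡⟨ ∑-cong S (λ V → trans (∑-*ˡ ([-1]^ size V) (𝔖 N) _) (∑-cong (𝔖 N) λ π → per V π)) ⟩
    ∑ S (λ V → ∑ (𝔖 N) (λ π → sign π * prod (λ p → g π p (lookup V p))))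
      ≡⟨ ∑-swap S (𝔖 N) (λ V π → sign π * prod (λ p → g π p (lookup V p))) ⟩
    ∑ (𝔖 N) (λ π → ∑ S (λ V → sign π * prod (λ p → g π p (lookup V p))))
      ≡⟨ ∑-cong (𝔖 N) (λ π → trans (sym (∑-*ˡ (sign π) S (λ V → prod (λ p → g π p (lookup V p))))) (cong (sign π *_) (trans (∑-subsets-prod (g π)) (prod-cong (entry π))))) ⟩
    ∑ (𝔖 N) (λ π → sign π * prod (λ p → D (Fin.punchIn j p) (π ⟨$⟩ʳ Fin.punchIn j p)))
      ≡⟨ ∑-cong (𝔖 N) (λ π → sym (ℚ.*-identityˡ (sign π * prod (λ p → D (Fin.punchIn j p) (π ⟨$⟩ʳ Fin.punchIn j p))))) ⟩
    ∑ (𝔖 N) (λ π → 1ℚ * (sign π * prod (λ p → D (Fin.punchIn j p) (π ⟨$⟩ʳ Fin.punchIn j p))))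
      ≡⟨ det-setRow D j (λ _ → 1ℚ) ⟨
    det (cycleMatrix j) ∎
    where
    open ≡-Reasoning
    S = subsets n
    D : Fin N → Fin N → ℚ
    D u w = 𝟙 (w Fin.≟ u) + - 𝟙 ((φ ⟨$⟩ʳ w) Fin.≟ u)
    e : Permutation′ N → Fin n → Bool → ℚ
    e π p b = 𝟙 (compatible? j b (Fin.punchIn j p) (π ⟨$⟩ʳ Fin.punchIn j p))
    g : Permutation′ N → Fin n → Bool → ℚ
    g π p b = (if b then - 1ℚ else 1ℚ) * e π p b
    per : ∀ V π → [-1]^ size V * (sign π * prod (λ u → 𝟙 (compatible? j (lookup (Vec.insertAt V j true) u) u (π ⟨$⟩ʳ u)))) ≡ sign π * prod (λ p → g π p (lookup V p))
    -- The factor at j is 1 and is dropped; the sign (-1)^|V| is distributed over the other letters,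
    -- one -1 for each member of V.
    per V π = trans (x*yz≈y*xz ([-1]^ size V) (sign π) _) (cong (sign π *_)
      (trans (cong₂ _*_ ([-1]^-size V) (trans (prod-punchIn j (λ u → 𝟙 (compatible? j (lookup (Vec.insertAt V j true) u) u (π ⟨$⟩ʳ u))))
          (trans (cong₂ _*_ (𝟙-yes (compatible? j (lookup (Vec.insertAt V j true) j) j (π ⟨$⟩ʳ j)) (λ j≢j → contradiction refl j≢j))
              (prod-cong λ p → cong (e π p) (Vec.insertAt-punchIn V j true p)))
            (ℚ.*-identityˡ (prod (λ p → e π p (lookup V p)))))))
        (sym (prod-* (λ p → if lookup V p then - 1ℚ else 1ℚ) (λ p → e π p (lookup V p))))))
    entry : ∀ π p → g π p true + g π p false ≡ D (Fin.punchIn j p) (π ⟨$⟩ʳ Fin.punchIn j p)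
    entry π p = trans (cong₂ (λ x y → - 1ℚ * x + 1ℚ * y) (drop true) (drop false)) (arrange (𝟙 (event? true q w)) (𝟙 (event? false q w)))
      where
      q = Fin.punchIn j p
      w = π ⟨$⟩ʳ q
      drop : ∀ b → e π p b ≡ 𝟙 (event? b q w)
      drop b = 𝟙-cong (compatible? j b q w) (event? b q w) (λ c → c (Fin.punchInᵢ≢i j p)) (λ x _ → x)
      arrange : ∀ x y → - 1ℚ * x + 1ℚ * y ≡ y + - x
      arrange = solve 2 (λ x y → (:- con 1ℚ) :* x :+ con 1ℚ :* y := y :+ :- x) refl
        where open ℚ-Solver

firstRow-false⇒ : ∀ {n} (C : Fin (suc n) → Bool) {x} → firstRow C x ≡ false → x ≢ zero × C x ≡ true
firstRow-false⇒ C {suc x} e = (λ ()) , trans (sym (Bool.not-involutive (C (suc x)))) (cong not e)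

⇒firstRow-false : ∀ {n} (C : Fin (suc n) → Bool) {x} → x ≢ zero → C x ≡ true → firstRow C x ≡ false
⇒firstRow-false C {zero}  x≢0 e = contradiction refl x≢0
⇒firstRow-false C {suc x} x≢0 e = cong not e

module _ {n : ℕ} (a : Fin (suc n)) (φ : Permutation′ (suc n)) where
  private
    N = suc n
    C = column a
    y₀ = tabloid₀ (hook N a)
  open Trace a

  -- Conjugating the column permutations by g passes from the fixed tableau to the one relabelled by
  -- g, with column `image g C` and corner g 0. Only these two data of g enter, so the class sum
  -- becomes a sum over sets with a marked element.
  F-weight : ∀ g → F a y₀ (flip g · flip φ · g) ≡ weight φ (g ⟨$⟩ʳ zero) (image g C)
  F-weight g = begin
    ∑ (𝔖 N) (term a y₀ τ) ≡⟨ ∑-conj {F = term a y₀ τ} (λ {π} {ρ} → term-resp a y₀ τ {π} {ρ}) (flip g) ⟨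
    ∑ (𝔖 N) (λ π → term a y₀ τ (flip g · π · g)) ≡⟨ ∑-cong (𝔖 N) per-π ⟩
    weight φ (g ⟨$⟩ʳ zero) (image g C) ∎
    where
    open ≡-Reasoning
    j : Fin N
    j = g ⟨$⟩ʳ zero
    τ : Permutation′ N
    τ = flip g · flip φ · g
    U : Vec Bool N
    U = image g C
    U≡ : ∀ u → lookup U u ≡ C (g ⟨$⟩ˡ u)
    U≡ = Vec.lookup∘tabulate (λ x → C (g ⟨$⟩ˡ x))
    per-π : ∀ π → term a y₀ τ (flip g · π · g) ≡ sign π * prod (λ u → 𝟙 (compatible? φ j (lookup U u) u (π ⟨$⟩ʳ u)))
    per-π π = begin
      𝟙 (supp? C π′) * (sign π′ * 𝟙 (π′ • y₀ ≟ᵗ τ • y₀)) ≡⟨ x*yz≈y*xz (𝟙 (supp? C π′)) (sign π′) (𝟙 (π′ • y₀ ≟ᵗ τ • y₀)) ⟩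
      sign π′ * (𝟙 (supp? C π′) * 𝟙 (π′ • y₀ ≟ᵗ τ • y₀)) ≡⟨ cong₂ _*_ (sign-conj (flip g) π) (trans (sym (𝟙-× (supp? C π′) (π′ • y₀ ≟ᵗ τ • y₀))) (𝟙-cong (supp? C π′ ×-dec (π′ • y₀ ≟ᵗ τ • y₀)) (Fin.all? d) to from)) ⟩
      sign π * 𝟙 (Fin.all? d) ≡⟨ cong (sign π *_) (prod-𝟙 d) ⟨
      sign π * prod (λ u → 𝟙 (d u)) ∎
      where
      π′ : Permutation′ N
      π′ = flip g · π · g
      d : ∀ u → Dec (Compatible φ j (lookup U u) u (π ⟨$⟩ʳ u))
      d u = compatible? φ j (lookup U u) u (π ⟨$⟩ʳ u)
      -- The tabloids of π′ and τ agree exactly when ψ stabilizes y₀, and ψ is g⁻¹ (φ π) g.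
      ψ : Permutation′ N
      ψ = flip τ · π′
      ψ≡ : ∀ x → ψ ⟨$⟩ʳ x ≡ g ⟨$⟩ˡ (φ ⟨$⟩ʳ (π ⟨$⟩ʳ (g ⟨$⟩ʳ x)))
      ψ≡ x = cong (λ z → g ⟨$⟩ˡ (φ ⟨$⟩ʳ z)) (inverseʳ g)
      event⇒ : π′ • y₀ ≡ τ • y₀ → Supp (firstRow C) ψ
      event⇒ e = stabilizer⇒ a ψ (trans (sym (•-· (flip τ) π′ y₀)) (trans (cong (flip τ •_) e) (•-inverse τ y₀)))
      ⇒event : Supp (firstRow C) ψ → π′ • y₀ ≡ τ • y₀
      ⇒event s = trans (sym (•-inverse (flip τ) (π′ • y₀))) (cong (τ •_) (trans (•-· (flip τ) π′ y₀) (⇒stabilizer a ψ s)))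
      to : Supp C π′ × π′ • y₀ ≡ τ • y₀ → ∀ u → Compatible φ j (lookup U u) u (π ⟨$⟩ʳ u)
      to (s , e) u u≢j = cases (C (g ⟨$⟩ˡ u)) refl (lookup U u) (U≡ u)
        where
        cases : ∀ c → C (g ⟨$⟩ˡ u) ≡ c → ∀ b → b ≡ C (g ⟨$⟩ˡ u) → Event φ b u (π ⟨$⟩ʳ u)
        cases true  q true  _ = trans (cong (λ z → φ ⟨$⟩ʳ (π ⟨$⟩ʳ z)) (sym (inverseʳ g)))
          (trans (sym (inverseʳ g)) (trans (cong (g ⟨$⟩ʳ_) (trans (sym (ψ≡ (g ⟨$⟩ˡ u))) (event⇒ e (g ⟨$⟩ˡ u) (⇒firstRow-false C (λ z → u≢j (from⇒to g z)) q)))) (inverseʳ g)))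
        cases false q false _ = trans (cong (π ⟨$⟩ʳ_) (sym (inverseʳ g)))
          (trans (sym (inverseʳ g)) (trans (cong (g ⟨$⟩ʳ_) (s (g ⟨$⟩ˡ u) q)) (inverseʳ g)))
        cases true  q false p = contradiction (trans p q) λ ()
        cases false q true  p = contradiction (trans p q) λ ()
      from : (∀ u → Compatible φ j (lookup U u) u (π ⟨$⟩ʳ u)) → Supp C π′ × π′ • y₀ ≡ τ • y₀
      from c = fixes , ⇒event rows
        where
        Uat : ∀ x {b} → C x ≡ b → lookup U (g ⟨$⟩ʳ x) ≡ b
        Uat x q = trans (U≡ (g ⟨$⟩ʳ x)) (trans (cong C (inverseˡ g)) q)
        at : ∀ x → x ≢ zero → ∀ {b} → C x ≡ b → Event φ b (g ⟨$⟩ʳ x) (π ⟨$⟩ʳ (g ⟨$⟩ʳ x))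
        at x x≢0 q = subst (λ b → Event φ b (g ⟨$⟩ʳ x) (π ⟨$⟩ʳ (g ⟨$⟩ʳ x))) (Uat x q) (c (g ⟨$⟩ʳ x) (λ e → x≢0 (to-injective g e)))
        fixes : Supp C π′
        fixes x q = trans (cong (g ⟨$⟩ˡ_) (at x (λ { refl → true≢false (column-zero a) q }) q)) (inverseˡ g)
        rows : Supp (firstRow C) ψ
        rows x r = trans (ψ≡ x) (trans (cong (g ⟨$⟩ˡ_) (at x (proj₁ (firstRow-false⇒ C r)) (proj₂ (firstRow-false⇒ C r)))) (inverseˡ g))

  -- Writing g as `insert zero j π` separates the image j of the corner from the image V of the
  -- other a letters of the column. Each V arises from a! (n - a)! permutations π, which cancels all
  -- of `order a` except the factor N.
  hookχ-weights : ι N * hookχ φ ≡ sum (λ j → ∑ (subsets n) (λ V → 𝟙 (size V ℕ.≟ toℕ a) * weight φ j (Vec.insertAt V j true)))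
  hookχ-weights = *-cancelˡ {ι w} (ι≢0 w {{toℕ a ℕ.!* (n ∸ toℕ a) !≢0}}) (begin
    ι w * (ι N * hookχ φ)
      ≡⟨ trans (sym (ℚ.*-assoc (ι w) (ι N) (hookχ φ))) (cong (_* hookχ φ) (sym (ι-* w N))) ⟩
    ι (order a) * hookχ φ
      ≡⟨ trace-formula φ ⟩
    classSum φ
      ≡⟨ ∑-cong (𝔖 N) F-weight ⟩
    ∑ (𝔖 N) (λ g → weight φ (g ⟨$⟩ʳ zero) (image g C))
      ≡⟨ ∑-perms-suc (λ g → weight φ (g ⟨$⟩ʳ zero) (image g C)) ⟩
    sum (λ j → ∑ (𝔖 n) (λ π → weight φ j (image (insert zero j π) C)))
      ≡⟨ sum-cong (λ j → trans (∑-cong (𝔖 n) λ π → cong (weight φ j) (trans (image-insert j π C) (cong (Vec.insertAt (image π C′) j) (column-zero a))))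
           (trans (∑-image C′ (λ V → weight φ j (Vec.insertAt V j true))) (cong (λ k → ι (k ! ℕ.* (n ∸ k) !) * ∑ (subsets n) (λ V → 𝟙 (size V ℕ.≟ k) * weight φ j (Vec.insertAt V j true))) |C′|))) ⟩
    sum (λ j → ι w * ∑ (subsets n) (λ V → 𝟙 (size V ℕ.≟ toℕ a) * weight φ j (Vec.insertAt V j true)))
      ≡⟨ sum-*ˡ (ι w) (λ j → ∑ (subsets n) (λ V → 𝟙 (size V ℕ.≟ toℕ a) * weight φ j (Vec.insertAt V j true))) ⟨
    ι w * sum (λ j → ∑ (subsets n) (λ V → 𝟙 (size V ℕ.≟ toℕ a) * weight φ j (Vec.insertAt V j true))) ∎)
    where
    open ≡-Reasoning
    w : ℕ
    w = toℕ a ! ℕ.* (n ∸ toℕ a) !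
    C′ : Fin n → Bool
    C′ = C ∘ suc
    |C′| : card C′ ≡ toℕ a
    |C′| = ℕ.suc-injective (trans (sym (trans (card-suc C) (cong (ℕ._+ card C′) (trans (cong bit (column-zero a)) bit-true)))) (card-column a))

-- The sum over a removes the restriction |V| = a and turns its sign into (-1)^|V|, so that all
-- subsets occur, as in `weight-det`.
alternating-hooks : ∀ {n} (φ : Permutation′ (suc n)) →
  ι (suc n) * sum (λ a → [-1]^ toℕ a * Trace.hookχ a φ) ≡ sum (λ j → det (cycleMatrix φ j))
alternating-hooks {n} φ = begin
  ι N * sum (λ a → [-1]^ toℕ a * Trace.hookχ a φ)
    ≡⟨ trans (sum-*ˡ (ι N) (λ a → [-1]^ toℕ a * Trace.hookχ a φ)) (sum-cong λ a → trans (x*yz≈y*xz (ι N) ([-1]^ toℕ a) (Trace.hookχ a φ)) (cong ([-1]^ toℕ a *_) (hookχ-weights a φ))) ⟩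
  sum (λ a → [-1]^ toℕ a * sum (λ j → ∑ S (λ V → 𝟙 (size V ℕ.≟ toℕ a) * W j V)))
    ≡⟨ trans (sum-cong λ a → sum-*ˡ ([-1]^ toℕ a) (λ j → ∑ S (λ V → 𝟙 (size V ℕ.≟ toℕ a) * W j V))) (sum-swap (λ a j → [-1]^ toℕ a * ∑ S (λ V → 𝟙 (size V ℕ.≟ toℕ a) * W j V))) ⟩
  sum (λ j → sum (λ a → [-1]^ toℕ a * ∑ S (λ V → 𝟙 (size V ℕ.≟ toℕ a) * W j V)))
    ≡⟨ sum-cong (λ j → trans (sum-cong λ a → ∑-*ˡ ([-1]^ toℕ a) S (λ V → 𝟙 (size V ℕ.≟ toℕ a) * W j V)) (sym (∑-sum S (λ V a → [-1]^ toℕ a * (𝟙 (size V ℕ.≟ toℕ a) * W j V))))) ⟩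
  sum (λ j → ∑ S (λ V → sum (λ a → [-1]^ toℕ a * (𝟙 (size V ℕ.≟ toℕ a) * W j V))))
    ≡⟨ sum-cong (λ j → ∑-cong S (by-size j)) ⟩
  sum (λ j → ∑ S (λ V → [-1]^ size V * W j V))
    ≡⟨ sum-cong (λ j → weight-det φ j) ⟩
  sum (λ j → det (cycleMatrix φ j)) ∎
  where
  open ≡-Reasoning
  N = suc n
  S = subsets n
  W : Fin N → Vec Bool n → ℚ
  W j V = weight φ j (Vec.insertAt V j true)
  by-size : ∀ j V → sum (λ a → [-1]^ toℕ a * (𝟙 (size V ℕ.≟ toℕ a) * W j V)) ≡ [-1]^ size V * W j V
  by-size j V = begin
    sum (λ a → [-1]^ toℕ a * (𝟙 (size V ℕ.≟ toℕ a) * W j V)) ≡⟨ sum-cong (λ a → trans (x*yz≈y*xz ([-1]^ toℕ a) (𝟙 (size V ℕ.≟ toℕ a)) (W j V)) (cong (_* ([-1]^ toℕ a * W j V)) (𝟙-cong (size V ℕ.≟ toℕ a) (s Fin.≟ a) (λ e → Fin.toℕ-injective (trans s≡ e)) (λ e → trans (sym s≡) (cong toℕ e))))) ⟩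
    sum (λ a → 𝟙 (s Fin.≟ a) * ([-1]^ toℕ a * W j V)) ≡⟨ sum-single s (λ a → [-1]^ toℕ a * W j V) ⟩
    [-1]^ toℕ s * W j V ≡⟨ cong (λ k → [-1]^ k * W j V) s≡ ⟩
    [-1]^ size V * W j V ∎
    where
    size<N : size V ℕ.< N
    size<N = ℕ.s≤s (size≤n (lookup V))
    s : Fin N
    s = Fin.fromℕ< size<N
    s≡ : toℕ s ≡ size V
    s≡ = Fin.toℕ-fromℕ< size<N

-- Evaluation of the determinants

module _ {n : ℕ} (φ : Permutation′ (suc n)) (j : Fin (suc n)) where
  private
    N = suc n
    M = cycleMatrix φ j
    D : Fin N → Fin N → ℚ
    D u w = 𝟙 (w Fin.≟ u) + - 𝟙 ((φ ⟨$⟩ʳ w) Fin.≟ u)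

  -- The rows of a cycle avoiding j add up to 0.
  det-short : ∀ z → ¬ SameCycle φ j z → det M ≡ 0ℚ
  det-short z ¬s = det-dependent-rows M z c (𝟙-yes (sameCycle? φ z z) (SameCycle-refl φ)) λ w → begin
    -- M and D differ only in row j, which has coefficient 0 because j is not in the cycle of z.
    sum (λ u → c u * M u w) ≡⟨ sum-cong (λ u → trans (entries u w (u Fin.≟ j)) (spread (c u) (𝟙 (w Fin.≟ u)) (𝟙 ((φ ⟨$⟩ʳ w) Fin.≟ u)))) ⟩
    sum (λ u → 𝟙 (w Fin.≟ u) * c u + 𝟙 ((φ ⟨$⟩ʳ w) Fin.≟ u) * (- 1ℚ * c u)) ≡⟨ sum-+ (λ u → 𝟙 (w Fin.≟ u) * c u) (λ u → 𝟙 ((φ ⟨$⟩ʳ w) Fin.≟ u) * (- 1ℚ * c u)) ⟩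
    sum (λ u → 𝟙 (w Fin.≟ u) * c u) + sum (λ u → 𝟙 ((φ ⟨$⟩ʳ w) Fin.≟ u) * (- 1ℚ * c u)) ≡⟨ cong₂ _+_ (sum-single w c) (sum-single (φ ⟨$⟩ʳ w) (λ u → - 1ℚ * c u)) ⟩
    c w + - 1ℚ * c (φ ⟨$⟩ʳ w) ≡⟨ cong (λ x → c w + - 1ℚ * x) (𝟙-cong (sameCycle? φ z (φ ⟨$⟩ʳ w)) (sameCycle? φ z w) (λ s → SameCycle-trans φ s (SameCycle-sym φ (step w))) (λ s → SameCycle-trans φ s (step w))) ⟩
    c w + - 1ℚ * c w ≡⟨ difference (c w) ⟩
    0ℚ ∎
    where
    open ≡-Reasoning
    c : Fin N → ℚ
    c u = 𝟙 (sameCycle? φ z u)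
    step : ∀ w → SameCycle φ w (φ ⟨$⟩ʳ w)
    step w = ∼⇒SameCycle φ (∼-step φ)
    difference : ∀ x → x + - 1ℚ * x ≡ 0ℚ
    difference = solve 1 (λ x → x :+ (:- con 1ℚ) :* x := con 0ℚ) refl
      where open ℚ-Solver
    spread : ∀ x y z → x * (y + - z) ≡ y * x + z * (- 1ℚ * x)
    spread = solve 3 (λ x y z → x :* (y :+ :- z) := y :* x :+ z :* ((:- con 1ℚ) :* x)) refl
      where open ℚ-Solver
    entries : ∀ u w → Dec (u ≡ j) → c u * M u w ≡ c u * D u w
    entries u w (no u≢j) = cong (c u *_) (setRow-away D j (λ _ → 1ℚ) u≢j w)
    entries u w (yes refl) = trans (𝟙-no* (sameCycle? φ z u) {M u w} (¬s ∘ SameCycle-sym φ)) (sym (𝟙-no* (sameCycle? φ z u) {D u w} (¬s ∘ SameCycle-sym φ)))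

  module _ (long : Long φ) where

    private
      unit : Fin N → ℚ
      unit w = 𝟙 (w Fin.≟ j)
      D₁ : Fin N → Fin N → ℚ
      D₁ = setRow D j unit

    -- A permutation contributing to det D₁ fixes j and maps every u to u or φ⁻¹ u; following φ⁻¹ from a
    -- letter that is moved, it would move j.
    only-id : ∀ π → (∀ u → D₁ u (π ⟨$⟩ʳ u) ≢ 0ℚ) → π ≈ₚ idₚ
    only-id π ≢0 u with (π ⟨$⟩ʳ u) Fin.≟ u
    ... | yes e = e
    ... | no  m = contradiction fix-j (subst (λ x → π ⟨$⟩ʳ x ≢ x) (proj₂ to-j) (moved (proj₁ to-j)))
      where
      to-j : ∃ λ k → pow (flip φ) k u ≡ j
      to-j = SameCycle⇒∼ (flip φ) (SameCycle-flip φ (long u j))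
      fix-j : π ⟨$⟩ʳ j ≡ j
      fix-j = decidable-stable ((π ⟨$⟩ʳ j) Fin.≟ j) λ ne → ≢0 j (trans (setRow-at D j unit (π ⟨$⟩ʳ j)) (𝟙-no ((π ⟨$⟩ʳ j) Fin.≟ j) ne))
      back : ∀ x → π ⟨$⟩ʳ x ≢ x → φ ⟨$⟩ʳ (π ⟨$⟩ʳ x) ≡ x
      back x ne = decidable-stable ((φ ⟨$⟩ʳ (π ⟨$⟩ʳ x)) Fin.≟ x) λ ne′ → ≢0 x (trans (setRow-away D j unit (λ { refl → ne fix-j }) (π ⟨$⟩ʳ x))
        (cong₂ (λ p q → p + - q) (𝟙-no ((π ⟨$⟩ʳ x) Fin.≟ x) ne) (𝟙-no ((φ ⟨$⟩ʳ (π ⟨$⟩ʳ x)) Fin.≟ x) ne′)))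
      moved : ∀ k → π ⟨$⟩ʳ pow (flip φ) k u ≢ pow (flip φ) k u
      moved zero    = m
      moved (suc k) e = moved k (to-injective π (trans (cong (π ⟨$⟩ʳ_) (to⇒from φ (back x (moved k)))) (trans e (sym (to⇒from φ (back x (moved k)))))))
        where x = pow (flip φ) k u

    det-D₁ : det D₁ ≡ 1ℚ
    det-D₁ = trans (∑-cong (𝔖 N) λ π → cases π (Fin.any? (λ u → D₁ u (π ⟨$⟩ʳ u) ℚ.≟ 0ℚ))) (perms! {N} idₚ)
      where
      diagonal : ∀ u → D₁ u u ≡ 1ℚ
      diagonal u = go (u Fin.≟ j)
        where
        go : Dec (u ≡ j) → D₁ u u ≡ 1ℚ
        go (yes refl) = trans (setRow-at D j unit j) (𝟙-yes (j Fin.≟ j) refl)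
        -- A letter u other than j is moved by φ, since its cycle contains j; so only the first
        -- indicator is nonzero.
        go (no u≢j) = trans (setRow-away D j unit u≢j u) (cong₂ (λ p q → p + - q) (𝟙-yes (u Fin.≟ u) refl) (𝟙-no ((φ ⟨$⟩ʳ u) Fin.≟ u) moves))
          where
          stays : φ ⟨$⟩ʳ u ≡ u → ∀ k → pow φ k u ≡ u
          stays e zero    = refl
          stays e (suc k) = trans (cong (φ ⟨$⟩ʳ_) (stays e k)) e
          moves : φ ⟨$⟩ʳ u ≢ u
          moves e = u≢j (trans (sym (stays e (proj₁ (SameCycle⇒∼ φ (long u j))))) (proj₂ (SameCycle⇒∼ φ (long u j))))
      prod-1 : ∀ {m} (f : Fin m → ℚ) → (∀ u → f u ≡ 1ℚ) → prod f ≡ 1ℚ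
      prod-1 {zero}  f e = prod-[] f
      prod-1 {suc m} f e = trans (prod-suc f) (cong₂ _*_ (e zero) (prod-1 (f ∘ suc) (e ∘ suc)))
      cases : ∀ π → Dec (∃ λ u → D₁ u (π ⟨$⟩ʳ u) ≡ 0ℚ) → sign π * prod (λ u → D₁ u (π ⟨$⟩ʳ u)) ≡ 𝟙 (π ≈ₚ? idₚ)
      cases π (yes (u , e)) = trans (cong (sign π *_) (trans (prod-punchIn u (λ u → D₁ u (π ⟨$⟩ʳ u))) (trans (cong (_* prod (λ p → D₁ (Fin.punchIn u p) (π ⟨$⟩ʳ Fin.punchIn u p))) e) (ℚ.*-zeroˡ (prod (λ p → D₁ (Fin.punchIn u p) (π ⟨$⟩ʳ Fin.punchIn u p)))))))
        (trans (ℚ.*-zeroʳ (sign π)) (sym (𝟙-no (π ≈ₚ? idₚ) λ i → contradiction (trans (sym (diagonal u)) (trans (cong (D₁ u) (sym (i u))) e)) λ ())))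
      cases π (no ¬z) = trans (cong₂ _*_ (trans (sign-cong {σ = π} {idₚ} i) sign-id) (prod-1 (λ u → D₁ u (π ⟨$⟩ʳ u)) λ u → trans (cong (D₁ u) (i u)) (diagonal u)))
        (sym (𝟙-yes (π ≈ₚ? idₚ) i))
        where
        i : π ≈ₚ idₚ
        i = only-id π (λ u e → ¬z (u , e))

    -- The constant row of M is (1 − N e_j) + N e_j, and with the row 1 − N e_j all rows add up to 0.
    det-long : det M ≡ ι N
    det-long = begin
      det M ≡⟨ det-cong (λ u w → row-cong u (λ w → sym (combination w)) w) ⟩
      det (setRow D j (λ w → sum (λ i → c i * r i w))) ≡⟨ det-row-linear D j c r ⟩
      sum (λ i → c i * det (setRow D j (r i))) ≡⟨ trans (sum-suc (λ i → c i * det (setRow D j (r i)))) (cong (c zero * det (setRow D j balanced) +_) (trans (sum-suc (λ i → c (suc i) * det (setRow D j (r (suc i))))) (cong (λ x → ι N * det D₁ + x) (sum-[] (λ i → c (suc (suc i)) * det (setRow D j (r (suc (suc i))))))))) ⟩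
      1ℚ * det (setRow D j balanced) + (ι N * det D₁ + 0ℚ) ≡⟨ cong₂ (λ x y → 1ℚ * x + (ι N * y + 0ℚ)) det-balanced det-D₁ ⟩
      1ℚ * 0ℚ + (ι N * 1ℚ + 0ℚ) ≡⟨ simplify (ι N) ⟩
      ι N ∎
      where
      open ≡-Reasoning
      balanced : Fin N → ℚ
      balanced w = 1ℚ + - (ι N * unit w)
      c : Fin 2 → ℚ
      c zero    = 1ℚ
      c (suc _) = ι N
      r : Fin 2 → Fin N → ℚ
      r zero    = balanced
      r (suc _) = unit
      simplify : ∀ x → 1ℚ * 0ℚ + (x * 1ℚ + 0ℚ) ≡ x
      simplify = solve 1 (λ x → con 1ℚ :* con 0ℚ :+ (x :* con 1ℚ :+ con 0ℚ) := x) refl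
        where open ℚ-Solver
      one : ∀ x y → 1ℚ * (1ℚ + - (x * y)) + (x * y + 0ℚ) ≡ 1ℚ
      one = solve 2 (λ x y → con 1ℚ :* (con 1ℚ :+ :- (x :* y)) :+ (x :* y :+ con 0ℚ) := con 1ℚ) refl
        where open ℚ-Solver
      combination : ∀ w → sum (λ i → c i * r i w) ≡ 1ℚ
      combination w = trans (sum-suc (λ i → c i * r i w)) (trans (cong (1ℚ * balanced w +_) (trans (sum-suc (λ i → c (suc i) * r (suc i) w)) (cong (ι N * unit w +_) (sum-[] (λ i → c (suc (suc i)) * r (suc (suc i)) w))))) (one (ι N) (unit w)))
      row-cong : ∀ u {r r′ : Fin N → ℚ} → (∀ w → r w ≡ r′ w) → ∀ w → setRow D j r u w ≡ setRow D j r′ u w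
      row-cong u e w = cong (λ x → if does (u Fin.≟ j) then x else D u w) (e w)
      sum-1 : sum {N} (λ _ → 1ℚ) ≡ ι N
      sum-1 = constant N
        where
        constant : ∀ k → sum {k} (λ _ → 1ℚ) ≡ ι k
        constant zero    = sum-[] (λ _ → 1ℚ)
        constant (suc k) = trans (sum-suc (λ _ → 1ℚ)) (cong (1ℚ +_) (constant k))
      sum-neg : ∀ {m} (f : Fin m → ℚ) → sum (λ i → - f i) ≡ - sum f
      sum-neg f = trans (sum-cong λ i → neg (f i)) (trans (sym (sum-*ˡ (- 1ℚ) f)) (sym (neg (sum f))))
        where
        neg : ∀ x → - x ≡ - 1ℚ * x
        neg x = trans (cong -_ (sym (ℚ.*-identityˡ x))) (ℚ.neg-distribˡ-* 1ℚ x)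
      unit-sum : ∀ u → sum (λ w → 𝟙 (w Fin.≟ u)) ≡ 1ℚ
      unit-sum u = trans (sum-cong λ w → 𝟙-cong (w Fin.≟ u) (u Fin.≟ w) sym sym) (sum-single-1 u)
      columns : ∀ u → sum (λ w → 1ℚ * setRow D j balanced u w) ≡ 0ℚ
      columns u = trans (sum-cong λ w → ℚ.*-identityˡ (setRow D j balanced u w)) (go (u Fin.≟ j))
        where
        go : Dec (u ≡ j) → sum (λ w → setRow D j balanced u w) ≡ 0ℚ
        go (yes refl) = begin
          sum (λ w → setRow D u balanced u w) ≡⟨ sum-cong (setRow-at D u balanced) ⟩
          sum (λ w → 1ℚ + - (ι N * unit w)) ≡⟨ sum-+ (λ _ → 1ℚ) (λ w → - (ι N * unit w)) ⟩
          sum {N} (λ _ → 1ℚ) + sum (λ w → - (ι N * unit w)) ≡⟨ cong₂ _+_ sum-1 (trans (sum-neg (λ w → ι N * unit w)) (cong -_ (trans (sym (sum-*ˡ (ι N) unit)) (trans (cong (ι N *_) (unit-sum u)) (ℚ.*-identityʳ (ι N)))))) ⟩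
          ι N + - ι N ≡⟨ ℚ.+-inverseʳ (ι N) ⟩
          0ℚ ∎
        go (no u≢j) = begin
          sum (λ w → setRow D j balanced u w) ≡⟨ sum-cong (setRow-away D j balanced u≢j) ⟩
          sum (λ w → 𝟙 (w Fin.≟ u) + - 𝟙 ((φ ⟨$⟩ʳ w) Fin.≟ u)) ≡⟨ sum-+ (λ w → 𝟙 (w Fin.≟ u)) (λ w → - 𝟙 ((φ ⟨$⟩ʳ w) Fin.≟ u)) ⟩
          sum (λ w → 𝟙 (w Fin.≟ u)) + sum (λ w → - 𝟙 ((φ ⟨$⟩ʳ w) Fin.≟ u)) ≡⟨ cong₂ _+_ (unit-sum u) (trans (sum-neg (λ w → 𝟙 ((φ ⟨$⟩ʳ w) Fin.≟ u))) (cong -_ (trans (sum-permute (λ w → 𝟙 (w Fin.≟ u)) φ) (unit-sum u)))) ⟩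
          1ℚ + - 1ℚ ≡⟨ ℚ.+-inverseʳ 1ℚ ⟩
          0ℚ ∎
      det-balanced : det (setRow D j balanced) ≡ 0ℚ
      -- Vanishing row sums are a relation between the columns, hence the transpose.
      det-balanced = trans (sym (det-transpose (setRow D j balanced))) (det-dependent-rows (λ u w → setRow D j balanced w u) zero (λ _ → 1ℚ) refl columns)

-- If φ is an n-cycle, each of the N determinants is N; otherwise every j has a letter outside its
-- cycle and they vanish. One of the two factors N cancels against the left side of
-- `alternating-hooks`.
alternating-hooks-long : ∀ {n} (φ : Permutation′ (suc n)) → sum (λ a → [-1]^ toℕ a * Trace.hookχ a φ) ≡ ι (suc n) * 𝟙 (long? φ)
alternating-hooks-long {n} φ = *-cancelˡ {ι N} (ι-suc≢0 n) (trans (alternating-hooks φ) (cases (long? φ)))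
  where
  N = suc n
  constant : ∀ x k → sum {k} (λ _ → x) ≡ ι k * x
  constant x zero    = trans (sum-[] (λ _ → x)) (sym (ℚ.*-zeroˡ x))
  constant x (suc k) = trans (sum-suc (λ _ → x)) (trans (cong (x +_) (constant x k)) (sym (trans (ℚ.*-distribʳ-+ x 1ℚ (ι k)) (cong (_+ ι k * x) (ℚ.*-identityˡ x)))))
  cases : (d : Dec (Long φ)) → sum (λ j → det (cycleMatrix φ j)) ≡ ι N * (ι N * 𝟙 d)
  cases d@(yes long) = trans (sum-cong λ j → det-long φ j long) (trans (constant (ι N) N) (cong (ι N *_) (sym (trans (cong (ι N *_) (𝟙-yes d long)) (ℚ.*-identityʳ (ι N))))))
  cases d@(no ¬long) = trans (sum-zero λ j → det-short φ j (proj₁ (elsewhere j)) (proj₂ (elsewhere j)))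
    (sym (trans (cong (λ x → ι N * (ι N * x)) (𝟙-no d ¬long)) (trans (cong (ι N *_) (ℚ.*-zeroʳ (ι N))) (ℚ.*-zeroʳ (ι N)))))
    where
    elsewhere : ∀ j → ∃ λ z → ¬ SameCycle φ j z
    elsewhere j = Fin.¬∀⟶∃¬ N (SameCycle φ j) (sameCycle? φ j) (λ all → ¬long (λ x y → SameCycle-trans φ (SameCycle-sym φ (all x)) (all y)))

-- Hook characters as class functions

module _ {n} (a : Fin (suc n)) where
  private
    N = suc n
    y₀ = tabloid₀ (hook N a)
  open Trace a

  classSum-cong : ∀ {σ τ} → σ ≈ₚ τ → classSum σ ≡ classSum τ
  classSum-cong {σ} {τ} e = ∑-cong (𝔖 N) λ g → F-resp a y₀ {flip g · flip σ · g} {flip g · flip τ · g} (λ x → cong (g ⟨$⟩ˡ_) (inverse-cong σ τ e (g ⟨$⟩ʳ x)))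

  -- Since g runs over the whole group, h is absorbed by replacing g with h g. Invariance of the
  -- character under conjugation is then read off from `trace-formula`.
  classSum-conj : ∀ h σ → classSum (h · σ · flip h) ≡ classSum σ
  classSum-conj h σ = trans (sym (∑-left {F = G} (λ {g} {g′} → G-resp {g} {g′}) h)) (∑-cong (𝔖 N) λ g →
    F-resp a y₀ {flip (h · g) · flip (h · σ · flip h) · h · g} {flip g · flip σ · g} (λ x → cong (g ⟨$⟩ˡ_)
      (trans (inverseˡ h) (cong (σ ⟨$⟩ˡ_) (inverseˡ h)))))
    where
    G : Permutation′ N → ℚ
    G g = F a y₀ (flip g · flip (h · σ · flip h) · g)
    G-resp : Resp G
    G-resp {g} {g′} e = F-resp a y₀ {flip g · flip (h · σ · flip h) · g} {flip g′ · flip (h · σ · flip h) · g′} (λ x →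
      trans (inverse-cong g g′ e (flip (h · σ · flip h) ⟨$⟩ʳ (g ⟨$⟩ʳ x))) (cong (λ z → g′ ⟨$⟩ˡ (flip (h · σ · flip h) ⟨$⟩ʳ z)) (e x)))

  order≢0 : ι (order a) ≢ 0ℚ
  order≢0 = ι≢0 (order a) {{ℕ.m*n≢0 (toℕ a ! ℕ.* (n ∸ toℕ a) !) N {{toℕ a ℕ.!* (n ∸ toℕ a) !≢0}}}}

  hookχ-classSum : ∀ {σ τ} → classSum σ ≡ classSum τ → hookχ σ ≡ hookχ τ
  hookχ-classSum {σ} {τ} e = *-cancelˡ {ι (order a)} order≢0 (trans (trace-formula σ) (trans e (sym (trace-formula τ))))

  hookχ-cong : ∀ {σ τ} → σ ≈ₚ τ → hookχ σ ≡ hookχ τ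
  hookχ-cong {σ} {τ} e = hookχ-classSum {σ} {τ} (classSum-cong {σ} {τ} e)

  classSum-conjugate : ∀ σ τ → (∃ λ g → τ ≈ₚ g · σ · flip g) → classSum σ ≡ classSum τ
  classSum-conjugate σ τ (g , e) = sym (trans (classSum-cong {τ} {g · σ · flip g} e) (classSum-conj g σ))

  hookχ-cycleType : ∀ σ τ → cycleType σ ≡ cycleType τ → hookχ σ ≡ hookχ τ
  hookχ-cycleType σ τ types = hookχ-classSum {σ} {τ} (classSum-conjugate σ τ (conjugate σ τ types))

open import Data.Integer.Base using (+_)
open import Data.Nat.Base using (_≤_)
open import Data.Rational.Base using (_/_)

-- The action of Σ_σ t^cyc(σ) σ

module L = CommutativeSemiring laurentSemiring
module L∑ = PermSums laurentSemiring

const-cong : ∀ {a b} → a ≡ b → const a ≈ᴸ const b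
const-cong refl k = refl

const-∑ : ∀ {X : Set} (xs : List X) (f : X → ℚ) → const (∑ xs f) ≈ᴸ L∑.∑ xs (λ x → const (f x))
const-∑ []       f = begin
  const (∑ [] f) ≈⟨ const-cong (∑-[] f) ⟩
  const 0ℚ ≈⟨ const-0 ⟩
  [] ≈⟨ L∑.∑-[] (λ x → const (f x)) ⟨
  L∑.∑ [] (λ x → const (f x)) ∎
  where open import Relation.Binary.Reasoning.Setoid L.setoid
const-∑ (x ∷ xs) f = begin
  const (∑ (x ∷ xs) f) ≈⟨ const-cong (∑-∷ x xs f) ⟩
  const (f x + ∑ xs f) ≈⟨ const-+ (f x) (∑ xs f) ⟩
  const (f x) +ᴸ const (∑ xs f) ≈⟨ L.+-congˡ {const (f x)} {const (∑ xs f)} {L∑.∑ xs (λ x → const (f x))} (const-∑ xs f) ⟩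
  const (f x) +ᴸ L∑.∑ xs (λ x → const (f x)) ≈⟨ L∑.∑-∷ x xs (λ x → const (f x)) ⟨
  L∑.∑ (x ∷ xs) (λ x → const (f x)) ∎
  where open import Relation.Binary.Reasoning.Setoid L.setoid

const-sum : ∀ {n} (f : Fin n → ℚ) → const (sum f) ≈ᴸ L∑.sum (λ i → const (f i))
const-sum {zero} f = begin
  const (sum f) ≈⟨ const-cong (sum-[] f) ⟩
  const 0ℚ ≈⟨ const-0 ⟩
  [] ≈⟨ L∑.sum-[] (λ i → const (f i)) ⟨
  L∑.sum (λ i → const (f i)) ∎
  where open import Relation.Binary.Reasoning.Setoid L.setoid
const-sum {suc n} f = begin
  const (sum f) ≈⟨ const-cong (sum-suc f) ⟩
  const (f zero + sum (λ i → f (suc i))) ≈⟨ const-+ (f zero) (sum (λ i → f (suc i))) ⟩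
  const (f zero) +ᴸ const (sum (λ i → f (suc i))) ≈⟨ L.+-congˡ {const (f zero)} {const (sum (λ i → f (suc i)))} {L∑.sum (λ i → const (f (suc i)))} (const-sum (f ∘ suc)) ⟩
  const (f zero) +ᴸ L∑.sum (λ i → const (f (suc i))) ≈⟨ L∑.sum-suc (λ i → const (f i)) ⟨
  L∑.sum (λ i → const (f i)) ∎
  where open import Relation.Binary.Reasoning.Setoid L.setoid

const-𝟙 : ∀ {A : Set} (d : Dec A) → const (𝟙 d) ≈ᴸ L∑.𝟙 d
const-𝟙 d@(yes a) = begin
  const (𝟙 d) ≈⟨ const-cong (𝟙-yes d a) ⟩
  const 1ℚ ≈⟨ L∑.𝟙-yes d a ⟨
  L∑.𝟙 d ∎
  where open import Relation.Binary.Reasoning.Setoid L.setoid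
const-𝟙 d@(no ¬a) = begin
  const (𝟙 d) ≈⟨ const-cong (𝟙-no d ¬a) ⟩
  const 0ℚ ≈⟨ const-0 ⟩
  [] ≈⟨ L∑.𝟙-no d ¬a ⟨
  L∑.𝟙 d ∎
  where open import Relation.Binary.Reasoning.Setoid L.setoid

/1-+ : ∀ x y → (x ℤ.+ y) ℚ./ 1 ≡ x ℚ./ 1 + y ℚ./ 1
/1-+ x y = ℚ.toℚᵘ-injective (begin
  ℚ.toℚᵘ ((x ℤ.+ y) ℚ./ 1) ≈⟨ ℚ.toℚᵘ-fromℚᵘ (mkℚᵘ (x ℤ.+ y) 0) ⟩
  mkℚᵘ (x ℤ.+ y) 0 ≈⟨ *≡* (cong (ℤ._* (+ 1)) (sym (cong₂ ℤ._+_ (ℤ.*-identityʳ x) (ℤ.*-identityʳ y)))) ⟩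
  mkℚᵘ x 0 ℚᵘ.+ mkℚᵘ y 0 ≈⟨ ℚᵘ.+-cong (ℚ.toℚᵘ-fromℚᵘ (mkℚᵘ x 0)) (ℚ.toℚᵘ-fromℚᵘ (mkℚᵘ y 0)) ⟨
  ℚ.toℚᵘ (x ℚ./ 1) ℚᵘ.+ ℚ.toℚᵘ (y ℚ./ 1) ≈⟨ ℚ.toℚᵘ-homo-+ (x ℚ./ 1) (y ℚ./ 1) ⟨
  ℚ.toℚᵘ (x ℚ./ 1 + y ℚ./ 1) ∎)
  where open ℚᵘ.≃-Reasoning

ι≡/1 : ∀ k → ι k ≡ (+ k) ℚ./ 1
ι≡/1 zero    = refl
ι≡/1 (suc k) = trans (cong (λ z → 1ℚ + z) (ι≡/1 k)) (sym (/1-+ (+ 1) (+ k)))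

content : ℕ → ℕ → ℚ
content j a = ((+ j) ℤ.- (+ a)) ℚ./ 1

content-arm : ∀ k a → content (k ℕ.+ a) a ≡ ι k
content-arm k a = trans (cong (ℚ._/ 1) (ℤ-Solver.solve 2 (λ k a → k :+ a :- a := k) refl (+ k) (+ a))) (sym (ι≡/1 k))
  where open ℤ-Solver

content-leg : ∀ j a → j ℕ.≤ a → content j a ≡ - ι (a ∸ j)
content-leg j a j≤a = begin
  content j a ≡⟨ ℚ.+-identityʳ (content j a) ⟨
  content j a + 0ℚ ≡⟨ cong (λ z → content j a + z) (ℚ.+-inverseʳ (ι (a ∸ j))) ⟨
  content j a + (ι (a ∸ j) + - ι (a ∸ j)) ≡⟨ ℚ.+-assoc (content j a) (ι (a ∸ j)) (- ι (a ∸ j)) ⟨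
  content j a + ι (a ∸ j) + - ι (a ∸ j) ≡⟨ cong (_+ - ι (a ∸ j)) (trans (cong (λ z → content j a + z) (ι≡/1 (a ∸ j))) (trans (sym (/1-+ ((+ j) ℤ.- (+ a)) (+ (a ∸ j)))) (cong (ℚ._/ 1) cancel))) ⟩
  0ℚ + - ι (a ∸ j) ≡⟨ ℚ.+-identityˡ (- ι (a ∸ j)) ⟩
  - ι (a ∸ j) ∎
  where
  open ≡-Reasoning
  cancel : (+ j) ℤ.- (+ a) ℤ.+ (+ (a ∸ j)) ≡ 0ℤ
  cancel = trans (cong (λ z → (+ j) ℤ.- (+ z) ℤ.+ (+ (a ∸ j))) (sym (ℕ.m+[n∸m]≡n j≤a)))
    (ℤ-Solver.solve 2 (λ j d → j :- (j :+ d) :+ d := con 0ℤ) refl (+ j) (+ (a ∸ j)))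
    where open ℤ-Solver

κℕ-suc : ∀ b n i → κℕ (suc b) (suc n) (suc i) ≡ κℕ b n i
κℕ-suc b n i = cong (if_then - ι (n ∸ i) else ι (b ∸ i)) (shift b)
  where
  shift : ∀ b → (suc b ℕ.≤ᵇ suc i) ≡ (b ℕ.≤ᵇ i)
  shift zero    = refl
  shift (suc b) = refl

t+ : ℚ → Laurent
t+ x = t^ 1ℤ +ᴸ const x

t+-cong : ∀ {x y} → x ≡ y → t+ x ≈ᴸ t+ y
t+-cong refl k = refl

-- Both products run over -a, ..., b: `κℕ` lists b, ..., 1 and then -a, ..., 0, while `content`
-- lists them in increasing order. Each step of the induction on b moves the leading factor to the
-- end.
prod-contents : ∀ b a → L∑.prod {suc (b ℕ.+ a)} (λ i → t+ (κℕ b (b ℕ.+ a) (toℕ i))) ≈ᴸ L∑.prod {suc (b ℕ.+ a)} (λ j → t+ (content (toℕ j) a))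
prod-contents zero    a = L∑.prod-cong {f = λ i → t+ (κℕ 0 a (toℕ i))} {λ j → t+ (content (toℕ j) a)} λ i → t+-cong (sym (content-leg (toℕ i) a (ℕ.≤-pred (Fin.toℕ<n i))))
prod-contents (suc b) a = begin
  L∑.prod (λ i → t+ (κℕ (suc b) m (toℕ i)))
    ≈⟨ L∑.prod-suc (λ i → t+ (κℕ (suc b) m (toℕ i))) ⟩
  t+ (ι (suc b)) *ᴸ L∑.prod {m} (λ i → t+ (κℕ (suc b) m (suc (toℕ i))))
    ≈⟨ L.*-congˡ {t+ (ι (suc b))} {L∑.prod {m} (λ i → t+ (κℕ (suc b) m (suc (toℕ i))))} {L∑.prod {m} (λ i → t+ (κℕ b (b ℕ.+ a) (toℕ i)))} (L∑.prod-cong {f = λ i → t+ (κℕ (suc b) m (suc (toℕ i)))} {λ i → t+ (κℕ b (b ℕ.+ a) (toℕ i))} λ i → t+-cong (κℕ-suc b (b ℕ.+ a) (toℕ i))) ⟩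
  t+ (ι (suc b)) *ᴸ L∑.prod {m} (λ i → t+ (κℕ b (b ℕ.+ a) (toℕ i)))
    ≈⟨ L.*-congˡ {t+ (ι (suc b))} {L∑.prod {m} (λ i → t+ (κℕ b (b ℕ.+ a) (toℕ i)))} {L∑.prod {m} (λ j → t+ (content (toℕ j) a))} (prod-contents b a) ⟩
  t+ (ι (suc b)) *ᴸ L∑.prod {m} (λ j → t+ (content (toℕ j) a))
    ≈⟨ L.*-comm (t+ (ι (suc b))) (L∑.prod {m} (λ j → t+ (content (toℕ j) a))) ⟩
  L∑.prod {m} (λ j → t+ (content (toℕ j) a)) *ᴸ t+ (ι (suc b))
    ≈⟨ L.*-cong {L∑.prod {m} (λ j → t+ (content (toℕ j) a))} {L∑.prod {m} (λ j → t+ (content (toℕ (Fin.inject₁ j)) a))} {t+ (ι (suc b))} {t+ (content (toℕ (Fin.fromℕ m)) a)}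
         (L∑.prod-cong {f = λ j → t+ (content (toℕ j) a)} {λ j → t+ (content (toℕ (Fin.inject₁ j)) a)} (λ j → t+-cong (cong (λ z → content z a) (sym (Fin.toℕ-inject₁ j)))))
         (t+-cong (trans (sym (content-arm (suc b) a)) (cong (λ z → content z a) (sym (Fin.toℕ-fromℕ m))))) ⟩
  L∑.prod {m} (λ j → t+ (content (toℕ (Fin.inject₁ j)) a)) *ᴸ t+ (content (toℕ (Fin.fromℕ m)) a)
    ≈⟨ L∑.prod-init-last (λ j → t+ (content (toℕ j) a)) ⟨
  L∑.prod {suc m} (λ j → t+ (content (toℕ j) a)) ∎
  where
  open import Relation.Binary.Reasoning.Setoid L.setoid
  m = suc (b ℕ.+ a)

prod-contents′ : ∀ {b a n} → b ℕ.+ a ≡ n → L∑.prod {suc n} (λ i → t+ (κℕ b n (toℕ i))) ≈ᴸ H (suc n) a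
prod-contents′ {b} {a} refl = L.trans {L∑.prod {suc (b ℕ.+ a)} (λ i → t+ (κℕ b (b ℕ.+ a) (toℕ i)))} {L∑.prod {suc (b ℕ.+ a)} (λ j → t+ (content (toℕ j) a))} {H (suc (b ℕ.+ a)) a}
  (prod-contents b a) (L.reflexive {L∑.prod {suc (b ℕ.+ a)} (λ j → t+ (content (toℕ j) a))} {H (suc (b ℕ.+ a)) a} (sym (L∑.∏-applyUpTo (λ j → j) (suc (b ℕ.+ a)) (λ j → t+ (content j a)))))

tᶜ : ∀ {n} → Permutation′ n → Laurent
tᶜ σ = t^ (+ cycles σ)

module Eigenvalues {n : ℕ} (a : Fin (suc n)) where
  open Contents a using (h; eigen)
  open Trace a
  private
    N = suc n
    b = n ∸ toℕ a
    Φ = F a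

  open import Relation.Binary.Reasoning.Setoid L.setoid

  -- The number of cycles is invariant under conjugation, so σ may be replaced by h σ h⁻¹. This
  -- brings the letters b, ..., n into the column, where F is an eigenfunction of each Jucys-Murphy
  -- element.
  F-eigen : ∀ y ρ → L∑.∑ (𝔖 N) (λ σ → tᶜ σ *ᴸ const (Φ y (σ · ρ))) ≈ᴸ H N (toℕ a) *ᴸ const (Φ y ρ)
  F-eigen y ρ = begin
    L∑.∑ (𝔖 N) G ≈⟨ L∑.∑-conj {F = G} (λ {σ} {τ} → G-resp {σ} {τ}) h ⟨
    L∑.∑ (𝔖 N) (λ σ → G (h · σ · flip h)) ≈⟨ L∑.∑-cong (𝔖 N) {λ σ → G (h · σ · flip h)} {λ σ → tᶜ σ *ᴸ const (Φ y (h · σ · flip h · ρ))} (λ σ → L.reflexive (cong (λ k → t^ (+ k) *ᴸ const (Φ y (h · σ · flip h · ρ))) (cycles-conj h σ))) ⟩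
    L∑.∑ (𝔖 N) (λ σ → tᶜ σ *ᴸ const (Φ y (h · σ · flip h · ρ))) ≈⟨ Jucys.∑-cycles laurentSemiring (t^ 1ℤ) (λ k → t^ (+ k)) (λ _ → refl) (λ _ _ → refl) κ F′ (λ {σ} {τ} → F′-resp {σ} {τ}) eigen′ (flip h · ρ) ⟩
    L∑.prod (λ i → t+ (κℕ b n (toℕ i))) *ᴸ const (Φ y (h · flip h · ρ)) ≈⟨ L.*-cong {L∑.prod (λ i → t+ (κℕ b n (toℕ i)))} {H N (toℕ a)} {const (Φ y (h · flip h · ρ))} {const (Φ y ρ)} (prod-contents′ (ℕ.m∸n+n≡m (a≤n a))) (const-cong (F-resp a y {h · flip h · ρ} {ρ} (λ x → inverseʳ h {ρ ⟨$⟩ʳ x}))) ⟩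
    H N (toℕ a) *ᴸ const (Φ y ρ) ∎
    where
    G : Permutation′ N → Laurent
    G σ = tᶜ σ *ᴸ const (Φ y (σ · ρ))
    G-resp : L∑.Resp G
    G-resp {σ} {τ} e = L.reflexive (cong₂ (λ k x → t^ (+ k) *ᴸ const x) (cycles-cong {σ = σ} {τ} e) (F-resp a y {σ · ρ} {τ · ρ} (λ i → e (ρ ⟨$⟩ʳ i))))
    κ : Fin N → Laurent
    κ i = const (κℕ b n (toℕ i))
    F′ : Permutation′ N → Laurent
    F′ σ = const (Φ y (h · σ))
    F′-resp : L∑.Resp F′
    F′-resp {σ} {τ} e = const-cong (F-resp a y {h · σ} {h · τ} (λ i → cong (h ⟨$⟩ʳ_) (e i)))
    eigen′ : ∀ i σ → L∑.sum (λ j → L∑.𝟙 (i Fin.<? j) *ᴸ F′ (transpose i j · σ)) ≈ᴸ κ i *ᴸ F′ σ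
    eigen′ i σ = begin
      L∑.sum (λ j → L∑.𝟙 (i Fin.<? j) *ᴸ F′ (transpose i j · σ)) ≈⟨ L∑.sum-cong {f = λ j → L∑.𝟙 (i Fin.<? j) *ᴸ F′ (transpose i j · σ)} {λ j → const (𝟙 (i Fin.<? j) * Φ y (h · transpose i j · σ))} (λ j → L.*-congʳ {F′ (transpose i j · σ)} {L∑.𝟙 (i Fin.<? j)} {const (𝟙 (i Fin.<? j))} (L.sym {const (𝟙 (i Fin.<? j))} {L∑.𝟙 (i Fin.<? j)} (const-𝟙 (i Fin.<? j)))) ⟩
      L∑.sum (λ j → const (𝟙 (i Fin.<? j) * Φ y (h · transpose i j · σ))) ≈⟨ const-sum (λ j → 𝟙 (i Fin.<? j) * Φ y (h · transpose i j · σ)) ⟨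
      const (sum (λ j → 𝟙 (i Fin.<? j) * Φ y (h · transpose i j · σ))) ≈⟨ const-cong (eigen y i σ) ⟩
      κ i *ᴸ F′ σ ∎

  y₀ = tabloid₀ (hook N a)

  -- In F(g⁻¹ (σ φ)⁻¹ g) the variable σ is inverted and stands between other factors. As the weight
  -- is invariant under inversion and conjugation, it can be brought to the front, where `F-eigen`
  -- applies.
  classSum-eigen : ∀ φ → L∑.∑ (𝔖 N) (λ σ → tᶜ σ *ᴸ const (classSum (σ · φ))) ≈ᴸ H N (toℕ a) *ᴸ const (classSum φ)
  classSum-eigen φ = begin
    L∑.∑ (𝔖 N) (λ σ → tᶜ σ *ᴸ const (classSum (σ · φ))) ≈⟨ L∑.∑-cong (𝔖 N) {λ σ → tᶜ σ *ᴸ const (classSum (σ · φ))} {λ σ → L∑.∑ (𝔖 N) (λ g → tᶜ σ *ᴸ const (f g σ))} (λ σ → L.trans {tᶜ σ *ᴸ const (classSum (σ · φ))} {tᶜ σ *ᴸ L∑.∑ (𝔖 N) (λ g → const (f g σ))} {L∑.∑ (𝔖 N) (λ g → tᶜ σ *ᴸ const (f g σ))} (L.*-congˡ {tᶜ σ} {const (classSum (σ · φ))} {L∑.∑ (𝔖 N) (λ g → const (f g σ))} (const-∑ (𝔖 N) (λ g → f g σ))) (L∑.∑-*ˡ (tᶜ σ) (𝔖 N) (λ g → const (f g σ)))) ⟩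
    L∑.∑ (𝔖 N) (λ σ → L∑.∑ (𝔖 N) (λ g → tᶜ σ *ᴸ const (f g σ))) ≈⟨ L∑.∑-swap (𝔖 N) (𝔖 N) (λ σ g → tᶜ σ *ᴸ const (f g σ)) ⟩
    L∑.∑ (𝔖 N) (λ g → L∑.∑ (𝔖 N) (λ σ → tᶜ σ *ᴸ const (f g σ))) ≈⟨ L∑.∑-cong (𝔖 N) {λ g → L∑.∑ (𝔖 N) (λ σ → tᶜ σ *ᴸ const (f g σ))} {λ g → H N (toℕ a) *ᴸ const (Φ y₀ (flip g · flip φ · g))} per-g ⟩
    L∑.∑ (𝔖 N) (λ g → H N (toℕ a) *ᴸ const (Φ y₀ (flip g · flip φ · g))) ≈⟨ L∑.∑-*ˡ (H N (toℕ a)) (𝔖 N) (λ g → const (Φ y₀ (flip g · flip φ · g))) ⟨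
    H N (toℕ a) *ᴸ L∑.∑ (𝔖 N) (λ g → const (Φ y₀ (flip g · flip φ · g))) ≈⟨ L.*-congˡ {H N (toℕ a)} {const (classSum φ)} {L∑.∑ (𝔖 N) (λ g → const (Φ y₀ (flip g · flip φ · g)))} (const-∑ (𝔖 N) (λ g → Φ y₀ (flip g · flip φ · g))) ⟨
    H N (toℕ a) *ᴸ const (classSum φ) ∎
    where
    f : Permutation′ N → Permutation′ N → ℚ
    f g σ = Φ y₀ (flip g · flip (σ · φ) · g)
    per-g : ∀ g → L∑.∑ (𝔖 N) (λ σ → tᶜ σ *ᴸ const (f g σ)) ≈ᴸ H N (toℕ a) *ᴸ const (Φ y₀ (flip g · flip φ · g))
    per-g g = begin
      L∑.∑ (𝔖 N) (λ σ → tᶜ σ *ᴸ const (f g σ)) ≈⟨ L∑.∑-cong (𝔖 N) {λ σ → tᶜ σ *ᴸ const (f g σ)} {λ σ → G (x · flip σ · flip x)} (λ σ → L.reflexive (cong₂ (λ k q → t^ (+ k) *ᴸ const q) (sym (trans (cycles-conj x (flip σ)) (cycles-flip σ))) (F-resp a y₀ {flip g · flip (σ · φ) · g} {(x · flip σ · flip x) · ρ} (λ i → cong (λ z → g ⟨$⟩ˡ (φ ⟨$⟩ˡ (σ ⟨$⟩ˡ z))) (sym (trans (cong (φ ⟨$⟩ʳ_) (inverseʳ g)) (inverseʳ φ))))))) ⟩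
      L∑.∑ (𝔖 N) (λ σ → G (x · flip σ · flip x)) ≈⟨ L∑.∑-flip {F = λ σ → G (x · σ · flip x)} (λ {σ} {τ} e → G-resp {x · σ · flip x} {x · τ · flip x} (λ i → cong (x ⟨$⟩ʳ_) (e (x ⟨$⟩ˡ i)))) ⟩
      L∑.∑ (𝔖 N) (λ σ → G (x · σ · flip x)) ≈⟨ L∑.∑-conj {F = G} (λ {σ} {τ} → G-resp {σ} {τ}) x ⟩
      L∑.∑ (𝔖 N) G ≈⟨ F-eigen y₀ ρ ⟩
      H N (toℕ a) *ᴸ const (Φ y₀ ρ) ∎
      where
      x ρ : Permutation′ N
      -- Chosen so that g⁻¹ (σ φ)⁻¹ g = (x σ⁻¹ x⁻¹) ρ.
      x = flip g · flip φ
      ρ = flip g · flip φ · g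
      G : Permutation′ N → Laurent
      G σ = tᶜ σ *ᴸ const (Φ y₀ (σ · ρ))
      G-resp : L∑.Resp G
      G-resp {σ} {τ} e = L.reflexive (cong₂ (λ k q → t^ (+ k) *ᴸ const q) (cycles-cong {σ = σ} {τ} e) (F-resp a y₀ {σ · ρ} {τ · ρ} (λ i → e (ρ ⟨$⟩ʳ i))))

-- The genus generating function

half-double : ∀ x → (x ℤ.* (+ 2)) ℤ./ (+ 2) ≡ x
half-double x = ℤ.*-cancelʳ-≡ q x (+ 2) (sym (trans division (trans (cong (λ r → (+ r) ℤ.+ q ℤ.* (+ 2)) (r≡0 r (n%d<d (x ℤ.* (+ 2)) (+ 2)) division)) (ℤ.+-identityˡ (q ℤ.* (+ 2))))))
  where
  q = (x ℤ.* (+ 2)) ℤ./ (+ 2)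
  r = (x ℤ.* (+ 2)) ℤ.% (+ 2)
  division : x ℤ.* (+ 2) ≡ (+ r) ℤ.+ q ℤ.* (+ 2)
  division = a≡a%n+[a/n]*n (x ℤ.* (+ 2)) (+ 2)
  odd : ∀ k → k ℕ.* 2 ≢ 1
  odd zero    ()
  odd (suc k) ()
  r≡0 : ∀ r → r ℕ.< 2 → x ℤ.* (+ 2) ≡ (+ r) ℤ.+ q ℤ.* (+ 2) → r ≡ 0
  r≡0 zero    _ _ = refl
  -- A remainder of 1 would give 2 |x - q| = 1.
  r≡0 (suc zero) _ e = contradiction (trans (sym (ℤ.abs-* (x ℤ.- q) (+ 2))) (cong ℤ.∣_∣ (trans (ℤ-Solver.solve 2 (λ x q → (x :- q) :* con (+ 2) := x :* con (+ 2) :- q :* con (+ 2)) refl x q) (trans (cong (λ z → z ℤ.- q ℤ.* (+ 2)) e) (ℤ-Solver.solve 1 (λ q → con (+ 1) :+ q :- q := con (+ 1)) refl (q ℤ.* (+ 2))))))) (odd ℤ.∣ x ℤ.- q ∣)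
    where open ℤ-Solver
  r≡0 (suc (suc r)) (ℕ.s≤s (ℕ.s≤s ())) _

[-1]^-even : ∀ E → [-1]^ E ≡ 1ℚ → ∃ λ q → E ≡ q ℕ.* 2
[-1]^-even zero          _ = 0 , refl
[-1]^-even (suc zero)    ()
[-1]^-even (suc (suc E)) e with [-1]^-even E (trans (sym (neg-involutive ([-1]^ E))) e)
... | q , refl = suc q , refl

pos-∸ : ∀ {m n} → m ℕ.≤ n → (+ (n ∸ m)) ≡ (+ n) ℤ.- (+ m)
pos-∸ {m} {n} m≤n = sym (trans (ℤ.m-n≡m⊖n n m) (ℤ.⊖-≥ m≤n))

module _ {n : ℕ} where

  totalCycles : ∀ {k} → Vec (Permutation′ n) k → ℕ
  totalCycles σs = Vec.sum (Vec.map cyc σs)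

  -- The exponent of the sign of the product. For a tuple in 𝓜 the product is the identity, so the
  -- defect of the whole tuple is even.
  defect : ∀ {k} → Vec (Permutation′ n) k → ℕ
  defect []       = 0
  defect (σ ∷ σs) = (n ∸ cycles σ) ℕ.+ defect σs

  sign-product : ∀ {k} (σs : Vec (Permutation′ n) k) → sign (product σs) ≡ [-1]^ defect σs
  sign-product []       = sign-id
  sign-product (σ ∷ σs) = trans (sign-· σ (product σs)) (trans (cong₂ _*_ (sign≡ σ) (sign-product σs)) (sym ([-1]^-+ (n ∸ cycles σ) (defect σs))))

  defect≡ : ∀ {k} (σs : Vec (Permutation′ n) k) → (+ defect σs) ≡ (+ k) ℤ.* (+ n) ℤ.- (+ totalCycles σs)
  defect≡ []               = refl
  defect≡ {suc k} (σ ∷ σs) = trans (cong₂ ℤ._+_ (trans (cong (λ c → + (n ∸ c)) (cycles≡cyc σ)) (pos-∸ (cyc≤n σ))) (defect≡ σs))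
    (ℤ-Solver.solve 4 (λ n c k t → (n :- c) :+ (k :* n :- t) := (con (+ 1) :+ k) :* n :- (c :+ t)) refl (+ n) (+ cyc σ) (+ k) (+ totalCycles σs))
    where open ℤ-Solver

  cyc-class : ∀ {lam : Partition n} {φ} → InClass lam φ → cyc φ ≡ ℓ lam
  cyc-class {φ = φ} c = trans (sym (↭-length (sort-↭ (cycleLengths φ)))) (cong length c)

  -- The numerator in `genus` is the defect of the tuple minus 2 n, hence even, and the division is
  -- exact. The exponent is then ℓ(λ) plus the number of all cycles of the σᵢ minus 1, and the
  -- single cycle of σ₀ cancels the 1.
  genus-exponent : ∀ {k} (lam : Partition n) φ σ (σs : Vec (Permutation′ n) k) → In𝓜 lam (φ , σ ∷ σs) → cyc σ ≡ 1 →
    ((+ suc k) ℤ.- 1ℤ) ℤ.* (+ n) ℤ.+ 1ℤ ℤ.+ (ℤ.- (+ 2)) ℤ.* genus lam (φ , σ ∷ σs) ≡ (+ ℓ lam) ℤ.+ (+ totalCycles σs)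
  genus-exponent {k} lam φ σ σs (e , c , _) cyc≡1 = begin
    ((+ suc k) ℤ.- 1ℤ) ℤ.* (+ n) ℤ.+ 1ℤ ℤ.+ (ℤ.- (+ 2)) ℤ.* (1ℤ ℤ.+ num ℤ./ (+ 2))
      ≡⟨ cong (λ z → ((+ suc k) ℤ.- 1ℤ) ℤ.* (+ n) ℤ.+ 1ℤ ℤ.+ (ℤ.- (+ 2)) ℤ.* (1ℤ ℤ.+ z)) (trans (cong (ℤ._/ (+ 2)) num≡) (half-double x)) ⟩
    ((+ suc k) ℤ.- 1ℤ) ℤ.* (+ n) ℤ.+ 1ℤ ℤ.+ (ℤ.- (+ 2)) ℤ.* (1ℤ ℤ.+ x)
      ≡⟨ solve 2 (λ y x → y :+ con (+ 1) :+ (:- con (+ 2)) :* (con (+ 1) :+ x) := y :- con (+ 1) :- x :* con (+ 2)) refl (((+ suc k) ℤ.- 1ℤ) ℤ.* (+ n)) x ⟩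
    ((+ suc k) ℤ.- 1ℤ) ℤ.* (+ n) ℤ.- 1ℤ ℤ.- x ℤ.* (+ 2)
      ≡⟨ cong (λ z → ((+ suc k) ℤ.- 1ℤ) ℤ.* (+ n) ℤ.- 1ℤ ℤ.- z) (sym num≡) ⟩
    ((+ suc k) ℤ.- 1ℤ) ℤ.* (+ n) ℤ.- 1ℤ ℤ.- (((+ suc k) ℤ.- 1ℤ) ℤ.* (+ n) ℤ.- (+ ℓ lam) ℤ.- (+ (cyc σ ℕ.+ totalCycles σs)))
      ≡⟨ cong (λ z → ((+ suc k) ℤ.- 1ℤ) ℤ.* (+ n) ℤ.- 1ℤ ℤ.- (((+ suc k) ℤ.- 1ℤ) ℤ.* (+ n) ℤ.- (+ ℓ lam) ℤ.- (+ (z ℕ.+ totalCycles σs)))) cyc≡1 ⟩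
    ((+ suc k) ℤ.- 1ℤ) ℤ.* (+ n) ℤ.- 1ℤ ℤ.- (((+ suc k) ℤ.- 1ℤ) ℤ.* (+ n) ℤ.- (+ ℓ lam) ℤ.- (1ℤ ℤ.+ (+ totalCycles σs)))
      ≡⟨ solve 3 (λ y l t → y :- con (+ 1) :- (y :- l :- (con (+ 1) :+ t)) := l :+ t) refl (((+ suc k) ℤ.- 1ℤ) ℤ.* (+ n)) (+ ℓ lam) (+ totalCycles σs) ⟩
    (+ ℓ lam) ℤ.+ (+ totalCycles σs) ∎
    where
    open ≡-Reasoning
    open ℤ-Solver
    num = ((+ suc k) ℤ.- 1ℤ) ℤ.* (+ n) ℤ.- (+ ℓ lam) ℤ.- (+ (cyc σ ℕ.+ totalCycles σs))
    E = defect (φ ∷ σ ∷ σs)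
    even : ∃ λ q → E ≡ q ℕ.* 2
    even = [-1]^-even E (trans (sym (sign-product (φ ∷ σ ∷ σs))) (trans (sign-cong {σ = product (φ ∷ σ ∷ σs)} {idₚ} e) sign-id))
    q = proj₁ even
    -- Half of the numerator, the defect being 2 q.
    x = (+ q) ℤ.- (+ n)
    2q≡ : (+ q) ℤ.* (+ 2) ≡ (+ suc (suc k)) ℤ.* (+ n) ℤ.- (+ (ℓ lam ℕ.+ (cyc σ ℕ.+ totalCycles σs)))
    2q≡ = trans (sym (ℤ.pos-* q 2)) (trans (cong +_ (sym (proj₂ even))) (trans (defect≡ (φ ∷ σ ∷ σs)) (cong (λ l → (+ suc (suc k)) ℤ.* (+ n) ℤ.- (+ (l ℕ.+ (cyc σ ℕ.+ totalCycles σs)))) (cyc-class {lam} {φ} c))))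
    num≡ : num ≡ x ℤ.* (+ 2)
    num≡ = sym (trans (solve 2 (λ q n → (q :- n) :* con (+ 2) := q :* con (+ 2) :- n :* con (+ 2)) refl (+ q) (+ n))
      (trans (cong (λ z → z ℤ.- (+ n) ℤ.* (+ 2)) 2q≡)
        (solve 4 (λ k n l t → (con (+ 2) :+ k) :* n :- (l :+ t) :- n :* con (+ 2) := ((con (+ 1) :+ k) :- con (+ 1)) :* n :- l :- t) refl (+ k) (+ n) (+ ℓ lam) (+ (cyc σ ℕ.+ totalCycles σs)))))

module A = Assembly laurentSemiring

∑ᴸ-[t^] : ∀ {X : Set} (xs : List X) (f : X → Laurent) j → (∑ᴸ xs f) [t^ j ] ≡ ∑ᴸ xs (λ x → f x [t^ j ])
∑ᴸ-[t^] []       f j = refl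
∑ᴸ-[t^] (x ∷ xs) f j = trans (List.map-++ (map₂ (λ z → j ℤ.* z)) (f x) (∑ᴸ xs f)) (cong (λ z → f x [t^ j ] ++ z) (∑ᴸ-[t^] xs f j))

weights≈ : ∀ {n k} (σs : Vec (Permutation′ (suc n)) k) → A.weights tᶜ σs ≈ᴸ t^ (+ totalCycles σs)
weights≈ []       = λ _ → refl
weights≈ (σ ∷ σs) = begin
  tᶜ σ *ᴸ A.weights tᶜ σs ≈⟨ L.*-cong {tᶜ σ} {t^ (+ cyc σ)} {A.weights tᶜ σs} {t^ (+ totalCycles σs)} (L.reflexive (cong (λ c → t^ (+ c)) (cycles≡cyc σ))) (weights≈ σs) ⟩
  t^ (+ cyc σ) *ᴸ t^ (+ totalCycles σs) ≡⟨⟩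
  t^ (+ (cyc σ ℕ.+ totalCycles σs)) ∎
  where open import Relation.Binary.Reasoning.Setoid L.setoid

power≡^ᴸ : ∀ p k → A.power p k ≡ p ^ᴸ k
power≡^ᴸ p zero    = refl
power≡^ᴸ p (suc k) = cong (p *ᴸ_) (power≡^ᴸ p k)

ι-length : ∀ {X : Set} {Q : X → Set} (Q? : Decidable Q) (xs : List X) → ι (length (filter Q? xs)) ≡ ∑ xs (λ x → 𝟙 (Q? x))
ι-length Q? xs = trans (count (filter Q? xs)) (trans (∑-filter Q? xs (λ _ → 1ℚ)) (ℚ∑.∑-cong xs λ x → ℚ.*-identityʳ (𝟙 (Q? x))))
  where
  count : ∀ xs → ι (length xs) ≡ ∑ xs (λ _ → 1ℚ)
  count []       = sym (∑-[] (λ _ → 1ℚ))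
  count (x ∷ xs) = trans (cong (λ z → 1ℚ + z) (count xs)) (sym (∑-∷ x xs (λ _ → 1ℚ)))

ι-*-/ : ∀ c n → ι (suc n) * ((+ c) ℚ./ suc n) ≡ ι c
ι-*-/ c n = trans (cong (_* ((+ c) ℚ./ suc n)) (ι≡/1 (suc n))) (trans (ℚ.toℚᵘ-injective (begin
  ℚ.toℚᵘ ((+ suc n) ℚ./ 1 * ((+ c) ℚ./ suc n)) ≈⟨ ℚ.toℚᵘ-homo-* ((+ suc n) ℚ./ 1) ((+ c) ℚ./ suc n) ⟩
  ℚ.toℚᵘ ((+ suc n) ℚ./ 1) ℚᵘ.* ℚ.toℚᵘ ((+ c) ℚ./ suc n) ≈⟨ ℚᵘ.*-cong (ℚ.toℚᵘ-fromℚᵘ (mkℚᵘ (+ suc n) 0)) (ℚ.toℚᵘ-fromℚᵘ (mkℚᵘ (+ c) n)) ⟩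
  mkℚᵘ (+ suc n) 0 ℚᵘ.* mkℚᵘ (+ c) n ≈⟨ *≡* (trans (ℤ.*-identityʳ ((+ suc n) ℤ.* (+ c))) (trans (ℤ.*-comm (+ suc n) (+ c)) (cong (λ z → (+ c) ℤ.* (+ z)) (sym (ℕ.*-identityˡ (suc n)))))) ⟩
  mkℚᵘ (+ c) 0 ≈⟨ ℚ.toℚᵘ-fromℚᵘ (mkℚᵘ (+ c) 0) ⟨
  ℚ.toℚᵘ ((+ c) ℚ./ 1) ∎)) (sym (ι≡/1 c)))
  where open ℚᵘ.≃-Reasoning

-- For tuples in 𝓜 the exponent (m − 1) n + 1 − 2 g is ℓ lam plus the number of cycles of σ₁ , … , σₘ₋₁.
P-tuples : ∀ {n} k (lam : Partition (suc n)) → P (suc k) lam ≈ᴸ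
  L∑.∑ (𝔖 (suc n)) (λ φ → L∑.∑ (𝔖 (suc n)) (λ σ → L∑.∑ (vectors k (𝔖 (suc n))) (λ σs → L∑.𝟙 (in𝓜? lam (φ , σ ∷ σs)) *ᴸ (t^ (+ ℓ lam) *ᴸ A.weights tᶜ σs))))
P-tuples {n} k lam = begin
  t^ e *ᴸ Γ (suc k) lam [t^ ℤ.- + 2 ]
    ≡⟨ cong (t^ e *ᴸ_) (trans (∑ᴸ-[t^] (𝓜 (suc k) lam) (λ M → monomial 1ℚ (genus lam M)) (ℤ.- + 2)) (sym (L∑.∑≡foldr (𝓜 (suc k) lam) term₀))) ⟩
  t^ e *ᴸ L∑.∑ (𝓜 (suc k) lam) term₀
    ≈⟨ L∑.∑-*ˡ (t^ e) (𝓜 (suc k) lam) term₀ ⟩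
  L∑.∑ (𝓜 (suc k) lam) term₁
    ≈⟨ L∑.∑-filter (in𝓜? lam) _ term₁ ⟩
  L∑.∑ (List.cartesianProduct (perms N) (vectors (suc k) (perms N))) (λ M → L∑.𝟙 (in𝓜? lam M) *ᴸ term₁ M)
    ≡⟨ cong (λ ps → L∑.∑ (List.cartesianProduct ps (vectors (suc k) ps)) (λ M → L∑.𝟙 (in𝓜? lam M) *ᴸ term₁ M)) (sym (𝔖≡perms N)) ⟩
  L∑.∑ (List.cartesianProduct (𝔖 N) (vectors (suc k) (𝔖 N))) (λ M → L∑.𝟙 (in𝓜? lam M) *ᴸ term₁ M)
    ≈⟨ L∑.∑-cartesianProductWith _,_ (𝔖 N) (vectors (suc k) (𝔖 N)) (λ M → L∑.𝟙 (in𝓜? lam M) *ᴸ term₁ M) ⟩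
  L∑.∑ (𝔖 N) (λ φ → L∑.∑ (vectors (suc k) (𝔖 N)) (λ σs → L∑.𝟙 (in𝓜? lam (φ , σs)) *ᴸ term₁ (φ , σs)))
    ≈⟨ L∑.∑-cong (𝔖 N) {λ φ → L∑.∑ (vectors (suc k) (𝔖 N)) (λ σs → L∑.𝟙 (in𝓜? lam (φ , σs)) *ᴸ term₁ (φ , σs))} {λ φ → L∑.∑ (𝔖 N) (λ σ → L∑.∑ (vectors k (𝔖 N)) (λ σs → L∑.𝟙 (in𝓜? lam (φ , σ ∷ σs)) *ᴸ term₁ (φ , σ ∷ σs)))} (λ φ → L∑.∑-cartesianProductWith _∷_ (𝔖 N) (vectors k (𝔖 N)) (λ σs → L∑.𝟙 (in𝓜? lam (φ , σs)) *ᴸ term₁ (φ , σs))) ⟩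
  L∑.∑ (𝔖 N) (λ φ → L∑.∑ (𝔖 N) (λ σ → L∑.∑ (vectors k (𝔖 N)) (λ σs → L∑.𝟙 (in𝓜? lam (φ , σ ∷ σs)) *ᴸ term₁ (φ , σ ∷ σs))))
    ≈⟨ L∑.∑-cong (𝔖 N) {λ φ → L∑.∑ (𝔖 N) (λ σ → L∑.∑ (vectors k (𝔖 N)) (before φ σ))} {λ φ → L∑.∑ (𝔖 N) (λ σ → L∑.∑ (vectors k (𝔖 N)) (after φ σ))}
         (λ φ → L∑.∑-cong (𝔖 N) {λ σ → L∑.∑ (vectors k (𝔖 N)) (before φ σ)} {λ σ → L∑.∑ (vectors k (𝔖 N)) (after φ σ)}
           (λ σ → L∑.∑-cong (vectors k (𝔖 N)) {before φ σ} {after φ σ} (λ σs → L∑.𝟙-guard (in𝓜? lam (φ , σ ∷ σs)) {term₁ (φ , σ ∷ σs)} {t^ (+ ℓ lam) *ᴸ A.weights tᶜ σs} (exponents φ σ σs)))) ⟩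
  L∑.∑ (𝔖 N) (λ φ → L∑.∑ (𝔖 N) (λ σ → L∑.∑ (vectors k (𝔖 N)) (after φ σ))) ∎
  where
  open import Relation.Binary.Reasoning.Setoid L.setoid
  N = suc n
  e = ((+ suc k) ℤ.- 1ℤ) ℤ.* (+ N) ℤ.+ 1ℤ
  term₀ term₁ : Tuple (suc k) N → Laurent
  term₀ M = monomial 1ℚ ((ℤ.- (+ 2)) ℤ.* genus lam M)
  term₁ M = t^ e *ᴸ term₀ M
  before after : Permutation′ N → Permutation′ N → Vec (Permutation′ N) k → Laurent
  before φ σ σs = L∑.𝟙 (in𝓜? lam (φ , σ ∷ σs)) *ᴸ term₁ (φ , σ ∷ σs)
  after φ σ σs = L∑.𝟙 (in𝓜? lam (φ , σ ∷ σs)) *ᴸ (t^ (+ ℓ lam) *ᴸ A.weights tᶜ σs)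
  exponents : ∀ φ σ σs → In𝓜 lam (φ , σ ∷ σs) → term₁ (φ , σ ∷ σs) ≈ᴸ t^ (+ ℓ lam) *ᴸ A.weights tᶜ σs
  exponents φ σ σs M∈ = begin
    t^ (e ℤ.+ (ℤ.- (+ 2)) ℤ.* genus lam (φ , σ ∷ σs)) ≡⟨ cong t^_ (genus-exponent lam φ σ σs M∈ (long⇒cyc σ (cycleType⇒long σ (proj₂ (proj₂ M∈))))) ⟩
    t^ (+ ℓ lam) *ᴸ t^ (+ totalCycles σs) ≈⟨ L.*-congˡ {t^ (+ ℓ lam)} {A.weights tᶜ σs} {t^ (+ totalCycles σs)} (weights≈ σs) ⟨
    t^ (+ ℓ lam) *ᴸ A.weights tᶜ σs ∎

hookχ-eigen : ∀ {n} (a : Fin (suc n)) ψ → L∑.∑ (𝔖 (suc n)) (λ σ → tᶜ σ *ᴸ const (Trace.hookχ a (σ · ψ))) ≈ᴸ H (suc n) (toℕ a) *ᴸ const (Trace.hookχ a ψ)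
hookχ-eigen {n} a ψ = begin
  L∑.∑ (𝔖 N) (λ σ → tᶜ σ *ᴸ const (hookχ (σ · ψ)))
    ≈⟨ L∑.∑-cong (𝔖 N) {λ σ → tᶜ σ *ᴸ const (hookχ (σ · ψ))} {λ σ → const c *ᴸ (tᶜ σ *ᴸ const (classSum (σ · ψ)))} (λ σ → L.trans {tᶜ σ *ᴸ const (hookχ (σ · ψ))} {tᶜ σ *ᴸ (const c *ᴸ const (classSum (σ · ψ)))} {const c *ᴸ (tᶜ σ *ᴸ const (classSum (σ · ψ)))} (L.*-congˡ {tᶜ σ} {const (hookχ (σ · ψ))} {const c *ᴸ const (classSum (σ · ψ))} (const-cong (scaled (σ · ψ)))) (L∑.x*yz≈y*xz (tᶜ σ) (const c) (const (classSum (σ · ψ))))) ⟩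
  L∑.∑ (𝔖 N) (λ σ → const c *ᴸ (tᶜ σ *ᴸ const (classSum (σ · ψ))))
    ≈⟨ L∑.∑-*ˡ (const c) (𝔖 N) (λ σ → tᶜ σ *ᴸ const (classSum (σ · ψ))) ⟨
  const c *ᴸ L∑.∑ (𝔖 N) (λ σ → tᶜ σ *ᴸ const (classSum (σ · ψ)))
    ≈⟨ L.*-congˡ {const c} {L∑.∑ (𝔖 N) (λ σ → tᶜ σ *ᴸ const (classSum (σ · ψ)))} {H N (toℕ a) *ᴸ const (classSum ψ)} (Eigenvalues.classSum-eigen a ψ) ⟩
  const c *ᴸ (H N (toℕ a) *ᴸ const (classSum ψ))
    ≈⟨ L∑.x*yz≈y*xz (const c) (H N (toℕ a)) (const (classSum ψ)) ⟩
  H N (toℕ a) *ᴸ (const c *ᴸ const (classSum ψ))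
    ≈⟨ L.*-congˡ {H N (toℕ a)} {const (hookχ ψ)} {const c *ᴸ const (classSum ψ)} (const-cong (scaled ψ)) ⟨
  H N (toℕ a) *ᴸ const (hookχ ψ) ∎
  where
  open import Relation.Binary.Reasoning.Setoid L.setoid
  open Trace a using (hookχ; classSum; trace-formula)
  N = suc n
  instance _ = ℚ.≢-nonZero (order≢0 a)
  c : ℚ
  c = ℚ.1/ ι (order a)
  scaled : ∀ ψ → hookχ ψ ≡ c * classSum ψ
  scaled ψ = sym (trans (cong (c *_) (sym (trace-formula ψ))) (trans (sym (ℚ.*-assoc c (ι (order a)) (hookχ ψ))) (trans (cong (_* hookχ ψ) (ℚ.*-inverseˡ (ι (order a)))) (ℚ.*-identityˡ (hookχ ψ)))))

alternating-hooksᴸ : ∀ {n} (ψ : Permutation′ (suc n)) → L∑.sum (λ a → const ([-1]^ toℕ a) *ᴸ const (Trace.hookχ a ψ)) ≈ᴸ const (ι (suc n)) *ᴸ L∑.𝟙 (long? ψ)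
alternating-hooksᴸ {n} ψ = begin
  L∑.sum (λ a → const ([-1]^ toℕ a * Trace.hookχ a ψ)) ≈⟨ const-sum (λ a → [-1]^ toℕ a * Trace.hookχ a ψ) ⟨
  const (sum (λ a → [-1]^ toℕ a * Trace.hookχ a ψ)) ≈⟨ const-cong (alternating-hooks-long ψ) ⟩
  const (ι (suc n)) *ᴸ const (𝟙 (long? ψ)) ≈⟨ L.*-congˡ {const (ι (suc n))} {const (𝟙 (long? ψ))} {L∑.𝟙 (long? ψ)} (const-𝟙 (long? ψ)) ⟩
  const (ι (suc n)) *ᴸ L∑.𝟙 (long? ψ) ∎
  where open import Relation.Binary.Reasoning.Setoid L.setoid

-- The coefficient has two sources: the sum over the class of λ gives |C(λ)|, and the expansion of
-- the indicator of the n-cycles for σ₀ gives 1/N. The exponent k counts σ₁, ..., σₘ₋₁.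
P-hooks : ∀ {n} k (lam : Partition (suc n)) φ → InClass lam φ →
  P (suc k) lam ≈ᴸ const ((+ ∣C lam ∣) ℚ./ suc n) *ᴸ t^ (+ ℓ lam) *ᴸ
    ∑ᴸ (allFin (suc n)) (λ a → const ([-1]^ toℕ a) *ᴸ H (suc n) (toℕ a) ^ᴸ k *ᴸ const (χ (hook (suc n) a) φ))
P-hooks {n} k lam φ φ∈ = begin
  P (suc k) lam
    ≈⟨ P-tuples k lam ⟩
  L∑.∑ (𝔖 N) (λ φ′ → L∑.∑ (𝔖 N) (λ σ → L∑.∑ (vectors k (𝔖 N)) (λ σs → L∑.𝟙 (in𝓜? lam (φ′ , σ ∷ σs)) *ᴸ (t^ (+ ℓ lam) *ᴸ A.weights tᶜ σs))))
    ≈⟨ A.∑-tuples tᶜ s h f f-resp hookχ-eigen (const (ι N)) (const N⁻¹) (const-cong (ℚ.*-inverseˡ (ι N))) alternating-hooksᴸ k lam φ class (t^ (+ ℓ lam)) ⟩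
  L∑.∑ (𝔖 N) (λ φ′ → L∑.𝟙 (inClass? lam φ′)) *ᴸ const N⁻¹ *ᴸ t^ (+ ℓ lam) *ᴸ L∑.sum (λ a → s a *ᴸ A.power (h a) k *ᴸ f a φ)
    ≈⟨ L.*-cong {L∑.∑ (𝔖 N) (λ φ′ → L∑.𝟙 (inClass? lam φ′)) *ᴸ const N⁻¹ *ᴸ t^ (+ ℓ lam)} {const ((+ ∣C lam ∣) ℚ./ N) *ᴸ t^ (+ ℓ lam)} {L∑.sum (λ a → s a *ᴸ A.power (h a) k *ᴸ f a φ)} {∑ᴸ (allFin N) summand}
         (L.*-congʳ {t^ (+ ℓ lam)} {L∑.∑ (𝔖 N) (λ φ′ → L∑.𝟙 (inClass? lam φ′)) *ᴸ const N⁻¹} {const ((+ ∣C lam ∣) ℚ./ N)} class-size) hooks ⟩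
  const ((+ ∣C lam ∣) ℚ./ N) *ᴸ t^ (+ ℓ lam) *ᴸ ∑ᴸ (allFin N) summand ∎
  where
  open import Relation.Binary.Reasoning.Setoid L.setoid
  N = suc n
  s h : Fin N → Laurent
  s a = const ([-1]^ toℕ a)
  h a = H (suc n) (toℕ a)
  f : Fin N → Permutation′ N → Laurent
  f a ψ = const (Trace.hookχ a ψ)
  f-resp : ∀ a → L∑.Resp (f a)
  f-resp a {σ} {τ} e = const-cong (hookχ-cong a {σ} {τ} e)
  instance _ = ℚ.≢-nonZero (ι-suc≢0 n)
  N⁻¹ : ℚ
  N⁻¹ = ℚ.1/ ι N
  class : ∀ a φ′ → InClass lam φ′ → f a φ′ ≈ᴸ f a φ
  class a φ′ c = const-cong (hookχ-cycleType a φ′ φ (trans c (sym φ∈)))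
  summand : Fin N → Laurent
  summand a = const ([-1]^ toℕ a) *ᴸ H (suc n) (toℕ a) ^ᴸ k *ᴸ const (χ (hook (suc n) a) φ)
  class-size : L∑.∑ (𝔖 N) (λ φ′ → L∑.𝟙 (inClass? lam φ′)) *ᴸ const N⁻¹ ≈ᴸ const ((+ ∣C lam ∣) ℚ./ N)
  class-size = begin
    L∑.∑ (𝔖 N) (λ φ′ → L∑.𝟙 (inClass? lam φ′)) *ᴸ const N⁻¹
      ≈⟨ L.*-congʳ {const N⁻¹} {L∑.∑ (𝔖 N) (λ φ′ → L∑.𝟙 (inClass? lam φ′))} {L∑.∑ (𝔖 N) (λ φ′ → const (𝟙 (inClass? lam φ′)))} (L∑.∑-cong (𝔖 N) {λ φ′ → L∑.𝟙 (inClass? lam φ′)} {λ φ′ → const (𝟙 (inClass? lam φ′))} (λ φ′ → L.sym {const (𝟙 (inClass? lam φ′))} {L∑.𝟙 (inClass? lam φ′)} (const-𝟙 (inClass? lam φ′)))) ⟩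
    L∑.∑ (𝔖 N) (λ φ′ → const (𝟙 (inClass? lam φ′))) *ᴸ const N⁻¹
      ≈⟨ L.*-congʳ {const N⁻¹} {const (∑ (𝔖 N) (λ φ′ → 𝟙 (inClass? lam φ′)))} {L∑.∑ (𝔖 N) (λ φ′ → const (𝟙 (inClass? lam φ′)))} (const-∑ (𝔖 N) (λ φ′ → 𝟙 (inClass? lam φ′))) ⟨
    const (∑ (𝔖 N) (λ φ′ → 𝟙 (inClass? lam φ′)) * N⁻¹)
      ≈⟨ const-cong quotient ⟩
    const ((+ ∣C lam ∣) ℚ./ N) ∎
    where
    quotient : ∑ (𝔖 N) (λ φ′ → 𝟙 (inClass? lam φ′)) * N⁻¹ ≡ (+ ∣C lam ∣) ℚ./ N
    quotient = *-cancelˡ {ι N} (ι-suc≢0 n) (trans (ℚ∑.x*yz≈y*xz (ι N) (∑ (𝔖 N) (λ φ′ → 𝟙 (inClass? lam φ′))) N⁻¹)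
      (trans (cong (∑ (𝔖 N) (λ φ′ → 𝟙 (inClass? lam φ′)) *_) (ℚ.*-inverseʳ (ι N))) (trans (ℚ.*-identityʳ (∑ (𝔖 N) (λ φ′ → 𝟙 (inClass? lam φ′))))
        (trans (cong (λ ps → ∑ ps (λ φ′ → 𝟙 (inClass? lam φ′))) (𝔖≡perms N)) (trans (sym (ι-length (inClass? lam) (perms N))) (sym (ι-*-/ ∣C lam ∣ n)))))))
  hooks : L∑.sum (λ a → s a *ᴸ A.power (h a) k *ᴸ f a φ) ≈ᴸ ∑ᴸ (allFin N) summand
  hooks = begin
    L∑.sum (λ a → s a *ᴸ A.power (h a) k *ᴸ f a φ) ≈⟨ L∑.sum-cong {f = λ a → s a *ᴸ A.power (h a) k *ᴸ f a φ} {summand} (λ a → L.reflexive {s a *ᴸ A.power (h a) k *ᴸ f a φ} {summand a} (same a)) ⟩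
    L∑.sum summand ≈⟨ L∑.∑-tabulate (λ a → a) summand ⟨
    L∑.∑ (allFin N) summand ≡⟨ L∑.∑≡foldr (allFin N) summand ⟩
    ∑ᴸ (allFin N) summand ∎
    where
    same : ∀ a → s a *ᴸ A.power (h a) k *ᴸ f a φ ≡ summand a
    same a = cong₂ (λ x y → s a *ᴸ x *ᴸ const y) (power≡^ᴸ (h a) k) (Trace.hookχ≡χ a φ)

theorem2p3 : ∀ (m n : ℕ) .{{_ : NonZero n}} → 2 ≤ m → (lam : Partition n) →
    ∀ (φ : Permutation′ n) → InClass lam φ →
    P m lam ≈ᴸ
    const (+ ∣C lam ∣ / n) *ᴸ t^ (+ ℓ lam) *ᴸ
    ∑ᴸ (allFin n) (λ a →
    const ([-1]^ toℕ a) *ᴸ H n (toℕ a) ^ᴸ (m ∸ 1) *ᴸ const (χ (hook n a) φ))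
theorem2p3 m       zero    {{n≢0}} = contradiction refl (ℕ.≢-nonZero⁻¹ 0 {{n≢0}})
theorem2p3 (suc k) (suc n) _ lam φ = P-hooks k lam φ
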